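{- Let $\sigma$ be a connected skew Young diagram whose topmost row is row $1$. Then, as formal power series, $$s_\sigma \;=\; \sum_{\mu\supseteq\sigma}(-1)^{|A(\mu/\sigma)|}\, b_{\sigma,\mu}\, G_\mu,$$ where the sum is over skew shapes $\mu\supseteq\sigma$ (containment convention below) and $b_{\sigma,\mu}$ is the product of (1) the number of row-weakly-bounded, reverse row-strict tableaux of shape $A(\mu/\sigma)$, and (2) the number of row-bounded, semistandard tableaux of shape $B(\mu/\sigma)$.
   Context: Boxes are pairs $(i,j)$ of positive integers, $i$ the row index (increasing downward), $j$ the column index (increasing to the right); $(i,j)\preceq(i',j')$ iff $i\le i'$, $j\le j'$. A skew Young diagram (skew shape) is a finite set of boxes closed under intervals; connected means its Hasse diagram under $\preceq$ is connected. Rows are numbered so that the top row of $\sigma$ is row 1. Containment convention: $\mu\supseteq\sigma$ means every box of $\sigma$ is in $\mu$ and every box of $\mu$ is in the same column as some box of $\sigma$; then $\mu\setminus\sigma$ splits into $A(\mu/\sigma)$ (boxes above boxes of $\sigma$ in their column) and $B(\mu/\sigma)$ (boxes below). A tableau assigns a positive integer to each box; semistandard: rows weakly increasing left to right, columns strictly increasing top to bottom; reverse row-strict: rows strictly decreasing left to right, columns weakly decreasing top to bottom; row-bounded: $T(i,j)<i$; row-weakly-bounded: $T(i,j)\le i$. Content $c(T)$: $i$-th entry is the number of occurrences of label $i$; $\mathbf{x}^c=\prod x_i^{c_i}$. A set-valued tableau assigns a nonempty finite set of positive integers to each box; it is semistandard if along rows $\max$ of each box $\le\min$ of the next box to the right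 and down columns $\max$ of each box $<\min$ of the box below; $|T|$ is the total number of labels. $s_\sigma=\sum_T\mathbf{x}^{c(T)}$ over semistandard tableaux of shape $\sigma$; $G_\mu=\sum_T(-1)^{|T|-|\mu|}\mathbf{x}^{c(T)}$ over semistandard set-valued tableaux of shape $\mu$. -}

module Defs where

open import Data.Nat as ℕ using (ℕ; zero; suc; _≤_; _∸_; _≡ᵇ_; _≤ᵇ_; _<ᵇ_)
open import Data.Integer as ℤ using (ℤ; +_; -_)
open import Data.Bool using (Bool; true; false; _∧_; _∨_; not; if_then_else_)
open import Data.List using (List; []; _∷_; _++_; length; map; filterᵇ; concatMap; foldr; zip; upTo)
open import Data.Bool.ListAction using (all; any)
open import Data.Nat.ListAction using (sum)
open import Data.List.Membership.Propositional using (_∈_)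
open import Data.List.Relation.Unary.All using (All)
open import Data.List.Relation.Unary.Any using (Any)
open import Data.List.Relation.Unary.AllPairs using (AllPairs)
open import Data.List.Relation.Unary.Unique.Propositional using (Unique)
open import Data.Product using (_×_; _,_; proj₁; proj₂; ∃; Σ)
open import Data.Sum using (_⊎_)
open import Relation.Binary.PropositionalEquality using (_≡_; _≢_)
open import Relation.Nullary using (¬_)
open import Function.Bundles using (_⇔_)

-- A box (i , j): i = row (increasing downward), j = column.
Box : Set
Box = ℕ × ℕ

row col : Box → ℕ
row = proj₁
col = proj₂

_≼_ : Box → Box → Set
b ≼ d = (row b ≤ row d) × (col b ≤ col d)

_≺_ : Box → Box → Set
b ≺ d = (b ≼ d) × (b ≢ d)

Positive : Box → Set
Positive b = (1 ≤ row b) × (1 ≤ col b)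

-- A finite set of boxes is represented by a duplicate-free list.
-- Skew shape: positive boxes, closed under intervals.
IsSkewShape : List Box → Set
IsSkewShape S =
  Unique S × All Positive S ×
  (∀ {b d e} → b ∈ S → e ∈ S → b ≼ d → d ≼ e → d ∈ S)

HasseEdge : List Box → Box → Box → Set
HasseEdge S b d = b ∈ S × d ∈ S × b ≺ d × (¬ ∃ λ e → e ∈ S × b ≺ e × e ≺ d)

data HassePath (S : List Box) : Box → Box → Set where
  here : ∀ {b} → HassePath S b b
  step : ∀ {b d e} → (HasseEdge S b d ⊎ HasseEdge S d b) → HassePath S d e → HassePath S b e

Connected : List Box → Set
Connected S = ∀ {b d} → b ∈ S → d ∈ S → HassePath S b d

-- the topmost row of σ is row 1 (boxes are positive, so row 1 is topmost)
TopRowIsOne : List Box → Set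
TopRowIsOne S = ∃ λ b → b ∈ S × row b ≡ 1

SameSet : List Box → List Box → Set
SameSet S S' = ∀ b → (b ∈ S) ⇔ (b ∈ S')

_⊇_ : List Box → List Box → Set
μ ⊇ σ = (∀ {b} → b ∈ σ → b ∈ μ) × (∀ {b} → b ∈ μ → ∃ λ d → d ∈ σ × col d ≡ col b)

_⇒ᵇ_ : Bool → Bool → Bool
a ⇒ᵇ c = not a ∨ c

_==ᵇ_ : Box → Box → Bool
b ==ᵇ d = (row b ≡ᵇ row d) ∧ (col b ≡ᵇ col d)

_∈ᵇ_ : Box → List Box → Bool
b ∈ᵇ S = any (b ==ᵇ_) S

Apart : List Box → List Box → List Box
Apart μ σ = filterᵇ (λ b → not (b ∈ᵇ σ) ∧ any (λ d → (col d ≡ᵇ col b) ∧ (row b <ᵇ row d)) σ) μ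

Bpart : List Box → List Box → List Box
Bpart μ σ = filterᵇ (λ b → not (b ∈ᵇ σ) ∧ any (λ d → (col d ≡ᵇ col b) ∧ (row d <ᵇ row b)) σ) μ

range1 : ℕ → List ℕ
range1 n = map suc (upTo n)

choices : {A : Set} → List (List A) → List (List A)
choices [] = [] ∷ []
choices (xs ∷ xss) = concatMap (λ x → map (x ∷_) (choices xss)) xs

fillings : {V : Set} → List Box → (Box → List V) → List (List (Box × V))
fillings S cand = map (zip S) (choices (map cand S))

allPairsᵇ : {V : Set} → (Box × V → Box × V → Bool) → List (Box × V) → Bool
allPairsᵇ p F = all (λ x → all (λ y → p x y) F) F

sameRowLeft sameColAbove : Box → Box → Bool
sameRowLeft b d = (row b ≡ᵇ row d) ∧ (col b <ᵇ col d)
sameColAbove b d = (col b ≡ᵇ col d) ∧ (row b <ᵇ row d)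

semistandardᵇ : List (Box × ℕ) → Bool
semistandardᵇ = allPairsᵇ λ { (b , v) (d , w) →
  (sameRowLeft b d ⇒ᵇ (v ≤ᵇ w)) ∧ (sameColAbove b d ⇒ᵇ (v <ᵇ w)) }

reverseRowStrictᵇ : List (Box × ℕ) → Bool
reverseRowStrictᵇ = allPairsᵇ λ { (b , v) (d , w) →
  (sameRowLeft b d ⇒ᵇ (w <ᵇ v)) ∧ (sameColAbove b d ⇒ᵇ (w ≤ᵇ v)) }

-- c_i with c given as a list (c₁, …, c_m); c_i = 0 for i > m
entry : List ℕ → ℕ → ℕ
entry [] _ = 0
entry (x ∷ xs) zero = 0
entry (x ∷ xs) (suc zero) = x
entry (x ∷ xs) (suc (suc i)) = entry xs (suc i)

countᵇ : {A : Set} → (A → Bool) → List A → ℕ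
countᵇ p xs = length (filterᵇ p xs)

contentIsᵇ : List ℕ → List (Box × ℕ) → Bool
contentIsᵇ c F = all (λ i → countᵇ (λ bv → proj₂ bv ≡ᵇ i) F ≡ᵇ entry c i) (range1 (length c))

-- Set-valued tableaux: a set of labels is a strictly increasing list

sublists : List ℕ → List (List ℕ)
sublists [] = [] ∷ []
sublists (x ∷ xs) = map (x ∷_) (sublists xs) ++ sublists xs

nonEmptyᵇ : List ℕ → Bool
nonEmptyᵇ [] = false
nonEmptyᵇ (_ ∷ _) = true

nonEmptySubsets : ℕ → List (List ℕ)
nonEmptySubsets m = filterᵇ nonEmptyᵇ (sublists (range1 m))

maxL minL : List ℕ → ℕ
maxL = foldr ℕ._⊔_ 0
minL [] = 0
minL (x ∷ xs) = foldr ℕ._⊓_ x xs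

setSemistandardᵇ : List (Box × List ℕ) → Bool
setSemistandardᵇ = allPairsᵇ λ { (b , v) (d , w) →
  (((row b ≡ᵇ row d) ∧ (suc (col b) ≡ᵇ col d)) ⇒ᵇ (maxL v ≤ᵇ minL w)) ∧
  (((col b ≡ᵇ col d) ∧ (suc (row b) ≡ᵇ row d)) ⇒ᵇ (maxL v <ᵇ minL w)) }

memᵇ : ℕ → List ℕ → Bool
memᵇ i = any (i ≡ᵇ_)

setContentIsᵇ : List ℕ → List (Box × List ℕ) → Bool
setContentIsᵇ c F = all (λ i → countᵇ (λ bv → memᵇ i (proj₂ bv)) F ≡ᵇ entry c i) (range1 (length c))

labelCount : List (Box × List ℕ) → ℕ
labelCount F = sum (map (λ bv → length (proj₂ bv)) F)

sign : ℕ → ℤ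
sign zero = + 1
sign (suc n) = - sign n

sumℤ : List ℤ → ℤ
sumℤ = foldr ℤ._+_ (+ 0)

sCoeff : List Box → List ℕ → ℕ
sCoeff σ c = countᵇ (λ F → semistandardᵇ F ∧ contentIsᵇ c F)
                    (fillings σ (λ _ → range1 (length c)))

GCoeff : List Box → List ℕ → ℤ
GCoeff μ c = sumℤ (map (λ F → sign (labelCount F ∸ length μ))
                       (filterᵇ (λ F → setSemistandardᵇ F ∧ setContentIsᵇ c F)
                                (fillings μ (λ _ → nonEmptySubsets (length c)))))

aCount : List Box → ℕ
aCount S = countᵇ reverseRowStrictᵇ (fillings S (λ b → range1 (row b)))

bCount : List Box → ℕ
bCount S = countᵇ semistandardᵇ (fillings S (λ b → range1 (row b ∸ 1)))

b-coeff : List Box → List Box → ℕ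
b-coeff σ μ = aCount (Apart μ σ) ℕ.* bCount (Bpart μ σ)

term : List Box → List ℕ → List Box → ℤ
term σ c μ = sign (length (Apart μ σ)) ℤ.* ((+ b-coeff σ μ) ℤ.* GCoeff μ c)

Covering : List Box → List ℕ → List (List Box) → Set
Covering σ c Ms =
  All (λ μ → IsSkewShape μ × μ ⊇ σ) Ms ×
  AllPairs (λ μ ν → ¬ SameSet μ ν) Ms ×
  (∀ μ → IsSkewShape μ → μ ⊇ σ → term σ c μ ≢ + 0 → Any (SameSet μ) Ms)

{-# OPTIONS --safe #-}
module Submission where

-- A shape μ ⊇ σ is recorded by the row lengths t′ of the part above it and d′ of the part it ends, so that
-- row i of μ is (t′ᵢ , d′ᵢ].  Interpolate between s and G by the sums S⁽ᵏ⁾ over set-valued tableaux in which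
-- only rows ≤ k may contain boxes with several labels.  Removing the largest label turns such sums into
-- products of one-letter kernels U⁽ᵏ⁾, and a row-by-row exchange of two horizontal strips gives
-- U⁽ᵏ⁻¹⁾ H = H U⁽ᵏ⁾, where H = Hₖ adds a horizontal strip in rows > k.  The products H₁ ⋯ H_K count the row-bounded
-- semistandard tableaux of d′/d.  On the upper boundary, a box removed from t that carries no label is traded
-- for an extra label, which introduces rook strips Rₖ; these satisfy Rₖ = Eₖ Rₖ₋₁ Hₖ with Eₖ the signed
-- vertical strips in rows ≥ k, and E_K ⋯ E₁ counts the row-weakly-bounded reverse row-strict tableaux of t/t′.
-- Cancelling the unitriangular matrix H₁ ⋯ H_K on the right yields s = Σ (H₁ ⋯ H_K) G (E_K ⋯ E₁).

open import Defs
open import Algebra.Solver.Ring.AlmostCommutativeRing using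
  (AlmostCommutativeRing; fromCommutativeRing; _-Raw-AlmostCommutative⟶_)
import Algebra.Solver.Ring as RingSolver
open import Algebra.Structures using (IsCommutativeRing)
open import Data.Bool using (Bool; true; false; T; _∧_; _∨_; not; if_then_else_)
open import Data.Bool.ListAction using (all; any)
open import Data.Bool.Properties using (T?; T-∧; ∧-assoc; ∧-identityʳ; ∨-zeroʳ; ∨-identityʳ)
open import Data.Empty using (⊥; ⊥-elim)
open import Data.Integer as ℤ using (ℤ; +_; 0ℤ; 1ℤ; -1ℤ)
import Data.Integer.Properties as ℤ
open import Data.List using (List; []; _∷_; _++_; length; map; filter; filterᵇ; concatMap; upTo; applyUpTo; zip; foldr;
  cartesianProduct; cartesianProductWith)
open import Data.List.Membership.Propositional using (_∈_; find; lose)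
import Data.List.Membership.Propositional.Properties as ∈
open import Data.List.Membership.Propositional.Properties.WithK using (unique∧set⇒bag)
import Data.List.Properties as List
open import Data.List.Relation.Binary.BagAndSetEquality using (∼bag⇒↭)
open import Data.List.Relation.Binary.Permutation.Propositional as Perm using (_↭_; refl; prep; swap; ↭-sym)
import Data.List.Relation.Binary.Permutation.Propositional.Properties as ↭
open import Data.List.Relation.Unary.All as All using (All; []; _∷_)
import Data.List.Relation.Unary.All.Properties as All
open import Data.List.Relation.Unary.AllPairs using (AllPairs; []; _∷_)
open import Data.List.Relation.Unary.Any as Any using (Any; here; there)
import Data.List.Relation.Unary.Any.Properties as Any
open import Data.List.Relation.Unary.Unique.Propositional using (Unique)
import Data.List.Relation.Unary.Unique.Propositional.Properties as Unique
open import Data.Nat as ℕ using (ℕ; zero; suc; _≤_; _<_; z≤n; s≤s; _∸_; _⊔_; _⊓_; _≤ᵇ_; _<ᵇ_; _≡ᵇ_)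
open import Data.Nat.Properties as ℕ using (_≤?_; _<?_; _≟_)
open import Data.Product using (_×_; _,_; proj₁; proj₂; ∃; ∃₂; Σ)
open import Data.Sum using (_⊎_; inj₁; inj₂)
open import Data.Unit using (⊤; tt)
open import Data.Vec using (Vec; []; _∷_; sum)
open import Data.Vec.Properties using (≡-dec)
open import Data.Vec.Relation.Binary.Pointwise.Inductive as Pointwise using (Pointwise; []; _∷_)
open import Function using (_∘_; id)
open import Function.Bundles using (Equivalence; mk⇔)
open import Level using (0ℓ)
open import Relation.Binary.Consequences using (dec⇒weaklyDec)
open import Relation.Binary.Definitions using (tri<; tri≈; tri>)
open import Relation.Binary.PropositionalEquality
open import Relation.Nullary using (¬_; Dec; yes; no; contradiction)
open import Relation.Nullary.Decidable using (_×-dec_; _⊎-dec_; _→-dec_)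
open ≡-Reasoning
open Equivalence using () renaming (to to fwd; from to bwd)

-- The kernels `remove` ignore the upper boundary t: they also put a second label in the box just
-- left of an emptied row, which is no box of the shape. This keeps the exchange of strips a matter
-- of d alone, and the error does not depend on the number of labels, so one matrix Rₖ on the right
-- corrects it. For k = 0 the correction is trivial, hence s appears without it. The factor H₁ ⋯ H_K
-- on the right is introduced on purpose. Moving it to the left through the kernels raises their
-- superscript from 0 to K, and R_K = (E_K ⋯ E₁)(H₁ ⋯ H_K) produces it again on the right, where it
-- cancels; the copy on the left stays. Identities are proved one coefficient at a time: a variable
-- is replaced by a functional on its powers, so all matrices have entries in ℤ. A fixed content
-- also makes the sum finite. With m labels a column holds at most m boxes, so if σ ends by row N, a
-- contributing μ ends by row K = m + N. Every Hₖ may open one more row, which is why vectors with K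
-- + N rows are used.

private variable
  n : ℕ
  𝒜 𝒜′ 𝒱 : Set
  𝒫 𝒬 : Set


-- The ring operations of ℤ are made opaque because unfolding them defeats unification.
infixl 6 _⊕_
infixl 7 _⊗_
infix 8 ⊖_

opaque
  _⊕_ _⊗_ : ℤ → ℤ → ℤ
  _⊕_ = ℤ._+_
  _⊗_ = ℤ._*_

  ⊖_ : ℤ → ℤ
  ⊖_ = ℤ.-_

  ⊕-def : ∀ a b → a ⊕ b ≡ a ℤ.+ b
  ⊕-def a b = refl

  ⊗-def : ∀ a b → a ⊗ b ≡ a ℤ.* b
  ⊗-def a b = refl

  ⊖-def : ∀ a → ⊖ a ≡ ℤ.- a
  ⊖-def a = refl

  isRing : IsCommutativeRing _≡_ _⊕_ _⊗_ ⊖_ 0ℤ 1ℤ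
  isRing = ℤ.+-*-isCommutativeRing

open IsCommutativeRing isRing public using () renaming
  ( +-assoc to ⊕-assoc; +-comm to ⊕-comm; +-identityˡ to ⊕-identityˡ; +-identityʳ to ⊕-identityʳ
  ; *-assoc to ⊗-assoc; *-comm to ⊗-comm; *-identityˡ to ⊗-identityˡ; *-identityʳ to ⊗-identityʳ
  ; zeroˡ to ⊗-zeroˡ; zeroʳ to ⊗-zeroʳ; distribˡ to ⊗-distribˡ-⊕; distribʳ to ⊗-distribʳ-⊕)

solverRing : AlmostCommutativeRing 0ℓ 0ℓ
solverRing = fromCommutativeRing (record { isCommutativeRing = isRing })

coefficients : ℤ.+-*-rawRing -Raw-AlmostCommutative⟶ solverRing
coefficients = record
  { ⟦_⟧ = id ; +-homo = λ a b → sym (⊕-def a b) ; *-homo = λ a b → sym (⊗-def a b)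
  ; -‿homo = λ a → sym (⊖-def a) ; 0-homo = refl ; 1-homo = refl }

module Solve = RingSolver ℤ.+-*-rawRing solverRing coefficients (dec⇒weaklyDec ℤ._≟_)
open Solve using (solve; _:+_; _:*_; :-_; _:=_; con)

⊗-congˡ : ∀ {a b c} → a ≡ b → a ⊗ c ≡ b ⊗ c
⊗-congˡ refl = refl

⊗-congʳ : ∀ {a b c} → b ≡ c → a ⊗ b ≡ a ⊗ c
⊗-congʳ refl = refl

⊕-congʳ : ∀ {a b c} → b ≡ c → a ⊕ b ≡ a ⊕ c
⊕-congʳ refl = refl

-- Indicators and finite sums in ℤ.

⟦_⟧ : Dec 𝒫 → ℤ
⟦ yes _ ⟧ = 1ℤ
⟦ no _ ⟧ = 0ℤ

⟦⟧-yes : (d : Dec 𝒫) → 𝒫 → ⟦ d ⟧ ≡ 1ℤ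
⟦⟧-yes (yes _) p = refl
⟦⟧-yes (no ¬p) p = contradiction p ¬p

⟦⟧-no : (d : Dec 𝒫) → ¬ 𝒫 → ⟦ d ⟧ ≡ 0ℤ
⟦⟧-no (yes p) ¬p = contradiction p ¬p
⟦⟧-no (no _) ¬p = refl

⟦⟧-cong : (d : Dec 𝒫) (e : Dec 𝒬) → (𝒫 → 𝒬) → (𝒬 → 𝒫) → ⟦ d ⟧ ≡ ⟦ e ⟧
⟦⟧-cong (yes p) e f g = sym (⟦⟧-yes e (f p))
⟦⟧-cong (no ¬p) e f g = sym (⟦⟧-no e (¬p ∘ g))

⟦⟧-× : (d : Dec 𝒫) (e : Dec 𝒬) → ⟦ d ×-dec e ⟧ ≡ ⟦ d ⟧ ⊗ ⟦ e ⟧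
⟦⟧-× (yes _) (yes _) = sym (⊗-identityˡ _)
⟦⟧-× (yes _) (no _) = sym (⊗-zeroʳ _)
⟦⟧-× (no _) (yes _) = sym (⊗-zeroˡ _)
⟦⟧-× (no _) (no _) = sym (⊗-zeroˡ _)

⟦⟧-scale-cong : (d : Dec 𝒫) {x y : ℤ} → (𝒫 → x ≡ y) → ⟦ d ⟧ ⊗ x ≡ ⟦ d ⟧ ⊗ y
⟦⟧-scale-cong (yes p) h = cong (1ℤ ⊗_) (h p)
⟦⟧-scale-cong (no _) {x} {y} h = trans (⊗-zeroˡ x) (sym (⊗-zeroˡ y))

⟦⟧⊗-no : (d : Dec 𝒫) {x : ℤ} → ¬ 𝒫 → ⟦ d ⟧ ⊗ x ≡ 0ℤ
⟦⟧⊗-no d {x} ¬p = trans (cong (_⊗ x) (⟦⟧-no d ¬p)) (⊗-zeroˡ x)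

⟦⟧⊗-yes : (d : Dec 𝒫) {x : ℤ} → 𝒫 → ⟦ d ⟧ ⊗ x ≡ x
⟦⟧⊗-yes d {x} p = trans (cong (_⊗ x) (⟦⟧-yes d p)) (⊗-identityˡ x)

-- Rewrites one factor where the other is nonzero. For the matrices below, nonvanishing of an entry
-- yields the interlacing and order facts that the rewriting needs.
*-cancel-support : ∀ (a : ℤ) {x y} → (a ≢ 0ℤ → x ≡ y) → a ⊗ x ≡ a ⊗ y
*-cancel-support a {x} {y} h with a ℤ.≟ 0ℤ
... | yes refl = trans (⊗-zeroˡ x) (sym (⊗-zeroˡ y))
... | no a≢0 = cong (a ⊗_) (h a≢0)

⟦⟧≢0 : (d : Dec 𝒫) → ⟦ d ⟧ ≢ 0ℤ → 𝒫
⟦⟧≢0 (yes p) _ = p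
⟦⟧≢0 (no _) h = contradiction refl h

*≢0ˡ : ∀ a b → a ⊗ b ≢ 0ℤ → a ≢ 0ℤ
*≢0ˡ a b h refl = h (⊗-zeroˡ b)

*≢0ʳ : ∀ a b → a ⊗ b ≢ 0ℤ → b ≢ 0ℤ
*≢0ʳ a b h refl = h (⊗-zeroʳ a)

∑ : List 𝒜 → (𝒜 → ℤ) → ℤ
∑ [] f = 0ℤ
∑ (x ∷ xs) f = f x ⊕ ∑ xs f

infix 6 ∑
syntax ∑ xs (λ x → e) = ∑[ x ∈ xs ] e

∑-cong∈ : (xs : List 𝒜) {f g : 𝒜 → ℤ} → (∀ {x} → x ∈ xs → f x ≡ g x) → ∑ xs f ≡ ∑ xs g
∑-cong∈ [] h = refl
∑-cong∈ (x ∷ xs) h = cong₂ _⊕_ (h (here refl)) (∑-cong∈ xs (h ∘ there))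

∑-cong : (xs : List 𝒜) {f g : 𝒜 → ℤ} → (∀ x → f x ≡ g x) → ∑ xs f ≡ ∑ xs g
∑-cong xs h = ∑-cong∈ xs (λ {x} _ → h x)

∑-zero : (xs : List 𝒜) {f : 𝒜 → ℤ} → (∀ {x} → x ∈ xs → f x ≡ 0ℤ) → ∑ xs f ≡ 0ℤ
∑-zero [] h = refl
∑-zero (x ∷ xs) h = trans (cong₂ _⊕_ (h (here refl)) (∑-zero xs (h ∘ there))) (⊕-identityˡ _)

∑-++ : (xs ys : List 𝒜) {f : 𝒜 → ℤ} → ∑ (xs ++ ys) f ≡ ∑ xs f ⊕ ∑ ys f
∑-++ [] ys = sym (⊕-identityˡ _)
∑-++ (x ∷ xs) ys {f} = trans (cong (f x ⊕_) (∑-++ xs ys)) (sym (⊕-assoc (f x) _ _))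

∑-map : (h : 𝒜 → 𝒜′) (xs : List 𝒜) {f : 𝒜′ → ℤ} → ∑ (map h xs) f ≡ ∑ xs (f ∘ h)
∑-map h [] = refl
∑-map h (x ∷ xs) = cong (_ ⊕_) (∑-map h xs)

∑-concatMap : (h : 𝒜 → List 𝒜′) (xs : List 𝒜) {f : 𝒜′ → ℤ} →
  ∑ (concatMap h xs) f ≡ ∑ xs (λ x → ∑ (h x) f)
∑-concatMap h [] = refl
∑-concatMap h (x ∷ xs) = trans (∑-++ (h x) _) (cong (_ ⊕_) (∑-concatMap h xs))

∑-⊕ : (xs : List 𝒜) {f g : 𝒜 → ℤ} → ∑ xs (λ x → f x ⊕ g x) ≡ ∑ xs f ⊕ ∑ xs g
∑-⊕ [] = sym (⊕-identityˡ _)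
∑-⊕ (x ∷ xs) {f} {g} = trans (cong (_ ⊕_) (∑-⊕ xs)) (lem (f x) (g x) _ _)
  where
  lem : ∀ a b c d → (a ⊕ b) ⊕ (c ⊕ d) ≡ (a ⊕ c) ⊕ (b ⊕ d)
  lem = solve 4 (λ a b c d → (a :+ b) :+ (c :+ d) := (a :+ c) :+ (b :+ d)) refl

∑-*ˡ : (xs : List 𝒜) (a : ℤ) {f : 𝒜 → ℤ} → ∑ xs (λ x → a ⊗ f x) ≡ a ⊗ ∑ xs f
∑-*ˡ [] a = sym (⊗-zeroʳ a)
∑-*ˡ (x ∷ xs) a = trans (cong (_ ⊕_) (∑-*ˡ xs a)) (sym (⊗-distribˡ-⊕ a _ _))

∑-swap : (xs : List 𝒜) (ys : List 𝒜′) {f : 𝒜 → 𝒜′ → ℤ} →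
  ∑ xs (λ x → ∑ ys (f x)) ≡ ∑ ys (λ y → ∑ xs (λ x → f x y))
∑-swap [] ys = sym (∑-zero ys (λ _ → refl))
∑-swap (x ∷ xs) ys {f} = trans (cong (_ ⊕_) (∑-swap xs ys)) (sym (∑-⊕ ys))

∑-filterᵇ : (p : 𝒜 → Bool) (xs : List 𝒜) {f : 𝒜 → ℤ} →
  ∑ (filterᵇ p xs) f ≡ ∑ xs (λ x → ⟦ T? (p x) ⟧ ⊗ f x)
∑-filterᵇ p [] = refl
∑-filterᵇ p (x ∷ xs) {f} with p x
... | true = cong₂ _⊕_ (sym (⊗-identityˡ (f x))) (∑-filterᵇ p xs)
... | false = trans (∑-filterᵇ p xs)
  (trans (sym (⊕-identityˡ _)) (cong (_⊕ _) (sym (⊗-zeroˡ (f x)))))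

+countᵇ : (p : 𝒜 → Bool) (xs : List 𝒜) → + countᵇ p xs ≡ ∑ xs (λ x → ⟦ T? (p x) ⟧)
+countᵇ p [] = refl
+countᵇ p (x ∷ xs) with p x
... | true = trans (sym (⊕-def 1ℤ (+ countᵇ p xs))) (cong (1ℤ ⊕_) (+countᵇ p xs))
... | false = trans (+countᵇ p xs) (sym (⊕-identityˡ _))

∑≤ : ℕ → (ℕ → ℤ) → ℤ
∑≤ zero f = f zero
∑≤ (suc n) f = f zero ⊕ ∑≤ n (f ∘ suc)

∑≤-cong : ∀ n {f g : ℕ → ℤ} → (∀ j → j ≤ n → f j ≡ g j) → ∑≤ n f ≡ ∑≤ n g
∑≤-cong zero h = h zero z≤n
∑≤-cong (suc n) h = cong₂ _⊕_ (h zero z≤n) (∑≤-cong n (λ j j≤n → h (suc j) (s≤s j≤n)))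

∑≤-zero : ∀ n {f : ℕ → ℤ} → (∀ j → j ≤ n → f j ≡ 0ℤ) → ∑≤ n f ≡ 0ℤ
∑≤-zero zero h = h zero z≤n
∑≤-zero (suc n) h = trans (cong₂ _⊕_ (h zero z≤n) (∑≤-zero n (λ j j≤n → h (suc j) (s≤s j≤n)))) (⊕-identityˡ _)

∑≤-⊕ : ∀ n {f g : ℕ → ℤ} → ∑≤ n (λ x → f x ⊕ g x) ≡ ∑≤ n f ⊕ ∑≤ n g
∑≤-⊕ zero = refl
∑≤-⊕ (suc n) {f} {g} = trans (cong (_ ⊕_) (∑≤-⊕ n)) (lem (f 0) (g 0) _ _)
  where
  lem : ∀ a b c d → (a ⊕ b) ⊕ (c ⊕ d) ≡ (a ⊕ c) ⊕ (b ⊕ d)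
  lem = solve 4 (λ a b c d → (a :+ b) :+ (c :+ d) := (a :+ c) :+ (b :+ d)) refl

∑≤-*ˡ : ∀ n (a : ℤ) {f : ℕ → ℤ} → ∑≤ n (λ x → a ⊗ f x) ≡ a ⊗ ∑≤ n f
∑≤-*ˡ zero a = refl
∑≤-*ˡ (suc n) a = trans (cong (_ ⊕_) (∑≤-*ˡ n a)) (sym (⊗-distribˡ-⊕ a _ _))

∑≤-⊖ : ∀ n {f : ℕ → ℤ} → ∑≤ n (λ x → ⊖ f x) ≡ ⊖ ∑≤ n f
∑≤-⊖ zero = refl
∑≤-⊖ (suc n) {f} = trans (cong (_ ⊕_) (∑≤-⊖ n))
  (solve 2 (λ a b → (:- a) :+ (:- b) := :- (a :+ b)) refl (f 0) _)

∑≤-swap : ∀ n m {f : ℕ → ℕ → ℤ} →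
  ∑≤ n (λ x → ∑≤ m (f x)) ≡ ∑≤ m (λ y → ∑≤ n (λ x → f x y))
∑≤-swap zero m = refl
∑≤-swap (suc n) m = trans (cong (_ ⊕_) (∑≤-swap n m)) (sym (∑≤-⊕ m))

∑≤-δ : ∀ n a {f : ℕ → ℤ} → a ≤ n → (∀ j → j ≢ a → f j ≡ 0ℤ) → ∑≤ n f ≡ f a
∑≤-δ zero zero a≤n h = refl
∑≤-δ (suc n) zero {f} a≤n h =
  trans (cong (f 0 ⊕_) (∑≤-zero n (λ j _ → h (suc j) (λ ())))) (⊕-identityʳ _)
∑≤-δ (suc n) (suc a) {f} (s≤s a≤n) h =
  trans (cong₂ _⊕_ (h 0 (λ ())) (∑≤-δ n a a≤n (λ j j≢a → h (suc j) (j≢a ∘ ℕ.suc-injective))))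
        (⊕-identityˡ _)

∑≤-last : ∀ n {f : ℕ → ℤ} → ∑≤ (suc n) f ≡ ∑≤ n f ⊕ f (suc n)
∑≤-last zero = refl
∑≤-last (suc n) {f} = trans (cong (f 0 ⊕_) (∑≤-last n)) (sym (⊕-assoc (f 0) _ _))

∑≤-upTo : ∀ n {f : ℕ → ℤ} → ∑ (upTo (suc n)) f ≡ ∑≤ n f
∑≤-upTo n = go n id
  where
  open import Data.List using (applyUpTo)
  go : ∀ n (h : ℕ → ℕ) {f} → ∑ (applyUpTo h (suc n)) f ≡ ∑≤ n (f ∘ h)
  go zero h = ⊕-identityʳ _
  go (suc n) h = cong (_ ⊕_) (go n (h ∘ suc))

-- Both summands live on the interval from a to b, and i ↦ a + b - i reverses it. This is the form
-- in which two horizontal strips are exchanged in a row.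
∑≤-reflect : ∀ n a b {f g : ℕ → ℤ} → b ≤ n →
  (∀ i j → i ℕ.+ j ≡ a ℕ.+ b → a ≤ i → i ≤ b → f i ≡ g j) →
  (∀ j → ¬ (a ≤ j × j ≤ b) → f j ≡ 0ℤ) → (∀ j → ¬ (a ≤ j × j ≤ b) → g j ≡ 0ℤ) →
  ∑≤ n f ≡ ∑≤ n g
∑≤-reflect n a b {f} {g} b≤n hfg hf hg with a ℕ.≤? b
... | no a≰b = trans (∑≤-zero n (λ j _ → hf j (λ (p , q) → a≰b (ℕ.≤-trans p q))))
                 (sym (∑≤-zero n (λ j _ → hg j (λ (p , q) → a≰b (ℕ.≤-trans p q)))))
... | yes a≤b = begin
  ∑≤ n f ≡⟨ shrink n b≤n f hf ⟩
  ∑≤ (b ∸ a) (λ i → f (a ℕ.+ i)) ≡⟨ rev (b ∸ a) ⟩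
  ∑≤ (b ∸ a) (λ i → f (a ℕ.+ ((b ∸ a) ∸ i)))
    ≡⟨ ∑≤-cong (b ∸ a) (λ j j≤ → hfg _ _ (eq j j≤) (ℕ.m≤m+n a _)
         (ℕ.≤-trans (ℕ.+-monoʳ-≤ a (ℕ.m∸n≤m (b ∸ a) j)) (ℕ.≤-reflexive (ℕ.m+[n∸m]≡n a≤b)))) ⟩
  ∑≤ (b ∸ a) (λ i → g (a ℕ.+ i)) ≡⟨ shrink n b≤n g hg ⟨
  ∑≤ n g ∎
  where
  eq : ∀ j → j ≤ b ∸ a → a ℕ.+ ((b ∸ a) ∸ j) ℕ.+ (a ℕ.+ j) ≡ a ℕ.+ b
  eq j j≤ = begin
    a ℕ.+ ((b ∸ a) ∸ j) ℕ.+ (a ℕ.+ j) ≡⟨ ℕ.+-assoc a _ _ ⟩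
    a ℕ.+ (((b ∸ a) ∸ j) ℕ.+ (a ℕ.+ j)) ≡⟨ cong (λ x → a ℕ.+ (((b ∸ a) ∸ j) ℕ.+ x)) (ℕ.+-comm a j) ⟩
    a ℕ.+ (((b ∸ a) ∸ j) ℕ.+ (j ℕ.+ a)) ≡⟨ cong (a ℕ.+_) (ℕ.+-assoc ((b ∸ a) ∸ j) j a) ⟨
    a ℕ.+ (((b ∸ a) ∸ j) ℕ.+ j ℕ.+ a) ≡⟨ cong (λ x → a ℕ.+ (x ℕ.+ a)) (ℕ.m∸n+n≡m j≤) ⟩
    a ℕ.+ ((b ∸ a) ℕ.+ a) ≡⟨ cong (a ℕ.+_) (ℕ.m∸n+n≡m a≤b) ⟩
    a ℕ.+ b ∎
  rev : ∀ n {f : ℕ → ℤ} → ∑≤ n f ≡ ∑≤ n (λ i → f (n ∸ i))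
  rev zero = refl
  rev (suc n) {f} = begin
    f 0 ⊕ ∑≤ n (f ∘ suc) ≡⟨ cong (f 0 ⊕_) (rev n) ⟩
    f 0 ⊕ ∑≤ n (λ i → f (suc (n ∸ i))) ≡⟨ ⊕-comm (f 0) _ ⟩
    ∑≤ n (λ i → f (suc (n ∸ i))) ⊕ f 0
      ≡⟨ cong₂ _⊕_ (∑≤-cong n (λ j j≤n → cong f (sym (ℕ.+-∸-assoc 1 j≤n)))) (cong f (sym (ℕ.n∸n≡0 n))) ⟩
    ∑≤ n (λ i → f (suc n ∸ i)) ⊕ f (suc n ∸ suc n) ≡⟨ ∑≤-last n ⟨
    ∑≤ (suc n) (λ i → f (suc n ∸ i)) ∎
  up : ∀ n b → b ≤ n → (f : ℕ → ℤ) → (∀ j → b < j → f j ≡ 0ℤ) → ∑≤ n f ≡ ∑≤ b f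
  up zero zero _ f h = refl
  up (suc n) zero _ f h = trans (cong (f 0 ⊕_) (∑≤-zero n (λ j _ → h (suc j) (s≤s z≤n)))) (⊕-identityʳ _)
  up (suc n) (suc b) (s≤s p) f h = cong (f 0 ⊕_) (up n b p (f ∘ suc) (λ j q → h (suc j) (s≤s q)))
  down : ∀ a b → a ≤ b → (f : ℕ → ℤ) → (∀ j → j < a → f j ≡ 0ℤ) → ∑≤ b f ≡ ∑≤ (b ∸ a) (λ i → f (a ℕ.+ i))
  down zero b _ f h = refl
  down (suc a) (suc b) (s≤s p) f h =
    trans (cong (_⊕ ∑≤ b (f ∘ suc)) (h 0 (s≤s z≤n))) (trans (⊕-identityˡ _)
      (down a b p (f ∘ suc) (λ j q → h (suc j) (s≤s q))))
  shrink : ∀ n → b ≤ n → (f : ℕ → ℤ) → (∀ j → ¬ (a ≤ j × j ≤ b) → f j ≡ 0ℤ) →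
    ∑≤ n f ≡ ∑≤ (b ∸ a) (λ i → f (a ℕ.+ i))
  shrink n b≤n f h = trans (up n b b≤n f (λ j b<j → h j (λ (_ , q) → ℕ.<⇒≱ b<j q)))
    (down a b a≤b f (λ j j<a → h j (λ (q , _) → ℕ.<⇒≱ j<a q)))

-- The differences cancel down to `w a`; the value at b is `w b` itself, so no term is left over at
-- the upper end.
∑≤-telescope : ∀ n a b (w : ℕ → ℤ) → a ≤ b → b ≤ n → {f : ℕ → ℤ} →
  (∀ j → a ≤ j → j < b → f j ≡ w j ⊕ ⊖ w (suc j)) → f b ≡ w b →
  (∀ j → ¬ (a ≤ j × j ≤ b) → f j ≡ 0ℤ) → ∑≤ n f ≡ w a
∑≤-telescope n zero zero w _ _ {f} h₁ h₂ h₃ =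
  trans (∑≤-δ n 0 z≤n (λ j j≢0 → h₃ j (λ (_ , j≤0) → j≢0 (ℕ.n≤0⇒n≡0 j≤0)))) h₂
∑≤-telescope (suc n) zero (suc b) w _ (s≤s b≤n) {f} h₁ h₂ h₃ =
  trans (cong₂ _⊕_ (h₁ 0 z≤n (s≤s z≤n))
    (∑≤-telescope n zero b (w ∘ suc) z≤n b≤n (λ j _ p → h₁ (suc j) z≤n (s≤s p)) h₂
      (λ j q → h₃ (suc j) (λ { (_ , s≤s p) → q (z≤n , p) }))))
    (lem (w 0) (w 1))
  where
  lem : ∀ x y → (x ⊕ ⊖ y) ⊕ y ≡ x
  lem = solve 2 (λ x y → (x :+ (:- y)) :+ y := x) refl
∑≤-telescope (suc n) (suc a) (suc b) w (s≤s a≤b) (s≤s b≤n) {f} h₁ h₂ h₃ =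
  trans (cong₂ _⊕_ (h₃ 0 (λ (p , _) → ℕ.n≮0 p))
    (∑≤-telescope n a b (w ∘ suc) a≤b b≤n (λ j p q → h₁ (suc j) (s≤s p) (s≤s q)) h₂
      (λ j q → h₃ (suc j) (λ { (s≤s p , s≤s p′) → q (p , p′) }))))
    (⊕-identityˡ _)

-- Vectors of row lengths.

next : Vec ℕ n → ℕ
next [] = 0
next (x ∷ _) = x

data Descending (p : ℕ) : ∀ {n} → Vec ℕ n → Set where
  [] : Descending p []
  _∷_ : ∀ {n x} {xs : Vec ℕ n} → x ≤ p → Descending x xs → Descending p (x ∷ xs)

next≤ : ∀ {p} {v : Vec ℕ n} → Descending p v → next v ≤ p
next≤ [] = z≤n
next≤ (x≤p ∷ _) = x≤p

-- Reserves an empty bottom row, so that a horizontal strip can be added without leaving `Vec ℕ n`.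
LastZero : Vec ℕ n → Set
LastZero [] = ⊤
LastZero (x ∷ []) = x ≡ 0
LastZero (_ ∷ v@(_ ∷ _)) = LastZero v

LastZero-tail : ∀ {x} {v : Vec ℕ n} → LastZero (x ∷ v) → LastZero v
LastZero-tail {v = []} _ = tt
LastZero-tail {v = _ ∷ _} h = h

-- One-letter kernels and the row-by-row exchange of two horizontal strips.

module Matrices (B : ℕ) where

  -- B will be the number of columns of σ. Every μ ⊇ σ stays in these columns, so all row lengths
  -- are at most B and the matrix products are finite sums.
  ΣV : (n : ℕ) → (Vec ℕ n → ℤ) → ℤ
  ΣV zero f = f []
  ΣV (suc n) f = ∑≤ B (λ j → ΣV n (λ v → f (j ∷ v)))

  ΣV-cong : ∀ n {f g : Vec ℕ n → ℤ} → (∀ v → f v ≡ g v) → ΣV n f ≡ ΣV n g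
  ΣV-cong zero h = h []
  ΣV-cong (suc n) h = ∑≤-cong B (λ j _ → ΣV-cong n (λ v → h (j ∷ v)))

  ΣV-zero : ∀ n {f : Vec ℕ n → ℤ} → (∀ v → f v ≡ 0ℤ) → ΣV n f ≡ 0ℤ
  ΣV-zero zero h = h []
  ΣV-zero (suc n) h = ∑≤-zero B (λ j _ → ΣV-zero n (λ v → h (j ∷ v)))

  ΣV-⊕ : ∀ n {f g : Vec ℕ n → ℤ} → ΣV n (λ v → f v ⊕ g v) ≡ ΣV n f ⊕ ΣV n g
  ΣV-⊕ zero = refl
  ΣV-⊕ (suc n) = trans (∑≤-cong B (λ j _ → ΣV-⊕ n)) (∑≤-⊕ B)

  ΣV-*ˡ : ∀ n (a : ℤ) {f : Vec ℕ n → ℤ} → ΣV n (λ v → a ⊗ f v) ≡ a ⊗ ΣV n f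
  ΣV-*ˡ zero a = refl
  ΣV-*ˡ (suc n) a = trans (∑≤-cong B (λ j _ → ΣV-*ˡ n a)) (∑≤-*ˡ B a)

  ΣV-*ʳ : ∀ n (a : ℤ) {f : Vec ℕ n → ℤ} → ΣV n (λ v → f v ⊗ a) ≡ ΣV n f ⊗ a
  ΣV-*ʳ n a {f} = trans (ΣV-cong n (λ v → ⊗-comm (f v) a)) (trans (ΣV-*ˡ n a) (⊗-comm a _))

  ΣV-∑≤ : ∀ n m {f : Vec ℕ n → ℕ → ℤ} →
    ΣV n (λ v → ∑≤ m (f v)) ≡ ∑≤ m (λ j → ΣV n (λ v → f v j))
  ΣV-∑≤ zero m = refl
  ΣV-∑≤ (suc n) m = trans (∑≤-cong B (λ j _ → ΣV-∑≤ n m)) (∑≤-swap B m)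

  ΣV-swap : ∀ n m {f : Vec ℕ n → Vec ℕ m → ℤ} →
    ΣV n (λ v → ΣV m (f v)) ≡ ΣV m (λ u → ΣV n (λ v → f v u))
  ΣV-swap n zero = refl
  ΣV-swap n (suc m) = trans (ΣV-∑≤ n B) (∑≤-cong B (λ j _ → ΣV-swap n m))

  ΣV-δ : ∀ {n p} {u : Vec ℕ n} {f : Vec ℕ n → ℤ} → Descending p u → p ≤ B →
    (∀ v → v ≢ u → f v ≡ 0ℤ) → ΣV n f ≡ f u
  ΣV-δ [] _ h = refl
  ΣV-δ {n = suc n} {u = x ∷ u} (x≤p ∷ ds) p≤B h =
    trans (∑≤-δ B x x≤B (λ j j≢x → ΣV-zero n (λ v → h (j ∷ v) (λ { refl → j≢x refl }))))
          (ΣV-δ ds x≤B (λ v v≢u → h (x ∷ v) (λ { refl → v≢u refl })))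
    where x≤B = ℕ.≤-trans x≤p p≤B

  -- The weight w is a linear functional on the powers of the variable being removed;
  -- the marked term accounts for the corner box that keeps a second label.
  remove : (k s : ℕ) → Vec ℕ n → Vec ℕ n → (ℕ → ℤ) → ℤ
  remove k s [] [] w = w 0
  remove k s (d ∷ ds) (κ ∷ κs) w =
    ⟦ next ds ≤? κ ⟧ ⊗ (⟦ κ ≤? d ⟧ ⊗
      (remove k (suc s) ds κs (λ x → w ((d ∸ κ) ℕ.+ x))
       ⊕ ⊖ (⟦ s ≤? k ⟧ ⊗ (⟦ next ds <? κ ⟧ ⊗
              remove k (suc s) ds κs (λ x → w ((d ∸ κ) ℕ.+ suc x))))))

  -- `add k 1` is the matrix Hₖ. The counter s is the index of the first row of the vectors, so that
  -- the recursion can start in any row.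
  add : (k s : ℕ) → Vec ℕ n → Vec ℕ n → ℤ
  add k s [] [] = 1ℤ
  add k s (κ ∷ κs) (ν ∷ νs) =
    ⟦ next νs ≤? κ ⟧ ⊗ (⟦ κ ≤? ν ⟧ ⊗ (⟦ (κ ≟ ν) ⊎-dec (k <? s) ⟧ ⊗ add k (suc s) κs νs))

  remove-cong : ∀ k s (d κ : Vec ℕ n) {w w′ : ℕ → ℤ} → (∀ x → w x ≡ w′ x) →
    remove k s d κ w ≡ remove k s d κ w′
  remove-cong k s [] [] h = h 0
  remove-cong k s (d ∷ ds) (κ ∷ κs) h
    rewrite remove-cong k (suc s) ds κs (λ x → h ((d ∸ κ) ℕ.+ x))
          | remove-cong k (suc s) ds κs (λ x → h ((d ∸ κ) ℕ.+ suc x)) = refl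

  module LocalRule (k′ : ℕ) where
    k = suc k′

    -- The part of an entry of U⁽ᵏ⁻¹⁾ Hₖ that belongs to the rows from s on.
    removeAdd : (s : ℕ) → Vec ℕ n → Vec ℕ n → (ℕ → ℤ) → ℤ
    removeAdd {n} s λs νs w = ΣV n (λ κs → remove k′ s λs κs w ⊗ add k s κs νs)

    -- The part of an entry of Hₖ U⁽ᵏ⁾ that belongs to the rows from s on. The weight π on the first
    -- row of τ stands for its interlacing with the row above, which the recursion has already
    -- consumed.
    addRemove : (s : ℕ) → (ℕ → ℤ) → Vec ℕ n → Vec ℕ n → (ℕ → ℤ) → ℤ
    addRemove {n} s π λs νs w = ΣV n (λ τs → π (next τs) ⊗ (add k s λs τs ⊗ remove k s τs νs w))

    addRemove-cong : ∀ s (λs νs : Vec ℕ n) {π π′ w w′ : ℕ → ℤ} → (∀ x → π x ≡ π′ x) → (∀ x → w x ≡ w′ x) →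
      addRemove s π λs νs w ≡ addRemove s π′ λs νs w′
    addRemove-cong {n} s λs νs h h′ = ΣV-cong n (λ τs →
      cong₂ (λ a b → a ⊗ (add k s λs τs ⊗ b)) (h (next τs)) (remove-cong k s τs νs h′))

    removeAdd-step : ∀ s λ₁ (λs : Vec ℕ n) ν νs w → removeAdd s (λ₁ ∷ λs) (ν ∷ νs) w ≡
      ∑≤ B (λ κ → ⟦ next λs ≤? κ ⟧ ⊗ (⟦ κ ≤? λ₁ ⟧ ⊗ (⟦ next νs ≤? κ ⟧ ⊗ (⟦ κ ≤? ν ⟧ ⊗
        (⟦ (κ ≟ ν) ⊎-dec (k <? s) ⟧ ⊗
          (removeAdd (suc s) λs νs (λ x → w ((λ₁ ∸ κ) ℕ.+ x))
           ⊕ ⊖ (⟦ s ≤? k′ ⟧ ⊗ (⟦ next λs <? κ ⟧ ⊗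
                 removeAdd (suc s) λs νs (λ x → w ((λ₁ ∸ κ) ℕ.+ suc x))))))))))
    removeAdd-step {n} s λ₁ λs ν νs w = ∑≤-cong B (λ κ _ → let
        a = ⟦ next λs ≤? κ ⟧; b = ⟦ κ ≤? λ₁ ⟧; c = ⟦ next νs ≤? κ ⟧; d = ⟦ κ ≤? ν ⟧
        e = ⟦ (κ ≟ ν) ⊎-dec (k <? s) ⟧; f = ⟦ s ≤? k′ ⟧; g = ⟦ next λs <? κ ⟧
        r₁ = λ κs → remove k′ (suc s) λs κs (λ x → w ((λ₁ ∸ κ) ℕ.+ x))
        r₂ = λ κs → remove k′ (suc s) λs κs (λ x → w ((λ₁ ∸ κ) ℕ.+ suc x))
        A = λ κs → add k (suc s) κs νs
      in begin
        ΣV n (λ κs → (a ⊗ (b ⊗ (r₁ κs ⊕ ⊖ (f ⊗ (g ⊗ r₂ κs))))) ⊗ (c ⊗ (d ⊗ (e ⊗ A κs))))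
          ≡⟨ ΣV-cong n (λ κs → solve 10 (λ a b c d e f g r₁ r₂ A →
               (a :* (b :* (r₁ :+ :- (f :* (g :* r₂))))) :* (c :* (d :* (e :* A))) :=
               ((a :* (b :* (c :* (d :* e)))) :* (r₁ :* A)) :+
               ((a :* (b :* (c :* (d :* (e :* :- (f :* g)))))) :* (r₂ :* A))) refl
               a b c d e f g (r₁ κs) (r₂ κs) (A κs)) ⟩
        ΣV n (λ κs → ((a ⊗ (b ⊗ (c ⊗ (d ⊗ e)))) ⊗ (r₁ κs ⊗ A κs)) ⊕
               ((a ⊗ (b ⊗ (c ⊗ (d ⊗ (e ⊗ ⊖ (f ⊗ g)))))) ⊗ (r₂ κs ⊗ A κs)))
          ≡⟨ trans (ΣV-⊕ n) (cong₂ _⊕_ (ΣV-*ˡ n _) (ΣV-*ˡ n _)) ⟩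
        ((a ⊗ (b ⊗ (c ⊗ (d ⊗ e)))) ⊗ ΣV n (λ κs → r₁ κs ⊗ A κs)) ⊕
          ((a ⊗ (b ⊗ (c ⊗ (d ⊗ (e ⊗ ⊖ (f ⊗ g)))))) ⊗ ΣV n (λ κs → r₂ κs ⊗ A κs))
          ≡⟨ solve 9 (λ a b c d e f g x y →
               ((a :* (b :* (c :* (d :* e)))) :* x) :+ ((a :* (b :* (c :* (d :* (e :* :- (f :* g)))))) :* y) :=
               a :* (b :* (c :* (d :* (e :* (x :+ :- (f :* (g :* y)))))))) refl
               a b c d e f g _ _ ⟩
        a ⊗ (b ⊗ (c ⊗ (d ⊗ (e ⊗ (ΣV n (λ κs → r₁ κs ⊗ A κs) ⊕ ⊖ (f ⊗ (g ⊗ ΣV n (λ κs → r₂ κs ⊗ A κs)))))))) ∎)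

    -- The first row of the remaining τ must interlace both with `λ₁` and with `ν`. These two
    -- conditions become the weight π of the recursive sums; in the marked term the second one is
    -- strict and absorbs the weak one.
    addRemove-step : ∀ s π λ₁ (λs : Vec ℕ n) ν νs w → addRemove s π (λ₁ ∷ λs) (ν ∷ νs) w ≡
      ∑≤ B (λ τ → π τ ⊗ (⟦ λ₁ ≤? τ ⟧ ⊗ (⟦ (λ₁ ≟ τ) ⊎-dec (k <? s) ⟧ ⊗ (⟦ ν ≤? τ ⟧ ⊗
        (addRemove (suc s) (λ x → ⟦ x ≤? λ₁ ⟧ ⊗ ⟦ x ≤? ν ⟧) λs νs (λ x → w ((τ ∸ ν) ℕ.+ x))
         ⊕ ⊖ (⟦ s ≤? k ⟧ ⊗
           addRemove (suc s) (λ x → ⟦ x ≤? λ₁ ⟧ ⊗ ⟦ x <? ν ⟧) λs νs (λ x → w ((τ ∸ ν) ℕ.+ suc x))))))))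
    addRemove-step {n} s π λ₁ λs ν νs w = ∑≤-cong B (λ τ _ → let
        p = π τ; a = ⟦ λ₁ ≤? τ ⟧; b = ⟦ (λ₁ ≟ τ) ⊎-dec (k <? s) ⟧; c = ⟦ ν ≤? τ ⟧; f = ⟦ s ≤? k ⟧
        x₁ = λ τs → ⟦ next {n} τs ≤? λ₁ ⟧; x₂ = λ τs → ⟦ next {n} τs ≤? ν ⟧; x₃ = λ τs → ⟦ next {n} τs <? ν ⟧
        A = λ τs → add k (suc s) λs τs
        r₁ = λ τs → remove k (suc s) τs νs (λ x → w ((τ ∸ ν) ℕ.+ x))
        r₂ = λ τs → remove k (suc s) τs νs (λ x → w ((τ ∸ ν) ℕ.+ suc x))
      in begin
        ΣV n (λ τs → p ⊗ ((x₁ τs ⊗ (a ⊗ (b ⊗ A τs))) ⊗ (x₂ τs ⊗ (c ⊗ (r₁ τs ⊕ ⊖ (f ⊗ (x₃ τs ⊗ r₂ τs)))))))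
          ≡⟨ ΣV-cong n (λ τs → trans (solve 10 (λ p a b c f x₁ x₂ x₃r₂ A r₁ →
               p :* ((x₁ :* (a :* (b :* A))) :* (x₂ :* (c :* (r₁ :+ :- (f :* x₃r₂))))) :=
               ((p :* (a :* (b :* c))) :* ((x₁ :* x₂) :* (A :* r₁))) :+
               ((p :* (a :* (b :* (c :* :- f)))) :* (((x₁ :* A) :* (x₂ :* x₃r₂))))) refl
               p a b c f (x₁ τs) (x₂ τs) (x₃ τs ⊗ r₂ τs) (A τs) (r₁ τs))
               (cong₂ _⊕_ refl (cong ((p ⊗ (a ⊗ (b ⊗ (c ⊗ ⊖ f)))) ⊗_)
                 (trans (cong ((x₁ τs ⊗ A τs) ⊗_) (absorb (next τs) (r₂ τs)))
                   (solve 4 (λ x A y r → (x :* A) :* (y :* r) := (x :* y) :* (A :* r)) refl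
                     (x₁ τs) (A τs) (x₃ τs) (r₂ τs)))))) ⟩
        ΣV n (λ τs → ((p ⊗ (a ⊗ (b ⊗ c))) ⊗ ((x₁ τs ⊗ x₂ τs) ⊗ (A τs ⊗ r₁ τs))) ⊕
               ((p ⊗ (a ⊗ (b ⊗ (c ⊗ ⊖ f)))) ⊗ ((x₁ τs ⊗ x₃ τs) ⊗ (A τs ⊗ r₂ τs))))
          ≡⟨ trans (ΣV-⊕ n) (cong₂ _⊕_ (ΣV-*ˡ n _) (ΣV-*ˡ n _)) ⟩
        ((p ⊗ (a ⊗ (b ⊗ c))) ⊗ ΣV n (λ τs → (x₁ τs ⊗ x₂ τs) ⊗ (A τs ⊗ r₁ τs))) ⊕
          ((p ⊗ (a ⊗ (b ⊗ (c ⊗ ⊖ f)))) ⊗ ΣV n (λ τs → (x₁ τs ⊗ x₃ τs) ⊗ (A τs ⊗ r₂ τs)))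
          ≡⟨ solve 7 (λ p a b c f x y →
               ((p :* (a :* (b :* c))) :* x) :+ ((p :* (a :* (b :* (c :* :- f)))) :* y) :=
               p :* (a :* (b :* (c :* (x :+ :- (f :* y)))))) refl p a b c f _ _ ⟩
        p ⊗ (a ⊗ (b ⊗ (c ⊗ (ΣV n (λ τs → (x₁ τs ⊗ x₂ τs) ⊗ (A τs ⊗ r₁ τs)) ⊕
          ⊖ (f ⊗ ΣV n (λ τs → (x₁ τs ⊗ x₃ τs) ⊗ (A τs ⊗ r₂ τs))))))) ∎)
      where
      absorb : ∀ x r → ⟦ x ≤? ν ⟧ ⊗ (⟦ x <? ν ⟧ ⊗ r) ≡ ⟦ x <? ν ⟧ ⊗ r
      absorb x r with x <? ν
      ... | yes x<ν rewrite ⟦⟧-yes (x ≤? ν) (ℕ.<⇒≤ x<ν) = ⊗-identityˡ _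
      ... | no _ rewrite ⊗-zeroˡ r = ⊗-zeroʳ _

    interval : ∀ a a′ b b′ x y →
      ⟦ a ≤? x ⟧ ⊗ (⟦ x ≤? b ⟧ ⊗ (⟦ a′ ≤? x ⟧ ⊗ (⟦ x ≤? b′ ⟧ ⊗ y))) ≡
      ⟦ (a ⊔ a′ ≤? x) ×-dec (x ≤? b ⊓ b′) ⟧ ⊗ y
    interval a a′ b b′ x y = trans
      (solve 5 (λ p q r s y → p :* (q :* (r :* (s :* y))) := ((p :* r) :* (q :* s)) :* y) refl
        ⟦ a ≤? x ⟧ ⟦ x ≤? b ⟧ ⟦ a′ ≤? x ⟧ ⟦ x ≤? b′ ⟧ y)
      (cong (_⊗ y) (trans (cong₂ _⊗_
          (trans (sym (⟦⟧-× (a ≤? x) (a′ ≤? x))) (⟦⟧-cong _ (a ⊔ a′ ≤? x) (λ (p , q) → ℕ.⊔-lub p q)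
            (λ p → ℕ.m⊔n≤o⇒m≤o a a′ p , ℕ.m⊔n≤o⇒n≤o a a′ p)))
          (trans (sym (⟦⟧-× (x ≤? b) (x ≤? b′))) (⟦⟧-cong _ (x ≤? b ⊓ b′) (λ (p , q) → ℕ.⊓-glb p q)
            (λ p → ℕ.m≤n⊓o⇒m≤n b b′ p , ℕ.m≤n⊓o⇒m≤o b b′ p))))
        (sym (⟦⟧-× (a ⊔ a′ ≤? x) (x ≤? b ⊓ b′)))))

    module _ {s} (k<s : k < s) where

      -- Beyond row k neither kernel marks a corner and `add` forces no equality, so each row is
      -- left with a plain interval condition.
      removeAdd-step-beyond : ∀ λ₁ (λs : Vec ℕ n) ν νs w → removeAdd s (λ₁ ∷ λs) (ν ∷ νs) w ≡
        ∑≤ B (λ κ → ⟦ (next λs ⊔ next νs ≤? κ) ×-dec (κ ≤? λ₁ ⊓ ν) ⟧ ⊗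
          removeAdd (suc s) λs νs (λ x → w ((λ₁ ∸ κ) ℕ.+ x)))
      removeAdd-step-beyond λ₁ λs ν νs w = trans (removeAdd-step s λ₁ λs ν νs w) (∑≤-cong B λ κ _ →
        trans (cong₂ (λ e f → ⟦ next λs ≤? κ ⟧ ⊗ (⟦ κ ≤? λ₁ ⟧ ⊗ (⟦ next νs ≤? κ ⟧ ⊗ (⟦ κ ≤? ν ⟧ ⊗
                (e ⊗ (removeAdd (suc s) λs νs (λ x → w ((λ₁ ∸ κ) ℕ.+ x)) ⊕ ⊖ (f ⊗ (⟦ next λs <? κ ⟧ ⊗ removeAdd (suc s) λs νs (λ x → w ((λ₁ ∸ κ) ℕ.+ suc x))))))))))
                (⟦⟧-yes ((κ ≟ ν) ⊎-dec (k <? s)) (inj₂ k<s)) (⟦⟧-no (s ≤? k′) (λ s≤k′ → ℕ.<⇒≱ k<s (ℕ.m≤n⇒m≤1+n s≤k′))))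
          (trans (solve 6 (λ a b c d x y → a :* (b :* (c :* (d :* (con 1ℤ :* (x :+ :- (con 0ℤ :* y)))))) :=
                  a :* (b :* (c :* (d :* x)))) refl _ _ _ _ _ _)
            (interval (next λs) (next νs) λ₁ ν κ _)))

      addRemove-step-beyond : ∀ π λ₁ (λs : Vec ℕ n) ν νs w → addRemove s π (λ₁ ∷ λs) (ν ∷ νs) w ≡
        ∑≤ B (λ τ → π τ ⊗ (⟦ λ₁ ⊔ ν ≤? τ ⟧ ⊗
          addRemove (suc s) (λ x → ⟦ x ≤? λ₁ ⟧ ⊗ ⟦ x ≤? ν ⟧) λs νs (λ x → w ((τ ∸ ν) ℕ.+ x))))
      addRemove-step-beyond π λ₁ λs ν νs w = trans (addRemove-step s π λ₁ λs ν νs w) (∑≤-cong B λ τ _ →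
        trans (cong₂ (λ e f → π τ ⊗ (⟦ λ₁ ≤? τ ⟧ ⊗ (e ⊗ (⟦ ν ≤? τ ⟧ ⊗
                (addRemove (suc s) (λ x → ⟦ x ≤? λ₁ ⟧ ⊗ ⟦ x ≤? ν ⟧) λs νs (λ x → w ((τ ∸ ν) ℕ.+ x))
                  ⊕ ⊖ (f ⊗ addRemove (suc s) (λ x → ⟦ x ≤? λ₁ ⟧ ⊗ ⟦ x <? ν ⟧) λs νs (λ x → w ((τ ∸ ν) ℕ.+ suc x))))))))
                (⟦⟧-yes ((λ₁ ≟ τ) ⊎-dec (k <? s)) (inj₂ k<s)) (⟦⟧-no (s ≤? k) (ℕ.<⇒≱ k<s)))
          (trans (solve 5 (λ a b c x y → a :* (b :* (con 1ℤ :* (c :* (x :+ :- (con 0ℤ :* y))))) :=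
                  a :* ((b :* c) :* x)) refl _ _ _ _ _)
            (⊗-congʳ {π τ} (⊗-congˡ (trans (sym (⟦⟧-× (λ₁ ≤? τ) (ν ≤? τ)))
              (⟦⟧-cong _ (λ₁ ⊔ ν ≤? τ) (λ (p , q) → ℕ.⊔-lub p q)
                (λ p → ℕ.m⊔n≤o⇒m≤o λ₁ ν p , ℕ.m⊔n≤o⇒n≤o λ₁ ν p)))))))

    -- κ in row i on one side corresponds to τ in row i + 1 on the other:
    -- both range over the same interval, and reversing it matches the exponents.
    beyond : ∀ {s} → k < s → ∀ {p} λ₁ (λs : Vec ℕ n) ν νs w → Descending p (λ₁ ∷ λs) → p ≤ B → LastZero (λ₁ ∷ λs) →
      removeAdd s (λ₁ ∷ λs) (ν ∷ νs) w ≡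
      addRemove (suc s) (λ x → ⟦ x ≤? λ₁ ⟧ ⊗ ⟦ x ≤? ν ⟧) λs νs (λ x → w ((λ₁ ⊔ ν ∸ ν) ℕ.+ x))
    beyond {s = s} k<s λ₁ [] ν [] w (λ≤p ∷ _) p≤B refl = begin
      removeAdd s (0 ∷ []) (ν ∷ []) w ≡⟨ removeAdd-step-beyond k<s 0 [] ν [] w ⟩
      ∑≤ B (λ κ → ⟦ (0 ≤? κ) ×-dec (κ ≤? 0) ⟧ ⊗ (w ((0 ∸ κ) ℕ.+ 0) ⊗ 1ℤ))
        -- The last row of λ is empty, so κ = 0 is the only admissible value, and no row is left for
        -- τ.
        ≡⟨ ∑≤-δ B 0 z≤n (λ j j≢0 → ⟦⟧⊗-no ((0 ≤? j) ×-dec (j ≤? 0)) (λ (_ , j≤0) → j≢0 (ℕ.n≤0⇒n≡0 j≤0))) ⟩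
      ⟦ (0 ≤? 0) ×-dec (0 ≤? 0) ⟧ ⊗ (w 0 ⊗ 1ℤ)
        ≡⟨ cong (λ y → ⟦ (0 ≤? 0) ×-dec (0 ≤? 0) ⟧ ⊗ (w y ⊗ 1ℤ)) (trans (sym (ℕ.n∸n≡0 ν)) (sym (ℕ.+-identityʳ _))) ⟩
      ⟦ (0 ≤? 0) ×-dec (0 ≤? 0) ⟧ ⊗ (w ((ν ∸ ν) ℕ.+ 0) ⊗ 1ℤ)
        ≡⟨ solve 1 (λ y → con 1ℤ :* (y :* con 1ℤ) := (con 1ℤ :* con 1ℤ) :* (con 1ℤ :* y)) refl _ ⟩
      (⟦ 0 ≤? 0 ⟧ ⊗ ⟦ 0 ≤? ν ⟧) ⊗ (1ℤ ⊗ w ((ν ∸ ν) ℕ.+ 0)) ∎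
    beyond {s = s} k<s λ₁ (λ₂ ∷ λs) ν (ν₂ ∷ νs) w (λ₁≤p ∷ desc) p≤B lz = begin
      removeAdd s (λ₁ ∷ λ₂ ∷ λs) (ν ∷ ν₂ ∷ νs) w
        ≡⟨ removeAdd-step-beyond k<s λ₁ (λ₂ ∷ λs) ν (ν₂ ∷ νs) w ⟩
      ∑≤ B (λ κ → ⟦ (λ₂ ⊔ ν₂ ≤? κ) ×-dec (κ ≤? λ₁ ⊓ ν) ⟧ ⊗
        removeAdd (suc s) (λ₂ ∷ λs) (ν₂ ∷ νs) (λ x → w ((λ₁ ∸ κ) ℕ.+ x)))
        ≡⟨ ∑≤-cong B (λ κ _ → cong (⟦ (λ₂ ⊔ ν₂ ≤? κ) ×-dec (κ ≤? λ₁ ⊓ ν) ⟧ ⊗_)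
             (beyond (ℕ.m≤n⇒m≤1+n k<s) λ₂ λs ν₂ νs (λ x → w ((λ₁ ∸ κ) ℕ.+ x)) desc λ₁≤B lz)) ⟩
      ∑≤ B (λ κ → ⟦ (λ₂ ⊔ ν₂ ≤? κ) ×-dec (κ ≤? λ₁ ⊓ ν) ⟧ ⊗
        rest (λ x → w ((λ₁ ∸ κ) ℕ.+ ((λ₂ ⊔ ν₂ ∸ ν₂) ℕ.+ x))))
        ≡⟨ ∑≤-reflect B (λ₂ ⊔ ν₂) (λ₁ ⊓ ν) (ℕ.≤-trans (ℕ.m⊓n≤m λ₁ ν) λ₁≤B)
             (λ i j e a≤i i≤b → cong₂ _⊗_
               (trans (⟦⟧-yes (within i) (a≤i , i≤b)) (sym (⟦⟧-yes (within j) (bounds i j e a≤i i≤b))))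
               (addRemove-cong (suc (suc s)) λs νs {π = λ x → ⟦ x ≤? λ₂ ⟧ ⊗ ⟦ x ≤? ν₂ ⟧} (λ _ → refl)
                 (λ x → cong w (exponents i j e a≤i i≤b x))))
             (λ j ¬p → ⟦⟧⊗-no (within j) ¬p) (λ j ¬p → ⟦⟧⊗-no (within j) ¬p) ⟩
      ∑≤ B (λ τ → ⟦ (λ₂ ⊔ ν₂ ≤? τ) ×-dec (τ ≤? λ₁ ⊓ ν) ⟧ ⊗
        rest (λ x → w ((λ₁ ⊔ ν ∸ ν) ℕ.+ ((τ ∸ ν₂) ℕ.+ x))))
        ≡⟨ ∑≤-cong B (λ τ _ → trans (⊗-congˡ (merge τ)) (⊗-assoc (⟦ τ ≤? λ₁ ⟧ ⊗ ⟦ τ ≤? ν ⟧) _ _)) ⟩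
      ∑≤ B (λ τ → (⟦ τ ≤? λ₁ ⟧ ⊗ ⟦ τ ≤? ν ⟧) ⊗ (⟦ λ₂ ⊔ ν₂ ≤? τ ⟧ ⊗
        rest (λ x → w ((λ₁ ⊔ ν ∸ ν) ℕ.+ ((τ ∸ ν₂) ℕ.+ x)))))
        ≡⟨ addRemove-step-beyond (ℕ.m≤n⇒m≤1+n k<s) (λ x → ⟦ x ≤? λ₁ ⟧ ⊗ ⟦ x ≤? ν ⟧) λ₂ λs ν₂ νs (λ x → w ((λ₁ ⊔ ν ∸ ν) ℕ.+ x)) ⟨
      addRemove (suc s) (λ x → ⟦ x ≤? λ₁ ⟧ ⊗ ⟦ x ≤? ν ⟧) (λ₂ ∷ λs) (ν₂ ∷ νs) (λ x → w ((λ₁ ⊔ ν ∸ ν) ℕ.+ x)) ∎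
      where
      λ₁≤B = ℕ.≤-trans λ₁≤p p≤B
      within : ∀ j → Dec ((λ₂ ⊔ ν₂ ≤ j) × (j ≤ λ₁ ⊓ ν))
      within j = (λ₂ ⊔ ν₂ ≤? j) ×-dec (j ≤? λ₁ ⊓ ν)
      rest = addRemove (suc (suc s)) (λ x → ⟦ x ≤? λ₂ ⟧ ⊗ ⟦ x ≤? ν₂ ⟧) λs νs
      merge : ∀ τ → ⟦ (λ₂ ⊔ ν₂ ≤? τ) ×-dec (τ ≤? λ₁ ⊓ ν) ⟧ ≡ (⟦ τ ≤? λ₁ ⟧ ⊗ ⟦ τ ≤? ν ⟧) ⊗ ⟦ λ₂ ⊔ ν₂ ≤? τ ⟧
      merge τ = trans (⟦⟧-× (λ₂ ⊔ ν₂ ≤? τ) (τ ≤? λ₁ ⊓ ν)) (trans (⊗-comm _ _) (⊗-congˡ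
        (trans (⟦⟧-cong (τ ≤? λ₁ ⊓ ν) ((τ ≤? λ₁) ×-dec (τ ≤? ν)) (λ p → ℕ.m≤n⊓o⇒m≤n λ₁ ν p , ℕ.m≤n⊓o⇒m≤o λ₁ ν p)
          (λ (p , q) → ℕ.⊓-glb p q)) (⟦⟧-× (τ ≤? λ₁) (τ ≤? ν)))))
      module _ i j (e : i ℕ.+ j ≡ (λ₂ ⊔ ν₂) ℕ.+ (λ₁ ⊓ ν)) (a≤i : λ₂ ⊔ ν₂ ≤ i) (i≤b : i ≤ λ₁ ⊓ ν) where
        bounds : (λ₂ ⊔ ν₂ ≤ j) × (j ≤ λ₁ ⊓ ν)
        bounds = ℕ.+-cancelˡ-≤ (λ₁ ⊓ ν) _ _ (ℕ.≤-trans (ℕ.≤-reflexive (trans (ℕ.+-comm _ (λ₂ ⊔ ν₂)) (sym e)))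
                   (ℕ.+-monoˡ-≤ j i≤b))
               , ℕ.+-cancelˡ-≤ (λ₂ ⊔ ν₂) _ _ (ℕ.≤-trans (ℕ.+-monoˡ-≤ j a≤i) (ℕ.≤-reflexive e))
        ν₂≤j = ℕ.≤-trans (ℕ.m≤n⊔m λ₂ ν₂) (proj₁ bounds)
        i≤λ₁ = ℕ.≤-trans i≤b (ℕ.m⊓n≤m λ₁ ν)
        exponents : ∀ x → (λ₁ ∸ i) ℕ.+ ((λ₂ ⊔ ν₂ ∸ ν₂) ℕ.+ x) ≡ (λ₁ ⊔ ν ∸ ν) ℕ.+ ((j ∸ ν₂) ℕ.+ x)
        exponents x = trans (sym (ℕ.+-assoc (λ₁ ∸ i) _ x)) (trans (cong (ℕ._+ x) core) (ℕ.+-assoc _ (j ∸ ν₂) x))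
          where
          -- Once the truncated differences are cleared, this is `λ₁ + ν = (λ₁ ⊔ ν) + (λ₁ ⊓ ν)`
          -- combined with the given value of `i + j`.
          core : (λ₁ ∸ i) ℕ.+ (λ₂ ⊔ ν₂ ∸ ν₂) ≡ (λ₁ ⊔ ν ∸ ν) ℕ.+ (j ∸ ν₂)
          core = ℕ.+-cancelʳ-≡ ((i ℕ.+ ν₂) ℕ.+ ν) _ _ (begin
            ((λ₁ ∸ i) ℕ.+ (λ₂ ⊔ ν₂ ∸ ν₂)) ℕ.+ ((i ℕ.+ ν₂) ℕ.+ ν) ≡⟨ shuffle (λ₁ ∸ i) (λ₂ ⊔ ν₂ ∸ ν₂) i ν₂ ν ⟩
            (((λ₁ ∸ i) ℕ.+ i) ℕ.+ ((λ₂ ⊔ ν₂ ∸ ν₂) ℕ.+ ν₂)) ℕ.+ ν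
              ≡⟨ cong₂ (λ x y → (x ℕ.+ y) ℕ.+ ν) (ℕ.m∸n+n≡m i≤λ₁) (ℕ.m∸n+n≡m (ℕ.m≤n⊔m λ₂ ν₂)) ⟩
            (λ₁ ℕ.+ (λ₂ ⊔ ν₂)) ℕ.+ ν ≡⟨ trans (cong (ℕ._+ ν) (ℕ.+-comm λ₁ _)) (ℕ.+-assoc (λ₂ ⊔ ν₂) λ₁ ν) ⟩
            (λ₂ ⊔ ν₂) ℕ.+ (λ₁ ℕ.+ ν) ≡⟨ cong ((λ₂ ⊔ ν₂) ℕ.+_) (maxmin λ₁ ν) ⟨
            (λ₂ ⊔ ν₂) ℕ.+ ((λ₁ ⊔ ν) ℕ.+ (λ₁ ⊓ ν)) ≡⟨ trans (cong ((λ₂ ⊔ ν₂) ℕ.+_) (ℕ.+-comm (λ₁ ⊔ ν) _)) (sym (ℕ.+-assoc (λ₂ ⊔ ν₂) _ _)) ⟩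
            ((λ₂ ⊔ ν₂) ℕ.+ (λ₁ ⊓ ν)) ℕ.+ (λ₁ ⊔ ν) ≡⟨ cong (ℕ._+ (λ₁ ⊔ ν)) e ⟨
            (i ℕ.+ j) ℕ.+ (λ₁ ⊔ ν) ≡⟨ cong₂ (λ x y → (i ℕ.+ x) ℕ.+ y) (ℕ.m∸n+n≡m ν₂≤j) (ℕ.m∸n+n≡m (ℕ.m≤n⊔m λ₁ ν)) ⟨
            (i ℕ.+ ((j ∸ ν₂) ℕ.+ ν₂)) ℕ.+ ((λ₁ ⊔ ν ∸ ν) ℕ.+ ν) ≡⟨ shuffle′ i (j ∸ ν₂) ν₂ (λ₁ ⊔ ν ∸ ν) ν ⟩
            ((λ₁ ⊔ ν ∸ ν) ℕ.+ (j ∸ ν₂)) ℕ.+ ((i ℕ.+ ν₂) ℕ.+ ν) ∎)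
            where
            open import Data.Nat.Tactic.RingSolver using (solve-∀)
            shuffle : ∀ a b i m ν → (a ℕ.+ b) ℕ.+ ((i ℕ.+ m) ℕ.+ ν) ≡ ((a ℕ.+ i) ℕ.+ (b ℕ.+ m)) ℕ.+ ν
            shuffle = solve-∀
            shuffle′ : ∀ i b m a ν → (i ℕ.+ (b ℕ.+ m)) ℕ.+ (a ℕ.+ ν) ≡ (a ℕ.+ b) ℕ.+ ((i ℕ.+ m) ℕ.+ ν)
            shuffle′ = solve-∀
            maxmin : ∀ a b → (a ⊔ b) ℕ.+ (a ⊓ b) ≡ a ℕ.+ b
            maxmin a b with ℕ.≤-total a b
            ... | inj₁ a≤b rewrite ℕ.m≤n⇒m⊔n≡n a≤b | ℕ.m≤n⇒m⊓n≡m a≤b = ℕ.+-comm b a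
            ... | inj₂ b≤a rewrite ℕ.m≥n⇒m⊔n≡m b≤a | ℕ.m≥n⇒m⊓n≡n b≤a = refl

    -- In a row s ≤ k `add` forces κ = ν, while `remove` demands κ ≤ `λ₁`.
    removeAdd-vanish : ∀ {s} → s ≤ k → ∀ (λs νs : Vec ℕ n) w → ¬ (next νs ≤ next λs) →
      removeAdd s λs νs w ≡ 0ℤ
    removeAdd-vanish s≤k [] [] w h = contradiction z≤n h
    removeAdd-vanish {s = s} s≤k (λ₁ ∷ λs) (ν ∷ νs) w h =
      trans (removeAdd-step s λ₁ λs ν νs w) (∑≤-zero B λ κ _ → zero-term κ)
      where
      zero-term : ∀ κ {x} → ⟦ next λs ≤? κ ⟧ ⊗ (⟦ κ ≤? λ₁ ⟧ ⊗ (⟦ next νs ≤? κ ⟧ ⊗ (⟦ κ ≤? ν ⟧ ⊗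
        (⟦ (κ ≟ ν) ⊎-dec (k <? s) ⟧ ⊗ x)))) ≡ 0ℤ
      zero-term κ with κ ≤? λ₁ | (κ ≟ ν) ⊎-dec (k <? s)
      ... | no _ | _ = trans (⊗-congʳ (⊗-zeroˡ _)) (⊗-zeroʳ _)
      ... | yes _ | no _ = trans (⊗-congʳ (⊗-congʳ (⊗-congʳ (trans (⊗-congʳ (⊗-zeroˡ _)) (⊗-zeroʳ _)))))
                             (solve 3 (λ a b c → a :* (b :* (c :* con 0ℤ)) := con 0ℤ) refl _ _ _)
      ... | yes κ≤λ₁ | yes (inj₁ refl) = contradiction κ≤λ₁ h
      ... | yes _ | yes (inj₂ k<s) = contradiction s≤k (ℕ.<⇒≱ k<s)

    private
      below : ℕ → ℕ → ℕ → ℤ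
      below a b x = ⟦ x ≤? a ⟧ ⊗ ⟦ x ≤? b ⟧

      strictlyBelow : ℕ → ℕ → ℕ → ℤ
      strictlyBelow a b x = ⟦ x ≤? a ⟧ ⊗ ⟦ x <? b ⟧

    -- In row k the marked terms telescope in τ, leaving only the least admissible τ.
    telescoped : ∀ {s} → s ≡ k → ∀ {p} λ₁ (λs : Vec ℕ n) ν νs (w : ℕ → ℤ) → Descending p (λ₁ ∷ λs) → p ≤ B →
      LastZero (λ₁ ∷ λs) → ν ≤ λ₁ →
      addRemove (suc s) (below λ₁ ν) λs νs w ⊕ ⊖ addRemove (suc s) (strictlyBelow λ₁ ν) λs νs (w ∘ suc) ≡
      ⟦ next λs ≤? ν ⟧ ⊗ (⟦ next νs ≤? ν ⟧ ⊗ removeAdd (suc s) λs νs w)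
    telescoped refl λ₁ [] ν [] w (λ≤p ∷ _) p≤B refl z≤n =
      solve 2 (λ x y → (con 1ℤ :* con 1ℤ) :* (con 1ℤ :* x) :+ :- ((con 1ℤ :* con 0ℤ) :* (con 1ℤ :* y)) :=
        con 1ℤ :* (con 1ℤ :* (x :* con 1ℤ))) refl (w 0) (w 1)
    telescoped {n = suc n} {s = s} refl λ₁ (λ₂ ∷ λs) ν (ν₂ ∷ νs) w (λ₁≤p ∷ desc@(λ₂≤λ₁ ∷ _)) p≤B lz ν≤λ₁ = begin
      addRemove (suc s) (below λ₁ ν) (λ₂ ∷ λs) (ν₂ ∷ νs) w ⊕
        ⊖ addRemove (suc s) (strictlyBelow λ₁ ν) (λ₂ ∷ λs) (ν₂ ∷ νs) (w ∘ suc)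
        ≡⟨ cong₂ (λ x y → x ⊕ ⊖ y) (addRemove-step-beyond ℕ.≤-refl (below λ₁ ν) λ₂ λs ν₂ νs w)
             (addRemove-step-beyond ℕ.≤-refl (strictlyBelow λ₁ ν) λ₂ λs ν₂ νs (w ∘ suc)) ⟩
      ∑≤ B f₁ ⊕ ⊖ ∑≤ B f₂ ≡⟨ cong (∑≤ B f₁ ⊕_) (∑≤-⊖ B) ⟨
      ∑≤ B f₁ ⊕ ∑≤ B (λ τ → ⊖ f₂ τ) ≡⟨ ∑≤-⊕ B ⟨
      ∑≤ B (λ τ → f₁ τ ⊕ ⊖ f₂ τ) ≡⟨ total ⟩
      ⟦ λ₂ ≤? ν ⟧ ⊗ (⟦ ν₂ ≤? ν ⟧ ⊗ rest (λ x → w ((λ₂ ⊔ ν₂ ∸ ν₂) ℕ.+ x)))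
        -- The surviving value at τ = `λ₂ ⊔ ν₂` is the right-hand side of `beyond` for the remaining
        -- rows.
        ≡⟨ ⊗-congʳ (⊗-congʳ (beyond ℕ.≤-refl λ₂ λs ν₂ νs w desc λ₁≤B lz)) ⟨
      ⟦ λ₂ ≤? ν ⟧ ⊗ (⟦ ν₂ ≤? ν ⟧ ⊗ removeAdd (suc s) (λ₂ ∷ λs) (ν₂ ∷ νs) w) ∎
      where
      λ₁≤B = ℕ.≤-trans λ₁≤p p≤B
      rest = addRemove (suc (suc s)) (below λ₂ ν₂) λs νs
      W : ℕ → ℤ
      W τ = rest (λ x → w ((τ ∸ ν₂) ℕ.+ x))
      f₁ f₂ : ℕ → ℤ
      f₁ τ = below λ₁ ν τ ⊗ (⟦ λ₂ ⊔ ν₂ ≤? τ ⟧ ⊗ W τ)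
      f₂ τ = strictlyBelow λ₁ ν τ ⊗ (⟦ λ₂ ⊔ ν₂ ≤? τ ⟧ ⊗ rest (λ x → w (suc ((τ ∸ ν₂) ℕ.+ x))))
      outside : ∀ τ → ¬ (λ₂ ⊔ ν₂ ≤ τ × τ ≤ ν) → f₁ τ ⊕ ⊖ f₂ τ ≡ 0ℤ
      outside τ h with λ₂ ⊔ ν₂ ≤? τ | τ ≤? ν
      ... | no _ | _ = solve 4 (λ a b c d → a :* (con 0ℤ :* b) :+ :- (c :* (con 0ℤ :* d)) := con 0ℤ) refl _ _ _ _
      ... | yes p | yes q = contradiction (p , q) h
      ... | yes _ | no τ≰ν rewrite ⟦⟧-no (τ <? ν) (τ≰ν ∘ ℕ.<⇒≤) =
        solve 3 (λ a b d → (a :* con 0ℤ) :* (con 1ℤ :* b) :+ :- ((a :* con 0ℤ) :* (con 1ℤ :* d)) := con 0ℤ) refl _ _ _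
      inside : ∀ τ → λ₂ ⊔ ν₂ ≤ τ → τ < ν → f₁ τ ⊕ ⊖ f₂ τ ≡ W τ ⊕ ⊖ W (suc τ)
      inside τ a≤τ τ<ν rewrite ⟦⟧-yes (λ₂ ⊔ ν₂ ≤? τ) a≤τ | ⟦⟧-yes (τ <? ν) τ<ν | ⟦⟧-yes (τ ≤? ν) (ℕ.<⇒≤ τ<ν)
        | ⟦⟧-yes (τ ≤? λ₁) (ℕ.≤-trans (ℕ.<⇒≤ τ<ν) ν≤λ₁)
        | ℕ.+-∸-assoc 1 (ℕ.≤-trans (ℕ.m≤n⊔m λ₂ ν₂) a≤τ) =
        solve 2 (λ x y → (con 1ℤ :* con 1ℤ) :* (con 1ℤ :* x) :+ :- ((con 1ℤ :* con 1ℤ) :* (con 1ℤ :* y)) := x :+ :- y) refl _ _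
      -- At τ = ν the strict inequality kills the marked term; this is the unpaired end of the
      -- telescope.
      end : λ₂ ⊔ ν₂ ≤ ν → f₁ ν ⊕ ⊖ f₂ ν ≡ W ν
      end a≤ν rewrite ⟦⟧-yes (λ₂ ⊔ ν₂ ≤? ν) a≤ν | ⟦⟧-no (ν <? ν) (ℕ.<-irrefl refl) | ⟦⟧-yes (ν ≤? ν) ℕ.≤-refl
        | ⟦⟧-yes (ν ≤? λ₁) ν≤λ₁ =
        solve 2 (λ x y → (con 1ℤ :* con 1ℤ) :* (con 1ℤ :* x) :+ :- ((con 1ℤ :* con 0ℤ) :* (con 1ℤ :* y)) := x) refl _ _
      total : ∑≤ B (λ τ → f₁ τ ⊕ ⊖ f₂ τ) ≡ ⟦ λ₂ ≤? ν ⟧ ⊗ (⟦ ν₂ ≤? ν ⟧ ⊗ W (λ₂ ⊔ ν₂))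
      total with λ₂ ≤? ν | ν₂ ≤? ν
      ... | yes p | yes q = trans (∑≤-telescope B (λ₂ ⊔ ν₂) ν W (ℕ.⊔-lub p q) (ℕ.≤-trans ν≤λ₁ λ₁≤B) inside
                (end (ℕ.⊔-lub p q)) outside) (sym (trans (⊗-identityˡ _) (⊗-identityˡ _)))
      ... | no p | _ = trans (∑≤-zero B (λ τ _ → outside τ (λ (a , b) → p (ℕ.≤-trans (ℕ.m⊔n≤o⇒m≤o λ₂ ν₂ a) b)))) (sym (⊗-zeroˡ _))
      ... | yes _ | no p = trans (∑≤-zero B (λ τ _ → outside τ (λ (a , b) → p (ℕ.≤-trans (ℕ.m⊔n≤o⇒n≤o λ₂ ν₂ a) b))))
                (sym (trans (⊗-congʳ (⊗-zeroˡ _)) (⊗-zeroʳ _)))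

    -- In rows s ≤ k `add` changes nothing, so τ starts with `λ₁` and κ with `ν`, and such a row
    -- contributes the same factor to both products. The two kernels differ in row k alone, where
    -- only U⁽ᵏ⁾ may mark a corner; there the recursion ends with `telescoped`.
    exchange-rows : ∀ {s} → s ≤ k → ∀ {p} π (λs νs : Vec ℕ n) w → Descending p λs → p ≤ B → LastZero λs →
      addRemove s π λs νs w ≡ π (next λs) ⊗ removeAdd s λs νs w
    exchange-rows s≤k π [] [] w _ _ _ = ⊗-congʳ (⊗-comm _ _)
    exchange-rows {n = suc n} {s} s≤k π (λ₁ ∷ λs) (ν ∷ νs) w (λ₁≤p ∷ desc) p≤B lz = begin
      addRemove s π (λ₁ ∷ λs) (ν ∷ νs) w ≡⟨ addRemove-step s π λ₁ λs ν νs w ⟩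
      ∑≤ B _ ≡⟨ ∑≤-δ B λ₁ λ₁≤B (λ τ τ≢λ₁ → trans (⊗-congʳ (⊗-congʳ (⟦⟧⊗-no ((λ₁ ≟ τ) ⊎-dec (k <? s))
          λ { (inj₁ e) → τ≢λ₁ (sym e) ; (inj₂ k<s) → ℕ.<⇒≱ k<s s≤k })))
          (trans (⊗-congʳ (⊗-zeroʳ _)) (⊗-zeroʳ _))) ⟩
      π λ₁ ⊗ (⟦ λ₁ ≤? λ₁ ⟧ ⊗ (⟦ (λ₁ ≟ λ₁) ⊎-dec (k <? s) ⟧ ⊗ (⟦ ν ≤? λ₁ ⟧ ⊗
        (addRemove (suc s) (below λ₁ ν) λs νs w₁
         ⊕ ⊖ (⟦ s ≤? k ⟧ ⊗ addRemove (suc s) (strictlyBelow λ₁ ν) λs νs (w₁ ∘ suc))))))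
        ≡⟨ ⊗-congʳ (trans (⟦⟧⊗-yes (λ₁ ≤? λ₁) ℕ.≤-refl) (trans (⟦⟧⊗-yes ((λ₁ ≟ λ₁) ⊎-dec (k <? s)) (inj₁ refl))
             (⟦⟧-scale-cong (ν ≤? λ₁) (λ ν≤λ₁ → trans (⊕-congʳ (cong ⊖_ (⟦⟧⊗-yes (s ≤? k) s≤k))) (core ν≤λ₁))))) ⟩
      π λ₁ ⊗ (⟦ ν ≤? λ₁ ⟧ ⊗ (⟦ next λs ≤? ν ⟧ ⊗ (⟦ next νs ≤? ν ⟧ ⊗ removed ν)))
        ≡⟨ ⊗-congʳ fixed-row ⟨
      π λ₁ ⊗ removeAdd s (λ₁ ∷ λs) (ν ∷ νs) w ∎
      where
      λ₁≤B = ℕ.≤-trans λ₁≤p p≤B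
      w₁ : ℕ → ℤ
      w₁ x = w ((λ₁ ∸ ν) ℕ.+ x)
      removed : ℕ → ℤ
      removed κ = removeAdd (suc s) λs νs (λ x → w ((λ₁ ∸ κ) ℕ.+ x))
           ⊕ ⊖ (⟦ s ≤? k′ ⟧ ⊗ (⟦ next λs <? κ ⟧ ⊗
                 removeAdd (suc s) λs νs (λ x → w ((λ₁ ∸ κ) ℕ.+ suc x))))
      core : ν ≤ λ₁ → addRemove (suc s) (below λ₁ ν) λs νs w₁ ⊕ ⊖ addRemove (suc s) (strictlyBelow λ₁ ν) λs νs (w₁ ∘ suc) ≡
        ⟦ next λs ≤? ν ⟧ ⊗ (⟦ next νs ≤? ν ⟧ ⊗ removed ν)
      core ν≤λ₁ with s ≤? k′
      ... | no s≰k′ = trans (telescoped (ℕ.≤-antisym s≤k (ℕ.≰⇒> s≰k′)) λ₁ λs ν νs w₁ (λ₁≤p ∷ desc) p≤B lz ν≤λ₁)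
        (⊗-congʳ (⊗-congʳ (solve 2 (λ x y → x := x :+ :- (con 0ℤ :* y)) refl _ _)))
      ... | yes s≤k′ = trans
        (cong₂ (λ x y → x ⊕ ⊖ y) (exchange-rows (s≤s s≤k′) (below λ₁ ν) λs νs w₁ desc λ₁≤B (LastZero-tail {x = λ₁} {λs} lz))
          (exchange-rows (s≤s s≤k′) (strictlyBelow λ₁ ν) λs νs (w₁ ∘ suc) desc λ₁≤B (LastZero-tail {x = λ₁} {λs} lz)))
        (combine (removeAdd-vanish (s≤s s≤k′) λs νs w₁) (removeAdd-vanish (s≤s s≤k′) λs νs (w₁ ∘ suc)))
        where
        -- The condition `next νs ≤ ν` occurs on the right only. Where it fails although
        -- `next λs ≤ ν`, both `removeAdd` sums vanish.
        combine : ∀ {x y} → (¬ (next νs ≤ next λs) → x ≡ 0ℤ) → (¬ (next νs ≤ next λs) → y ≡ 0ℤ) →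
          (below λ₁ ν (next λs) ⊗ x) ⊕ ⊖ (strictlyBelow λ₁ ν (next λs) ⊗ y) ≡
          ⟦ next λs ≤? ν ⟧ ⊗ (⟦ next νs ≤? ν ⟧ ⊗ (x ⊕ ⊖ (1ℤ ⊗ (⟦ next λs <? ν ⟧ ⊗ y))))
        combine hx hy rewrite ⟦⟧-yes (next λs ≤? λ₁) (next≤ desc) with next λs ≤? ν | next νs ≤? ν
        ... | no p | _ rewrite ⟦⟧-no (next λs <? ν) (p ∘ ℕ.<⇒≤) =
          solve 3 (λ x y z → (con 1ℤ :* con 0ℤ) :* x :+ :- ((con 1ℤ :* con 0ℤ) :* y) := con 0ℤ :* z) refl _ _ _
        ... | yes _ | yes _ =
          solve 3 (λ x y z → (con 1ℤ :* con 1ℤ) :* x :+ :- ((con 1ℤ :* z) :* y) :=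
            con 1ℤ :* (con 1ℤ :* (x :+ :- (con 1ℤ :* (z :* y))))) refl _ _ _
        ... | yes p | no q rewrite hx (λ r → q (ℕ.≤-trans r p)) | hy (λ r → q (ℕ.≤-trans r p)) =
          solve 1 (λ z → (con 1ℤ :* con 1ℤ) :* con 0ℤ :+ :- ((con 1ℤ :* z) :* con 0ℤ) :=
            con 1ℤ :* (con 0ℤ :* (con 0ℤ :+ :- (con 1ℤ :* (z :* con 0ℤ))))) refl _
      fixed-row : removeAdd s (λ₁ ∷ λs) (ν ∷ νs) w ≡
        ⟦ ν ≤? λ₁ ⟧ ⊗ (⟦ next λs ≤? ν ⟧ ⊗ (⟦ next νs ≤? ν ⟧ ⊗ removed ν))
      fixed-row with ν ≤? λ₁
      ... | yes ν≤λ₁ = trans (removeAdd-step s λ₁ λs ν νs w) (trans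
        (∑≤-δ B ν (ℕ.≤-trans ν≤λ₁ λ₁≤B) (λ κ κ≢ν → trans (⊗-congʳ (⊗-congʳ (⊗-congʳ (⊗-congʳ (forced κ κ≢ν)))))
          (solve 4 (λ a b c d → a :* (b :* (c :* (d :* con 0ℤ))) := con 0ℤ) refl _ _ _ _)))
        (trans (⊗-congʳ (trans (⟦⟧⊗-yes (ν ≤? λ₁) ν≤λ₁) (⊗-congʳ (trans (⟦⟧⊗-yes (ν ≤? ν) ℕ.≤-refl)
          (⟦⟧⊗-yes ((ν ≟ ν) ⊎-dec (k <? s)) (inj₁ refl)))))) (sym (⊗-identityˡ _))))
        where
        forced : ∀ κ → κ ≢ ν → ∀ {x} → ⟦ (κ ≟ ν) ⊎-dec (k <? s) ⟧ ⊗ x ≡ 0ℤ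
        forced κ κ≢ν = ⟦⟧⊗-no ((κ ≟ ν) ⊎-dec (k <? s)) (λ { (inj₁ e) → κ≢ν e ; (inj₂ k<s) → ℕ.<⇒≱ k<s s≤k })
      ... | no ν≰λ₁ = trans (removeAdd-step s λ₁ λs ν νs w) (trans (∑≤-zero B (λ κ _ → zero-term κ)) (sym (⊗-zeroˡ _)))
        where
        zero-term : ∀ κ {a c d x} → a ⊗ (⟦ κ ≤? λ₁ ⟧ ⊗ (c ⊗ (d ⊗ (⟦ (κ ≟ ν) ⊎-dec (k <? s) ⟧ ⊗ x)))) ≡ 0ℤ
        zero-term κ with κ ≤? λ₁ | (κ ≟ ν) ⊎-dec (k <? s)
        ... | no _ | _ = solve 5 (λ a c d e x → a :* (con 0ℤ :* (c :* (d :* (e :* x)))) := con 0ℤ) refl _ _ _ _ _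
        ... | yes _ | no _ = solve 5 (λ a c d e x → a :* (e :* (c :* (d :* (con 0ℤ :* x)))) := con 0ℤ) refl _ _ _ _ _
        ... | yes κ≤λ₁ | yes (inj₁ refl) = contradiction κ≤λ₁ ν≰λ₁
        ... | yes _ | yes (inj₂ k<s) = contradiction s≤k (ℕ.<⇒≱ k<s)

-- Containment, horizontal strips and heights.

infix 4 _≤ᵛ_
_≤ᵛ_ : Vec ℕ n → Vec ℕ n → Set
_≤ᵛ_ = Pointwise _≤_

≤ᵛ-refl : {v : Vec ℕ n} → v ≤ᵛ v
≤ᵛ-refl = Pointwise.refl ℕ.≤-refl

≤ᵛ-trans : {u v w : Vec ℕ n} → u ≤ᵛ v → v ≤ᵛ w → u ≤ᵛ w
≤ᵛ-trans = Pointwise.trans ℕ.≤-trans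

next-≤ᵛ : {u v : Vec ℕ n} → u ≤ᵛ v → next u ≤ next v
next-≤ᵛ [] = z≤n
next-≤ᵛ (p ∷ _) = p

HeightLE : ℕ → Vec ℕ n → Set
HeightLE h [] = ⊤
HeightLE zero (x ∷ v) = x ≡ 0 × HeightLE zero v
HeightLE (suc h) (x ∷ v) = HeightLE h v

LastZero-height : ∀ {h} (v : Vec ℕ n) → HeightLE h v → h < n → LastZero v
LastZero-height [] _ _ = tt
LastZero-height {h = zero} (x ∷ []) (p , _) _ = p
LastZero-height {h = zero} (x ∷ y ∷ v) (_ , p) _ = LastZero-height (y ∷ v) p (s≤s z≤n)
LastZero-height {h = suc h} (x ∷ []) _ (s≤s ())
LastZero-height {h = suc h} (x ∷ y ∷ v) p (s≤s q) = LastZero-height (y ∷ v) p q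

data Strip : Vec ℕ n → Vec ℕ n → Set where
  [] : Strip [] []
  strip : ∀ {n d κ} {ds κs : Vec ℕ n} → next ds ≤ κ → κ ≤ d → Strip ds κs → Strip (d ∷ ds) (κ ∷ κs)

Strip-next : {d κ : Vec ℕ n} → Strip d κ → next κ ≤ next d
Strip-next [] = z≤n
Strip-next (strip _ p _) = p

Strip⇒≤ᵛ : {d κ : Vec ℕ n} → Strip d κ → κ ≤ᵛ d
Strip⇒≤ᵛ [] = []
Strip⇒≤ᵛ (strip _ p s) = p ∷ Strip⇒≤ᵛ s

Descending-next : ∀ {p} {v : Vec ℕ n} → Descending p v → ∀ {q} → next v ≤ q → Descending q v
Descending-next [] _ = []
Descending-next (_ ∷ d) x≤q = x≤q ∷ d

Strip-descendingˡ : ∀ {p} {d κ : Vec ℕ n} → Strip d κ → Descending p d → Descending p κ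
Strip-descendingˡ [] [] = []
Strip-descendingˡ (strip p κ≤d s) (q ∷ desc) =
  ℕ.≤-trans κ≤d q ∷ Descending-next (Strip-descendingˡ s desc) (ℕ.≤-trans (Strip-next s) p)

Strip-descendingʳ : ∀ {p} {d κ : Vec ℕ n} → Strip d κ → next d ≤ p → Descending p d
Strip-descendingʳ [] q = []
Strip-descendingʳ (strip p κ≤d s) q = q ∷ Strip-descendingʳ s (ℕ.≤-trans p κ≤d)

HeightLE-zero : {v : Vec ℕ n} → Descending 0 v → HeightLE 0 v
HeightLE-zero [] = tt
HeightLE-zero (z≤n ∷ d) = refl , HeightLE-zero d

-- By interlacing, row i + 1 of d is at most row i of κ, so a horizontal strip reaches at most one
-- new row.
Strip-height : ∀ {h} {d κ : Vec ℕ n} → Strip d κ → HeightLE h κ → HeightLE (suc h) d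
Strip-height [] _ = tt
Strip-height {h = zero} (strip p _ s) (refl , _) = HeightLE-zero (Strip-descendingʳ s p)
Strip-height {h = suc h} (strip _ _ s) q = Strip-height s q

≤ᵛ-height : ∀ {h} {u v : Vec ℕ n} → u ≤ᵛ v → HeightLE h v → HeightLE h u
≤ᵛ-height [] _ = tt
≤ᵛ-height {h = zero} (p ∷ ps) (refl , q) = ℕ.n≤0⇒n≡0 p , ≤ᵛ-height ps q
≤ᵛ-height {h = suc h} (p ∷ ps) q = ≤ᵛ-height ps q

≤ᵛ-LastZero : {u v : Vec ℕ n} → u ≤ᵛ v → LastZero v → LastZero u
≤ᵛ-LastZero [] _ = tt
≤ᵛ-LastZero (p ∷ []) refl = ℕ.n≤0⇒n≡0 p
≤ᵛ-LastZero (p ∷ q ∷ ps) l = ≤ᵛ-LastZero (q ∷ ps) l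

sum-≤ᵛ : {u v : Vec ℕ n} → u ≤ᵛ v → sum u ≤ sum v
sum-≤ᵛ [] = z≤n
sum-≤ᵛ (p ∷ ps) = ℕ.+-mono-≤ p (sum-≤ᵛ ps)

sum-≤ᵛ-strict : {u v : Vec ℕ n} → u ≤ᵛ v → u ≢ v → sum u < sum v
sum-≤ᵛ-strict [] h = contradiction refl h
sum-≤ᵛ-strict {u = x ∷ u} {y ∷ v} (p ∷ ps) h with x ≟ y
... | no x≢y = ℕ.+-mono-<-≤ (ℕ.≤∧≢⇒< p x≢y) (sum-≤ᵛ ps)
... | yes refl = ℕ.+-monoʳ-< x (sum-≤ᵛ-strict ps (λ { refl → h refl }))

δ : Vec ℕ n → Vec ℕ n → ℤ
δ u v = ⟦ ≡-dec _≟_ u v ⟧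

-- Products of kernels and of horizontal strips, and cancellation.

module ChainIdentity (B : ℕ) where
  open Matrices B

  Matrix : ℕ → Set
  Matrix n = Vec ℕ n → Vec ℕ n → ℤ

  infixl 7 _∙_
  _∙_ : Matrix n → Matrix n → Matrix n
  (M ∙ N) x y = ΣV _ (λ z → M x z ⊗ N z y)

  ∙-assoc : (M N O : Matrix n) → ∀ x y → ((M ∙ N) ∙ O) x y ≡ (M ∙ (N ∙ O)) x y
  ∙-assoc {n} M N O x y = begin
    ΣV n (λ z → ΣV n (λ u → M x u ⊗ N u z) ⊗ O z y)
      ≡⟨ ΣV-cong n (λ z → trans (sym (ΣV-*ʳ n (O z y))) (ΣV-cong n (λ u → ⊗-assoc _ _ _))) ⟩
    ΣV n (λ z → ΣV n (λ u → M x u ⊗ (N u z ⊗ O z y))) ≡⟨ ΣV-swap n n ⟩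
    ΣV n (λ u → ΣV n (λ z → M x u ⊗ (N u z ⊗ O z y))) ≡⟨ ΣV-cong n (λ u → ΣV-*ˡ n (M x u)) ⟩
    ΣV n (λ u → M x u ⊗ ΣV n (λ z → N u z ⊗ O z y)) ∎

  ∙-congʳ : (M : Matrix n) {N O : Matrix n} → ∀ x y → (∀ z → M x z ≢ 0ℤ → N z y ≡ O z y) → (M ∙ N) x y ≡ (M ∙ O) x y
  ∙-congʳ {n} M x y h = ΣV-cong n (λ z → *-cancel-support (M x z) (h z))

  ∙-congˡ : {M N : Matrix n} (O : Matrix n) → ∀ x y → (∀ z → O z y ≢ 0ℤ → M x z ≡ N x z) → (M ∙ O) x y ≡ (N ∙ O) x y
  ∙-congˡ {n} {M} {N} O x y h = ΣV-cong n (λ z → trans (⊗-comm (M x z) _) (trans (*-cancel-support (O z y) (h z)) (⊗-comm _ _)))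

  ΣV≢0 : ∀ n (f : Vec ℕ n → ℤ) → ΣV n f ≢ 0ℤ → ∃ λ v → f v ≢ 0ℤ
  ΣV≢0 zero f h = [] , h
  ΣV≢0 (suc n) f h =
    let j , p = go B (λ j → ΣV n (λ v → f (j ∷ v))) h ; v , q = ΣV≢0 n (λ v → f (j ∷ v)) p in j ∷ v , q
    where
    go : ∀ N (g : ℕ → ℤ) → ∑≤ N g ≢ 0ℤ → ∃ λ j → g j ≢ 0ℤ
    go zero g h = 0 , h
    go (suc N) g h with g 0 ℤ.≟ 0ℤ
    ... | no p = 0 , p
    ... | yes p = let j , q = go N (g ∘ suc) (λ e → h (trans (cong₂ _⊕_ p e) (⊕-identityˡ _))) in suc j , q

  ∙≢0 : (M N : Matrix n) → ∀ x y → (M ∙ N) x y ≢ 0ℤ → ∃ λ z → M x z ≢ 0ℤ × N z y ≢ 0ℤ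
  ∙≢0 {n} M N x y h = let z , p = ΣV≢0 n (λ z → M x z ⊗ N z y) h in z , *≢0ˡ (M x z) _ p , *≢0ʳ (M x z) _ p

  δ-diag : (v : Vec ℕ n) → δ v v ≡ 1ℤ
  δ-diag v = ⟦⟧-yes (≡-dec _≟_ v v) refl

  δ≢0 : (u v : Vec ℕ n) → δ u v ≢ 0ℤ → u ≡ v
  δ≢0 u v = ⟦⟧≢0 (≡-dec _≟_ u v)

  -- The products sum over entries up to B only, so δ acts as a unit at vectors that respect this
  -- bound; a descending vector bounded by p ≤ B does.
  δ-∙ : (M : Matrix n) → ∀ {p x} y → Descending p x → p ≤ B → (δ ∙ M) x y ≡ M x y
  δ-∙ M {x = x} y d p≤B = trans (ΣV-δ d p≤B (λ z z≢x → trans (⊗-congˡ (⟦⟧-no (≡-dec _≟_ x z) (z≢x ∘ sym))) (⊗-zeroˡ _)))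
    (trans (⊗-congˡ (δ-diag x)) (⊗-identityˡ _))

  ∙-δ : (M : Matrix n) → ∀ {p} x {y} → Descending p y → p ≤ B → (M ∙ δ) x y ≡ M x y
  ∙-δ M x {y} d p≤B = trans (ΣV-δ d p≤B (λ z z≢y → trans (⊗-congʳ (⟦⟧-no (≡-dec _≟_ z y) z≢y)) (⊗-zeroʳ _)))
    (trans (⊗-congʳ (δ-diag y)) (⊗-identityʳ _))

  remove-strip : ∀ k s (d κ : Vec ℕ n) w → remove k s d κ w ≢ 0ℤ → Strip d κ
  remove-strip k s [] [] w _ = []
  remove-strip k s (d ∷ ds) (κ ∷ κs) w h with next ds ≤? κ | κ ≤? d
  ... | no _ | _ = contradiction (⊗-zeroˡ _) h
  ... | yes _ | no _ = contradiction (trans (⊗-congʳ (⊗-zeroˡ _)) (⊗-zeroʳ _)) h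
  ... | yes p | yes q = strip p q rest
    where
    r₁ = remove k (suc s) ds κs (λ x → w ((d ∸ κ) ℕ.+ x))
    r₂ = remove k (suc s) ds κs (λ x → w ((d ∸ κ) ℕ.+ suc x))
    rest : Strip ds κs
    rest with r₁ ℤ.≟ 0ℤ | r₂ ℤ.≟ 0ℤ
    ... | no e | _ = remove-strip k (suc s) ds κs _ e
    ... | yes _ | no e = remove-strip k (suc s) ds κs _ e
    ... | yes e | yes e′ = contradiction
      (trans (⊗-identityˡ _) (trans (⊗-identityˡ _) (trans (cong₂ (λ a b → a ⊕ ⊖ (⟦ s ≤? k ⟧ ⊗ (⟦ next ds <? κ ⟧ ⊗ b))) e e′)
        (solve 2 (λ a b → con 0ℤ :+ :- (a :* (b :* con 0ℤ)) := con 0ℤ) refl _ _)))) h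

  add-strip : ∀ k s (κ ν : Vec ℕ n) → add k s κ ν ≢ 0ℤ → Strip ν κ
  add-strip k s [] [] h = []
  add-strip k s (κ ∷ κs) (ν ∷ νs) h with next νs ≤? κ | κ ≤? ν
  ... | no _ | _ = contradiction (⊗-zeroˡ _) h
  ... | yes _ | no _ = contradiction (trans (⊗-congʳ (⊗-zeroˡ _)) (⊗-zeroʳ _)) h
  ... | yes p | yes q = strip p q (add-strip k (suc s) κs νs (λ e → h (trans (⊗-identityˡ _) (trans (⊗-identityˡ _)
          (trans (⊗-congʳ e) (⊗-zeroʳ _))))))

  add-next : ∀ {k s} → s ≤ k → (κ ν : Vec ℕ n) → add k s κ ν ≢ 0ℤ → next κ ≡ next ν
  add-next s≤k [] [] h = refl
  add-next {k = k} {s} s≤k (κ ∷ κs) (ν ∷ νs) h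
    with ⟦⟧≢0 ((κ ≟ ν) ⊎-dec (k <? s)) (*≢0ˡ _ _ (*≢0ʳ ⟦ κ ≤? ν ⟧ _ (*≢0ʳ ⟦ next νs ≤? κ ⟧ _ h)))
  ... | inj₁ e = e
  ... | inj₂ k<s = contradiction s≤k (ℕ.<⇒≱ k<s)

  -- Hₖ with k ≥ 1 leaves row 1 alone, so a bound on the row lengths survives the addition of the
  -- strip.
  add-descending : ∀ {k p} {κ ν : Vec ℕ n} → add (suc k) 1 κ ν ≢ 0ℤ → Descending p κ → Descending p ν
  add-descending {κ = κ} {ν} h d = Strip-descendingʳ (add-strip _ _ κ ν h)
    (ℕ.≤-trans (ℕ.≤-reflexive (sym (add-next (s≤s z≤n) κ ν h))) (next≤ d))

  add-diag : ∀ k s {p} {v : Vec ℕ n} → Descending p v → add k s v v ≡ 1ℤ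
  add-diag k s [] = refl
  add-diag k s {v = x ∷ v} (_ ∷ d) = trans (⟦⟧⊗-yes (next v ≤? x) (next≤ d)) (trans (⟦⟧⊗-yes (x ≤? x) ℕ.≤-refl)
    (trans (⟦⟧⊗-yes ((x ≟ x) ⊎-dec (k <? s)) (inj₁ refl)) (add-diag k (suc s) d)))

  exchange : ∀ k w (d ν : Vec ℕ n) → Descending B d → LastZero d →
    ((λ x y → remove k 1 x y w) ∙ add (suc k) 1) d ν ≡ (add (suc k) 1 ∙ (λ x y → remove (suc k) 1 x y w)) d ν
  exchange {n} k w d ν desc lz = sym (trans (ΣV-cong n (λ τ → sym (⊗-identityˡ _)))
    (trans (LocalRule.exchange-rows k (s≤s z≤n) (λ _ → 1ℤ) d ν w desc ℕ.≤-refl lz) (⊗-identityˡ _)))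

  module _ (w : ℕ → ℕ → ℤ) where

    -- The kernels of the labels m, ..., 1, the largest first. The final δ says that the vector left
    -- over after all labels is the upper boundary. `w ℓ` evaluates the powers of the variable of
    -- label ℓ.
    removeChain : (k m : ℕ) → Matrix n
    removeChain k zero = δ
    removeChain k (suc m) = (λ x y → remove k 1 x y (w (suc m))) ∙ removeChain k m

    removeChain-add : ∀ k m (d ν : Vec ℕ n) → Descending B d → LastZero d →
      (removeChain k m ∙ add (suc k) 1) d ν ≡ (add (suc k) 1 ∙ removeChain (suc k) m) d ν
    -- `∙-δ` asks for a descending bounded ν, which the support of `add` provides; off the support
    -- both sides are zero.
    removeChain-add k zero d ν desc lz with add (suc k) 1 d ν ℤ.≟ 0ℤ
    ... | no h = trans (δ-∙ (add (suc k) 1) ν desc ℕ.≤-refl) (sym (∙-δ (add (suc k) 1) d (add-descending h desc) ℕ.≤-refl))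
    ... | yes e = trans (δ-∙ (add (suc k) 1) ν desc ℕ.≤-refl) (trans e (sym (ΣV-zero _ vanish)))
      where
      vanish : ∀ v → add (suc k) 1 d v ⊗ δ v ν ≡ 0ℤ
      vanish v with ≡-dec _≟_ v ν
      ... | yes refl = trans (⊗-congˡ e) (⊗-zeroˡ _)
      ... | no _ = ⊗-zeroʳ _
    removeChain-add k (suc m) d ν desc lz = begin
      ((U ∙ P) ∙ H) d ν ≡⟨ ∙-assoc U P H d ν ⟩
      (U ∙ (P ∙ H)) d ν ≡⟨ ∙-congʳ U {P ∙ H} {H ∙ P′} d ν (λ κ h → let s = remove-strip k 1 d κ _ h in
          removeChain-add k m κ ν (Strip-descendingˡ s desc) (≤ᵛ-LastZero (Strip⇒≤ᵛ s) lz)) ⟩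
      (U ∙ (H ∙ P′)) d ν ≡⟨ ∙-assoc U H P′ d ν ⟨
      ((U ∙ H) ∙ P′) d ν ≡⟨ ∙-congˡ {M = U ∙ H} {H ∙ U′} P′ d ν (λ κ _ → exchange k (w (suc m)) d κ desc lz) ⟩
      ((H ∙ U′) ∙ P′) d ν ≡⟨ ∙-assoc H U′ P′ d ν ⟩
      (H ∙ (U′ ∙ P′)) d ν ∎
      where
      H = add (suc k) 1
      U U′ : Matrix _
      U x y = remove k 1 x y (w (suc m))
      U′ x y = remove (suc k) 1 x y (w (suc m))
      P = removeChain k m
      P′ = removeChain (suc k) m

  addChain : ℕ → Matrix n
  addChain zero = δ
  addChain (suc K) = addChain K ∙ add (suc K) 1

  record Extends {n} (K p h : ℕ) (d d′ : Vec ℕ n) : Set where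
    constructor extends
    field
      descending : Descending p d′
      above : d ≤ᵛ d′
      height : HeightLE (K ℕ.+ h) d′

  addChain-extends : ∀ K {p h} (d d′ : Vec ℕ n) → addChain K d d′ ≢ 0ℤ → Descending p d → HeightLE h d → Extends K p h d d′
  addChain-extends zero d d′ h desc ht with refl ← δ≢0 d d′ h = extends desc ≤ᵛ-refl ht
  addChain-extends (suc K) d d′ h desc ht with u , p , q ← ∙≢0 (addChain K) (add (suc K) 1) d d′ h
    with extends desc′ le ht′ ← addChain-extends K d u p desc ht =
    extends (add-descending q desc′) (≤ᵛ-trans le (Strip⇒≤ᵛ s)) (Strip-height s ht′)
    where s = add-strip (suc K) 1 u d′ q

  -- Each Hₖ raises the superscript of the kernels by one. It may also open one more row, and
  -- `K ℕ.+ h ≤ n` guarantees an empty last row at each of these exchanges.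
  removeChain-addChain : ∀ w K m {h} (d ν : Vec ℕ n) → Descending B d → Descending B ν → HeightLE h d → K ℕ.+ h ≤ n →
    (removeChain w 0 m ∙ addChain K) d ν ≡ (addChain K ∙ removeChain w K m) d ν
  removeChain-addChain w zero m d ν desc desc′ ht _ =
    trans (∙-δ (removeChain w 0 m) d desc′ ℕ.≤-refl) (sym (δ-∙ (removeChain w 0 m) ν desc ℕ.≤-refl))
  removeChain-addChain w (suc K) m d ν desc desc′ ht lt = begin
    (P ∙ (b ∙ H)) d ν ≡⟨ ∙-assoc P b H d ν ⟨
    ((P ∙ b) ∙ H) d ν ≡⟨ ∙-congˡ {M = P ∙ b} {b ∙ P₁} H d ν (λ z h → removeChain-addChain w K m d z desc
        (Strip-descendingˡ (add-strip _ _ z ν h) desc′) ht (ℕ.<⇒≤ lt)) ⟩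
    ((b ∙ P₁) ∙ H) d ν ≡⟨ ∙-assoc b P₁ H d ν ⟩
    (b ∙ (P₁ ∙ H)) d ν ≡⟨ ∙-congʳ b {P₁ ∙ H} {H ∙ P₂} d ν (λ z h → let extends dz _ hz = addChain-extends K d z h desc ht in
        removeChain-add w K m z ν dz (LastZero-height z hz lt)) ⟩
    (b ∙ (H ∙ P₂)) d ν ≡⟨ ∙-assoc b H P₂ d ν ⟨
    ((b ∙ H) ∙ P₂) d ν ∎
    where
    P = removeChain w 0 m
    P₁ = removeChain w K m
    P₂ = removeChain w (suc K) m
    b = addChain K
    H = add (suc K) 1

  addChain-lower : ∀ K {p} (t ν : Vec ℕ n) → addChain K t ν ≢ 0ℤ → Descending p ν → Descending p t × t ≤ᵛ ν
  addChain-lower zero t ν h desc with refl ← δ≢0 t ν h = desc , ≤ᵛ-refl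
  addChain-lower (suc K) t ν h desc with u , p , q ← ∙≢0 (addChain K) (add (suc K) 1) t ν h
    with s ← add-strip (suc K) 1 u ν q
    with desc′ , le ← addChain-lower K t u p (Strip-descendingˡ s desc) = desc′ , ≤ᵛ-trans le (Strip⇒≤ᵛ s)

  ≤ᵛ-antisym : {u v : Vec ℕ n} → u ≤ᵛ v → v ≤ᵛ u → u ≡ v
  ≤ᵛ-antisym [] [] = refl
  ≤ᵛ-antisym (p ∷ ps) (q ∷ qs) = cong₂ _∷_ (ℕ.≤-antisym p q) (≤ᵛ-antisym ps qs)

  addChain-diag : ∀ K {v : Vec ℕ n} → Descending B v → addChain K v v ≡ 1ℤ
  addChain-diag zero {v} d = δ-diag v
  addChain-diag (suc K) {v} d = trans (ΣV-δ d ℕ.≤-refl off)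
    (trans (cong₂ _⊗_ (addChain-diag K d) (add-diag (suc K) 1 d)) (⊗-identityˡ _))
    where
    off : ∀ z → z ≢ v → addChain K v z ⊗ add (suc K) 1 z v ≡ 0ℤ
    off z z≢v with add (suc K) 1 z v ℤ.≟ 0ℤ | addChain K v z ℤ.≟ 0ℤ
    ... | yes e | _ = trans (⊗-congʳ e) (⊗-zeroʳ _)
    ... | no _ | yes e = trans (⊗-congˡ e) (⊗-zeroˡ _)
    ... | no h | no h′ with s ← add-strip (suc K) 1 z v h =
      contradiction (≤ᵛ-antisym (Strip⇒≤ᵛ s) (proj₂ (addChain-lower K v z h′ (Strip-descendingˡ s d)))) z≢v

  -- Induction on the sum of the parts of ν. Column ν of M has 1 on the diagonal; its other nonzero
  -- entries lie at vectors with smaller sum, where X and Y already agree, so the equation for ν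
  -- reduces to X ν = Y ν.
  unitriangular-cancel : (M : Matrix n) →
    (∀ t ν → M t ν ≢ 0ℤ → Descending B ν → Descending B t × t ≤ᵛ ν) → (∀ {ν} → Descending B ν → M ν ν ≡ 1ℤ) →
    ∀ (d : Vec ℕ n) (X Y : Vec ℕ n → ℤ) →
    (∀ ν → Descending B ν → ν ≤ᵛ d → ΣV n (λ t → X t ⊗ M t ν) ≡ ΣV n (λ t → Y t ⊗ M t ν)) →
    ∀ t → Descending B t → t ≤ᵛ d → X t ≡ Y t
  unitriangular-cancel {n} M low diag d X Y h t desc le = go (suc (sum t)) t ℕ.≤-refl desc le
    where
    isolate : ∀ Z ν → Descending B ν → (∀ t → M t ν ≢ 0ℤ → t ≢ ν → Z t ≡ 0ℤ) → ΣV n (λ t → Z t ⊗ M t ν) ≡ Z ν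
    isolate Z ν desc hz = trans (ΣV-δ desc ℕ.≤-refl off) (trans (⊗-congʳ (diag desc)) (⊗-identityʳ _))
      where
      off : ∀ t → t ≢ ν → Z t ⊗ M t ν ≡ 0ℤ
      off t t≢ν with M t ν ℤ.≟ 0ℤ
      ... | yes e = trans (⊗-congʳ e) (⊗-zeroʳ _)
      ... | no e = trans (⊗-congˡ (hz t e t≢ν)) (⊗-zeroˡ _)
    D : Vec ℕ n → ℤ
    D t = X t ⊕ ⊖ Y t
    sumD : ∀ ν → Descending B ν → ν ≤ᵛ d → ΣV n (λ t → D t ⊗ M t ν) ≡ 0ℤ
    sumD ν desc le = begin
      ΣV n (λ t → D t ⊗ M t ν) ≡⟨ ΣV-cong n (λ t → solve 3 (λ x y m → (x :+ :- y) :* m := x :* m :+ con -1ℤ :* (y :* m)) refl (X t) (Y t) (M t ν)) ⟩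
      ΣV n (λ t → X t ⊗ M t ν ⊕ -1ℤ ⊗ (Y t ⊗ M t ν)) ≡⟨ trans (ΣV-⊕ n) (⊕-congʳ (ΣV-*ˡ n -1ℤ)) ⟩
      ΣV n (λ t → X t ⊗ M t ν) ⊕ -1ℤ ⊗ ΣV n (λ t → Y t ⊗ M t ν) ≡⟨ cong (_⊕ -1ℤ ⊗ ΣV n (λ t → Y t ⊗ M t ν)) (h ν desc le) ⟩
      ΣV n (λ t → Y t ⊗ M t ν) ⊕ -1ℤ ⊗ ΣV n (λ t → Y t ⊗ M t ν) ≡⟨ solve 1 (λ x → x :+ con -1ℤ :* x := con 0ℤ) refl _ ⟩
      0ℤ ∎
    D⇒≡ : ∀ t → D t ≡ 0ℤ → X t ≡ Y t
    D⇒≡ t e = trans (solve 2 (λ x y → x := (x :+ :- y) :+ y) refl (X t) (Y t)) (trans (cong (_⊕ Y t) e) (⊕-identityˡ _))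
    zeroD : ∀ N ν → sum ν < N → Descending B ν → ν ≤ᵛ d → D ν ≡ 0ℤ
    zeroD (suc N) ν (s≤s lt) desc le = trans (sym (isolate D ν desc (λ t e t≢ν → let desc′ , le′ = low t ν e desc in
      zeroD N t (ℕ.<-≤-trans (sum-≤ᵛ-strict le′ t≢ν) lt) desc′ (≤ᵛ-trans le′ le)))) (sumD ν desc le)
    go : ∀ N ν → sum ν < N → Descending B ν → ν ≤ᵛ d → X ν ≡ Y ν
    go N ν lt desc le = D⇒≡ ν (zeroD N ν lt desc le)

  -- Rook strips as products of vertical and horizontal strips.

  ∑≤-pick : ∀ a (f : ℕ → ℤ) → (B < a → f a ≡ 0ℤ) → ∑≤ B (λ b → ⟦ a ≟ b ⟧ ⊗ f b) ≡ f a
  ∑≤-pick a f h with a ≤? B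
  ... | yes a≤B = trans (∑≤-δ B a a≤B (λ j j≢a → ⟦⟧⊗-no (a ≟ j) (j≢a ∘ sym))) (⟦⟧⊗-yes (a ≟ a) refl)
  ... | no a≰B = trans (∑≤-zero B (λ j j≤B → ⟦⟧⊗-no (a ≟ j) (λ { refl → a≰B j≤B }))) (sym (h (ℕ.≰⇒> a≰B)))

  -- Rₖ: t arises from a by at most one box in each row s ≤ k, each box with sign -1. The bound
  -- `next ts ≤ a` keeps these boxes in distinct columns.
  rook : (k s : ℕ) → Matrix n
  rook k s [] [] = 1ℤ
  rook k s (a ∷ as) (t ∷ ts) =
    ⟦ next ts ≤? a ⟧ ⊗ ((⟦ a ≟ t ⟧ ⊕ ⊖ (⟦ s ≤? k ⟧ ⊗ ⟦ suc a ≟ t ⟧)) ⊗ rook k (suc s) as ts)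

  -- Eₖ: b arises from a by at most one box in each row s ≥ k, each box with sign -1. A vertical
  -- strip relates single rows only, so the descent of a and of b has to be demanded separately.
  vertical : (k s : ℕ) → Matrix n
  vertical k s [] [] = 1ℤ
  vertical k s (a ∷ as) (b ∷ bs) =
    ⟦ next as ≤? a ⟧ ⊗ (⟦ next bs ≤? b ⟧ ⊗ ((⟦ a ≟ b ⟧ ⊕ ⊖ (⟦ k ≤? s ⟧ ⊗ ⟦ suc a ≟ b ⟧)) ⊗ vertical k (suc s) as bs))

  private
    -- The factor of row s in Rₖ Hₖ₊₁: a signed rook box in rows up to k, equality in row k + 1,
    -- free growth in later rows.
    mixedRow : (k s b t : ℕ) → ℤ
    mixedRow k s b t with s ≤? k
    ... | yes _ = ⟦ b ≟ t ⟧ ⊕ ⊖ ⟦ suc b ≟ t ⟧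
    ... | no _ = ⟦ b ≤? t ⟧ ⊗ ⟦ (b ≟ t) ⊎-dec (suc k <? s) ⟧

    mixed : (k s : ℕ) → Matrix n
    mixed k s [] [] = 1ℤ
    mixed k s (b ∷ bs) (t ∷ ts) = ⟦ next ts ≤? b ⟧ ⊗ (mixedRow k s b t ⊗ mixed k (suc s) bs ts)

  -- Rₖ acts in rows up to k and Hₖ₊₁ in rows after k + 1. In every row one of the two is the
  -- identity, so the intermediate vector is determined.
  rook-∙-add : ∀ k s {p} (b t : Vec ℕ n) → Descending p t → p ≤ B → (rook k s ∙ add (suc k) s) b t ≡ mixed k s b t
  rook-∙-add k s [] [] [] _ = ⊗-identityˡ _
  rook-∙-add {n = suc n} k s (b ∷ bs) (t ∷ ts) (t≤p ∷ desc) p≤B = begin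
    ∑≤ B (λ c → ΣV n (λ cs → (⟦ next cs ≤? b ⟧ ⊗ (ρ c ⊗ rook k (suc s) bs cs)) ⊗
      (⟦ next ts ≤? c ⟧ ⊗ (⟦ c ≤? t ⟧ ⊗ (α c ⊗ add (suc k) (suc s) cs ts)))))
      ≡⟨ ∑≤-cong B (λ c _ → ΣV-cong n (λ cs → decouple c cs)) ⟩
    ∑≤ B (λ c → ΣV n (λ cs → (⟦ next ts ≤? b ⟧ ⊗ (ρ c ⊗ (⟦ next ts ≤? c ⟧ ⊗ (⟦ c ≤? t ⟧ ⊗ α c)))) ⊗
      (rook k (suc s) bs cs ⊗ add (suc k) (suc s) cs ts)))
      ≡⟨ ∑≤-cong B (λ c _ → trans (ΣV-*ˡ n _) (trans (⊗-congʳ (rook-∙-add k (suc s) bs ts desc t≤B)) (⊗-assoc _ _ _))) ⟩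
    ∑≤ B (λ c → ⟦ next ts ≤? b ⟧ ⊗ ((ρ c ⊗ (⟦ next ts ≤? c ⟧ ⊗ (⟦ c ≤? t ⟧ ⊗ α c))) ⊗ mixed k (suc s) bs ts))
      ≡⟨ ∑≤-*ˡ B _ ⟩
    ⟦ next ts ≤? b ⟧ ⊗ ∑≤ B (λ c → (ρ c ⊗ (⟦ next ts ≤? c ⟧ ⊗ (⟦ c ≤? t ⟧ ⊗ α c))) ⊗ mixed k (suc s) bs ts)
      ≡⟨ ⟦⟧-scale-cong (next ts ≤? b) (λ nt≤b → trans (∑≤-cong B (λ c _ → ⊗-comm _ _)) (trans (∑≤-*ˡ B _)
           (trans (⊗-comm _ _) (⊗-congˡ (rowSum nt≤b))))) ⟩
    ⟦ next ts ≤? b ⟧ ⊗ (mixedRow k s b t ⊗ mixed k (suc s) bs ts) ∎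
    where
    t≤B = ℕ.≤-trans t≤p p≤B
    ρ α : ℕ → ℤ
    ρ c = ⟦ b ≟ c ⟧ ⊕ ⊖ (⟦ s ≤? k ⟧ ⊗ ⟦ suc b ≟ c ⟧)
    α c = ⟦ (c ≟ t) ⊎-dec (suc k <? s) ⟧
    -- The bound `next cs ≤ b` involves the intermediate vector. For s ≤ k the next row is not
    -- touched by `add`, so `next cs` equals `next ts`; for s > k the rook factor forces c = b, and
    -- `next cs ≤ next ts ≤ c` makes both bounds hold.
    decouple : ∀ c cs → (⟦ next cs ≤? b ⟧ ⊗ (ρ c ⊗ rook k (suc s) bs cs)) ⊗
      (⟦ next ts ≤? c ⟧ ⊗ (⟦ c ≤? t ⟧ ⊗ (α c ⊗ add (suc k) (suc s) cs ts))) ≡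
      (⟦ next ts ≤? b ⟧ ⊗ (ρ c ⊗ (⟦ next ts ≤? c ⟧ ⊗ (⟦ c ≤? t ⟧ ⊗ α c)))) ⊗
      (rook k (suc s) bs cs ⊗ add (suc k) (suc s) cs ts)
    decouple c cs = trans
      (solve 7 (λ x ρ r y z α A → (x :* (ρ :* r)) :* (y :* (z :* (α :* A))) := A :* (x :* (ρ :* (y :* (z :* (α :* r)))))) refl
        ⟦ next cs ≤? b ⟧ (ρ c) (rook k (suc s) bs cs) ⟦ next ts ≤? c ⟧ ⟦ c ≤? t ⟧ (α c) (add (suc k) (suc s) cs ts))
      (trans (*-cancel-support (add (suc k) (suc s) cs ts) (λ h → swap-bound h {⟦ c ≤? t ⟧ ⊗ (α c ⊗ rook k (suc s) bs cs)}))
      (solve 7 (λ x ρ r y z α A → A :* (x :* (ρ :* (y :* (z :* (α :* r))))) := (x :* (ρ :* (y :* (z :* α)))) :* (r :* A)) refl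
        ⟦ next ts ≤? b ⟧ (ρ c) (rook k (suc s) bs cs) ⟦ next ts ≤? c ⟧ ⟦ c ≤? t ⟧ (α c) (add (suc k) (suc s) cs ts)))
      where
      swap-bound : add (suc k) (suc s) cs ts ≢ 0ℤ → ∀ {x} → ⟦ next cs ≤? b ⟧ ⊗ (ρ c ⊗ (⟦ next ts ≤? c ⟧ ⊗ x)) ≡
        ⟦ next ts ≤? b ⟧ ⊗ (ρ c ⊗ (⟦ next ts ≤? c ⟧ ⊗ x))
      swap-bound h with s ≤? k
      ... | yes s≤k rewrite add-next (s≤s s≤k) cs ts h = refl
      ... | no s≰k with b ≟ c | next ts ≤? c
      ...   | no _ | _ = trans (solve 3 (λ a e r → a :* ((con 0ℤ :+ :- (con 0ℤ :* e)) :* r) := con 0ℤ) refl _ _ _)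
                        (sym (solve 3 (λ a e r → a :* ((con 0ℤ :+ :- (con 0ℤ :* e)) :* r) := con 0ℤ) refl _ _ _))
      ...   | yes refl | no _ = trans (solve 3 (λ a e r → a :* (e :* (con 0ℤ :* r)) := con 0ℤ) refl _ _ _)
                        (sym (solve 3 (λ a e r → a :* (e :* (con 0ℤ :* r)) := con 0ℤ) refl _ _ _))
      ...   | yes refl | yes p = ⊗-congˡ (trans (⟦⟧-yes (next cs ≤? b) (ℕ.≤-trans (Strip-next (add-strip _ _ cs ts h)) p))
                        (sym (⟦⟧-yes (next ts ≤? b) p)))
    rowSum : next ts ≤ b → ∑≤ B (λ c → ρ c ⊗ (⟦ next ts ≤? c ⟧ ⊗ (⟦ c ≤? t ⟧ ⊗ α c))) ≡ mixedRow k s b t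
    rowSum nt≤b with s ≤? k
    ... | yes s≤k = trans (∑≤-δ B t t≤B (λ c c≢t → trans (⊗-congʳ (trans (⊗-congʳ (trans (⊗-congʳ
          (⟦⟧-no ((c ≟ t) ⊎-dec (suc k <? s)) λ { (inj₁ e) → c≢t e ; (inj₂ q) → ℕ.<⇒≱ q (ℕ.m≤n⇒m≤1+n s≤k) })) (⊗-zeroʳ _))) (⊗-zeroʳ _))) (⊗-zeroʳ _)))
        (trans (⊗-congʳ (trans (⟦⟧⊗-yes (next ts ≤? t) (next≤ desc)) (trans (⟦⟧⊗-yes (t ≤? t) ℕ.≤-refl)
          (⟦⟧-yes ((t ≟ t) ⊎-dec (suc k <? s)) (inj₁ refl)))))
        (solve 2 (λ x y → (x :+ :- (con 1ℤ :* y)) :* con 1ℤ := x :+ :- y) refl _ _))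
    ... | no s≰k = trans (∑≤-cong B (λ c _ → ⊗-congˡ {c = ⟦ next ts ≤? c ⟧ ⊗ (⟦ c ≤? t ⟧ ⊗ α c)}
          (solve 2 (λ x y → x :+ :- (con 0ℤ :* y) := x) refl ⟦ b ≟ c ⟧ ⟦ suc b ≟ c ⟧)))
        (trans (∑≤-pick b (λ c → ⟦ next ts ≤? c ⟧ ⊗ (⟦ c ≤? t ⟧ ⊗ α c))
          (λ B<b → trans (⊗-congʳ (⟦⟧⊗-no (b ≤? t) (λ b≤t → ℕ.<⇒≱ B<b (ℕ.≤-trans b≤t t≤B)))) (⊗-zeroʳ _)))
        (⟦⟧⊗-yes (next ts ≤? b) nt≤b))

  private
    mixed-next : ∀ k s (b t : Vec ℕ n) → mixed k s b t ≢ 0ℤ → next b ≤ next t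
    mixed-next k s [] [] _ = z≤n
    mixed-next k s (b ∷ bs) (t ∷ ts) h with s ≤? k | *≢0ˡ _ _ (*≢0ʳ ⟦ next ts ≤? b ⟧ _ h)
    ... | no _ | p = ⟦⟧≢0 (b ≤? t) (*≢0ˡ _ _ p)
    ... | yes _ | p with b ≟ t | suc b ≟ t
    ...   | yes refl | _ = ℕ.≤-refl
    ...   | no _ | yes refl = ℕ.n≤1+n _
    ...   | no _ | no _ = contradiction (solve 0 (con 0ℤ :+ :- con 0ℤ := con 0ℤ) refl) p

  rook-next : ∀ k s (a t : Vec ℕ n) → rook k s a t ≢ 0ℤ → next a ≤ next t × (k < s → next a ≡ next t)
  rook-next k s [] [] _ = z≤n , λ _ → refl
  rook-next k s (a ∷ as) (t ∷ ts) h with *≢0ˡ _ _ (*≢0ʳ ⟦ next ts ≤? a ⟧ _ h)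
  ... | p with a ≟ t | suc a ≟ t
  ...   | yes refl | _ = ℕ.≤-refl , λ _ → refl
  ...   | no _ | yes refl = ℕ.n≤1+n _ , λ k<s → contradiction
          (trans (cong (λ z → 0ℤ ⊕ ⊖ (z ⊗ 1ℤ)) (⟦⟧-no (s ≤? k) (ℕ.<⇒≱ k<s))) (solve 0 (con 0ℤ :+ :- (con 0ℤ :* con 1ℤ) := con 0ℤ) refl)) p
  ...   | no _ | no _ = contradiction (solve 1 (λ x → con 0ℤ :+ :- (x :* con 0ℤ) := con 0ℤ) refl _) p

  -- Row by row: before row k + 1 the vertical factor is the identity; in row k + 1 it supplies the
  -- missing rook box; in later rows its difference in a inverts the free growth of Hₖ₊₁, because
  -- [a ≤ t] - [a + 1 ≤ t] = [a = t].
  vertical-∙-mixed : ∀ k s {p} (a t : Vec ℕ n) → Descending p t → p ≤ B →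
    (vertical (suc k) s ∙ mixed k s) a t ≡ rook (suc k) s a t
  vertical-∙-mixed k s [] [] [] _ = ⊗-identityˡ _
  vertical-∙-mixed {n = suc n} k s (a ∷ as) (t ∷ ts) (t≤p ∷ desc) p≤B = begin
    ∑≤ B (λ b → ΣV n (λ bs → (⟦ next as ≤? a ⟧ ⊗ (⟦ next bs ≤? b ⟧ ⊗ (σ b ⊗ vertical (suc k) (suc s) as bs))) ⊗
      (⟦ next ts ≤? b ⟧ ⊗ (μ b ⊗ mixed k (suc s) bs ts))))
      ≡⟨ ∑≤-cong B (λ b _ → ΣV-cong n (λ bs → decouple b bs)) ⟩
    ∑≤ B (λ b → ΣV n (λ bs → (⟦ next as ≤? a ⟧ ⊗ (σ b ⊗ (⟦ next ts ≤? b ⟧ ⊗ μ b))) ⊗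
      (vertical (suc k) (suc s) as bs ⊗ mixed k (suc s) bs ts)))
      ≡⟨ ∑≤-cong B (λ b _ → trans (ΣV-*ˡ n _) (trans (⊗-congʳ (vertical-∙-mixed k (suc s) as ts desc t≤B))
           (trans (⊗-comm _ _) (solve 3 (λ r x y → r :* (x :* y) := (r :* x) :* y) refl _ _ _)))) ⟩
    ∑≤ B (λ b → (R ⊗ ⟦ next as ≤? a ⟧) ⊗ (σ b ⊗ (⟦ next ts ≤? b ⟧ ⊗ μ b)))
      ≡⟨ trans (∑≤-*ˡ B _) (⊗-assoc _ _ _) ⟩
    R ⊗ (⟦ next as ≤? a ⟧ ⊗ ∑≤ B (λ b → σ b ⊗ (⟦ next ts ≤? b ⟧ ⊗ μ b)))
      ≡⟨ *-cancel-support R (λ h → let p , q = rook-next (suc k) (suc s) as ts h in rowSum p (λ x → q (s≤s x))) ⟩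
    R ⊗ (⟦ next ts ≤? a ⟧ ⊗ (⟦ a ≟ t ⟧ ⊕ ⊖ (⟦ s ≤? suc k ⟧ ⊗ ⟦ suc a ≟ t ⟧)))
      ≡⟨ trans (⊗-comm _ _) (⊗-assoc _ _ _) ⟩
    ⟦ next ts ≤? a ⟧ ⊗ ((⟦ a ≟ t ⟧ ⊕ ⊖ (⟦ s ≤? suc k ⟧ ⊗ ⟦ suc a ≟ t ⟧)) ⊗ R) ∎
    where
    t≤B = ℕ.≤-trans t≤p p≤B
    R = rook (suc k) (suc s) as ts
    σ μ : ℕ → ℤ
    σ b = ⟦ a ≟ b ⟧ ⊕ ⊖ (⟦ suc k ≤? s ⟧ ⊗ ⟦ suc a ≟ b ⟧)
    μ b = mixedRow k s b t
    decouple : ∀ b bs → (⟦ next as ≤? a ⟧ ⊗ (⟦ next bs ≤? b ⟧ ⊗ (σ b ⊗ vertical (suc k) (suc s) as bs))) ⊗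
      (⟦ next ts ≤? b ⟧ ⊗ (μ b ⊗ mixed k (suc s) bs ts)) ≡
      (⟦ next as ≤? a ⟧ ⊗ (σ b ⊗ (⟦ next ts ≤? b ⟧ ⊗ μ b))) ⊗ (vertical (suc k) (suc s) as bs ⊗ mixed k (suc s) bs ts)
    decouple b bs = trans
      (solve 7 (λ x y σ V z μ X → (x :* (y :* (σ :* V))) :* (z :* (μ :* X)) := X :* ((z :* y) :* (x :* (σ :* (μ :* V))))) refl
        _ ⟦ next bs ≤? b ⟧ (σ b) _ ⟦ next ts ≤? b ⟧ (μ b) (mixed k (suc s) bs ts))
      (trans (*-cancel-support (mixed k (suc s) bs ts) (λ h → ⊗-congˡ (absorb (mixed-next k (suc s) bs ts h))))
      (solve 6 (λ x σ V z μ X → X :* (z :* (x :* (σ :* (μ :* V)))) := (x :* (σ :* (z :* μ))) :* (V :* X)) refl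
        _ (σ b) _ ⟦ next ts ≤? b ⟧ (μ b) (mixed k (suc s) bs ts)))
      where
      absorb : next bs ≤ next ts → ⟦ next ts ≤? b ⟧ ⊗ ⟦ next bs ≤? b ⟧ ≡ ⟦ next ts ≤? b ⟧
      absorb le = trans (⟦⟧-scale-cong (next ts ≤? b) (λ q → ⟦⟧-yes (next bs ≤? b) (ℕ.≤-trans le q))) (⊗-identityʳ _)
    rowSum : next as ≤ next ts → (suc k ≤ s → next as ≡ next ts) →
      ⟦ next as ≤? a ⟧ ⊗ ∑≤ B (λ b → σ b ⊗ (⟦ next ts ≤? b ⟧ ⊗ μ b)) ≡
      ⟦ next ts ≤? a ⟧ ⊗ (⟦ a ≟ t ⟧ ⊕ ⊖ (⟦ s ≤? suc k ⟧ ⊗ ⟦ suc a ≟ t ⟧))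
    rowSum le eq with s ≤? k
    ... | yes s≤k = begin
      ⟦ next as ≤? a ⟧ ⊗ ∑≤ B (λ b → σ b ⊗ (⟦ next ts ≤? b ⟧ ⊗ f b))
        ≡⟨ ⊗-congʳ (trans (∑≤-cong B (λ b _ → ⊗-congˡ (trans (cong (λ z → ⟦ a ≟ b ⟧ ⊕ ⊖ (z ⊗ ⟦ suc a ≟ b ⟧)) (⟦⟧-no (suc k ≤? s) (ℕ.≤⇒≯ s≤k)))
               (solve 2 (λ x y → x :+ :- (con 0ℤ :* y) := x) refl _ _)))) (∑≤-pick a (λ b → ⟦ next ts ≤? b ⟧ ⊗ f b) far)) ⟩
      ⟦ next as ≤? a ⟧ ⊗ (⟦ next ts ≤? a ⟧ ⊗ f a) ≡⟨ trans (⊗-comm _ _) (⊗-assoc _ _ _) ⟩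
      ⟦ next ts ≤? a ⟧ ⊗ (f a ⊗ ⟦ next as ≤? a ⟧)
        ≡⟨ ⟦⟧-scale-cong (next ts ≤? a) (λ q → trans (⊗-congʳ (⟦⟧-yes (next as ≤? a) (ℕ.≤-trans le q))) (⊗-identityʳ _)) ⟩
      ⟦ next ts ≤? a ⟧ ⊗ f a ≡⟨ ⊗-congʳ (⊕-congʳ (cong ⊖_ (sym (⟦⟧⊗-yes (s ≤? suc k) (ℕ.m≤n⇒m≤1+n s≤k))))) ⟩
      ⟦ next ts ≤? a ⟧ ⊗ (⟦ a ≟ t ⟧ ⊕ ⊖ (⟦ s ≤? suc k ⟧ ⊗ ⟦ suc a ≟ t ⟧)) ∎
      where
      f : ℕ → ℤ
      f b = ⟦ b ≟ t ⟧ ⊕ ⊖ ⟦ suc b ≟ t ⟧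
      far : B < a → ⟦ next ts ≤? a ⟧ ⊗ f a ≡ 0ℤ
      far B<a = trans (⊗-congʳ (trans (cong₂ (λ x y → x ⊕ ⊖ y) (⟦⟧-no (a ≟ t) (λ { refl → ℕ.<⇒≱ B<a t≤B }))
        (⟦⟧-no (suc a ≟ t) (λ { refl → ℕ.<⇒≱ B<a (ℕ.<⇒≤ t≤B) }))) (solve 0 (con 0ℤ :+ :- con 0ℤ := con 0ℤ) refl))) (⊗-zeroʳ _)
    -- The next row has index greater than k + 1. On the support of the rook matrix of the remaining
    -- rows it is unchanged, so `next as` may be replaced by `next ts`.
    ... | no s≰k = trans (cong (λ z → ⟦ z ≤? a ⟧ ⊗ ∑≤ B (λ b → σ b ⊗ (⟦ next ts ≤? b ⟧ ⊗ f b))) (eq (ℕ.≰⇒> s≰k)))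
        (⟦⟧-scale-cong (next ts ≤? a) (λ q → begin
      ∑≤ B (λ b → σ b ⊗ h b) ≡⟨ ∑≤-cong B (λ b _ → trans (⊗-congˡ (⊕-congʳ (cong ⊖_ (⟦⟧⊗-yes (suc k ≤? s) (ℕ.≰⇒> s≰k)))))
          (solve 3 (λ x y z → (x :+ :- y) :* z := x :* z :+ :- (y :* z)) refl ⟦ a ≟ b ⟧ ⟦ suc a ≟ b ⟧ (h b))) ⟩
      ∑≤ B (λ b → ⟦ a ≟ b ⟧ ⊗ h b ⊕ ⊖ (⟦ suc a ≟ b ⟧ ⊗ h b))
        ≡⟨ trans (∑≤-⊕ B) (⊕-congʳ (∑≤-⊖ B)) ⟩
      ∑≤ B (λ b → ⟦ a ≟ b ⟧ ⊗ h b) ⊕ ⊖ ∑≤ B (λ b → ⟦ suc a ≟ b ⟧ ⊗ h b)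
        ≡⟨ cong₂ (λ x y → x ⊕ ⊖ y) (∑≤-pick a h (far a)) (∑≤-pick (suc a) h (far (suc a))) ⟩
      h a ⊕ ⊖ h (suc a) ≡⟨ cong₂ (λ x y → x ⊕ ⊖ y) (⟦⟧⊗-yes (next ts ≤? a) q) (⟦⟧⊗-yes (next ts ≤? suc a) (ℕ.m≤n⇒m≤1+n q)) ⟩
      f a ⊕ ⊖ f (suc a) ≡⟨ difference ⟩
      ⟦ a ≟ t ⟧ ⊕ ⊖ (⟦ s ≤? suc k ⟧ ⊗ ⟦ suc a ≟ t ⟧) ∎))
      where
      f h : ℕ → ℤ
      f b = ⟦ b ≤? t ⟧ ⊗ ⟦ (b ≟ t) ⊎-dec (suc k <? s) ⟧
      h b = ⟦ next ts ≤? b ⟧ ⊗ f b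
      far : ∀ b → B < b → h b ≡ 0ℤ
      far b B<b = trans (⊗-congʳ (⟦⟧⊗-no (b ≤? t) (λ b≤t → ℕ.<⇒≱ B<b (ℕ.≤-trans b≤t t≤B)))) (⊗-zeroʳ _)
      at-end : ∀ b → ¬ (suc k < s) → f b ≡ ⟦ b ≟ t ⟧
      at-end b ¬q = trans (sym (⟦⟧-× (b ≤? t) ((b ≟ t) ⊎-dec (suc k <? s)))) (⟦⟧-cong _ (b ≟ t)
        (λ { (_ , inj₁ e) → e ; (_ , inj₂ q) → contradiction q ¬q }) (λ e → ℕ.≤-reflexive e , inj₁ e))
      anywhere : ∀ b → suc k < s → f b ≡ ⟦ b ≤? t ⟧
      anywhere b q = trans (⊗-congʳ (⟦⟧-yes ((b ≟ t) ⊎-dec (suc k <? s)) (inj₂ q))) (⊗-identityʳ _)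
      difference : f a ⊕ ⊖ f (suc a) ≡ ⟦ a ≟ t ⟧ ⊕ ⊖ (⟦ s ≤? suc k ⟧ ⊗ ⟦ suc a ≟ t ⟧)
      difference with s ≤? suc k
      ... | yes s≤k₁ = cong₂ (λ x y → x ⊕ ⊖ y) (at-end a (ℕ.≤⇒≯ s≤k₁)) (trans (at-end (suc a) (ℕ.≤⇒≯ s≤k₁)) (sym (⊗-identityˡ _)))
      ... | no s≰k₁ = trans (cong₂ (λ x y → x ⊕ ⊖ y) (anywhere a (ℕ.≰⇒> s≰k₁)) (anywhere (suc a) (ℕ.≰⇒> s≰k₁))) compare
        where
        compare : ⟦ a ≤? t ⟧ ⊕ ⊖ ⟦ suc a ≤? t ⟧ ≡ ⟦ a ≟ t ⟧ ⊕ ⊖ (0ℤ ⊗ ⟦ suc a ≟ t ⟧)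
        compare with ℕ.<-cmp a t
        ... | tri< lt ne _ = trans (cong₂ (λ x y → x ⊕ ⊖ y) (⟦⟧-yes (a ≤? t) (ℕ.<⇒≤ lt)) (⟦⟧-yes (suc a ≤? t) lt))
            (trans (solve 1 (λ y → con 1ℤ :+ :- con 1ℤ := con 0ℤ :+ :- (con 0ℤ :* y)) refl _) (cong (_⊕ ⊖ (0ℤ ⊗ ⟦ suc a ≟ t ⟧)) (sym (⟦⟧-no (a ≟ t) ne))))
        ... | tri≈ nl e _ = trans (cong₂ (λ x y → x ⊕ ⊖ y) (⟦⟧-yes (a ≤? t) (ℕ.≤-reflexive e)) (⟦⟧-no (suc a ≤? t) nl))
            (trans (solve 1 (λ y → con 1ℤ :+ :- con 0ℤ := con 1ℤ :+ :- (con 0ℤ :* y)) refl _) (cong (_⊕ ⊖ (0ℤ ⊗ ⟦ suc a ≟ t ⟧)) (sym (⟦⟧-yes (a ≟ t) e))))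
        ... | tri> nl ne gt = trans (cong₂ (λ x y → x ⊕ ⊖ y) (⟦⟧-no (a ≤? t) (ℕ.<⇒≱ gt)) (⟦⟧-no (suc a ≤? t) nl))
            (trans (solve 1 (λ y → con 0ℤ :+ :- con 0ℤ := con 0ℤ :+ :- (con 0ℤ :* y)) refl _) (cong (_⊕ ⊖ (0ℤ ⊗ ⟦ suc a ≟ t ⟧)) (sym (⟦⟧-no (a ≟ t) ne))))

  verticalChain : ℕ → Matrix n
  verticalChain zero = δ
  verticalChain (suc K) = vertical (suc K) 1 ∙ verticalChain K

  rook-zero : ∀ s {p} (a t : Vec ℕ n) → Descending p t → rook 0 (suc s) a t ≡ δ a t
  rook-zero s [] [] [] = refl
  rook-zero s (a ∷ as) (t ∷ ts) (_ ∷ desc) = trans (⊗-congʳ (⊗-congʳ (rook-zero (suc s) as ts desc))) entryδ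
    where
    entryδ : ⟦ next ts ≤? a ⟧ ⊗ ((⟦ a ≟ t ⟧ ⊕ ⊖ (0ℤ ⊗ ⟦ suc a ≟ t ⟧)) ⊗ δ as ts) ≡ δ (a ∷ as) (t ∷ ts)
    entryδ with a ≟ t | ≡-dec _≟_ as ts
    ... | yes refl | yes refl = trans (⟦⟧⊗-yes (next ts ≤? a) (next≤ desc)) (solve 1 (λ x → (con 1ℤ :+ :- (con 0ℤ :* x)) :* con 1ℤ := con 1ℤ) refl _)
    ... | yes refl | no _ = solve 2 (λ x y → x :* (y :* con 0ℤ) := con 0ℤ) refl _ _
    ... | no _ | yes refl = solve 2 (λ x y → x :* ((con 0ℤ :+ :- (con 0ℤ :* y)) :* con 1ℤ) := con 0ℤ) refl _ _
    ... | no _ | no _ = solve 2 (λ x y → x :* (y :* con 0ℤ) := con 0ℤ) refl _ _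

  -- Iterating Rₖ = Eₖ Rₖ₋₁ Hₖ from the identity R₀ nests the factors: the E come out with
  -- decreasing, the H with increasing index.
  rook-factor : ∀ K (a t : Vec ℕ n) → Descending B t → rook K 1 a t ≡ (verticalChain K ∙ addChain K) a t
  rook-factor zero a t desc = trans (rook-zero 0 a t desc) (sym (∙-δ δ a desc ℕ.≤-refl))
  rook-factor (suc K) a t desc = begin
    rook (suc K) 1 a t ≡⟨ vertical-∙-mixed K 1 a t desc ℕ.≤-refl ⟨
    (E ∙ mixed K 1) a t ≡⟨ ∙-congʳ E {mixed K 1} {rook K 1 ∙ H} a t (λ z _ → sym (rook-∙-add K 1 z t desc ℕ.≤-refl)) ⟩
    (E ∙ (rook K 1 ∙ H)) a t ≡⟨ ∙-congʳ E {rook K 1 ∙ H} {(A ∙ b) ∙ H} a t (λ z _ → ∙-congˡ {M = rook K 1} {A ∙ b} H z t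
         (λ u h → rook-factor K z u (Strip-descendingˡ (add-strip _ _ u t h) desc))) ⟩
    (E ∙ ((A ∙ b) ∙ H)) a t ≡⟨ ∙-congʳ E {(A ∙ b) ∙ H} {A ∙ (b ∙ H)} a t (λ z _ → ∙-assoc A b H z t) ⟩
    (E ∙ (A ∙ (b ∙ H))) a t ≡⟨ ∙-assoc E A (b ∙ H) a t ⟨
    ((E ∙ A) ∙ (b ∙ H)) a t ∎
    where
    E = vertical (suc K) 1
    A = verticalChain K
    b = addChain K
    H = add (suc K) 1

  -- The two sides are compared only after multiplication by `b` on the right. On the left `b` moves
  -- through the kernels, on the right it completes `rook-factor`, and both become b S R_K.
  expansion : ∀ w K m {h} (S : Matrix n) {d : Vec ℕ n} → Descending B d → HeightLE h d → K ℕ.+ h ≤ n →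
    (∀ d′ t → Descending B d′ → Descending B t → t ≤ᵛ d′ → removeChain w K m d′ t ≡ (S ∙ rook K 1) d′ t) →
    ∀ t → Descending B t → t ≤ᵛ d → removeChain w 0 m d t ≡ (addChain K ∙ (S ∙ verticalChain K)) d t
  expansion w K m S {d} desc ht lt hS = unitriangular-cancel b (addChain-lower K) (addChain-diag K) d (P₀ d)
    ((b ∙ (S ∙ A)) d) λ ν descν le → begin
      (P₀ ∙ b) d ν ≡⟨ removeChain-addChain w K m d ν desc descν ht lt ⟩
      (b ∙ removeChain w K m) d ν ≡⟨ ∙-congʳ b {removeChain w K m} {S ∙ rook K 1} d ν (λ z h → let extends dz le′ _ = addChain-extends K d z h desc ht in
          hS z ν dz descν (≤ᵛ-trans le le′)) ⟩
      (b ∙ (S ∙ rook K 1)) d ν ≡⟨ ∙-congʳ b {S ∙ rook K 1} {S ∙ (A ∙ b)} d ν (λ z _ → ∙-congʳ S {rook K 1} {A ∙ b} z ν (λ u _ → rook-factor K u ν descν)) ⟩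
      (b ∙ (S ∙ (A ∙ b))) d ν ≡⟨ ∙-congʳ b {S ∙ (A ∙ b)} {(S ∙ A) ∙ b} d ν (λ z _ → sym (∙-assoc S A b z ν)) ⟩
      (b ∙ ((S ∙ A) ∙ b)) d ν ≡⟨ ∙-assoc b (S ∙ A) b d ν ⟨
      ((b ∙ (S ∙ A)) ∙ b) d ν ∎
    where
    P₀ = removeChain w 0 m
    b = addChain K
    A = verticalChain K

-- Sums over fillings and removal of the largest label.

sumF : List Box → (Box → List 𝒱) → (List (Box × 𝒱) → ℤ) → ℤ
sumF [] C f = f []
sumF (b ∷ S) C f = ∑ (C b) (λ v → sumF S C (λ F → f ((b , v) ∷ F)))

data Filling {𝒱 : Set} (C : Box → List 𝒱) : List Box → List (Box × 𝒱) → Set where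
  [] : Filling C [] []
  _∷_ : ∀ {b v S F} → v ∈ C b → Filling C S F → Filling C (b ∷ S) ((b , v) ∷ F)

∑-fillings : ∀ S (C : Box → List 𝒱) f → ∑ (fillings S C) f ≡ sumF S C f
∑-fillings [] C f = ⊕-identityʳ _
∑-fillings (b ∷ S) C f = begin
  ∑ (map (zip (b ∷ S)) (concatMap (λ x → map (x ∷_) (choices (map C S))) (C b))) f
    ≡⟨ ∑-map (zip (b ∷ S)) (concatMap (λ x → map (x ∷_) (choices (map C S))) (C b)) ⟩
  ∑ (concatMap (λ x → map (x ∷_) (choices (map C S))) (C b)) (λ c → f (zip (b ∷ S) c))
    ≡⟨ ∑-concatMap (λ x → map (x ∷_) (choices (map C S))) (C b) ⟩
  ∑ (C b) (λ x → ∑ (map (x ∷_) (choices (map C S))) (λ c → f (zip (b ∷ S) c)))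
    ≡⟨ ∑-cong (C b) (λ x → trans (∑-map (x ∷_) (choices (map C S))) (trans (sym (∑-map (zip S) (choices (map C S))))
         (∑-fillings S C (λ F → f ((b , x) ∷ F))))) ⟩
  ∑ (C b) (λ x → sumF S C (λ F → f ((b , x) ∷ F))) ∎

sumF-cong : ∀ S {C : Box → List 𝒱} {f g} → (∀ F → Filling C S F → f F ≡ g F) → sumF S C f ≡ sumF S C g
sumF-cong [] h = h [] []
sumF-cong (b ∷ S) {C} h = ∑-cong∈ (C b) (λ v∈ → sumF-cong S (λ F p → h _ (v∈ ∷ p)))

sumF-*ˡ : ∀ S (C : Box → List 𝒱) a {f} → sumF S C (λ F → a ⊗ f F) ≡ a ⊗ sumF S C f
sumF-*ˡ [] C a = refl
sumF-*ˡ (b ∷ S) C a = trans (∑-cong (C b) (λ v → sumF-*ˡ S C a)) (∑-*ˡ (C b) a)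

sumF-zero : ∀ S (C : Box → List 𝒱) {f} → (∀ F → f F ≡ 0ℤ) → sumF S C f ≡ 0ℤ
sumF-zero [] C h = h []
sumF-zero (b ∷ S) C h = ∑-zero (C b) (λ {v} _ → sumF-zero S C (λ F → h ((b , v) ∷ F)))

sumF-∑ : ∀ S (C : Box → List 𝒱) (xs : List 𝒜) {f : 𝒜 → List (Box × 𝒱) → ℤ} →
  ∑ xs (λ x → sumF S C (f x)) ≡ sumF S C (λ F → ∑ xs (λ x → f x F))
sumF-∑ [] C xs = refl
sumF-∑ (b ∷ S) C xs = trans (∑-swap xs (C b)) (∑-cong (C b) (λ v → sumF-∑ S C xs))

sumF-++ : ∀ S S′ (C : Box → List 𝒱) {f} → sumF (S ++ S′) C f ≡ sumF S C (λ F → sumF S′ C (λ F′ → f (F ++ F′)))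
sumF-++ [] S′ C = refl
sumF-++ (b ∷ S) S′ C = ∑-cong (C b) (λ v → sumF-++ S S′ C)

sumF-↭ : ∀ {S S′} (C : Box → List 𝒱) → S ↭ S′ → ∀ {f} → (∀ {F F′} → F ↭ F′ → f F ≡ f F′) → sumF S C f ≡ sumF S′ C f
sumF-↭ C refl h = refl
sumF-↭ C (prep b p) h = ∑-cong (C b) (λ v → sumF-↭ C p (λ q → h (prep _ q)))
sumF-↭ {S = _ ∷ _ ∷ S} {S′ = _ ∷ _ ∷ S′} C (swap b d p) {f} h = trans (∑-swap (C b) (C d))
  (∑-cong (C d) (λ w → ∑-cong (C b) (λ v → trans (sumF-cong S (λ F _ → h (swap _ _ refl)))
    (sumF-↭ C p (λ q → h (prep _ (prep _ q)))))))
sumF-↭ C (Perm.trans p q) h = trans (sumF-↭ C p h) (sumF-↭ C q h)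

Filling-lookup : ∀ {C : Box → List 𝒱} {S F b} → Filling C S F → b ∈ S → ∃ λ v → (b , v) ∈ F × v ∈ C b
Filling-lookup (v∈ ∷ _) (here refl) = _ , here refl , v∈
Filling-lookup (_ ∷ p) (there q) with v , r , v∈ ← Filling-lookup p q = v , there r , v∈

Filling-∈ : ∀ {C : Box → List 𝒱} {S F b v} → Filling C S F → (b , v) ∈ F → b ∈ S × v ∈ C b
Filling-∈ (v∈ ∷ _) (here refl) = here refl , v∈
Filling-∈ (_ ∷ p) (there q) with r , v∈ ← Filling-∈ p q = there r , v∈

∧-interchange : ∀ a b c d → (a ∧ b) ∧ (c ∧ d) ≡ (a ∧ c) ∧ (b ∧ d)
∧-interchange false b c d = refl
∧-interchange true false false d = refl
∧-interchange true false true d = refl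
∧-interchange true true c d = refl

⟦T?∧⟧ : ∀ a b → ⟦ T? (a ∧ b) ⟧ ≡ ⟦ T? a ⟧ ⊗ ⟦ T? b ⟧
⟦T?∧⟧ true b = sym (⊗-identityˡ _)
⟦T?∧⟧ false b = sym (⊗-zeroˡ _)

T-iff : ∀ {a b : Bool} → (T a → T b) → (T b → T a) → a ≡ b
T-iff {true} {true} _ _ = refl
T-iff {false} {false} _ _ = refl
T-iff {true} {false} f _ = ⊥-elim (f tt)
T-iff {false} {true} _ g = ⊥-elim (g tt)

T-all⁺ : ∀ {p : 𝒜 → Bool} xs → (∀ {x} → x ∈ xs → T (p x)) → T (all p xs)
T-all⁺ [] h = tt
T-all⁺ {p = p} (x ∷ xs) h = Equivalence.from T-∧ (h (here refl) , T-all⁺ xs (h ∘ there))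

T-all⁻ : ∀ {p : 𝒜 → Bool} xs → T (all p xs) → ∀ {x} → x ∈ xs → T (p x)
T-all⁻ (x ∷ xs) h (here refl) = proj₁ (Equivalence.to T-∧ h)
T-all⁻ (x ∷ xs) h (there q) = T-all⁻ xs (proj₂ (Equivalence.to T-∧ h)) q

T-allPairs⁺ : ∀ {p : Box × 𝒱 → Box × 𝒱 → Bool} F → (∀ {x y} → x ∈ F → y ∈ F → T (p x y)) → T (allPairsᵇ p F)
T-allPairs⁺ F h = T-all⁺ F (λ q → T-all⁺ F (h q))

T-allPairs⁻ : ∀ {p : Box × 𝒱 → Box × 𝒱 → Bool} F → T (allPairsᵇ p F) → ∀ {x y} → x ∈ F → y ∈ F → T (p x y)
T-allPairs⁻ F h q r = T-all⁻ F (T-all⁻ F h q) r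

allPairs-↭ : ∀ (p : Box × 𝒱 → Box × 𝒱 → Bool) {F F′} → F ↭ F′ → allPairsᵇ p F ≡ allPairsᵇ p F′
allPairs-↭ p {F} {F′} q = T-iff
  (λ h → T-allPairs⁺ F′ (λ a b → T-allPairs⁻ F h (↭.∈-resp-↭ (↭-sym q) a) (↭.∈-resp-↭ (↭-sym q) b)))
  (λ h → T-allPairs⁺ F (λ a b → T-allPairs⁻ F′ h (↭.∈-resp-↭ q a) (↭.∈-resp-↭ q b)))

-- The role of a box with respect to the largest label ℓ: it does not contain ℓ,
-- it contains ℓ among other labels, or it contains ℓ only.
data Kind : Set where
  keep mark drop : Kind

kinds : Box → List Kind
kinds _ = keep ∷ mark ∷ drop ∷ []

kept : List (Box × Kind) → List Box
kept [] = []
kept ((b , keep) ∷ K) = b ∷ kept K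
kept ((b , mark) ∷ K) = b ∷ kept K
kept ((b , drop) ∷ K) = kept K

allowed : (mo qo : ℕ → Bool) → List (Box × Kind) → ℤ
allowed mo qo [] = 1ℤ
allowed mo qo ((b , keep) ∷ K) = allowed mo qo K
allowed mo qo ((b , mark) ∷ K) = ⟦ T? (mo (row b)) ⟧ ⊗ allowed mo qo K
allowed mo qo ((b , drop) ∷ K) = ⟦ T? (qo (row b)) ⟧ ⊗ allowed mo qo K

-- `C` lists the entries with labels up to ℓ, `C′` those with smaller labels. The module serves
-- set-valued tableaux, where `marked` adds ℓ to a set, and reverse row-strict tableaux, where `mo`
-- is constantly false and no box is ever marked.
module Peeling {𝒱 : Set} (C C′ : Box → List 𝒱) (marked : 𝒱 → 𝒱) (only : 𝒱) (mo qo : ℕ → Bool)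
  (C-split : ∀ b (g : 𝒱 → ℤ) → ∑ (C b) g ≡
    ∑ (C′ b) g ⊕ (⟦ T? (mo (row b)) ⟧ ⊗ ∑ (C′ b) (g ∘ marked) ⊕ ⟦ T? (qo (row b)) ⟧ ⊗ g only)) where

  private
    permitted = allowed mo qo

  combine : List (Box × Kind) → List (Box × 𝒱) → List (Box × 𝒱)
  combine [] F = []
  combine ((b , drop) ∷ K) F = (b , only) ∷ combine K F
  combine (_ ∷ K) [] = []
  combine ((b , keep) ∷ K) ((_ , v) ∷ F) = (b , v) ∷ combine K F
  combine ((b , mark) ∷ K) ((_ , v) ∷ F) = (b , marked v) ∷ combine K F

  sumF-split : ∀ S f → sumF S C f ≡ sumF S kinds (λ K → permitted K ⊗ sumF (kept K) C′ (λ F → f (combine K F)))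
  sumF-split [] f = sym (⊗-identityˡ _)
  sumF-split (b ∷ S) f = begin
    ∑ (C b) (λ v → sumF S C (λ F → f ((b , v) ∷ F)))
      ≡⟨ C-split b (λ v → sumF S C (λ F → f ((b , v) ∷ F))) ⟩
    ∑ (C′ b) (λ v → sumF S C (λ F → f ((b , v) ∷ F))) ⊕
      (α ⊗ ∑ (C′ b) (λ v → sumF S C (λ F → f ((b , marked v) ∷ F))) ⊕ β ⊗ sumF S C (λ F → f ((b , only) ∷ F)))
      ≡⟨ cong₂ _⊕_ (pull id) (cong₂ _⊕_ (trans (⊗-congʳ (pull marked)) (trans (sym (sumF-*ˡ S kinds α)) (sumF-cong S (λ K _ → sym (⊗-assoc _ _ _)))))
           (trans (⊗-congʳ (sumF-split S _)) (trans (sym (sumF-*ˡ S kinds β)) (sumF-cong S (λ K _ → sym (⊗-assoc _ _ _)))))) ⟩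
    sumF S kinds (λ K → Θ ((b , keep) ∷ K)) ⊕ (sumF S kinds (λ K → Θ ((b , mark) ∷ K)) ⊕ sumF S kinds (λ K → Θ ((b , drop) ∷ K)))
      ≡⟨ ⊕-congʳ (⊕-congʳ (⊕-identityʳ _)) ⟨
    sumF (b ∷ S) kinds Θ ∎
    where
    α = ⟦ T? (mo (row b)) ⟧
    β = ⟦ T? (qo (row b)) ⟧
    Θ : List (Box × Kind) → ℤ
    Θ K = permitted K ⊗ sumF (kept K) C′ (λ F → f (combine K F))
    pull : ∀ (h : 𝒱 → 𝒱) → ∑ (C′ b) (λ v → sumF S C (λ F → f ((b , h v) ∷ F))) ≡
      sumF S kinds (λ K → permitted K ⊗ ∑ (C′ b) (λ v → sumF (kept K) C′ (λ F → f ((b , h v) ∷ combine K F))))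
    pull h = trans (∑-cong (C′ b) (λ v → sumF-split S (λ F → f ((b , h v) ∷ F))))
      (trans (sumF-∑ S kinds (C′ b)) (sumF-cong S (λ K _ → ∑-*ˡ (C′ b) (permitted K))))

  data Combines : List (Box × Kind) → List (Box × 𝒱) → List (Box × 𝒱) → Set where
    [] : Combines [] [] []
    keep : ∀ {b v K F G} → v ∈ C′ b → Combines K F G → Combines ((b , keep) ∷ K) ((b , v) ∷ F) ((b , v) ∷ G)
    mark : ∀ {b v K F G} → v ∈ C′ b → Combines K F G → Combines ((b , mark) ∷ K) ((b , v) ∷ F) ((b , marked v) ∷ G)
    drop : ∀ {b K F G} → Combines K F G → Combines ((b , drop) ∷ K) F ((b , only) ∷ G)

  combine-Combines : ∀ K {F} → Filling C′ (kept K) F → Combines K F (combine K F)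
  combine-Combines [] [] = []
  combine-Combines ((b , keep) ∷ K) (v∈ ∷ p) = keep v∈ (combine-Combines K p)
  combine-Combines ((b , mark) ∷ K) (v∈ ∷ p) = mark v∈ (combine-Combines K p)
  combine-Combines ((b , drop) ∷ K) p = drop (combine-Combines K p)

  data Kept : Kind → (𝒱 → 𝒱) → Set where
    keep : Kept keep id
    mark : Kept mark marked

  -- Since ℓ exceeds all other labels, comparing two entries splits into a condition `pk` on their
  -- kinds and the old condition on what remains of them.
  module Pairs (p : Box × 𝒱 → Box × 𝒱 → Bool) (pk : Box × Kind → Box × Kind → Bool)
    (both : ∀ {x y f g} b d {v w} → Kept x f → Kept y g → v ∈ C′ b → w ∈ C′ d →
      p (b , f v) (d , g w) ≡ pk (b , x) (d , y) ∧ p (b , v) (d , w))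
    (dropʳ : ∀ {x f} b d {v} → Kept x f → v ∈ C′ b → p (b , f v) (d , only) ≡ pk (b , x) (d , drop))
    (dropˡ : ∀ {y g} b d {w} → Kept y g → w ∈ C′ d → p (b , only) (d , g w) ≡ pk (b , drop) (d , y))
    (drops : ∀ b d → p (b , only) (d , only) ≡ pk (b , drop) (d , drop)) where

    private
      ∧-rotate : ∀ a b c → a ∧ (b ∧ c) ≡ (a ∧ b) ∧ c
      ∧-rotate a b c = sym (∧-assoc a b c)

    all-kept : ∀ {x f b v} → Kept x f → v ∈ C′ b → ∀ {K F G} → Combines K F G →
      all (p (b , f v)) G ≡ all (pk (b , x)) K ∧ all (p (b , v)) F
    all-kept k v∈ [] = refl
    all-kept k v∈ (keep {b} {K = K} w∈ c) = trans (cong₂ _∧_ (both _ _ k keep v∈ w∈) (all-kept k v∈ c)) (∧-interchange (pk _ (b , keep)) _ _ _)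
    all-kept k v∈ (mark {b} w∈ c) = trans (cong₂ _∧_ (both _ _ k mark v∈ w∈) (all-kept k v∈ c)) (∧-interchange (pk _ (b , mark)) _ _ _)
    all-kept k v∈ (drop {b} c) = trans (cong₂ _∧_ (dropʳ _ _ k v∈) (all-kept k v∈ c)) (∧-rotate (pk _ (b , drop)) _ _)

    all-drop : ∀ {b K F G} → Combines K F G → all (p (b , only)) G ≡ all (pk (b , drop)) K
    all-drop [] = refl
    all-drop (keep w∈ c) = cong₂ _∧_ (dropˡ _ _ keep w∈) (all-drop c)
    all-drop (mark w∈ c) = cong₂ _∧_ (dropˡ _ _ mark w∈) (all-drop c)
    all-drop (drop c) = cong₂ _∧_ (drops _ _) (all-drop c)

    allPairs-split : ∀ {K F G} → Combines K F G → allPairsᵇ p G ≡ allPairsᵇ pk K ∧ allPairsᵇ p F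
    allPairs-split {K} {F} {G} c = go c
      where
      go : ∀ {K₁ F₁ G₁} → Combines K₁ F₁ G₁ → all (λ g → all (p g) G) G₁ ≡ all (λ k → all (pk k) K) K₁ ∧ all (λ f → all (p f) F) F₁
      go [] = refl
      go (keep {b} v∈ c₁) = trans (cong₂ _∧_ (all-kept keep v∈ c) (go c₁)) (∧-interchange (all (pk (b , keep)) K) _ _ _)
      go (mark {b} v∈ c₁) = trans (cong₂ _∧_ (all-kept mark v∈ c) (go c₁)) (∧-interchange (all (pk (b , mark)) K) _ _ _)
      go (drop {b} c₁) = trans (cong₂ _∧_ (all-drop c) (go c₁)) (∧-rotate (all (pk (b , drop)) K) _ _)

    peel : (φ φ′ : List (Box × 𝒱) → ℤ) (ψ : List (Box × Kind) → ℤ) →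
      (∀ {K F G} → Combines K F G → φ G ≡ ψ K ⊗ φ′ F) → ∀ S →
      sumF S C (λ G → ⟦ T? (allPairsᵇ p G) ⟧ ⊗ φ G) ≡
      sumF S kinds (λ K → permitted K ⊗ (⟦ T? (allPairsᵇ pk K) ⟧ ⊗ (ψ K ⊗
        sumF (kept K) C′ (λ F → ⟦ T? (allPairsᵇ p F) ⟧ ⊗ φ′ F))))
    peel φ φ′ ψ h S = trans (sumF-split S _) (sumF-cong S (λ K _ → ⊗-congʳ (begin
      sumF (kept K) C′ (λ F → ⟦ T? (allPairsᵇ p (combine K F)) ⟧ ⊗ φ (combine K F))
        ≡⟨ sumF-cong (kept K) (λ F fill → let c = combine-Combines K fill in
             trans (cong₂ _⊗_ (trans (cong (λ x → ⟦ T? x ⟧) (allPairs-split c)) (⟦T?∧⟧ (allPairsᵇ pk K) (allPairsᵇ p F))) (h c))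
               (solve 4 (λ a b c d → (a :* b) :* (c :* d) := (a :* c) :* (b :* d)) refl
                 ⟦ T? (allPairsᵇ pk K) ⟧ ⟦ T? (allPairsᵇ p F) ⟧ (ψ K) (φ′ F))) ⟩
      sumF (kept K) C′ (λ F → (⟦ T? (allPairsᵇ pk K) ⟧ ⊗ ψ K) ⊗ (⟦ T? (allPairsᵇ p F) ⟧ ⊗ φ′ F))
        ≡⟨ trans (sumF-*ˡ (kept K) C′ _) (⊗-assoc _ _ _) ⟩
      ⟦ T? (allPairsᵇ pk K) ⟧ ⊗ (ψ K ⊗ sumF (kept K) C′ (λ F → ⟦ T? (allPairsᵇ p F) ⟧ ⊗ φ′ F)) ∎)))

-- Boxes between two vectors, and sums over the kinds of their boxes.

-- Columns are counted from the left end of the shape: the cell j of a row has column j + z.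
module Shapes (z : ℕ) where

  cells : ℕ → ℕ → ℕ → List Box
  cells s a zero = []
  cells s a (suc ℓ) = (s , suc a ℕ.+ z) ∷ cells s (suc a) ℓ

  rowCells : ℕ → ℕ → ℕ → List Box
  rowCells s a b = cells s a (b ∸ a)

  boxes : ℕ → Vec ℕ n → Vec ℕ n → List Box
  boxes s [] [] = []
  boxes s (t ∷ ts) (d ∷ ds) = rowCells s t d ++ boxes (suc s) ts ds

  rowCells-empty : ∀ s a → rowCells s a a ≡ []
  rowCells-empty s a = cong (cells s a) (ℕ.n∸n≡0 a)

  rowCells-cons : ∀ s {a b} → a < b → rowCells s a b ≡ (s , suc a ℕ.+ z) ∷ rowCells s (suc a) b
  rowCells-cons s {a} {suc b} (s≤s a≤b) = cong (cells s a) (ℕ.+-∸-assoc 1 a≤b)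

  tag : Kind → List Box → List (Box × Kind)
  tag x = map (_, x)

  -- In a row the boxes with ℓ alone form the right end, and ℓ can join other labels only in the box
  -- just before them. The flag decides whether it does; that box is number κ, hence the `κ ∸ 1`.
  arrangement : (s t κ d : ℕ) → Bool → List (Box × Kind)
  arrangement s t κ d false = tag keep (rowCells s t κ) ++ tag drop (rowCells s κ d)
  arrangement s t κ d true = tag keep (rowCells s t (κ ∸ 1)) ++ ((s , κ ℕ.+ z) , mark) ∷ tag drop (rowCells s κ d)

  -- Forbidden neighbours in a row of a set-valued tableau: a box containing ℓ can only be followed
  -- by a box with ℓ alone.
  data Bad : Kind → Kind → Set where
    mark-keep : Bad mark keep
    mark-mark : Bad mark mark
    drop-keep : Bad drop keep
    drop-mark : Bad drop mark

  -- In a strictly decreasing row the largest label can only stand in the first box. Marks are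
  -- excluded separately.
  data BadA : Kind → Kind → Set where
    keep-drop : BadA keep drop
    drop-drop : BadA drop drop

  Vanishes : (Kind → Kind → Set) → (List (Box × Kind) → ℤ) → Set
  Vanishes Bd Θ = ∀ X s j {x y} Y → Bd x y → Θ (X ++ ((s , j) , x) ∷ ((s , suc j) , y) ∷ Y) ≡ 0ℤ

  Vanishes-∷ : ∀ {Bd Θ} p → Vanishes Bd Θ → Vanishes Bd (λ K → Θ (p ∷ K))
  Vanishes-∷ p v X = v (p ∷ X)

  Vanishes-++ : ∀ {Bd Θ} P → Vanishes Bd Θ → Vanishes Bd (λ K → Θ (P ++ K))
  Vanishes-++ [] v = v
  Vanishes-++ {Θ = Θ} (p ∷ P) v = Vanishes-++ {Θ = λ K → Θ (p ∷ K)} P (Vanishes-∷ {Θ = Θ} p v)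

  module RowSums (B : ℕ) where
    open Matrices B

    between : ℕ → ℕ → (ℕ → ℤ) → ℤ
    between a b f = ∑≤ B (λ κ → ⟦ a ≤? κ ⟧ ⊗ (⟦ κ ≤? b ⟧ ⊗ f κ))

    between-split : ∀ {a b} f → a ≤ b → b ≤ B → between a b f ≡ f a ⊕ between (suc a) b f
    between-split {a} {b} f a≤b b≤B = begin
      ∑≤ B (λ κ → ⟦ a ≤? κ ⟧ ⊗ (⟦ κ ≤? b ⟧ ⊗ f κ)) ≡⟨ ∑≤-cong B (λ κ _ → trans (⊗-congˡ (cases κ)) (⊗-distribʳ-⊕ _ _ _)) ⟩
      ∑≤ B (λ κ → ⟦ a ≟ κ ⟧ ⊗ (⟦ κ ≤? b ⟧ ⊗ f κ) ⊕ ⟦ suc a ≤? κ ⟧ ⊗ (⟦ κ ≤? b ⟧ ⊗ f κ)) ≡⟨ ∑≤-⊕ B ⟩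
      ∑≤ B (λ κ → ⟦ a ≟ κ ⟧ ⊗ (⟦ κ ≤? b ⟧ ⊗ f κ)) ⊕ between (suc a) b f
        ≡⟨ cong (_⊕ between (suc a) b f) (trans (ChainIdentity.∑≤-pick B a (λ κ → ⟦ κ ≤? b ⟧ ⊗ f κ)
             (λ B<a → contradiction (ℕ.≤-trans a≤b b≤B) (ℕ.<⇒≱ B<a))) (⟦⟧⊗-yes (a ≤? b) a≤b)) ⟩
      f a ⊕ between (suc a) b f ∎
      where
      cases : ∀ κ → ⟦ a ≤? κ ⟧ ≡ ⟦ a ≟ κ ⟧ ⊕ ⟦ suc a ≤? κ ⟧
      cases κ with a ≟ κ | suc a ≤? κ
      ... | yes refl | yes p = contradiction p (ℕ.<-irrefl refl)
      ... | yes refl | no _ = trans (⟦⟧-yes (a ≤? a) ℕ.≤-refl) (sym (⊕-identityʳ _))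
      ... | no _ | yes p = trans (⟦⟧-yes (a ≤? κ) (ℕ.<⇒≤ p)) (sym (⊕-identityˡ _))
      ... | no ne | no p = trans (⟦⟧-no (a ≤? κ) (λ q → p (ℕ.≤∧≢⇒< q ne))) (sym (⊕-identityˡ _))

    between-empty : ∀ {a b} f → b < a → between a b f ≡ 0ℤ
    between-empty {a} {b} f b<a = ∑≤-zero B λ κ _ → zero-term κ
      where
      zero-term : ∀ κ → ⟦ a ≤? κ ⟧ ⊗ (⟦ κ ≤? b ⟧ ⊗ f κ) ≡ 0ℤ
      zero-term κ with a ≤? κ
      ... | no _ = ⊗-zeroˡ _
      ... | yes p = trans (⊗-congʳ (⟦⟧⊗-no (κ ≤? b) (λ q → ℕ.<⇒≱ b<a (ℕ.≤-trans p q)))) (⊗-zeroʳ _)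

    between-cong : ∀ a b {f g} → (∀ κ → a ≤ κ → κ ≤ b → f κ ≡ g κ) → between a b f ≡ between a b g
    between-cong a b h = ∑≤-cong B (λ κ _ → ⟦⟧-scale-cong (a ≤? κ) (λ p → ⟦⟧-scale-cong (κ ≤? b) (λ q → h κ p q)))

    module _ (s : ℕ) where
      unmarked withMark : ℕ → ℕ → (List (Box × Kind) → ℤ) → ℤ
      unmarked a zero Θ = Θ []
      unmarked a (suc ℓ) Θ = Θ (tag drop (cells s a (suc ℓ))) ⊕ unmarked (suc a) ℓ (λ K → Θ (((s , suc a ℕ.+ z) , keep) ∷ K))
      withMark a zero Θ = 0ℤ
      withMark a (suc ℓ) Θ = Θ (((s , suc a ℕ.+ z) , mark) ∷ tag drop (cells s (suc a) ℓ)) ⊕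
        withMark (suc a) ℓ (λ K → Θ (((s , suc a ℕ.+ z) , keep) ∷ K))

      after-drop : ∀ a ℓ {Θ} x → Bad x keep → Bad x mark → Vanishes Bad Θ →
        sumF (cells s a ℓ) kinds (λ K → Θ (((s , a ℕ.+ z) , x) ∷ K)) ≡ Θ (((s , a ℕ.+ z) , x) ∷ tag drop (cells s a ℓ))
      after-drop a zero x b₁ b₂ v = refl
      after-drop a (suc ℓ) {Θ} x b₁ b₂ v = trans (cong₂ _⊕_
          (sumF-zero (cells s (suc a) ℓ) kinds (λ K → v [] s (a ℕ.+ z) K b₁))
          (cong₂ _⊕_ (sumF-zero (cells s (suc a) ℓ) kinds (λ K → v [] s (a ℕ.+ z) K b₂))
            (⊕-identityʳ _)))
        (trans (⊕-identityˡ _) (trans (⊕-identityˡ _)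
          (after-drop (suc a) ℓ {λ K → Θ (((s , a ℕ.+ z) , x) ∷ K)} drop drop-keep drop-mark (Vanishes-∷ {Θ = Θ} _ v))))

      -- As soon as a box contains the label, `after-drop` forces all later boxes of the row to
      -- contain it alone; the sum runs over the place where this begins.
      sumF-cells : ∀ a ℓ {Θ} → Vanishes Bad Θ → sumF (cells s a ℓ) kinds Θ ≡ unmarked a ℓ Θ ⊕ withMark a ℓ Θ
      sumF-cells a zero v = sym (⊕-identityʳ _)
      sumF-cells a (suc ℓ) {Θ} v = trans (cong₂ _⊕_ (sumF-cells (suc a) ℓ (Vanishes-∷ {Θ = Θ} _ v))
          (cong₂ _⊕_ (after-drop (suc a) ℓ {Θ} mark mark-keep mark-mark v)
            (trans (⊕-identityʳ _) (after-drop (suc a) ℓ {Θ} drop drop-keep drop-mark v))))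
        (solve 4 (λ a b c d → (a :+ b) :+ (c :+ d) := (d :+ a) :+ (c :+ b)) refl _ _ _ _)

      unmarked-between : ∀ a ℓ b → b ≡ a ℕ.+ ℓ → b ≤ B → ∀ Θ →
        unmarked a ℓ Θ ≡ between a b (λ κ → Θ (arrangement s a κ b false))
      unmarked-between a zero b e b≤B Θ rewrite e | ℕ.+-identityʳ a = sym (trans
        (between-split _ ℕ.≤-refl b≤B) (trans (cong₂ _⊕_ (cong Θ (cong₂ (λ x y → tag keep x ++ tag drop y) (rowCells-empty s a) (rowCells-empty s a)))
          (between-empty _ ℕ.≤-refl)) (⊕-identityʳ _)))
      unmarked-between a (suc ℓ) b e b≤B Θ = begin
        Θ (tag drop (cells s a (suc ℓ))) ⊕ unmarked (suc a) ℓ (λ K → Θ (((s , suc a ℕ.+ z) , keep) ∷ K))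
          ≡⟨ cong₂ _⊕_ (cong Θ (cong₂ (λ x y → tag keep x ++ tag drop (cells s a y)) (sym (rowCells-empty s a))
                 (trans (sym (ℕ.m+n∸m≡n a (suc ℓ))) (cong (_∸ a) (sym e)))))
               (trans (unmarked-between (suc a) ℓ b (trans e (ℕ.+-suc a ℓ)) b≤B _)
                 (between-cong (suc a) b (λ κ a<κ _ → cong (λ x → Θ (tag keep x ++ tag drop (rowCells s κ b))) (sym (rowCells-cons s a<κ))))) ⟩
        Θ (arrangement s a a b false) ⊕ between (suc a) b (λ κ → Θ (arrangement s a κ b false))
          ≡⟨ between-split (λ κ → Θ (arrangement s a κ b false)) (ℕ.≤-trans (ℕ.m≤m+n a (suc ℓ)) (ℕ.≤-reflexive (sym e))) b≤B ⟨
        between a b (λ κ → Θ (arrangement s a κ b false)) ∎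

      withMark-between : ∀ a ℓ b → b ≡ a ℕ.+ ℓ → b ≤ B → ∀ Θ →
        withMark a ℓ Θ ≡ between (suc a) b (λ κ → Θ (arrangement s a κ b true))
      withMark-between a zero b e b≤B Θ rewrite e | ℕ.+-identityʳ a = sym (between-empty _ ℕ.≤-refl)
      withMark-between a (suc ℓ) b e b≤B Θ = begin
        Θ (((s , suc a ℕ.+ z) , mark) ∷ tag drop (cells s (suc a) ℓ)) ⊕ withMark (suc a) ℓ (λ K → Θ (((s , suc a ℕ.+ z) , keep) ∷ K))
          ≡⟨ cong₂ _⊕_ (cong Θ (cong₂ (λ x y → tag keep x ++ ((s , suc a ℕ.+ z) , mark) ∷ tag drop (cells s (suc a) y)) (sym (rowCells-empty s a))
                 (trans (sym (ℕ.m+n∸m≡n (suc a) ℓ)) (cong (_∸ suc a) (sym e′)))))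
               (trans (withMark-between (suc a) ℓ b e′ b≤B _)
                 (between-cong (suc (suc a)) b (λ { (suc κ) (s≤s a<κ) _ → cong (λ x → Θ (tag keep x ++ ((s , suc κ ℕ.+ z) , mark) ∷ tag drop (rowCells s (suc κ) b))) (sym (rowCells-cons s a<κ)) }))) ⟩
        Θ (arrangement s a (suc a) b true) ⊕ between (suc (suc a)) b (λ κ → Θ (arrangement s a κ b true))
          ≡⟨ between-split (λ κ → Θ (arrangement s a κ b true)) (ℕ.≤-trans (ℕ.m≤m+n (suc a) ℓ) (ℕ.≤-reflexive (sym e′))) b≤B ⟨
        between (suc a) b (λ κ → Θ (arrangement s a κ b true)) ∎
        where e′ = trans e (ℕ.+-suc a ℓ)

      sumF-rowCells : ∀ {a b Θ} → a ≤ b → b ≤ B → Vanishes Bad Θ → sumF (rowCells s a b) kinds Θ ≡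
        ∑≤ B (λ κ → ⟦ a ≤? κ ⟧ ⊗ (⟦ κ ≤? b ⟧ ⊗ (Θ (arrangement s a κ b false) ⊕ ⟦ a <? κ ⟧ ⊗ Θ (arrangement s a κ b true))))
      sumF-rowCells {a} {b} {Θ} a≤b b≤B v = trans (sumF-cells a (b ∸ a) v)
        (trans (cong₂ _⊕_ (unmarked-between a (b ∸ a) b e b≤B Θ) (withMark-between a (b ∸ a) b e b≤B Θ))
        (trans (sym (∑≤-⊕ B)) (∑≤-cong B (λ κ _ → merge κ))))
        where
        e = sym (ℕ.m+[n∸m]≡n a≤b)
        merge : ∀ κ {x y} → ⟦ a ≤? κ ⟧ ⊗ (⟦ κ ≤? b ⟧ ⊗ x) ⊕ ⟦ a <? κ ⟧ ⊗ (⟦ κ ≤? b ⟧ ⊗ y) ≡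
          ⟦ a ≤? κ ⟧ ⊗ (⟦ κ ≤? b ⟧ ⊗ (x ⊕ ⟦ a <? κ ⟧ ⊗ y))
        merge κ with a <? κ
        ... | yes a<κ rewrite ⟦⟧-yes (a ≤? κ) (ℕ.<⇒≤ a<κ) =
          solve 3 (λ x y c → con 1ℤ :* (c :* x) :+ con 1ℤ :* (c :* y) := con 1ℤ :* (c :* (x :+ con 1ℤ :* y))) refl _ _ _
        ... | no _ = solve 4 (λ x y c d → d :* (c :* x) :+ con 0ℤ :* (c :* y) := d :* (c :* (x :+ con 0ℤ :* y))) refl _ _ _ _

      arrangementA : ℕ → ℕ → ℕ → List (Box × Kind)
      arrangementA a b d = tag drop (rowCells s a b) ++ tag keep (rowCells s b d)

      after-keep : ∀ a ℓ {Θ} x → BadA x drop → Vanishes BadA Θ → (∀ X b Y → Θ (X ++ (b , mark) ∷ Y) ≡ 0ℤ) →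
        sumF (cells s a ℓ) kinds (λ K → Θ (((s , a ℕ.+ z) , x) ∷ K)) ≡ Θ (((s , a ℕ.+ z) , x) ∷ tag keep (cells s a ℓ))
      after-keep a zero x b v m = refl
      after-keep a (suc ℓ) {Θ} x b v m = trans (cong₂ _⊕_
          (after-keep (suc a) ℓ {λ K → Θ (((s , a ℕ.+ z) , x) ∷ K)} keep keep-drop (Vanishes-∷ {Θ = Θ} _ v) (λ X → m (_ ∷ X)))
          (cong₂ _⊕_ (sumF-zero (cells s (suc a) ℓ) kinds (λ K → m (_ ∷ []) _ K))
            (trans (⊕-identityʳ _) (sumF-zero (cells s (suc a) ℓ) kinds (λ K → v [] s (a ℕ.+ z) K b)))))
        (trans (⊕-congʳ (⊕-identityˡ _)) (⊕-identityʳ _))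

      -- At most the first box is dropped, so the new left end b of the row is a or a + 1.
      sumF-rowCellsA : ∀ {a d Θ} → a ≤ d → d ≤ B → Vanishes BadA Θ → (∀ X b Y → Θ (X ++ (b , mark) ∷ Y) ≡ 0ℤ) →
        sumF (rowCells s a d) kinds Θ ≡
        ∑≤ B (λ b → (⟦ a ≟ b ⟧ ⊕ ⟦ suc a ≟ b ⟧) ⊗ (⟦ b ≤? d ⟧ ⊗ Θ (arrangementA a b d)))
      sumF-rowCellsA {a} {d} {Θ} a≤d d≤B v m = trans direct (sym (trans
        (trans (∑≤-cong B (λ b _ → ⊗-distribʳ-⊕ _ _ _)) (∑≤-⊕ B))
        (cong₂ _⊕_ (pick a) (pick (suc a)))))
        where
        f : ℕ → ℤ
        f b = ⟦ b ≤? d ⟧ ⊗ Θ (arrangementA a b d)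
        pick : ∀ x → ∑≤ B (λ b → ⟦ x ≟ b ⟧ ⊗ f b) ≡ f x
        pick x = ChainIdentity.∑≤-pick B x f (λ B<x → ⟦⟧⊗-no (x ≤? d) (λ x≤d → ℕ.<⇒≱ B<x (ℕ.≤-trans x≤d d≤B)))
        direct : sumF (rowCells s a d) kinds Θ ≡ f a ⊕ f (suc a)
        direct with a <? d
        ... | no a≮d with refl ← ℕ.≤-antisym a≤d (ℕ.≮⇒≥ a≮d) = sym (trans (cong₂ _⊕_ (trans (⟦⟧⊗-yes (a ≤? a) ℕ.≤-refl)
              (cong Θ (cong₂ (λ x y → tag drop x ++ tag keep y) (rowCells-empty s a) (rowCells-empty s a)))) (⊗-zeroˡ _))
              (trans (⊕-identityʳ _) (sym (cong (λ S → sumF S kinds Θ) (rowCells-empty s a)))))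
        ... | yes a<d = trans (cong (λ S → sumF S kinds Θ) (rowCells-cons s a<d))
            (trans (cong₂ _⊕_ (after-keep (suc a) (d ∸ suc a) {Θ} keep keep-drop v m)
              (cong₂ _⊕_ (sumF-zero (rowCells s (suc a) d) kinds (λ K → m [] _ K))
                (trans (⊕-identityʳ _) (after-keep (suc a) (d ∸ suc a) {Θ} drop drop-drop v m))))
            (trans (⊕-congʳ (⊕-identityˡ _)) (sym (cong₂ _⊕_
              (trans (⟦⟧⊗-yes (a ≤? d) a≤d) (cong Θ (cong₂ (λ x y → tag drop x ++ tag keep y) (rowCells-empty s a) (rowCells-cons s a<d))))
              (trans (⊗-identityˡ _) (cong (λ x → Θ (tag drop x ++ tag keep (rowCells s (suc a) d)))
                (trans (rowCells-cons s ℕ.≤-refl) (cong ((s , suc a ℕ.+ z) ∷_) (rowCells-empty s (suc a)))))))))) 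

    rowsAt : (s : ℕ) (t d κ : Vec ℕ n) → (List (Box × Kind) → ℤ) → ℤ
    rowsAt s [] [] [] Θ = Θ []
    rowsAt s (t ∷ ts) (d ∷ ds) (κ ∷ κs) Θ = ⟦ t ≤? κ ⟧ ⊗ (⟦ κ ≤? d ⟧ ⊗
      (rowsAt (suc s) ts ds κs (λ K → Θ (arrangement s t κ d false ++ K)) ⊕
       ⟦ t <? κ ⟧ ⊗ rowsAt (suc s) ts ds κs (λ K → Θ (arrangement s t κ d true ++ K))))

    sumF-boxes : ∀ s {p} (t d : Vec ℕ n) {Θ} → t ≤ᵛ d → Descending p d → p ≤ B → Vanishes Bad Θ →
      sumF (boxes s t d) kinds Θ ≡ ΣV n (λ κ → rowsAt s t d κ Θ)
    sumF-boxes s [] [] [] _ _ _ = refl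
    sumF-boxes {n = suc n} s (t ∷ ts) (d ∷ ds) {Θ} (t≤d ∷ le) (d≤p ∷ desc) p≤B v = begin
      sumF (rowCells s t d ++ boxes (suc s) ts ds) kinds Θ ≡⟨ sumF-++ (rowCells s t d) (boxes (suc s) ts ds) kinds ⟩
      sumF (rowCells s t d) kinds (λ K → sumF (boxes (suc s) ts ds) kinds (λ K′ → Θ (K ++ K′)))
        ≡⟨ sumF-rowCells s t≤d d≤B (λ X s′ j Y b → sumF-zero (boxes (suc s) ts ds) kinds
             (λ K → trans (cong Θ (List.++-assoc X _ K)) (v X s′ j (Y ++ K) b))) ⟩
      ∑≤ B (λ κ → ⟦ t ≤? κ ⟧ ⊗ (⟦ κ ≤? d ⟧ ⊗ (rest κ false ⊕ ⟦ t <? κ ⟧ ⊗ rest κ true)))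
        ≡⟨ ∑≤-cong B (λ κ _ → trans (⊗-congʳ (⊗-congʳ (trans (cong₂ _⊕_ (ih κ false) (trans (⊗-congʳ (ih κ true)) (sym (ΣV-*ˡ n _)))) (sym (ΣV-⊕ n)))))
             (trans (⊗-congʳ (sym (ΣV-*ˡ n _))) (sym (ΣV-*ˡ n _)))) ⟩
      ΣV (suc n) (λ κ → rowsAt s (t ∷ ts) (d ∷ ds) κ Θ) ∎
      where
      d≤B = ℕ.≤-trans d≤p p≤B
      rest : ℕ → Bool → ℤ
      rest κ ε = sumF (boxes (suc s) ts ds) kinds (λ K′ → Θ (arrangement s t κ d ε ++ K′))
      ih : ∀ κ ε → rest κ ε ≡ ΣV n (λ κs → rowsAt (suc s) ts ds κs (λ K → Θ (arrangement s t κ d ε ++ K)))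
      ih κ ε = sumF-boxes (suc s) ts ds le desc d≤B (Vanishes-++ {Θ = Θ} (arrangement s t κ d ε) v)

    rowsAtA : (s : ℕ) (a d b : Vec ℕ n) → (List (Box × Kind) → ℤ) → ℤ
    rowsAtA s [] [] [] Θ = Θ []
    rowsAtA s (a ∷ as) (d ∷ ds) (b ∷ bs) Θ = (⟦ a ≟ b ⟧ ⊕ ⟦ suc a ≟ b ⟧) ⊗ (⟦ b ≤? d ⟧ ⊗
      rowsAtA (suc s) as ds bs (λ K → Θ (arrangementA s a b d ++ K)))

    sumF-boxesA : ∀ s {p} (a d : Vec ℕ n) {Θ} → a ≤ᵛ d → Descending p d → p ≤ B → Vanishes BadA Θ →
      (∀ X b Y → Θ (X ++ (b , mark) ∷ Y) ≡ 0ℤ) → sumF (boxes s a d) kinds Θ ≡ ΣV n (λ b → rowsAtA s a d b Θ)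
    sumF-boxesA s [] [] [] _ _ _ _ = refl
    sumF-boxesA {n = suc n} s (a ∷ as) (d ∷ ds) {Θ} (a≤d ∷ le) (d≤p ∷ desc) p≤B v m = begin
      sumF (rowCells s a d ++ boxes (suc s) as ds) kinds Θ ≡⟨ sumF-++ (rowCells s a d) (boxes (suc s) as ds) kinds ⟩
      sumF (rowCells s a d) kinds (λ K → sumF (boxes (suc s) as ds) kinds (λ K′ → Θ (K ++ K′)))
        ≡⟨ sumF-rowCellsA s a≤d d≤B (λ X s′ j Y b → sumF-zero (boxes (suc s) as ds) kinds
             (λ K → trans (cong Θ (List.++-assoc X _ K)) (v X s′ j (Y ++ K) b)))
             (λ X b Y → sumF-zero (boxes (suc s) as ds) kinds (λ K → trans (cong Θ (List.++-assoc X _ K)) (m X b (Y ++ K)))) ⟩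
      ∑≤ B (λ b → (⟦ a ≟ b ⟧ ⊕ ⟦ suc a ≟ b ⟧) ⊗ (⟦ b ≤? d ⟧ ⊗ rest b))
        ≡⟨ ∑≤-cong B (λ b _ → trans (⊗-congʳ (trans (⊗-congʳ (ih b)) (sym (ΣV-*ˡ n _)))) (sym (ΣV-*ˡ n _))) ⟩
      ΣV (suc n) (λ b → rowsAtA s (a ∷ as) (d ∷ ds) b Θ) ∎
      where
      d≤B = ℕ.≤-trans d≤p p≤B
      rest : ℕ → ℤ
      rest b = sumF (boxes (suc s) as ds) kinds (λ K′ → Θ (arrangementA s a b d ++ K′))
      ih : ∀ b → rest b ≡ ΣV n (λ bs → rowsAtA (suc s) as ds bs (λ K → Θ (arrangementA s a b d ++ K)))
      ih b = sumF-boxesA (suc s) as ds le desc d≤B (Vanishes-++ {Θ = Θ} (arrangementA s a b d) v)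
        (λ X c Y → trans (cong Θ (sym (List.++-assoc (arrangementA s a b d) X _))) (m (arrangementA s a b d ++ X) c Y))

T-⇒⁺ : ∀ {a b} → (T a → T b) → T (a ⇒ᵇ b)
T-⇒⁺ {true} h = h tt
T-⇒⁺ {false} h = tt

T-⇒⁻ : ∀ {a b} → T (a ⇒ᵇ b) → T a → T b
T-⇒⁻ {true} h _ = h

T-∧⁺ : ∀ {a b} → T a → T b → T (a ∧ b)
T-∧⁺ x y = Equivalence.from T-∧ (x , y)

T-∧⁻ : ∀ {a b} → T (a ∧ b) → T a × T b
T-∧⁻ = Equivalence.to T-∧

⇒ᵇ-∧-split : ∀ g₁ g₂ {h₁ h₂ a₁ a₂ c₁ c₂} → a₁ ≡ h₁ ∧ c₁ → a₂ ≡ h₂ ∧ c₂ →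
  (g₁ ⇒ᵇ a₁) ∧ (g₂ ⇒ᵇ a₂) ≡ ((g₁ ⇒ᵇ h₁) ∧ (g₂ ⇒ᵇ h₂)) ∧ ((g₁ ⇒ᵇ c₁) ∧ (g₂ ⇒ᵇ c₂))
⇒ᵇ-∧-split g₁ g₂ {h₁} {h₂} {c₁ = c₁} {c₂} refl refl = trans (cong₂ _∧_ (distrib g₁ h₁ c₁) (distrib g₂ h₂ c₂)) (∧-interchange (g₁ ⇒ᵇ h₁) _ _ _)
  where
  distrib : ∀ g h c → (g ⇒ᵇ (h ∧ c)) ≡ (g ⇒ᵇ h) ∧ (g ⇒ᵇ c)
  distrib true h c = refl
  distrib false h c = refl

cong-⇒ᵇ : ∀ g₁ g₂ {h₁ h₂ a₁ a₂} → a₁ ≡ h₁ → a₂ ≡ h₂ → (g₁ ⇒ᵇ a₁) ∧ (g₂ ⇒ᵇ a₂) ≡ (g₁ ⇒ᵇ h₁) ∧ (g₂ ⇒ᵇ h₂)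
cong-⇒ᵇ _ _ refl refl = refl

≡ᵇ-refl : ∀ m → T (m ≡ᵇ m)
≡ᵇ-refl m = ℕ.≡⇒≡ᵇ m m refl

T-false : ∀ {b} → ¬ T b → b ≡ false
T-false {false} _ = refl
T-false {true} h = contradiction tt h

T-true : ∀ {b} → T b → b ≡ true
T-true {true} _ = refl

-- What the kinds know about the order of neighbours: ℓ is the maximum of a marked and of a dropped
-- box, but the minimum only of a dropped one.
hor ver : Kind → Kind → Bool
hor keep _ = true
hor _ drop = true
hor _ _ = false
ver keep _ = true
ver _ _ = false

setKinds : Box × Kind → Box × Kind → Bool
setKinds (b , x) (d , y) =
  (((row b ≡ᵇ row d) ∧ (suc (col b) ≡ᵇ col d)) ⇒ᵇ hor x y) ∧
  (((col b ≡ᵇ col d) ∧ (suc (row b) ≡ᵇ row d)) ⇒ᵇ ver x y)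

labels : List (Box × Kind) → ℕ
labels [] = 0
labels ((_ , keep) ∷ K) = labels K
labels ((_ , mark) ∷ K) = suc (labels K)
labels ((_ , drop) ∷ K) = suc (labels K)

markSign : List (Box × Kind) → ℤ
markSign [] = 1ℤ
markSign ((_ , mark) ∷ K) = ⊖ markSign K
markSign ((_ , _) ∷ K) = markSign K

module _ (z : ℕ) where
  open Shapes z

  cells-∈⁻ : ∀ s a ℓ {b} → b ∈ cells s a ℓ → ∃ λ j → b ≡ (s , j ℕ.+ z) × a < j × j ≤ a ℕ.+ ℓ
  cells-∈⁻ s a (suc ℓ) (here refl) = suc a , refl , ℕ.≤-refl , ℕ.≤-trans (s≤s (ℕ.m≤m+n a ℓ)) (ℕ.≤-reflexive (sym (ℕ.+-suc a ℓ)))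
  cells-∈⁻ s a (suc ℓ) (there p) with j , e , q , r ← cells-∈⁻ s (suc a) ℓ p =
    j , e , ℕ.<⇒≤ q , ℕ.≤-trans r (ℕ.≤-reflexive (sym (ℕ.+-suc a ℓ)))

  rowCells-∈⁻ : ∀ s a b {c} → c ∈ rowCells s a b → ∃ λ j → c ≡ (s , j ℕ.+ z) × a < j × j ≤ b
  rowCells-∈⁻ s a b p with j , e , q , r ← cells-∈⁻ s a (b ∸ a) p with ℕ.≤-total a b
  ... | inj₁ a≤b = j , e , q , ℕ.≤-trans r (ℕ.≤-reflexive (ℕ.m+[n∸m]≡n a≤b))
  ... | inj₂ b≤a = contradiction (ℕ.≤-trans r (ℕ.≤-reflexive (trans (cong (a ℕ.+_) (ℕ.m≤n⇒m∸n≡0 b≤a)) (ℕ.+-identityʳ a)))) (ℕ.<⇒≱ q)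

  cells-∈⁺ : ∀ s a ℓ j → a < j → j ≤ a ℕ.+ ℓ → (s , j ℕ.+ z) ∈ cells s a ℓ
  cells-∈⁺ s a zero j p q = contradiction (ℕ.≤-trans q (ℕ.≤-reflexive (ℕ.+-identityʳ a))) (ℕ.<⇒≱ p)
  cells-∈⁺ s a (suc ℓ) j p q with j ≟ suc a
  ... | yes refl = here refl
  ... | no ne = there (cells-∈⁺ s (suc a) ℓ j (ℕ.≤∧≢⇒< p (ne ∘ sym)) (ℕ.≤-trans q (ℕ.≤-reflexive (ℕ.+-suc a ℓ))))

  rowCells-∈⁺ : ∀ s {a b} j → a < j → j ≤ b → (s , j ℕ.+ z) ∈ rowCells s a b
  rowCells-∈⁺ s {a} {b} j p q = cells-∈⁺ s a (b ∸ a) j p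
    (ℕ.≤-trans q (ℕ.≤-reflexive (sym (ℕ.m+[n∸m]≡n (ℕ.≤-trans (ℕ.<⇒≤ p) q)))))

  rowCells-++ : ∀ s {a b c} → a ≤ b → b ≤ c → rowCells s a b ++ rowCells s b c ≡ rowCells s a c
  rowCells-++ s {a} {b} {c} a≤b b≤c = go (b ∸ a) a (sym (ℕ.m+[n∸m]≡n a≤b))
    where
    go : ∀ ℓ a → b ≡ a ℕ.+ ℓ → cells s a ℓ ++ rowCells s b c ≡ rowCells s a c
    go zero a e = cong (λ x → rowCells s x c) (trans e (ℕ.+-identityʳ a))
    go (suc ℓ) a e = trans (cong ((s , suc a ℕ.+ z) ∷_) (go ℓ (suc a) (trans e (ℕ.+-suc a ℓ))))
      (sym (rowCells-cons s (ℕ.≤-trans (ℕ.≤-trans (s≤s (ℕ.m≤m+n a ℓ)) (ℕ.≤-reflexive (trans (sym (ℕ.+-suc a ℓ)) (sym e)))) b≤c)))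

  rowCells-snoc : ∀ s {a b} → a ≤ b → rowCells s a b ++ (s , suc b ℕ.+ z) ∷ [] ≡ rowCells s a (suc b)
  rowCells-snoc s {a} {b} a≤b = trans (cong (rowCells s a b ++_) (sym (trans (rowCells-cons s (ℕ.≤-refl {suc b}))
    (cong ((s , suc b ℕ.+ z) ∷_) (rowCells-empty s (suc b)))))) (rowCells-++ s a≤b (ℕ.n≤1+n b))

  boxes-row : ∀ s (t d : Vec ℕ n) {b} → b ∈ boxes s t d → s ≤ row b
  boxes-row s [] [] ()
  boxes-row s (t ∷ ts) (d ∷ ds) p with ∈.∈-++⁻ (rowCells s t d) p
  ... | inj₁ q with _ , refl , _ ← rowCells-∈⁻ s t d q = ℕ.≤-refl
  ... | inj₂ q = ℕ.<⇒≤ (boxes-row (suc s) ts ds q)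

  boxes-first⁻ : ∀ s (t d : Vec ℕ n) {c} → (s , c) ∈ boxes s t d → ∃ λ j → c ≡ j ℕ.+ z × next t < j × j ≤ next d
  boxes-first⁻ s [] [] ()
  boxes-first⁻ s (t ∷ ts) (d ∷ ds) p with ∈.∈-++⁻ (rowCells s t d) p
  ... | inj₁ q with j , refl , r ← rowCells-∈⁻ s t d q = j , refl , r
  ... | inj₂ q = contradiction (boxes-row (suc s) ts ds q) (ℕ.<-irrefl refl)

  boxes-first⁺ : ∀ s (t d : Vec ℕ n) {j} → next t < j → j ≤ next d → (s , j ℕ.+ z) ∈ boxes s t d
  boxes-first⁺ s [] [] p q = contradiction q (ℕ.<⇒≱ p)
  boxes-first⁺ s (t ∷ ts) (d ∷ ds) p q = ∈.∈-++⁺ˡ (rowCells-∈⁺ s _ p q)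

  tag-∈⁻ : ∀ {x} S {b y} → (b , y) ∈ tag x S → b ∈ S × y ≡ x
  tag-∈⁻ S p with _ , q , refl ← ∈.∈-map⁻ (_, _) p = q , refl

  keys : List (Box × Kind) → List Box
  keys = map proj₁

  keys-tag : ∀ x S → keys (tag x S) ≡ S
  keys-tag x S = trans (sym (List.map-∘ S)) (List.map-id S)

  keys-∈ : ∀ {b} K → b ∈ keys K → ∃ λ x → (b , x) ∈ K
  keys-∈ K p with (_ , x) , q , refl ← ∈.∈-map⁻ proj₁ p = x , q

  data Arranged : (s : ℕ) (t d κ : Vec ℕ n) → List (Box × Kind) → Set where
    [] : ∀ {s} → Arranged s [] [] [] []
    noMark : ∀ {n s t κ d} {ts ds κs : Vec ℕ n} {K} → t ≤ κ → κ ≤ d → Arranged (suc s) ts ds κs K →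
      Arranged s (t ∷ ts) (d ∷ ds) (κ ∷ κs) (arrangement s t κ d false ++ K)
    withMark : ∀ {n s t κ d} {ts ds κs : Vec ℕ n} {K} → t < κ → κ ≤ d → Arranged (suc s) ts ds κs K →
      Arranged s (t ∷ ts) (d ∷ ds) (κ ∷ κs) (arrangement s t κ d true ++ K)

  arrangement-keys : ∀ s {t κ d} ε → t ≤ κ → κ ≤ d → (T ε → t < κ) → keys (arrangement s t κ d ε) ≡ rowCells s t d
  arrangement-keys s {t} {κ} {d} false t≤κ κ≤d _ = trans (List.map-++ proj₁ (tag keep (rowCells s t κ)) _)
    (trans (cong₂ _++_ (keys-tag keep (rowCells s t κ)) (keys-tag drop (rowCells s κ d))) (rowCells-++ s t≤κ κ≤d))
  arrangement-keys s {t} {zero} {d} true t≤κ κ≤d h = contradiction (h tt) λ ()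
  arrangement-keys s {t} {suc κ} {d} true t≤κ κ≤d h = trans (List.map-++ proj₁ (tag keep (rowCells s t κ)) _)
    (trans (cong₂ (λ x y → x ++ (s , suc κ ℕ.+ z) ∷ y) (keys-tag keep _) (keys-tag drop _))
    (trans (sym (List.++-assoc (rowCells s t κ) _ _)) (trans (cong (_++ rowCells s (suc κ) d) (rowCells-snoc s (ℕ.≤-pred (h tt))))
      (rowCells-++ s t≤κ κ≤d))))

  Arranged-keys : ∀ {s} {t d κ : Vec ℕ n} {K} → Arranged s t d κ K → keys K ≡ boxes s t d
  Arranged-keys [] = refl
  Arranged-keys {s = s} (noMark {t = t} {κ = κ} {d = d} {K = K} p q a) = trans (List.map-++ proj₁ (arrangement s t κ d false) K)
    (cong₂ _++_ (arrangement-keys s false p q (λ ())) (Arranged-keys a))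
  Arranged-keys {s = s} (withMark {t = t} {κ = κ} {d = d} {K = K} p q a) = trans (List.map-++ proj₁ (arrangement s t κ d true) K)
    (cong₂ _++_ (arrangement-keys s true (ℕ.<⇒≤ p) q (λ _ → p)) (Arranged-keys a))

  data Position (κ j : ℕ) (ε : Bool) : Kind → Set where
    keep : j ≤ κ → Position κ j ε keep
    mark : j ≡ κ → T ε → Position κ j ε mark
    drop : κ < j → Position κ j ε drop

  arrangement-∈ : ∀ s t κ d ε {b x} → (b , x) ∈ arrangement s t κ d ε → ∃ λ j → b ≡ (s , j ℕ.+ z) × Position κ j ε x
  arrangement-∈ s t κ d false p with ∈.∈-++⁻ (tag keep (rowCells s t κ)) p
  ... | inj₁ q with r , refl ← tag-∈⁻ _ q with j , e , _ , u ← rowCells-∈⁻ s t κ r = j , e , keep u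
  ... | inj₂ q with r , refl ← tag-∈⁻ _ q with j , e , u , _ ← rowCells-∈⁻ s κ d r = j , e , drop u
  arrangement-∈ s t κ d true p with ∈.∈-++⁻ (tag keep (rowCells s t (κ ∸ 1))) p
  ... | inj₁ q with r , refl ← tag-∈⁻ _ q with j , e , _ , u ← rowCells-∈⁻ s t (κ ∸ 1) r = j , e , keep (ℕ.≤-trans u (ℕ.m∸n≤m κ 1))
  ... | inj₂ (here refl) = κ , refl , mark refl tt
  ... | inj₂ (there q) with r , refl ← tag-∈⁻ _ q with j , e , u , _ ← rowCells-∈⁻ s κ d r = j , e , drop u

  drop-∈ : ∀ s {t κ d} ε {j} → κ < j → j ≤ d → ((s , j ℕ.+ z) , drop) ∈ arrangement s t κ d ε
  drop-∈ s {t} {κ} {d} false p q = ∈.∈-++⁺ʳ (tag keep (rowCells s t κ)) (∈.∈-map⁺ (_, drop) (rowCells-∈⁺ s _ p q))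
  drop-∈ s {t} {κ} {d} true p q = ∈.∈-++⁺ʳ (tag keep (rowCells s t (κ ∸ 1))) (there (∈.∈-map⁺ (_, drop) (rowCells-∈⁺ s _ p q)))

  bad-hor : ∀ {x y} → Bad x y → ¬ T (hor x y)
  bad-hor mark-keep ()
  bad-hor mark-mark ()
  bad-hor drop-keep ()
  bad-hor drop-mark ()

  pairs-vanish : ∀ X s j {x y} Y → Bad x y → ¬ T (allPairsᵇ setKinds (X ++ ((s , j) , x) ∷ ((s , suc j) , y) ∷ Y))
  pairs-vanish X s j Y b h = bad-hor b (T-⇒⁻ (proj₁ (T-∧⁻ (T-allPairs⁻ {p = setKinds} _ h
    (∈.∈-++⁺ʳ X (here refl)) (∈.∈-++⁺ʳ X (there (here refl)))))) (T-∧⁺ (≡ᵇ-refl s) (≡ᵇ-refl j)))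

  -- Nothing may lie under a box that contains the largest label. The dropped boxes start after κ; a
  -- mark sits in κ itself and makes the bound strict.
  RowCondition : (κ nd : ℕ) → Bool → Set
  RowCondition κ nd false = nd ≤ κ
  RowCondition κ nd true = nd < κ

  rowCondition? : ∀ κ nd ε → Dec (RowCondition κ nd ε)
  rowCondition? κ nd false = nd ≤? κ
  rowCondition? κ nd true = nd <? κ

  module _ {s t κ d : ℕ} {n} {ts ds κs : Vec ℕ n} {K} (ε : Bool) (t≤κ : t ≤ κ) (κ≤d : κ ≤ d) (mark-ok : T ε → t < κ)
    (nt≤t : next ts ≤ t) (nd≤d : next ds ≤ d) (arr : Arranged (suc s) ts ds κs K) where

    private
      L = arrangement s t κ d ε

      below-∈ : ∀ {j} → next ts < j → j ≤ next ds → ∃ λ y → ((suc s , j ℕ.+ z) , y) ∈ K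
      below-∈ p q = keys-∈ K (subst (_ ∈_) (sym (Arranged-keys arr)) (boxes-first⁺ (suc s) ts ds p q))

      K-box : ∀ {b y} → (b , y) ∈ K → b ∈ boxes (suc s) ts ds
      K-box p = subst (_ ∈_) (Arranged-keys arr) (∈.∈-map⁺ proj₁ p)

    -- If the next row were longer, it would have a box under the first box of this row that
    -- contains the largest label: column κ with a mark, column κ + 1 without.
    pairs-row⁻ : T (allPairsᵇ setKinds (L ++ K)) → RowCondition κ (next ds) ε × T (allPairsᵇ setKinds K)
    pairs-row⁻ h = cond ε refl , T-allPairs⁺ {p = setKinds} K (λ p q → T-allPairs⁻ {p = setKinds} (L ++ K) h (∈.∈-++⁺ʳ L p) (∈.∈-++⁺ʳ L q))
      where
      vertical-bad : ∀ {j x y} → ((s , j ℕ.+ z) , x) ∈ L → ((suc s , j ℕ.+ z) , y) ∈ K → T (ver x y)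
      vertical-bad {j} p q = T-⇒⁻ (proj₂ (T-∧⁻ (T-allPairs⁻ {p = setKinds} (L ++ K) h (∈.∈-++⁺ˡ p) (∈.∈-++⁺ʳ L q))))
        (T-∧⁺ (≡ᵇ-refl (j ℕ.+ z)) (≡ᵇ-refl (suc s)))
      cond : ∀ e → e ≡ ε → RowCondition κ (next ds) e
      cond false refl with next ds ≤? κ
      ... | yes p = p
      ... | no p with y , q ← below-∈ (s≤s (ℕ.≤-trans nt≤t t≤κ)) (ℕ.≰⇒> p) =
        ⊥-elim (vertical-bad (drop-∈ s false ℕ.≤-refl (ℕ.≤-trans (ℕ.≰⇒> p) nd≤d)) q)
      cond true refl with next ds <? κ
      ... | yes p = p
      ... | no p with y , q ← below-∈ (ℕ.≤-<-trans nt≤t (mark-ok tt)) (ℕ.≮⇒≥ p) =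
        ⊥-elim (vertical-bad (∈.∈-++⁺ʳ (tag keep (rowCells s t (κ ∸ 1))) (here refl)) q)

    pairs-row⁺ : RowCondition κ (next ds) ε → T (allPairsᵇ setKinds K) → T (allPairsᵇ setKinds (L ++ K))
    pairs-row⁺ c h = T-allPairs⁺ {p = setKinds} (L ++ K) (λ p q → go (∈.∈-++⁻ L p) (∈.∈-++⁻ L q))
      where
      go : ∀ {k k′} → k ∈ L ⊎ k ∈ K → k′ ∈ L ⊎ k′ ∈ K → T (setKinds k k′)
      go (inj₂ p) (inj₂ q) = T-allPairs⁻ {p = setKinds} K h p q
      go (inj₁ p) (inj₁ q) with j , refl , x ← arrangement-∈ s t κ d ε p | i , refl , y ← arrangement-∈ s t κ d ε q =
        T-∧⁺ (T-⇒⁺ (λ e → horizontal x y (ℕ.+-cancelʳ-≡ z (suc j) i (ℕ.≡ᵇ⇒≡ (suc j ℕ.+ z) _ (proj₂ (T-∧⁻ {s ≡ᵇ s} e))))))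
          (T-⇒⁺ (λ e → contradiction (ℕ.≡ᵇ⇒≡ (suc s) s (proj₂ (T-∧⁻ {j ℕ.+ z ≡ᵇ i ℕ.+ z} e))) (ℕ.1+n≢n)))
        where
        horizontal : ∀ {j i x y} → Position κ j ε x → Position κ i ε y → suc j ≡ i → T (hor x y)
        horizontal (keep _) _ _ = tt
        horizontal (mark refl _) (keep j≤κ) refl = contradiction j≤κ (ℕ.<-irrefl refl)
        horizontal (mark refl _) (mark e _) refl = contradiction e ℕ.1+n≢n
        horizontal (mark _ _) (drop _) _ = tt
        horizontal (drop κ<j) (keep j≤κ) refl = contradiction (ℕ.<-trans κ<j j≤κ) (ℕ.<-irrefl refl)
        horizontal (drop κ<j) (mark refl _) refl = contradiction κ<j (ℕ.<-asym (ℕ.n<1+n _))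
        horizontal (drop _) (drop _) _ = tt
      go {k′ = (r , c′) , y} (inj₁ p) (inj₂ q) with j , refl , x ← arrangement-∈ s t κ d ε p =
        T-∧⁺ (T-⇒⁺ (λ e → contradiction (ℕ.≤-trans (boxes-row (suc s) ts ds (K-box q)) (ℕ.≤-reflexive (sym (ℕ.≡ᵇ⇒≡ s r (proj₁ (T-∧⁻ {s ≡ᵇ r} e))))))
              (ℕ.<-irrefl refl)))
          (T-⇒⁺ (λ e → let e₁ , e₂ = T-∧⁻ {j ℕ.+ z ≡ᵇ c′} e in
            vertical y x (subst₂ (λ r′ c″ → (r′ , c″) ∈ boxes (suc s) ts ds) (sym (ℕ.≡ᵇ⇒≡ (suc s) r e₂)) (sym (ℕ.≡ᵇ⇒≡ (j ℕ.+ z) c′ e₁)) (K-box q))))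
        where
        vertical : ∀ {j x} y → Position κ j ε x → (suc s , j ℕ.+ z) ∈ boxes (suc s) ts ds → T (ver x y)
        vertical {j} y x b with i , e , _ , i≤ ← boxes-first⁻ (suc s) ts ds b with refl ← ℕ.+-cancelʳ-≡ z j i e = below y x i≤ ε refl
          where
          below : ∀ {j x} y → Position κ j ε x → j ≤ next ds → ∀ e → e ≡ ε → T (ver x y)
          below _ (keep _) _ _ _ = tt
          below _ (mark refl _) le true refl = contradiction c (ℕ.≤⇒≯ le)
          below _ (drop κ<j) le false refl = contradiction c (ℕ.<⇒≱ (ℕ.≤-trans κ<j le))
          below _ (drop κ<j) le true refl = contradiction (ℕ.<⇒≤ c) (ℕ.<⇒≱ (ℕ.≤-trans κ<j le))
      go {k = (r , c′) , y} (inj₂ q) (inj₁ p) with j , refl , x ← arrangement-∈ s t κ d ε p =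
        T-∧⁺ (T-⇒⁺ (λ e → contradiction (ℕ.≤-trans s<r (ℕ.≤-reflexive (ℕ.≡ᵇ⇒≡ r s (proj₁ (T-∧⁻ {r ≡ᵇ s} e))))) (ℕ.<-irrefl refl)))
          (T-⇒⁺ (λ e → contradiction (ℕ.≤-trans (ℕ.m≤n⇒m≤1+n s<r) (ℕ.≤-reflexive (ℕ.≡ᵇ⇒≡ (suc r) s (proj₂ (T-∧⁻ {c′ ≡ᵇ j ℕ.+ z} e))))) (ℕ.<-irrefl refl)))
        where s<r = boxes-row (suc s) ts ds (K-box q)

    pairs-row : ⟦ T? (allPairsᵇ setKinds (L ++ K)) ⟧ ≡ ⟦ rowCondition? κ (next ds) ε ⟧ ⊗ ⟦ T? (allPairsᵇ setKinds K) ⟧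
    pairs-row = trans (⟦⟧-cong (T? (allPairsᵇ setKinds (L ++ K))) (rowCondition? κ (next ds) ε ×-dec T? (allPairsᵇ setKinds K))
        pairs-row⁻ (λ (p , q) → pairs-row⁺ p q))
      (⟦⟧-× (rowCondition? κ (next ds) ε) (T? (allPairsᵇ setKinds K)))

  module SetRows (B : ℕ) where
    open Matrices B
    open RowSums B hiding (unmarked; withMark)

    rowsAt-cong : ∀ s (t d κ : Vec ℕ n) {Θ Θ′} → (∀ K → Arranged s t d κ K → Θ K ≡ Θ′ K) → rowsAt s t d κ Θ ≡ rowsAt s t d κ Θ′
    rowsAt-cong s [] [] [] h = h [] []
    rowsAt-cong s (t ∷ ts) (d ∷ ds) (κ ∷ κs) h = ⟦⟧-scale-cong (t ≤? κ) (λ p → ⟦⟧-scale-cong (κ ≤? d) (λ q →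
      cong₂ _⊕_ (rowsAt-cong (suc s) ts ds κs (λ K a → h _ (noMark p q a)))
        (⟦⟧-scale-cong (t <? κ) (λ r → rowsAt-cong (suc s) ts ds κs (λ K a → h _ (withMark r q a))))))

    rowsAt-*ˡ : ∀ s (t d κ : Vec ℕ n) a {Θ} → rowsAt s t d κ (λ K → a ⊗ Θ K) ≡ a ⊗ rowsAt s t d κ Θ
    rowsAt-*ˡ s [] [] [] a = refl
    rowsAt-*ˡ s (t ∷ ts) (d ∷ ds) (κ ∷ κs) a = trans (⊗-congʳ (⊗-congʳ (cong₂ (λ x y → x ⊕ ⟦ t <? κ ⟧ ⊗ y)
      (rowsAt-*ˡ (suc s) ts ds κs a) (rowsAt-*ˡ (suc s) ts ds κs a))))
      (solve 6 (λ p q r a x y → p :* (q :* (a :* x :+ r :* (a :* y))) := a :* (p :* (q :* (x :+ r :* y)))) refl _ _ _ _ _ _)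

    module _ (mo qo : ℕ → Bool) where

      permitted : List (Box × Kind) → ℤ
      permitted = allowed mo qo

      -- The one-letter kernel that respects the upper boundary t: a marked box must exist, which is
      -- the condition t < κ absent from `remove`. In addition `mo` and `qo` select the rows for
      -- marks and drops.
      removeFrom : (s : ℕ) (t d κ : Vec ℕ n) → (ℕ → ℤ) → ℤ
      removeFrom s [] [] [] w = w 0
      removeFrom s (t ∷ ts) (d ∷ ds) (κ ∷ κs) w = ⟦ t ≤? κ ⟧ ⊗ (⟦ next ds ≤? κ ⟧ ⊗ (⟦ κ ≤? d ⟧ ⊗ (⟦ (κ ≟ d) ⊎-dec T? (qo s) ⟧ ⊗
        (removeFrom (suc s) ts ds κs (λ x → w ((d ∸ κ) ℕ.+ x)) ⊕ ⊖ (⟦ T? (mo s) ⟧ ⊗ (⟦ t <? κ ⟧ ⊗ (⟦ next ds <? κ ⟧ ⊗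
          removeFrom (suc s) ts ds κs (λ x → w ((d ∸ κ) ℕ.+ suc x)))))))))

      weight : (ℕ → ℤ) → (List Box → ℤ) → List (Box × Kind) → ℤ
      weight w Ψ K = permitted K ⊗ (⟦ T? (allPairsᵇ setKinds K) ⟧ ⊗ ((markSign K ⊗ w (labels K)) ⊗ Ψ (kept K)))

      weight-vanishes : ∀ w Ψ → Vanishes Bad (weight w Ψ)
      weight-vanishes w Ψ X s j Y b = trans (⊗-congʳ (⟦⟧⊗-no (T? _) (pairs-vanish X s j Y b))) (⊗-zeroʳ _)

      private
        drops-permitted : ∀ s a ℓ K → permitted (tag drop (cells s a ℓ) ++ K) ≡ ⟦ (ℓ ≟ 0) ⊎-dec T? (qo s) ⟧ ⊗ permitted K
        drops-permitted s a zero K = sym (⟦⟧⊗-yes ((0 ≟ 0) ⊎-dec T? (qo s)) (inj₁ refl))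
        drops-permitted s a (suc ℓ) K = trans (⊗-congʳ (drops-permitted s (suc a) ℓ K)) (merge (T? (qo s)) ℓ)
          where
          merge : ∀ (q : Dec (T (qo s))) ℓ {x} → ⟦ q ⟧ ⊗ (⟦ (ℓ ≟ 0) ⊎-dec q ⟧ ⊗ x) ≡ ⟦ (suc ℓ ≟ 0) ⊎-dec q ⟧ ⊗ x
          merge (yes q) zero = ⊗-identityˡ _
          merge (yes q) (suc ℓ) = ⊗-identityˡ _
          merge (no q) ℓ = trans (⊗-zeroˡ _) (sym (⊗-zeroˡ _))

        drops-labels : ∀ s a ℓ K → labels (tag drop (cells s a ℓ) ++ K) ≡ ℓ ℕ.+ labels K
        drops-labels s a zero K = refl
        drops-labels s a (suc ℓ) K = cong suc (drops-labels s (suc a) ℓ K)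

        drops-sign : ∀ S K → markSign (tag drop S ++ K) ≡ markSign K
        drops-sign [] K = refl
        drops-sign (_ ∷ S) K = drops-sign S K

        drops-kept : ∀ S K → kept (tag drop S ++ K) ≡ kept K
        drops-kept [] K = refl
        drops-kept (_ ∷ S) K = drops-kept S K

        keeps-permitted : ∀ S K → permitted (tag keep S ++ K) ≡ permitted K
        keeps-permitted [] K = refl
        keeps-permitted (_ ∷ S) K = keeps-permitted S K

        keeps-labels : ∀ S K → labels (tag keep S ++ K) ≡ labels K
        keeps-labels [] K = refl
        keeps-labels (_ ∷ S) K = keeps-labels S K

        keeps-sign : ∀ S K → markSign (tag keep S ++ K) ≡ markSign K
        keeps-sign [] K = refl
        keeps-sign (_ ∷ S) K = keeps-sign S K

        keeps-kept : ∀ S K → kept (tag keep S ++ K) ≡ S ++ kept K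
        keeps-kept [] K = refl
        keeps-kept (b ∷ S) K = cong (b ∷_) (keeps-kept S K)

        dropFactor : ∀ s {κ d} → κ ≤ d → ⟦ ((d ∸ κ) ≟ 0) ⊎-dec T? (qo s) ⟧ ≡ ⟦ (κ ≟ d) ⊎-dec T? (qo s) ⟧
        dropFactor s {κ} {d} κ≤d = ⟦⟧-cong (((d ∸ κ) ≟ 0) ⊎-dec T? (qo s)) ((κ ≟ d) ⊎-dec T? (qo s))
          (λ { (inj₁ e) → inj₁ (ℕ.≤-antisym κ≤d (ℕ.m∸n≡0⇒m≤n e)) ; (inj₂ q) → inj₂ q })
          (λ { (inj₁ refl) → inj₁ (ℕ.n∸n≡0 κ) ; (inj₂ q) → inj₂ q })

      -- All parts of the weight except w are multiplicative over the rows; w is shifted by the d -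
      -- κ dropped boxes, and by one more for a mark.
      rowsAt-weight : ∀ s {p q} (t d κ : Vec ℕ n) w Ψ → Descending p t → Descending q d →
        rowsAt s t d κ (weight w Ψ) ≡ removeFrom s t d κ w ⊗ Ψ (boxes s t κ)
      rowsAt-weight s [] [] [] w Ψ _ _ = solve 2 (λ w p → con 1ℤ :* (con 1ℤ :* ((con 1ℤ :* w) :* p)) := w :* p) refl _ _
      rowsAt-weight s (t ∷ ts) (d ∷ ds) (κ ∷ κs) w Ψ (_ ∷ dt) (_ ∷ dd) = begin
        ⟦ t ≤? κ ⟧ ⊗ (⟦ κ ≤? d ⟧ ⊗ (rowsAt (suc s) ts ds κs (λ K → weight w Ψ (arrangement s t κ d false ++ K)) ⊕
          ⟦ t <? κ ⟧ ⊗ rowsAt (suc s) ts ds κs (λ K → weight w Ψ (arrangement s t κ d true ++ K))))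
          ≡⟨ ⟦⟧-scale-cong (t ≤? κ) (λ t≤κ → ⟦⟧-scale-cong (κ ≤? d) (λ κ≤d → cong₂ _⊕_ (unmarked-row t≤κ κ≤d)
               (⟦⟧-scale-cong (t <? κ) (λ t<κ → marked-row t<κ κ≤d)))) ⟩
        ⟦ t ≤? κ ⟧ ⊗ (⟦ κ ≤? d ⟧ ⊗ ((⟦ next ds ≤? κ ⟧ ⊗ β) ⊗ (R₁ ⊗ Ψ (boxes s (t ∷ ts) (κ ∷ κs))) ⊕
          ⟦ t <? κ ⟧ ⊗ ((⟦ next ds <? κ ⟧ ⊗ ⊖ (⟦ T? (mo s) ⟧ ⊗ β)) ⊗ (R₂ ⊗ Ψ (boxes s (t ∷ ts) (κ ∷ κs))))))
          ≡⟨ ⊗-congʳ (⊗-congʳ (⊕-congʳ (⊗-congʳ (⊗-congˡ (⊗-congˡ {c = ⊖ (⟦ T? (mo s) ⟧ ⊗ β)} strict))))) ⟩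
        ⟦ t ≤? κ ⟧ ⊗ (⟦ κ ≤? d ⟧ ⊗ ((⟦ next ds ≤? κ ⟧ ⊗ β) ⊗ (R₁ ⊗ Ψ (boxes s (t ∷ ts) (κ ∷ κs))) ⊕
          ⟦ t <? κ ⟧ ⊗ (((⟦ next ds ≤? κ ⟧ ⊗ ⟦ next ds <? κ ⟧) ⊗ ⊖ (⟦ T? (mo s) ⟧ ⊗ β)) ⊗ (R₂ ⊗ Ψ (boxes s (t ∷ ts) (κ ∷ κs))))))
          ≡⟨ solve 10 (λ a b c β r₁ f e μ r₂ P → a :* (b :* ((c :* β) :* (r₁ :* P) :+ e :* (((c :* f) :* :- (μ :* β)) :* (r₂ :* P)))) :=
               (a :* (c :* (b :* (β :* (r₁ :+ :- (μ :* (e :* (f :* r₂)))))))) :* P) refl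
               ⟦ t ≤? κ ⟧ ⟦ κ ≤? d ⟧ ⟦ next ds ≤? κ ⟧ β R₁ ⟦ next ds <? κ ⟧ ⟦ t <? κ ⟧ ⟦ T? (mo s) ⟧ R₂ _ ⟩
        removeFrom s (t ∷ ts) (d ∷ ds) (κ ∷ κs) w ⊗ Ψ (boxes s (t ∷ ts) (κ ∷ κs)) ∎
        where
        β = ⟦ (κ ≟ d) ⊎-dec T? (qo s) ⟧
        R₁ = removeFrom (suc s) ts ds κs (λ x → w ((d ∸ κ) ℕ.+ x))
        R₂ = removeFrom (suc s) ts ds κs (λ x → w ((d ∸ κ) ℕ.+ suc x))
        Ψ′ : List Box → ℤ
        Ψ′ S = Ψ (rowCells s t κ ++ S)
        strict : ⟦ next ds <? κ ⟧ ≡ ⟦ next ds ≤? κ ⟧ ⊗ ⟦ next ds <? κ ⟧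
        strict with next ds <? κ
        ... | yes p = sym (⟦⟧⊗-yes (next ds ≤? κ) (ℕ.<⇒≤ p))
        ... | no _ = sym (⊗-zeroʳ _)
        unmarked-row : t ≤ κ → κ ≤ d → rowsAt (suc s) ts ds κs (λ K → weight w Ψ (arrangement s t κ d false ++ K)) ≡
          (⟦ next ds ≤? κ ⟧ ⊗ β) ⊗ (R₁ ⊗ Ψ (boxes s (t ∷ ts) (κ ∷ κs)))
        unmarked-row t≤κ κ≤d = trans (rowsAt-cong (suc s) ts ds κs λ K a → trans (cong₂ _⊗_ (perm K) (cong₂ _⊗_
            (pairs-row false t≤κ κ≤d (λ ()) (next≤ dt) (next≤ dd) a) (cong₂ _⊗_ (cong₂ (λ x y → x ⊗ w y) (sgn K) (lab K)) (cong Ψ (kep K)))))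
            (solve 5 (λ β p c h r → (β :* p) :* ((c :* h) :* r) := (c :* β) :* (p :* (h :* r))) refl β _ _ _ _))
          (trans (rowsAt-*ˡ (suc s) ts ds κs _) (⊗-congʳ (rowsAt-weight (suc s) ts ds κs (λ x → w ((d ∸ κ) ℕ.+ x)) Ψ′ dt dd)))
          where
          assoc : ∀ K → arrangement s t κ d false ++ K ≡ tag keep (rowCells s t κ) ++ (tag drop (rowCells s κ d) ++ K)
          assoc K = List.++-assoc (tag keep (rowCells s t κ)) _ K
          perm : ∀ K → permitted (arrangement s t κ d false ++ K) ≡ β ⊗ permitted K
          perm K = trans (cong permitted (assoc K)) (trans (keeps-permitted (rowCells s t κ) _) (trans (drops-permitted s κ (d ∸ κ) K) (⊗-congˡ (dropFactor s κ≤d))))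
          sgn : ∀ K → markSign (arrangement s t κ d false ++ K) ≡ markSign K
          sgn K = trans (cong markSign (assoc K)) (trans (keeps-sign (rowCells s t κ) _) (drops-sign (rowCells s κ d) K))
          lab : ∀ K → labels (arrangement s t κ d false ++ K) ≡ (d ∸ κ) ℕ.+ labels K
          lab K = trans (cong labels (assoc K)) (trans (keeps-labels (rowCells s t κ) _) (drops-labels s κ (d ∸ κ) K))
          kep : ∀ K → kept (arrangement s t κ d false ++ K) ≡ rowCells s t κ ++ kept K
          kep K = trans (cong kept (assoc K)) (trans (keeps-kept (rowCells s t κ) _) (cong (rowCells s t κ ++_) (drops-kept (rowCells s κ d) K)))
        marked-row : t < κ → κ ≤ d → rowsAt (suc s) ts ds κs (λ K → weight w Ψ (arrangement s t κ d true ++ K)) ≡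
          (⟦ next ds <? κ ⟧ ⊗ ⊖ (⟦ T? (mo s) ⟧ ⊗ β)) ⊗ (R₂ ⊗ Ψ (boxes s (t ∷ ts) (κ ∷ κs)))
        marked-row t<κ κ≤d = trans (rowsAt-cong (suc s) ts ds κs λ K a → trans (cong₂ _⊗_ (perm K) (cong₂ _⊗_
            (pairs-row true (ℕ.<⇒≤ t<κ) κ≤d (λ _ → t<κ) (next≤ dt) (next≤ dd) a) (cong₂ _⊗_ (cong₂ (λ x y → x ⊗ w y) (sgn K) (lab K)) (cong Ψ (kep K)))))
            (solve 8 (λ μ β p c h σ ω r → (μ :* (β :* p)) :* ((c :* h) :* (((:- σ) :* ω) :* r)) := (c :* :- (μ :* β)) :* (p :* (h :* ((σ :* ω) :* r)))) refl
              ⟦ T? (mo s) ⟧ β _ _ _ (markSign K) _ _))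
          (trans (rowsAt-*ˡ (suc s) ts ds κs _) (⊗-congʳ (rowsAt-weight (suc s) ts ds κs (λ x → w ((d ∸ κ) ℕ.+ suc x)) Ψ′ dt dd)))
          where
          m : Box × Kind
          m = (s , κ ℕ.+ z) , mark
          assoc : ∀ K → arrangement s t κ d true ++ K ≡ tag keep (rowCells s t (κ ∸ 1)) ++ (m ∷ tag drop (rowCells s κ d) ++ K)
          assoc K = List.++-assoc (tag keep (rowCells s t (κ ∸ 1))) _ K
          perm : ∀ K → permitted (arrangement s t κ d true ++ K) ≡ ⟦ T? (mo s) ⟧ ⊗ (β ⊗ permitted K)
          perm K = trans (cong permitted (assoc K)) (trans (keeps-permitted (rowCells s t (κ ∸ 1)) _)
            (⊗-congʳ (trans (drops-permitted s κ (d ∸ κ) K) (⊗-congˡ (dropFactor s κ≤d)))))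
          sgn : ∀ K → markSign (arrangement s t κ d true ++ K) ≡ ⊖ markSign K
          sgn K = trans (cong markSign (assoc K)) (trans (keeps-sign (rowCells s t (κ ∸ 1)) _) (cong ⊖_ (drops-sign (rowCells s κ d) K)))
          lab : ∀ K → labels (arrangement s t κ d true ++ K) ≡ (d ∸ κ) ℕ.+ suc (labels K)
          lab K = trans (cong labels (assoc K)) (trans (keeps-labels (rowCells s t (κ ∸ 1)) _)
            (trans (cong suc (drops-labels s κ (d ∸ κ) K)) (sym (ℕ.+-suc (d ∸ κ) (labels K)))))
          snoc : ∀ κ → t < κ → rowCells s t (κ ∸ 1) ++ (s , κ ℕ.+ z) ∷ [] ≡ rowCells s t κ
          snoc (suc κ) (s≤s t≤κ) = rowCells-snoc s t≤κ
          kep : ∀ K → kept (arrangement s t κ d true ++ K) ≡ rowCells s t κ ++ kept K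
          kep K = trans (cong kept (assoc K)) (trans (keeps-kept (rowCells s t (κ ∸ 1)) _)
            (trans (cong (λ x → rowCells s t (κ ∸ 1) ++ (s , κ ℕ.+ z) ∷ x) (drops-kept (rowCells s κ d) K))
            (trans (sym (List.++-assoc (rowCells s t (κ ∸ 1)) _ (kept K))) (cong (_++ kept K) (snoc κ t<κ)))))

-- Set-valued tableaux as iterated kernels.

+countᵇ-cong : ∀ {A : Set} {p q : A → Bool} xs → (∀ {x} → x ∈ xs → p x ≡ q x) → countᵇ p xs ≡ countᵇ q xs
+countᵇ-cong [] h = refl
+countᵇ-cong {p = p} {q} (x ∷ xs) h rewrite h (here refl) with q x
... | true = cong suc (+countᵇ-cong xs (h ∘ there))
... | false = +countᵇ-cong xs (h ∘ there)

memᵇ-++ : ∀ i v u → memᵇ i (v ++ u) ≡ memᵇ i v ∨ memᵇ i u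
memᵇ-++ i [] u = refl
memᵇ-++ i (x ∷ v) u with i ≡ᵇ x
... | true = refl
... | false = memᵇ-++ i v u

memᵇ-false : ∀ i v → All (_< i) v → memᵇ i v ≡ false
memᵇ-false i [] [] = refl
memᵇ-false i (x ∷ v) (x<i ∷ p) rewrite T-false {i ≡ᵇ x} (λ h → ℕ.<-irrefl (sym (ℕ.≡ᵇ⇒≡ i x h)) x<i) = memᵇ-false i v p

memᵇ-self : ∀ i → memᵇ i (i ∷ []) ≡ true
memᵇ-self i rewrite T-true (≡ᵇ-refl i) = refl

memᵇ-other : ∀ {i j} → i ≢ j → memᵇ i (j ∷ []) ≡ false
memᵇ-other {i} {j} h rewrite T-false {i ≡ᵇ j} (λ e → h (ℕ.≡ᵇ⇒≡ i j e)) = refl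

count : ℕ → List (Box × List ℕ) → ℕ
count i = countᵇ (λ bv → memᵇ i (proj₂ bv))

sgF : List (Box × List ℕ) → ℤ
sgF [] = 1ℤ
sgF ((_ , v) ∷ F) = sign (length v ∸ 1) ⊗ sgF F

-- The value of a monomial under one functional per variable. With `exactly c` it is the indicator
-- of content c and extracts a coefficient; with the constant 1 it counts all tableaux.
contentWeight : (ℕ → ℕ → ℤ) → ℕ → List (Box × List ℕ) → ℤ
contentWeight w zero F = 1ℤ
contentWeight w (suc m) F = w (suc m) (count (suc m) F) ⊗ contentWeight w m F

LabelSet : ℕ → List ℕ → Set
LabelSet m v = T (nonEmptyᵇ v) × All (_≤ m) v

maxL-≤ : ∀ {m} v → All (_≤ m) v → maxL v ≤ m
maxL-≤ [] [] = z≤n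
maxL-≤ (x ∷ v) (p ∷ ps) = ℕ.⊔-lub p (maxL-≤ v ps)

minL-≤ : ∀ {m} v → All (_≤ m) v → minL v ≤ m
minL-≤ [] [] = z≤n
minL-≤ (x ∷ v) (p ∷ _) = ℕ.≤-trans (go v) p
  where
  go : ∀ v → foldr _⊓_ x v ≤ x
  go [] = ℕ.≤-refl
  go (y ∷ v) = ℕ.≤-trans (ℕ.m⊓n≤n y _) (go v)

maxL-snoc : ∀ {m} v → All (_≤ m) v → maxL (v ++ suc m ∷ []) ≡ suc m
maxL-snoc [] [] = ℕ.⊔-identityʳ _
maxL-snoc (x ∷ v) (p ∷ ps) rewrite maxL-snoc v ps = ℕ.m≤n⇒m⊔n≡n (ℕ.m≤n⇒m≤1+n p)

minL-snoc : ∀ {m} v → LabelSet m v → minL (v ++ suc m ∷ []) ≡ minL v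
minL-snoc {m} (x ∷ v) (_ , p ∷ _) = trans (List.foldr-++ _⊓_ x v (suc m ∷ [])) (cong (λ y → foldr _⊓_ y v) (ℕ.m≥n⇒m⊓n≡n (ℕ.m≤n⇒m≤1+n p)))

module SetTableaux (w : ℕ → ℕ → ℤ) (mo qo : ℕ → ℕ → Bool) where

  -- mo ℓ r and qo ℓ r allow ℓ to join other labels, respectively to stand alone, in row r.
  candidates : ℕ → ℕ → List (List ℕ)
  candidates zero r = []
  candidates (suc m) r = candidates m r ++
    ((if mo (suc m) r then map (_++ suc m ∷ []) (candidates m r) else []) ++ (if qo (suc m) r then (suc m ∷ []) ∷ [] else []))

  tableaux : ℕ → List Box → ℤ
  tableaux m S = sumF S (candidates m ∘ row) (λ F → ⟦ T? (setSemistandardᵇ F) ⟧ ⊗ (sgF F ⊗ contentWeight w m F))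

  candidates-labels : ∀ m r {v} → v ∈ candidates m r → LabelSet m v
  candidates-labels (suc m) r p with ∈.∈-++⁻ (candidates m r) p
  ... | inj₁ q with ne , a ← candidates-labels m r q = ne , All.map ℕ.m≤n⇒m≤1+n a
  ... | inj₂ q with mo (suc m) r
  candidates-labels (suc m) r p | inj₂ q | true with ∈.∈-++⁻ (map (_++ suc m ∷ []) (candidates m r)) q
  candidates-labels (suc m) r p | inj₂ q | true | inj₁ q′ with v , v∈ , refl ← ∈.∈-map⁻ (_++ suc m ∷ []) q′ with ne , a ← candidates-labels m r v∈ =
    nonEmpty v ne , All.++⁺ (All.map ℕ.m≤n⇒m≤1+n a) (ℕ.≤-refl ∷ [])
    where
    nonEmpty : ∀ v → T (nonEmptyᵇ v) → T (nonEmptyᵇ (v ++ suc m ∷ []))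
    nonEmpty (_ ∷ _) _ = tt
  candidates-labels (suc m) r p | inj₂ q | true | inj₂ q′ with qo (suc m) r | q′
  ... | true | here refl = tt , ℕ.≤-refl ∷ []
  candidates-labels (suc m) r p | inj₂ q | false with qo (suc m) r | q
  ... | true | here refl = tt , ℕ.≤-refl ∷ []

  candidates-split : ∀ m r (g : List ℕ → ℤ) → ∑ (candidates (suc m) r) g ≡ ∑ (candidates m r) g ⊕
    (⟦ T? (mo (suc m) r) ⟧ ⊗ ∑ (candidates m r) (g ∘ (_++ suc m ∷ [])) ⊕ ⟦ T? (qo (suc m) r) ⟧ ⊗ g (suc m ∷ []))
  candidates-split m r g = trans (∑-++ (candidates m r) _) (⊕-congʳ (trans (∑-++ (if mo (suc m) r then map (_++ suc m ∷ []) (candidates m r) else []) _)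
    (cong₂ _⊕_ (joined (mo (suc m) r)) (alone (qo (suc m) r)))))
    where
    joined : ∀ b → ∑ (if b then map (_++ suc m ∷ []) (candidates m r) else []) g ≡ ⟦ T? b ⟧ ⊗ ∑ (candidates m r) (g ∘ (_++ suc m ∷ []))
    joined true = trans (∑-map (_++ suc m ∷ []) (candidates m r)) (sym (⊗-identityˡ _))
    joined false = sym (⊗-zeroˡ _)
    alone : ∀ b → ∑ (if b then (suc m ∷ []) ∷ [] else []) g ≡ ⟦ T? b ⟧ ⊗ g (suc m ∷ [])
    alone true = trans (⊕-identityʳ _) (sym (⊗-identityˡ _))
    alone false = sym (⊗-zeroˡ _)

  module _ (m : ℕ) where
    open Peeling (candidates (suc m) ∘ row) (candidates m ∘ row) (_++ suc m ∷ []) (suc m ∷ []) (mo (suc m)) (qo (suc m))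
      (λ b → candidates-split m (row b))

    private
      setPair : Box × List ℕ → Box × List ℕ → Bool
      setPair (b , v) (d , u) =
        (((row b ≡ᵇ row d) ∧ (suc (col b) ≡ᵇ col d)) ⇒ᵇ (maxL v ≤ᵇ minL u)) ∧
        (((col b ≡ᵇ col d) ∧ (suc (row b) ≡ᵇ row d)) ⇒ᵇ (maxL v <ᵇ minL u))

      ≤ᵇ-yes : ∀ {a b} → a ≤ b → (a ≤ᵇ b) ≡ true
      ≤ᵇ-yes p = T-true (ℕ.≤⇒≤ᵇ p)
      ≤ᵇ-no : ∀ {a b} → b < a → (a ≤ᵇ b) ≡ false
      ≤ᵇ-no {a} p = T-false (λ h → ℕ.<⇒≱ p (ℕ.≤ᵇ⇒≤ a _ h))
      <ᵇ-yes : ∀ {a b} → a < b → (a <ᵇ b) ≡ true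
      <ᵇ-yes p = T-true (ℕ.<⇒<ᵇ p)
      <ᵇ-no : ∀ {a b} → b ≤ a → (a <ᵇ b) ≡ false
      <ᵇ-no {a} p = T-false (λ h → ℕ.≤⇒≯ p (ℕ.<ᵇ⇒< a _ h))

      minL-kept : ∀ {x f u} → Kept x f → LabelSet m u → minL (f u) ≡ minL u
      minL-kept keep _ = refl
      minL-kept mark p = minL-snoc _ p

      hor-kept : ∀ {x y f g v u} → Kept x f → Kept y g → LabelSet m v → LabelSet m u →
        (maxL (f v) ≤ᵇ minL (g u)) ≡ hor x y ∧ (maxL v ≤ᵇ minL u)
      hor-kept keep k _ pu rewrite minL-kept k pu = refl
      hor-kept {v = v} mark keep pv pu rewrite maxL-snoc v (proj₂ pv) = ≤ᵇ-no (s≤s (minL-≤ _ (proj₂ pu)))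
      hor-kept {v = v} mark mark pv pu rewrite minL-kept mark pu | maxL-snoc v (proj₂ pv) = ≤ᵇ-no (s≤s (minL-≤ _ (proj₂ pu)))

      ver-kept : ∀ {x y f g v u} → Kept x f → Kept y g → LabelSet m v → LabelSet m u →
        (maxL (f v) <ᵇ minL (g u)) ≡ ver x y ∧ (maxL v <ᵇ minL u)
      ver-kept keep k _ pu rewrite minL-kept k pu = refl
      ver-kept {v = v} mark keep pv pu rewrite maxL-snoc v (proj₂ pv) = <ᵇ-no (ℕ.m≤n⇒m≤1+n (minL-≤ _ (proj₂ pu)))
      ver-kept {v = v} mark mark pv pu rewrite minL-kept mark pu | maxL-snoc v (proj₂ pv) = <ᵇ-no (ℕ.m≤n⇒m≤1+n (minL-≤ _ (proj₂ pu)))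

      hor-drop : ∀ {x f v} → Kept x f → LabelSet m v → (maxL (f v) ≤ᵇ suc m) ≡ hor x drop
      hor-drop keep pv = ≤ᵇ-yes (ℕ.m≤n⇒m≤1+n (maxL-≤ _ (proj₂ pv)))
      hor-drop {v = v} mark pv rewrite maxL-snoc v (proj₂ pv) = ≤ᵇ-yes {suc m} {suc m} ℕ.≤-refl

      ver-drop : ∀ {x f v} → Kept x f → LabelSet m v → (maxL (f v) <ᵇ suc m) ≡ ver x drop
      ver-drop keep pv = <ᵇ-yes (s≤s (maxL-≤ _ (proj₂ pv)))
      ver-drop {v = v} mark pv rewrite maxL-snoc v (proj₂ pv) = <ᵇ-no {suc m} {suc m} ℕ.≤-refl

      drop-hor : ∀ {y g u} → Kept y g → LabelSet m u → (suc m ⊔ 0 ≤ᵇ minL (g u)) ≡ hor drop y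
      drop-hor keep pu = ≤ᵇ-no (s≤s (minL-≤ _ (proj₂ pu)))
      drop-hor mark pu rewrite minL-kept mark pu = ≤ᵇ-no (s≤s (minL-≤ _ (proj₂ pu)))

      drop-ver : ∀ {y g u} → Kept y g → LabelSet m u → (suc m ⊔ 0 <ᵇ minL (g u)) ≡ ver drop y
      drop-ver keep pu = <ᵇ-no (ℕ.m≤n⇒m≤1+n (minL-≤ _ (proj₂ pu)))
      drop-ver mark pu rewrite minL-kept mark pu = <ᵇ-no (ℕ.m≤n⇒m≤1+n (minL-≤ _ (proj₂ pu)))

      cand : ∀ {b v} → v ∈ candidates m (row b) → LabelSet m v
      cand {b} = candidates-labels m (row b)

      G₁ G₂ : Box → Box → Bool
      G₁ b d = (row b ≡ᵇ row d) ∧ (suc (col b) ≡ᵇ col d)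
      G₂ b d = (col b ≡ᵇ col d) ∧ (suc (row b) ≡ᵇ row d)

      pair-keep-keep : ∀ {x y f g} b d {v u} → Kept x f → Kept y g → v ∈ candidates m (row b) → u ∈ candidates m (row d) →
        setPair (b , f v) (d , g u) ≡ setKinds (b , x) (d , y) ∧ setPair (b , v) (d , u)
      pair-keep-keep b d k k′ v∈ u∈ = ⇒ᵇ-∧-split (G₁ b d) (G₂ b d)
        (hor-kept k k′ (cand {b} v∈) (cand {d} u∈)) (ver-kept k k′ (cand {b} v∈) (cand {d} u∈))

      pair-keep-drop : ∀ {x f} b d {v} → Kept x f → v ∈ candidates m (row b) → setPair (b , f v) (d , suc m ∷ []) ≡ setKinds (b , x) (d , drop)
      pair-keep-drop b d k v∈ = cong-⇒ᵇ (G₁ b d) (G₂ b d) (hor-drop k (cand {b} v∈)) (ver-drop k (cand {b} v∈))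

      pair-drop-keep : ∀ {y g} b d {u} → Kept y g → u ∈ candidates m (row d) → setPair (b , suc m ∷ []) (d , g u) ≡ setKinds (b , drop) (d , y)
      pair-drop-keep b d k u∈ = cong-⇒ᵇ (G₁ b d) (G₂ b d) (drop-hor k (cand {d} u∈)) (drop-ver k (cand {d} u∈))

      pair-drop-drop : ∀ b d → setPair (b , suc m ∷ []) (d , suc m ∷ []) ≡ setKinds (b , drop) (d , drop)
      pair-drop-drop b d = cong-⇒ᵇ (G₁ b d) (G₂ b d) (≤ᵇ-yes {suc m ⊔ 0} {suc m} ℕ.≤-refl) (<ᵇ-no {suc m ⊔ 0} {suc m} ℕ.≤-refl)

    open Pairs setPair setKinds pair-keep-keep pair-keep-drop pair-drop-keep pair-drop-drop

    private
      count-top : ∀ {K F G} → Combines K F G → count (suc m) G ≡ labels K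
      count-top [] = refl
      count-top (keep {b} {v} v∈ c) rewrite memᵇ-false (suc m) v (All.map s≤s (proj₂ (cand {b} v∈))) = count-top c
      count-top (mark {v = v} v∈ c) rewrite trans (memᵇ-++ (suc m) v (suc m ∷ [])) (trans (cong (memᵇ (suc m) v ∨_) (memᵇ-self (suc m))) (∨-zeroʳ _)) = cong suc (count-top c)
      count-top (drop c) rewrite memᵇ-self (suc m) = cong suc (count-top c)

      count-lower : ∀ {i} → i ≤ m → ∀ {K F G} → Combines K F G → count i G ≡ count i F
      count-lower i≤m [] = refl
      count-lower {i} i≤m (keep {v = v} v∈ c) with memᵇ i v
      ... | true = cong suc (count-lower i≤m c)
      ... | false = count-lower i≤m c
      count-lower {i} i≤m (mark {v = v} v∈ c)
        rewrite trans (memᵇ-++ i v (suc m ∷ [])) (trans (cong (memᵇ i v ∨_) (memᵇ-other {i} (ℕ.<⇒≢ (s≤s i≤m)))) (∨-identityʳ _)) with memᵇ i v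
      ... | true = cong suc (count-lower i≤m c)
      ... | false = count-lower i≤m c
      count-lower {i} i≤m (drop c) rewrite memᵇ-other {i} {suc m} (ℕ.<⇒≢ (s≤s i≤m)) = count-lower i≤m c

      content-lower : ∀ ℓ → ℓ ≤ m → ∀ {K F G} → Combines K F G → contentWeight w ℓ G ≡ contentWeight w ℓ F
      content-lower zero _ c = refl
      content-lower (suc ℓ) le c = cong₂ _⊗_ (cong (w (suc ℓ)) (count-lower le c)) (content-lower ℓ (ℕ.<⇒≤ le) c)

      sgF-combine : ∀ {K F G} → Combines K F G → sgF G ≡ markSign K ⊗ sgF F
      sgF-combine [] = sym (⊗-identityˡ _)
      sgF-combine (keep {v = v} {K = K} v∈ c) = trans (⊗-congʳ (sgF-combine c)) (solve 3 (λ a b c → a :* (b :* c) := b :* (a :* c)) refl (sign (length v ∸ 1)) (markSign K) _)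
      sgF-combine (mark {b} {v} {K = K} v∈ c) = trans (cong₂ _⊗_ (longer v (cand {b} v∈)) (sgF-combine c))
          (solve 3 (λ a b c → (:- a) :* (b :* c) := (:- b) :* (a :* c)) refl (sign (length v ∸ 1)) (markSign K) _)
        where
        longer : ∀ v → LabelSet m v → sign (length (v ++ suc m ∷ []) ∸ 1) ≡ ⊖ sign (length v ∸ 1)
        longer (x ∷ v) _ rewrite List.length-++ v {suc m ∷ []} | ℕ.+-comm (length v) 1 = sym (⊖-def _)
      sgF-combine (drop c) = trans (⊗-identityˡ _) (sgF-combine c)

    -- The boxes that keep a smaller label still start at t in every row, so the peeling can be
    -- repeated with the same upper boundary.
    tableaux-peel : ∀ z B {n p q} (t d : Vec ℕ n) → t ≤ᵛ d → Descending p t → Descending q d → q ≤ B →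
      tableaux (suc m) (Shapes.boxes z 1 t d) ≡ Matrices.ΣV B n (λ κ →
        SetRows.removeFrom z B (mo (suc m)) (qo (suc m)) 1 t d κ (w (suc m)) ⊗ tableaux m (Shapes.boxes z 1 t κ))
    tableaux-peel z B t d le dt dd q≤B = trans
      (peel (λ G → sgF G ⊗ contentWeight w (suc m) G) (λ F → sgF F ⊗ contentWeight w m F) (λ K → markSign K ⊗ w (suc m) (labels K))
        (λ {K} {F} {G} c → trans (cong₂ _⊗_ (sgF-combine c) (cong₂ _⊗_ (cong (w (suc m)) (count-top c)) (content-lower m ℕ.≤-refl c)))
          (solve 4 (λ a b c d → (a :* b) :* (c :* d) := (a :* c) :* (b :* d)) refl (markSign K) (sgF F) (w (suc m) (labels K)) (contentWeight w m F)))
        (Shapes.boxes z 1 t d))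
      (trans (Shapes.RowSums.sumF-boxes z B 1 t d le dd q≤B (weight-vanishes (mo (suc m)) (qo (suc m)) (w (suc m)) (tableaux m)))
        (Matrices.ΣV-cong B _ (λ κ → rowsAt-weight (mo (suc m)) (qo (suc m)) 1 t d κ (w (suc m)) (tableaux m) dt dd)))
      where open SetRows z B

-- Tableau sums against chains of matrices; the upper boundary.

module Linking (z B : ℕ) where
  open Shapes z
  open Matrices B
  open RowSums B
  open ChainIdentity B
  open SetRows z B using (removeFrom)

  boxes-empty : ∀ s (v : Vec ℕ n) → boxes s v v ≡ []
  boxes-empty s [] = refl
  boxes-empty s (x ∷ v) = cong₂ _++_ (rowCells-empty s x) (boxes-empty (suc s) v)

  boxes-nonEmpty : ∀ s {t d : Vec ℕ n} → t ≤ᵛ d → boxes s t d ≡ [] → t ≡ d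
  boxes-nonEmpty s [] _ = refl
  boxes-nonEmpty s {t ∷ ts} {d ∷ ds} (p ∷ ps) e with ℕ.m≤n⇒m<n∨m≡n p
  ... | inj₁ t<d with () ← trans (sym (cong (_++ boxes (suc s) ts ds) (rowCells-cons s t<d))) e
  ... | inj₂ refl = cong (t ∷_) (boxes-nonEmpty (suc s) ps (trans (cong (_++ boxes (suc s) ts ds) (sym (rowCells-empty s t))) e))

  module _ (w : ℕ → ℕ → ℤ) (mo qo : ℕ → ℕ → Bool) where
    open SetTableaux w mo qo

    tableaux-zero : ∀ s {t d : Vec ℕ n} → t ≤ᵛ d → tableaux 0 (boxes s t d) ≡ δ t d
    tableaux-zero s {t} {d} le with ≡-dec _≟_ t d
    ... | yes refl = trans (cong (tableaux 0) (boxes-empty s t)) (solve 0 (con 1ℤ :* (con 1ℤ :* con 1ℤ) := con 1ℤ) refl)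
    ... | no t≢d with boxes s t d in e
    ...   | [] = contradiction (boxes-nonEmpty s le e) t≢d
    ...   | _ ∷ _ = refl

  aboveΠ : Vec ℕ n → Vec ℕ n → ℤ
  aboveΠ [] [] = 1ℤ
  aboveΠ (t ∷ ts) (κ ∷ κs) = ⟦ t ≤? κ ⟧ ⊗ aboveΠ ts κs

  aboveΠ-yes : {t κ : Vec ℕ n} → t ≤ᵛ κ → aboveΠ t κ ≡ 1ℤ
  aboveΠ-yes [] = refl
  aboveΠ-yes {t = t ∷ _} {κ ∷ _} (p ∷ ps) = trans (⟦⟧⊗-yes (t ≤? κ) p) (aboveΠ-yes ps)

  aboveΠ-≢0 : (t κ : Vec ℕ n) → aboveΠ t κ ≢ 0ℤ → t ≤ᵛ κ
  aboveΠ-≢0 [] [] h = []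
  aboveΠ-≢0 (t ∷ ts) (κ ∷ κs) h = ⟦⟧≢0 (t ≤? κ) (*≢0ˡ _ _ h) ∷ aboveΠ-≢0 ts κs (*≢0ʳ ⟦ t ≤? κ ⟧ _ h)

  -- The tableaux counted by addChain: row r has labels below r, and no box has several.
  module _ where
    open SetTableaux (λ _ _ → 1ℤ) (λ _ _ → false) (λ ℓ r → ℓ <ᵇ r)

    removeFrom-add : ∀ k s (t d κ : Vec ℕ n) → removeFrom (λ _ → false) (k <ᵇ_) s t d κ (λ _ → 1ℤ) ≡ aboveΠ t κ ⊗ add k s κ d
    removeFrom-add k s [] [] [] = sym (⊗-identityˡ _)
    removeFrom-add k s (t ∷ ts) (d ∷ ds) (κ ∷ κs)
      rewrite removeFrom-add k (suc s) ts ds κs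
            | ⟦⟧-cong ((κ ≟ d) ⊎-dec T? (k <ᵇ s)) ((κ ≟ d) ⊎-dec (k <? s)) (λ { (inj₁ e) → inj₁ e ; (inj₂ q) → inj₂ (ℕ.<ᵇ⇒< k s q) })
                (λ { (inj₁ e) → inj₁ e ; (inj₂ q) → inj₂ (ℕ.<⇒<ᵇ q) }) =
      solve 7 (λ a b c e x A y → a :* (b :* (c :* (e :* ((A :* x) :+ :- (con 0ℤ :* y))))) := (a :* A) :* (b :* (c :* (e :* x)))) refl
        ⟦ t ≤? κ ⟧ _ _ _ (add k (suc s) κs ds) (aboveΠ ts κs) _

    -- The boxes with label k form a horizontal strip in rows with index greater than k, which is
    -- the strip added by Hₖ; the largest label is the last factor.
    addChain-tableaux : ∀ K {d d′ : Vec ℕ n} → d ≤ᵛ d′ → Descending B d → Descending B d′ →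
      tableaux K (boxes 1 d d′) ≡ addChain K d d′
    addChain-tableaux zero le _ _ = tableaux-zero (λ _ _ → 1ℤ) (λ _ _ → false) (λ ℓ r → ℓ <ᵇ r) 1 le
    addChain-tableaux {n = n} (suc K) {d} {d′} le dd dd′ = trans (tableaux-peel K z B d d′ le dd dd′ ℕ.≤-refl) (ΣV-cong n entryK)
      where
      entryK : ∀ κ → removeFrom (λ _ → false) (suc K <ᵇ_) 1 d d′ κ (λ _ → 1ℤ) ⊗ tableaux K (boxes 1 d κ) ≡ addChain K d κ ⊗ add (suc K) 1 κ d′
      entryK κ with aboveΠ d κ ℤ.≟ 0ℤ | add (suc K) 1 κ d′ ℤ.≟ 0ℤ
      ... | _ | yes e = trans (⊗-congˡ (trans (removeFrom-add (suc K) 1 d d′ κ) (trans (⊗-congʳ e) (⊗-zeroʳ _))))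
            (trans (⊗-zeroˡ _) (sym (trans (⊗-congʳ e) (⊗-zeroʳ _))))
      ... | yes e | no h = trans (⊗-congˡ (trans (removeFrom-add (suc K) 1 d d′ κ) (trans (⊗-congˡ e) (⊗-zeroˡ _))))
            (trans (⊗-zeroˡ _) (sym (trans (⊗-congˡ vanish) (⊗-zeroˡ _))))
        where
        vanish : addChain K d κ ≡ 0ℤ
        vanish with addChain K d κ ℤ.≟ 0ℤ
        ... | yes e′ = e′
        ... | no h′ with _ , le′ ← addChain-lower K d κ h′ (Strip-descendingˡ (add-strip _ _ κ d′ h) dd′) with () ← trans (sym (aboveΠ-yes le′)) e
      ... | no h | no h′ = trans (cong₂ _⊗_ (trans (removeFrom-add (suc K) 1 d d′ κ) (trans (⊗-congˡ (aboveΠ-yes le′)) (⊗-identityˡ _)))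
            (addChain-tableaux K le′ dd (Strip-descendingˡ (add-strip _ _ κ d′ h′) dd′))) (⊗-comm _ _)
        where le′ = aboveΠ-≢0 d κ h

  rook-descending : ∀ k s {p} (a t : Vec ℕ n) → rook k s a t ≢ 0ℤ → Descending p t → Descending p a × a ≤ᵛ t
  rook-descending k s [] [] h [] = [] , []
  rook-descending k s (a ∷ as) (t ∷ ts) h (t≤p ∷ d)
    with desc , le ← rook-descending k (suc s) as ts (*≢0ʳ _ _ (*≢0ʳ ⟦ next ts ≤? a ⟧ _ h)) d =
    ℕ.≤-trans a≤t t≤p ∷ Descending-next desc (ℕ.≤-trans (next-≤ᵛ le) (⟦⟧≢0 (next ts ≤? a) (*≢0ˡ _ _ h))) , a≤t ∷ le
    where
    a≤t = proj₁ (rook-next k s (a ∷ as) (t ∷ ts) h)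

  rook-diag : ∀ k s {p} {v : Vec ℕ n} → Descending p v → rook k s v v ≡ 1ℤ
  rook-diag k s [] = refl
  rook-diag k s {v = x ∷ v} (_ ∷ d) = trans (⟦⟧⊗-yes (next v ≤? x) (next≤ d)) (trans (cong₂ _⊗_
    (trans (cong₂ (λ a b → a ⊕ ⊖ (⟦ s ≤? k ⟧ ⊗ b)) (⟦⟧-yes (x ≟ x) refl) (⟦⟧-no (suc x ≟ x) ℕ.1+n≢n))
      (solve 1 (λ y → con 1ℤ :+ :- (y :* con 0ℤ) := con 1ℤ) refl _)) (rook-diag k (suc s) d)) (⊗-identityˡ _))

  module _ (k : ℕ) where

    private
      μ : ℕ → ℤ
      μ s = ⟦ s ≤? k ⟧

      ρ : ℕ → ℕ → ℕ → ℤ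
      ρ s t a = ⟦ a ≟ t ⟧ ⊕ ⊖ (μ s ⊗ ⟦ suc a ≟ t ⟧)

      from : (s : ℕ) (t d κ : Vec ℕ n) → (ℕ → ℤ) → ℤ
      from = removeFrom (_≤ᵇ k) (λ _ → true)

      tail₁ tail₂ : (d κ : ℕ) → (ℕ → ℤ) → ℕ → ℤ
      tail₁ d κ w x = w ((d ∸ κ) ℕ.+ x)
      tail₂ d κ w x = w ((d ∸ κ) ℕ.+ suc x)

      onto : (s a κ : ℕ) → (List Box → ℤ) → List Box → ℤ
      onto s a κ Φ S = Φ (rowCells s a κ ++ S)

    -- In the first sum the kernel sees the boundary t′ left by the rook strip; in the second it is
    -- `remove`, restricted to κ ≥ t and independent of the rook strip. Φ is arbitrary so that the
    -- recursion can carry the rows already treated.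
    rookThenFrom fromThenRook : (s : ℕ) (t d : Vec ℕ n) → (ℕ → ℤ) → (List Box → ℤ) → ℤ
    rookThenFrom {n} s t d w Φ = ΣV n (λ t′ → rook k s t′ t ⊗ ΣV n (λ κ → from s t′ d κ w ⊗ Φ (boxes s t′ κ)))
    fromThenRook {n} s t d w Φ = ΣV n (λ t′ → rook k s t′ t ⊗ ΣV n (λ κ → (aboveΠ t κ ⊗ remove k s d κ w) ⊗ Φ (boxes s t′ κ)))

    private
      regroup : ∀ {n} (c β e : ℤ) (r : Vec ℕ n → ℤ) (F₁ F₂ Ψ : Vec ℕ n → Vec ℕ n → ℤ) →
        ΣV n (λ as → (c ⊗ r as) ⊗ ΣV n (λ κs → (β ⊗ (F₁ as κs ⊕ ⊖ (e ⊗ F₂ as κs))) ⊗ Ψ as κs)) ≡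
        (c ⊗ β) ⊗ (ΣV n (λ as → r as ⊗ ΣV n (λ κs → F₁ as κs ⊗ Ψ as κs)) ⊕ ⊖ (e ⊗ ΣV n (λ as → r as ⊗ ΣV n (λ κs → F₂ as κs ⊗ Ψ as κs))))
      regroup {n} c β e r F₁ F₂ Ψ = trans (ΣV-cong n (λ as → trans (⊗-congʳ (trans (ΣV-cong n (λ κs →
            solve 5 (λ β a e b ψ → (β :* (a :+ :- (e :* b))) :* ψ := β :* (a :* ψ) :+ (β :* (:- e)) :* (b :* ψ)) refl β (F₁ as κs) e (F₂ as κs) (Ψ as κs)))
            (trans (ΣV-⊕ n) (cong₂ _⊕_ (ΣV-*ˡ n β) (ΣV-*ˡ n (β ⊗ ⊖ e))))))
            (solve 6 (λ c r β x e y → (c :* r) :* (β :* x :+ (β :* (:- e)) :* y) := (c :* β) :* (r :* x) :+ ((c :* β) :* (:- e)) :* (r :* y)) refl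
              c (r as) β _ e _)))
        (trans (ΣV-⊕ n) (trans (cong₂ _⊕_ (ΣV-*ˡ n (c ⊗ β)) (ΣV-*ˡ n ((c ⊗ β) ⊗ ⊖ e)))
          (solve 4 (λ a e x y → a :* x :+ (a :* (:- e)) :* y := a :* (x :+ :- (e :* y))) refl (c ⊗ β) e _ _)))

    rookThenFrom-step : ∀ s t (ts : Vec ℕ n) d ds w Φ → rookThenFrom s (t ∷ ts) (d ∷ ds) w Φ ≡
      ∑≤ B (λ a → (⟦ next ts ≤? a ⟧ ⊗ ρ s t a) ⊗ between a d (λ κ → ⟦ next ds ≤? κ ⟧ ⊗
        (rookThenFrom (suc s) ts ds (tail₁ d κ w) (onto s a κ Φ) ⊕ ⊖ ((μ s ⊗ (⟦ a <? κ ⟧ ⊗ ⟦ next ds <? κ ⟧)) ⊗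
          rookThenFrom (suc s) ts ds (tail₂ d κ w) (onto s a κ Φ)))))
    rookThenFrom-step {n} s t ts d ds w Φ = ∑≤-cong B λ a _ → begin
      ΣV n (λ as → (⟦ next ts ≤? a ⟧ ⊗ (ρ s t a ⊗ rook k (suc s) as ts)) ⊗ ∑≤ B (λ κ → ΣV n (λ κs → G a κ as κs ⊗ Φ (boxes s (a ∷ as) (κ ∷ κs)))))
        ≡⟨ ΣV-cong n (λ as → trans (⊗-congˡ (sym (⊗-assoc _ _ _))) (sym (∑≤-*ˡ B _))) ⟩
      ΣV n (λ as → ∑≤ B (λ κ → ((⟦ next ts ≤? a ⟧ ⊗ ρ s t a) ⊗ rook k (suc s) as ts) ⊗ ΣV n (λ κs → G a κ as κs ⊗ Φ (boxes s (a ∷ as) (κ ∷ κs)))))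
        ≡⟨ ΣV-∑≤ n B ⟩
      ∑≤ B (λ κ → ΣV n (λ as → ((⟦ next ts ≤? a ⟧ ⊗ ρ s t a) ⊗ rook k (suc s) as ts) ⊗ ΣV n (λ κs → G a κ as κs ⊗ Φ (boxes s (a ∷ as) (κ ∷ κs)))))
        ≡⟨ ∑≤-cong B (λ κ _ → trans (ΣV-cong n (λ as → ⊗-congʳ (ΣV-cong n (λ κs → ⊗-congˡ (normalise a κ _ _)))))
             (trans (regroup (⟦ next ts ≤? a ⟧ ⊗ ρ s t a) (⟦ a ≤? κ ⟧ ⊗ (⟦ κ ≤? d ⟧ ⊗ ⟦ next ds ≤? κ ⟧)) (μ s ⊗ (⟦ a <? κ ⟧ ⊗ ⟦ next ds <? κ ⟧)) (λ as → rook k (suc s) as ts)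
               (λ as κs → from (suc s) as ds κs (tail₁ d κ w)) (λ as κs → from (suc s) as ds κs (tail₂ d κ w)) (λ as κs → onto s a κ Φ (boxes (suc s) as κs)))
             (solve 5 (λ c x y u v → (c :* (x :* (y :* u))) :* v := c :* (x :* (y :* (u :* v)))) refl _ _ _ _ _))) ⟩
      ∑≤ B (λ κ → (⟦ next ts ≤? a ⟧ ⊗ ρ s t a) ⊗ (⟦ a ≤? κ ⟧ ⊗ (⟦ κ ≤? d ⟧ ⊗ (⟦ next ds ≤? κ ⟧ ⊗
        (rookThenFrom (suc s) ts ds (tail₁ d κ w) (onto s a κ Φ) ⊕ ⊖ ((μ s ⊗ (⟦ a <? κ ⟧ ⊗ ⟦ next ds <? κ ⟧)) ⊗
          rookThenFrom (suc s) ts ds (tail₂ d κ w) (onto s a κ Φ)))))))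
        ≡⟨ ∑≤-*ˡ B _ ⟩
      _ ∎
      where
      G : ℕ → ℕ → Vec ℕ n → Vec ℕ n → ℤ
      G a κ as κs = from s (a ∷ as) (d ∷ ds) (κ ∷ κs) w
      normalise : ∀ a κ x y → ⟦ a ≤? κ ⟧ ⊗ (⟦ next ds ≤? κ ⟧ ⊗ (⟦ κ ≤? d ⟧ ⊗ (⟦ (κ ≟ d) ⊎-dec T? true ⟧ ⊗ (x ⊕ ⊖ (⟦ T? (s ≤ᵇ k) ⟧ ⊗ (⟦ a <? κ ⟧ ⊗ (⟦ next ds <? κ ⟧ ⊗ y))))))) ≡
        (⟦ a ≤? κ ⟧ ⊗ (⟦ κ ≤? d ⟧ ⊗ ⟦ next ds ≤? κ ⟧)) ⊗ (x ⊕ ⊖ ((μ s ⊗ (⟦ a <? κ ⟧ ⊗ ⟦ next ds <? κ ⟧)) ⊗ y))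
      normalise a κ x y rewrite ⟦⟧-yes ((κ ≟ d) ⊎-dec T? true) (inj₂ tt) | ⟦⟧-cong (T? (s ≤ᵇ k)) (s ≤? k) (ℕ.≤ᵇ⇒≤ s k) ℕ.≤⇒≤ᵇ =
        solve 8 (λ a b c x m e f y → a :* (b :* (c :* (con 1ℤ :* (x :+ :- (m :* (e :* (f :* y))))))) := (a :* (c :* b)) :* (x :+ :- ((m :* (e :* f)) :* y))) refl
          _ _ _ _ _ _ _ _

    fromThenRook-step : ∀ s t (ts : Vec ℕ n) d ds w Φ → fromThenRook s (t ∷ ts) (d ∷ ds) w Φ ≡
      ∑≤ B (λ a → (⟦ next ts ≤? a ⟧ ⊗ ρ s t a) ⊗ between t d (λ κ → ⟦ next ds ≤? κ ⟧ ⊗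
        (fromThenRook (suc s) ts ds (tail₁ d κ w) (onto s a κ Φ) ⊕ ⊖ ((μ s ⊗ ⟦ next ds <? κ ⟧) ⊗
          fromThenRook (suc s) ts ds (tail₂ d κ w) (onto s a κ Φ)))))
    fromThenRook-step {n} s t ts d ds w Φ = ∑≤-cong B λ a _ → begin
      ΣV n (λ as → (⟦ next ts ≤? a ⟧ ⊗ (ρ s t a ⊗ rook k (suc s) as ts)) ⊗ ∑≤ B (λ κ → ΣV n (λ κs → G κ κs ⊗ Φ (boxes s (a ∷ as) (κ ∷ κs)))))
        ≡⟨ ΣV-cong n (λ as → trans (⊗-congˡ (sym (⊗-assoc _ _ _))) (sym (∑≤-*ˡ B _))) ⟩
      ΣV n (λ as → ∑≤ B (λ κ → ((⟦ next ts ≤? a ⟧ ⊗ ρ s t a) ⊗ rook k (suc s) as ts) ⊗ ΣV n (λ κs → G κ κs ⊗ Φ (boxes s (a ∷ as) (κ ∷ κs)))))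
        ≡⟨ ΣV-∑≤ n B ⟩
      ∑≤ B (λ κ → ΣV n (λ as → ((⟦ next ts ≤? a ⟧ ⊗ ρ s t a) ⊗ rook k (suc s) as ts) ⊗ ΣV n (λ κs → G κ κs ⊗ Φ (boxes s (a ∷ as) (κ ∷ κs)))))
        ≡⟨ ∑≤-cong B (λ κ _ → trans (ΣV-cong n (λ as → ⊗-congʳ (ΣV-cong n (λ κs → ⊗-congˡ (
               solve 8 (λ a A b c x m f y → (a :* A) :* (b :* (c :* (x :+ :- (m :* (f :* y))))) := (a :* (c :* b)) :* (A :* x :+ :- ((m :* f) :* (A :* y)))) refl
                 _ (aboveΠ ts κs) _ _ _ _ _ _)))))
             (trans (regroup (⟦ next ts ≤? a ⟧ ⊗ ρ s t a) (⟦ t ≤? κ ⟧ ⊗ (⟦ κ ≤? d ⟧ ⊗ ⟦ next ds ≤? κ ⟧)) (μ s ⊗ ⟦ next ds <? κ ⟧) (λ as → rook k (suc s) as ts)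
               (λ as κs → aboveΠ ts κs ⊗ remove k (suc s) ds κs (tail₁ d κ w)) (λ as κs → aboveΠ ts κs ⊗ remove k (suc s) ds κs (tail₂ d κ w)) (λ as κs → onto s a κ Φ (boxes (suc s) as κs)))
             (solve 5 (λ c x y u v → (c :* (x :* (y :* u))) :* v := c :* (x :* (y :* (u :* v)))) refl _ _ _ _ _))) ⟩
      ∑≤ B (λ κ → (⟦ next ts ≤? a ⟧ ⊗ ρ s t a) ⊗ (⟦ t ≤? κ ⟧ ⊗ (⟦ κ ≤? d ⟧ ⊗ (⟦ next ds ≤? κ ⟧ ⊗
        (fromThenRook (suc s) ts ds (tail₁ d κ w) (onto s a κ Φ) ⊕ ⊖ ((μ s ⊗ ⟦ next ds <? κ ⟧) ⊗
          fromThenRook (suc s) ts ds (tail₂ d κ w) (onto s a κ Φ)))))))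
        ≡⟨ ∑≤-*ˡ B _ ⟩
      _ ∎
      where
      G : ℕ → Vec ℕ n → ℤ
      G κ κs = aboveΠ (t ∷ ts) (κ ∷ κs) ⊗ remove k s (d ∷ ds) (κ ∷ κs) w

    fromThenRook-cong : ∀ s (t d : Vec ℕ n) {w w′ Φ Φ′} → (∀ x → w x ≡ w′ x) → (∀ S → Φ S ≡ Φ′ S) →
      fromThenRook s t d w Φ ≡ fromThenRook s t d w′ Φ′
    fromThenRook-cong {n} s t d h h′ = ΣV-cong n (λ t′ → ⊗-congʳ (ΣV-cong n (λ κ →
      cong₂ (λ a b → (aboveΠ t κ ⊗ a) ⊗ b) (remove-cong k s d κ h) (h′ _))))

    private
      rho-sum : ∀ s t nt (h : ℕ → ℤ) → t ≤ B → ∑≤ B (λ a → (⟦ nt ≤? a ⟧ ⊗ ρ s t a) ⊗ h a) ≡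
        ⟦ nt ≤? t ⟧ ⊗ h t ⊕ ⊖ (μ s ⊗ ∑≤ B (λ a → ⟦ suc a ≟ t ⟧ ⊗ (⟦ nt ≤? a ⟧ ⊗ h a)))
      rho-sum s t nt h t≤B = begin
        ∑≤ B (λ a → (⟦ nt ≤? a ⟧ ⊗ ρ s t a) ⊗ h a)
          ≡⟨ ∑≤-cong B (λ a _ → solve 5 (λ n e m f h → (n :* (e :+ :- (m :* f))) :* h := e :* (n :* h) :+ (:- m) :* (f :* (n :* h))) refl
               ⟦ nt ≤? a ⟧ ⟦ a ≟ t ⟧ (μ s) ⟦ suc a ≟ t ⟧ (h a)) ⟩
        ∑≤ B (λ a → ⟦ a ≟ t ⟧ ⊗ (⟦ nt ≤? a ⟧ ⊗ h a) ⊕ (⊖ μ s) ⊗ (⟦ suc a ≟ t ⟧ ⊗ (⟦ nt ≤? a ⟧ ⊗ h a)))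
          ≡⟨ trans (∑≤-⊕ B) (cong₂ _⊕_ (trans (∑≤-δ B t t≤B (λ j j≢t → ⟦⟧⊗-no (j ≟ t) j≢t)) (⟦⟧⊗-yes (t ≟ t) refl)) (∑≤-*ˡ B _)) ⟩
        ⟦ nt ≤? t ⟧ ⊗ h t ⊕ (⊖ μ s) ⊗ ∑≤ B (λ a → ⟦ suc a ≟ t ⟧ ⊗ (⟦ nt ≤? a ⟧ ⊗ h a))
          ≡⟨ solve 3 (λ a m b → a :+ (:- m) :* b := a :+ :- (m :* b)) refl _ _ _ ⟩
        ⟦ nt ≤? t ⟧ ⊗ h t ⊕ ⊖ (μ s ⊗ ∑≤ B (λ a → ⟦ suc a ≟ t ⟧ ⊗ (⟦ nt ≤? a ⟧ ⊗ h a))) ∎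

      pred-sum : ∀ a (h : ℕ → ℤ) → suc a ≤ B → ∑≤ B (λ b → ⟦ suc b ≟ suc a ⟧ ⊗ h b) ≡ h a
      pred-sum a h le = trans (∑≤-δ B a (ℕ.<⇒≤ le) (λ j j≢a → ⟦⟧⊗-no (suc j ≟ suc a) (j≢a ∘ ℕ.suc-injective))) (⟦⟧⊗-yes (suc a ≟ suc a) refl)

      zero-one : ∀ {P : Set} (p : Dec P) → ⟦ p ⟧ ≡ 0ℤ ⊎ ⟦ p ⟧ ≡ 1ℤ
      zero-one (yes _) = inj₂ refl
      zero-one (no _) = inj₁ refl

      module Compare (m : ℤ) (d nd : ℕ) (X Y : ℕ → ℕ → ℤ) where
        f₁ f₂ : ℕ → ℕ → ℤ
        f₁ a κ = ⟦ nd ≤? κ ⟧ ⊗ (X a κ ⊕ ⊖ ((m ⊗ (⟦ a <? κ ⟧ ⊗ ⟦ nd <? κ ⟧)) ⊗ Y a κ))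
        f₂ a κ = ⟦ nd ≤? κ ⟧ ⊗ (X a κ ⊕ ⊖ ((m ⊗ ⟦ nd <? κ ⟧) ⊗ Y a κ))

        above : ∀ {a κ} → a < κ → f₁ a κ ≡ f₂ a κ
        above {a} {κ} a<κ = ⊗-congʳ (⊕-congʳ (cong ⊖_ (⊗-congˡ (⊗-congʳ (⟦⟧⊗-yes (a <? κ) a<κ)))))

      -- For a = t the left side lacks the marked term at κ = t; for a = t - 1 it has a surplus
      -- unmarked term at κ = a. By the last hypothesis the two agree in size, and the sign of the
      -- rook box is that of the mark.
      compare-rows : ∀ m → m ≡ 0ℤ ⊎ m ≡ 1ℤ → ∀ t d nt nd X Y → t ≤ d → d ≤ B → nt ≤ t → nt ≤ nd → (∀ a → suc a ≡ t → X a a ≡ Y t t) →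
        let open Compare m d nd X Y in
        ⟦ nt ≤? t ⟧ ⊗ between t d (f₁ t) ⊕ ⊖ (m ⊗ ∑≤ B (λ a → ⟦ suc a ≟ t ⟧ ⊗ (⟦ nt ≤? a ⟧ ⊗ between a d (f₁ a)))) ≡
        ⟦ nt ≤? t ⟧ ⊗ between t d (f₂ t) ⊕ ⊖ (m ⊗ ∑≤ B (λ a → ⟦ suc a ≟ t ⟧ ⊗ (⟦ nt ≤? a ⟧ ⊗ between t d (f₂ a))))
      compare-rows m (inj₁ refl) t d nt nd X Y _ _ _ _ _ = cong₂ _⊕_ (⊗-congʳ (between-cong t d (λ κ _ _ → ⊗-congʳ (⊕-congʳ (cong ⊖_ (⊗-congˡ
        (trans (⊗-zeroˡ _) (sym (⊗-zeroˡ _))))))))) (cong ⊖_ (trans (⊗-zeroˡ _) (sym (⊗-zeroˡ _))))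
      compare-rows m (inj₂ refl) zero d nt nd X Y _ _ _ _ _ = cong₂ _⊕_
        (⊗-congʳ (between-cong 0 d (λ { zero _ _ → ⊗-congʳ (⊕-congʳ (cong ⊖_ (⊗-congˡ (⊗-congʳ (trans (⊗-zeroˡ _) (sym (⟦⟧-no (nd <? 0) ℕ.n≮0)))))))
                                      ; (suc κ) _ _ → Compare.above m d nd X Y (s≤s z≤n) })))
        (cong (λ x → ⊖ (1ℤ ⊗ x)) (trans (∑≤-zero B (λ a _ → ⟦⟧⊗-no (suc a ≟ 0) (λ ()))) (sym (∑≤-zero B (λ a _ → ⟦⟧⊗-no (suc a ≟ 0) (λ ()))))))
      compare-rows m (inj₂ refl) (suc a) d nt nd X Y t≤d d≤B nt≤t nt≤nd e = begin
        ⟦ nt ≤? suc a ⟧ ⊗ between (suc a) d (f₁ (suc a)) ⊕ ⊖ (1ℤ ⊗ ∑≤ B (λ b → ⟦ suc b ≟ suc a ⟧ ⊗ (⟦ nt ≤? b ⟧ ⊗ between b d (f₁ b))))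
          ≡⟨ cong₂ (λ x y → x ⊕ ⊖ (1ℤ ⊗ y)) (⟦⟧⊗-yes (nt ≤? suc a) nt≤t) (pred-sum a _ t≤B) ⟩
        between (suc a) d (f₁ (suc a)) ⊕ ⊖ (1ℤ ⊗ (⟦ nt ≤? a ⟧ ⊗ between a d (f₁ a)))
          ≡⟨ cong₂ (λ x y → x ⊕ ⊖ (1ℤ ⊗ (⟦ nt ≤? a ⟧ ⊗ y))) (trans (between-split _ t≤d d≤B) (⊕-congʳ (between-cong _ d (λ κ p _ → above p))))
               (trans (between-split _ (ℕ.<⇒≤ t≤d) d≤B) (⊕-congʳ (between-cong _ d (λ κ p _ → above p)))) ⟩
        (f₁ (suc a) (suc a) ⊕ U) ⊕ ⊖ (1ℤ ⊗ (⟦ nt ≤? a ⟧ ⊗ (f₁ a a ⊕ V))) ≡⟨ corner (nd ≤? a) ⟩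
        (f₂ (suc a) (suc a) ⊕ U) ⊕ ⊖ (1ℤ ⊗ (⟦ nt ≤? a ⟧ ⊗ V))
          ≡⟨ cong (λ x → x ⊕ ⊖ (1ℤ ⊗ (⟦ nt ≤? a ⟧ ⊗ V))) (between-split _ t≤d d≤B) ⟨
        between (suc a) d (f₂ (suc a)) ⊕ ⊖ (1ℤ ⊗ (⟦ nt ≤? a ⟧ ⊗ V))
          ≡⟨ cong₂ (λ x y → x ⊕ ⊖ (1ℤ ⊗ y)) (⟦⟧⊗-yes (nt ≤? suc a) nt≤t) (pred-sum a _ t≤B) ⟨
        ⟦ nt ≤? suc a ⟧ ⊗ between (suc a) d (f₂ (suc a)) ⊕ ⊖ (1ℤ ⊗ ∑≤ B (λ b → ⟦ suc b ≟ suc a ⟧ ⊗ (⟦ nt ≤? b ⟧ ⊗ between (suc a) d (f₂ b)))) ∎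
        where
        open Compare 1ℤ d nd X Y
        t≤B = ℕ.≤-trans t≤d d≤B
        U = between (suc (suc a)) d (f₂ (suc a))
        V = between (suc a) d (f₂ a)
        corner : Dec (nd ≤ a) → (f₁ (suc a) (suc a) ⊕ U) ⊕ ⊖ (1ℤ ⊗ (⟦ nt ≤? a ⟧ ⊗ (f₁ a a ⊕ V))) ≡ (f₂ (suc a) (suc a) ⊕ U) ⊕ ⊖ (1ℤ ⊗ (⟦ nt ≤? a ⟧ ⊗ V))
        corner (no p) rewrite ⟦⟧-no (nd ≤? a) p | ⟦⟧-no (nd <? suc a) (p ∘ ℕ.≤-pred) =
          solve 9 (λ c x e y U n x′ z V → (c :* (x :+ :- ((con 1ℤ :* (e :* con 0ℤ)) :* y)) :+ U) :+ :- (con 1ℤ :* (n :* (con 0ℤ :* x′ :+ V))) :=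
            (c :* (x :+ :- ((con 1ℤ :* con 0ℤ) :* y)) :+ U) :+ :- (con 1ℤ :* (n :* V))) refl _ _ _ _ U _ _ 0ℤ V
        corner (yes p) rewrite ⟦⟧-yes (nd ≤? a) p | ⟦⟧-yes (nd <? suc a) (s≤s p) | ⟦⟧-yes (nd ≤? suc a) (ℕ.m≤n⇒m≤1+n p)
          | ⟦⟧-yes (nt ≤? a) (ℕ.≤-trans nt≤nd p) | ⟦⟧-no (suc a <? suc a) (ℕ.<-irrefl refl) | ⟦⟧-no (a <? a) (ℕ.<-irrefl refl) | e a refl =
          solve 6 (λ x y U V z z′ → (con 1ℤ :* (x :+ :- ((con 1ℤ :* (con 0ℤ :* con 1ℤ)) :* y)) :+ U) :+ :- (con 1ℤ :* (con 1ℤ :* (con 1ℤ :* (y :+ :- ((con 1ℤ :* (con 0ℤ :* z)) :* z′)) :+ V))) :=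
            (con 1ℤ :* (x :+ :- ((con 1ℤ :* con 1ℤ) :* y)) :+ U) :+ :- (con 1ℤ :* (con 1ℤ :* V))) refl _ _ U V _ _

    -- The two orders differ only where a row becomes empty: there, a rook box removed from t
    -- plays the same role as a second label in that box.
    rook-exchange : ∀ s {p q} (t d : Vec ℕ n) w Φ → Descending p t → Descending q d → q ≤ B → t ≤ᵛ d →
      rookThenFrom s t d w Φ ≡ fromThenRook s t d w Φ
    rook-exchange s [] [] w Φ _ _ _ _ = solve 2 (λ w p → con 1ℤ :* (w :* p) := con 1ℤ :* ((con 1ℤ :* w) :* p)) refl _ _
    rook-exchange s (t ∷ ts) (d ∷ ds) w Φ (_ ∷ dt) (d≤q ∷ dd) q≤B (t≤d ∷ le) = begin
      rookThenFrom s (t ∷ ts) (d ∷ ds) w Φ ≡⟨ rookThenFrom-step s t ts d ds w Φ ⟩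
      ∑≤ B (λ a → (⟦ next ts ≤? a ⟧ ⊗ ρ s t a) ⊗ between a d (λ κ → ⟦ next ds ≤? κ ⟧ ⊗
        (rookThenFrom (suc s) ts ds (tail₁ d κ w) (onto s a κ Φ) ⊕ ⊖ ((μ s ⊗ (⟦ a <? κ ⟧ ⊗ ⟦ next ds <? κ ⟧)) ⊗
          rookThenFrom (suc s) ts ds (tail₂ d κ w) (onto s a κ Φ)))))
        ≡⟨ ∑≤-cong B (λ a _ → ⊗-congʳ (between-cong a d (λ κ _ _ → ⊗-congʳ (cong₂ (λ x y → x ⊕ ⊖ ((μ s ⊗ (⟦ a <? κ ⟧ ⊗ ⟦ next ds <? κ ⟧)) ⊗ y))
             (rook-exchange (suc s) ts ds (tail₁ d κ w) (onto s a κ Φ) dt dd d≤B le)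
             (rook-exchange (suc s) ts ds (tail₂ d κ w) (onto s a κ Φ) dt dd d≤B le))))) ⟩
      ∑≤ B (λ a → (⟦ next ts ≤? a ⟧ ⊗ ρ s t a) ⊗ between a d (f₁ a)) ≡⟨ rho-sum s t (next ts) (λ a → between a d (f₁ a)) t≤B ⟩
      ⟦ next ts ≤? t ⟧ ⊗ between t d (f₁ t) ⊕ ⊖ (μ s ⊗ ∑≤ B (λ a → ⟦ suc a ≟ t ⟧ ⊗ (⟦ next ts ≤? a ⟧ ⊗ between a d (f₁ a))))
        ≡⟨ compare-rows (μ s) (zero-one (s ≤? k)) t d (next ts) nd X Y t≤d d≤B (next≤ dt) (next-≤ᵛ le) X≡Y ⟩
      ⟦ next ts ≤? t ⟧ ⊗ between t d (f₂ t) ⊕ ⊖ (μ s ⊗ ∑≤ B (λ a → ⟦ suc a ≟ t ⟧ ⊗ (⟦ next ts ≤? a ⟧ ⊗ between t d (f₂ a))))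
        ≡⟨ rho-sum s t (next ts) (λ a → between t d (f₂ a)) t≤B ⟨
      ∑≤ B (λ a → (⟦ next ts ≤? a ⟧ ⊗ ρ s t a) ⊗ between t d (f₂ a)) ≡⟨ fromThenRook-step s t ts d ds w Φ ⟨
      fromThenRook s (t ∷ ts) (d ∷ ds) w Φ ∎
      where
      d≤B = ℕ.≤-trans d≤q q≤B
      t≤B = ℕ.≤-trans t≤d d≤B
      nd = next ds
      X Y f₁ f₂ : ℕ → ℕ → ℤ
      X a κ = fromThenRook (suc s) ts ds (tail₁ d κ w) (onto s a κ Φ)
      Y a κ = fromThenRook (suc s) ts ds (tail₂ d κ w) (onto s a κ Φ)
      f₁ a κ = ⟦ nd ≤? κ ⟧ ⊗ (X a κ ⊕ ⊖ ((μ s ⊗ (⟦ a <? κ ⟧ ⊗ ⟦ nd <? κ ⟧)) ⊗ Y a κ))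
      f₂ a κ = ⟦ nd ≤? κ ⟧ ⊗ (X a κ ⊕ ⊖ ((μ s ⊗ ⟦ nd <? κ ⟧) ⊗ Y a κ))
      -- Emptying the row down to a = t - 1 drops one box more than down to t, which counts like the
      -- additional label of the mark; in both cases no box of the row remains.
      X≡Y : ∀ a → suc a ≡ t → X a a ≡ Y t t
      X≡Y a refl = fromThenRook-cong (suc s) ts ds (λ x → cong w (trans (cong (ℕ._+ x) (ℕ.+-∸-assoc 1 t≤d)) (sym (ℕ.+-suc (d ∸ t) x))))
        (λ S → cong (λ y → Φ (y ++ S)) (trans (rowCells-empty s a) (sym (rowCells-empty s (suc a)))))

    module _ (w : ℕ → ℕ → ℤ) where
      open SetTableaux w (λ _ r → r ≤ᵇ k) (λ _ _ → true)

      removeChain-lower : ∀ m {p} (d t : Vec ℕ n) → removeChain w k m d t ≢ 0ℤ → Descending p d → t ≤ᵛ d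
      removeChain-lower zero d t h _ with refl ← δ≢0 d t h = ≤ᵛ-refl
      removeChain-lower (suc m) d t h desc with u , p , q ← ∙≢0 (λ x y → remove k 1 x y (w (suc m))) (removeChain w k m) d t h
        with s ← remove-strip k 1 d u _ p = ≤ᵛ-trans (removeChain-lower m u t q (Strip-descendingˡ s desc)) (Strip⇒≤ᵛ s)

      -- This is P⁽ᵏ⁾ = S⁽ᵏ⁾ Rₖ for the product P⁽ᵏ⁾ of kernels. `rook-exchange` pushes the
      -- correction past one kernel at a time; without labels the tableau sum is δ, and t ≤ d leaves
      -- only the empty rook strip.
      removeChain-rook : ∀ m (d t : Vec ℕ n) → Descending B d → Descending B t → t ≤ᵛ d →
        removeChain w k m d t ≡ ((λ d t′ → tableaux m (boxes 1 t′ d)) ∙ rook k 1) d t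
      removeChain-rook {n} zero d t dd dt le = sym (trans (∙-congˡ {M = λ d t′ → tableaux 0 (boxes 1 t′ d)} {N = δ} (rook k 1) d t
          (λ t′ h → trans (tableaux-zero w (λ _ r → r ≤ᵇ k) (λ _ _ → true) 1 (≤ᵛ-trans (proj₂ (rook-descending k 1 t′ t h dt)) le)) (δ-sym t′ d)))
          (trans (δ-∙ (rook k 1) t dd ℕ.≤-refl) rook-δ))
        where
        δ-sym : ∀ (u v : Vec ℕ n) → δ u v ≡ δ v u
        δ-sym u v = ⟦⟧-cong (≡-dec _≟_ u v) (≡-dec _≟_ v u) sym sym
        rook-δ : rook k 1 d t ≡ δ d t
        rook-δ with ≡-dec _≟_ d t
        ... | yes refl = rook-diag k 1 dt
        ... | no d≢t with rook k 1 d t ℤ.≟ 0ℤ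
        ...   | yes e = e
        ...   | no h = contradiction (≤ᵛ-antisym (proj₂ (rook-descending k 1 d t h dt)) le) d≢t
      removeChain-rook {n} (suc m) d t dd dt le = sym (begin
        ΣV n (λ t′ → tableaux (suc m) (boxes 1 t′ d) ⊗ rook k 1 t′ t)
          ≡⟨ ΣV-cong n (λ t′ → trans (⊗-comm _ _) (*-cancel-support (rook k 1 t′ t) (λ h → let dt′ , le′ = rook-descending k 1 t′ t h dt in
               tableaux-peel m z B t′ d (≤ᵛ-trans le′ le) dt′ dd ℕ.≤-refl))) ⟩
        rookThenFrom 1 t d (w (suc m)) (tableaux m) ≡⟨ rook-exchange 1 t d (w (suc m)) (tableaux m) dt dd ℕ.≤-refl le ⟩
        fromThenRook 1 t d (w (suc m)) (tableaux m)
          ≡⟨ ΣV-cong n (λ t′ → trans (sym (ΣV-*ˡ n _)) (ΣV-cong n (λ κ → solve 4 (λ r a u x → r :* ((a :* u) :* x) := u :* (a :* (x :* r))) refl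
               (rook k 1 t′ t) (aboveΠ t κ) (U κ) (tableaux m (boxes 1 t′ κ))))) ⟩
        ΣV n (λ t′ → ΣV n (λ κ → U κ ⊗ (aboveΠ t κ ⊗ (tableaux m (boxes 1 t′ κ) ⊗ rook k 1 t′ t)))) ≡⟨ ΣV-swap n n ⟩
        ΣV n (λ κ → ΣV n (λ t′ → U κ ⊗ (aboveΠ t κ ⊗ (tableaux m (boxes 1 t′ κ) ⊗ rook k 1 t′ t))))
          ≡⟨ ΣV-cong n (λ κ → trans (ΣV-*ˡ n (U κ)) (*-cancel-support (U κ) (λ h → trans (ΣV-*ˡ n (aboveΠ t κ)) (entryκ κ (Strip-descendingˡ (remove-strip k 1 d κ _ h) dd))))) ⟩
        ΣV n (λ κ → U κ ⊗ removeChain w k m κ t) ∎)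
        where
        U : Vec ℕ n → ℤ
        U κ = remove k 1 d κ (w (suc m))
        entryκ : ∀ κ → Descending B κ → aboveΠ t κ ⊗ ΣV n (λ t′ → tableaux m (boxes 1 t′ κ) ⊗ rook k 1 t′ t) ≡ removeChain w k m κ t
        entryκ κ dκ with aboveΠ t κ ℤ.≟ 0ℤ
        ... | no h = trans (⊗-congˡ (aboveΠ-yes (aboveΠ-≢0 t κ h))) (trans (⊗-identityˡ _) (sym (removeChain-rook m κ t dκ dt (aboveΠ-≢0 t κ h))))
        ... | yes e = trans (⊗-congˡ e) (trans (⊗-zeroˡ _) (sym vanish))
          where
          vanish : removeChain w k m κ t ≡ 0ℤ
          vanish with removeChain w k m κ t ℤ.≟ 0ℤ
          ... | yes e′ = e′
          ... | no h with () ← trans (sym (aboveΠ-yes (removeChain-lower m κ t h dκ))) e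

-- Reverse row-strict tableaux as chains of vertical strips.

horA verA : Kind → Kind → Bool
horA _ drop = false
horA _ _ = true
verA drop _ = true
verA _ drop = false
verA _ _ = true

reversePair : Box × ℕ → Box × ℕ → Bool
reversePair (b , v) (d , u) = (sameRowLeft b d ⇒ᵇ (u <ᵇ v)) ∧ (sameColAbove b d ⇒ᵇ (u ≤ᵇ v))

reverseKinds : Box × Kind → Box × Kind → Bool
reverseKinds (b , x) (d , y) = (sameRowLeft b d ⇒ᵇ horA x y) ∧ (sameColAbove b d ⇒ᵇ verA x y)

flaggedLabels : ℕ → ℕ → List ℕ
flaggedLabels zero r = []
flaggedLabels (suc K) r = flaggedLabels K r ++ (if suc K ≤ᵇ r then suc K ∷ [] else [])

flaggedLabels-≤ : ∀ K r {v} → v ∈ flaggedLabels K r → v ≤ K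
flaggedLabels-≤ (suc K) r p with ∈.∈-++⁻ (flaggedLabels K r) p
... | inj₁ q = ℕ.m≤n⇒m≤1+n (flaggedLabels-≤ K r q)
... | inj₂ q with suc K ≤ᵇ r | q
...   | true | here refl = ℕ.≤-refl

parity : {V : Set} → List (Box × V) → ℤ
parity [] = 1ℤ
parity (_ ∷ F) = ⊖ parity F

-- The sign of the theorem for the part above σ is included, because every box of Eₖ carries a
-- factor -1.
reverseTableaux : ℕ → List Box → ℤ
reverseTableaux K S = sumF S (flaggedLabels K ∘ row) (λ F → ⟦ T? (reverseRowStrictᵇ F) ⟧ ⊗ parity F)

dropParity : List (Box × Kind) → ℤ
dropParity [] = 1ℤ
dropParity ((_ , drop) ∷ K) = ⊖ dropParity K
dropParity (_ ∷ K) = dropParity K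

-- The largest label stands at the left end of its rows, so its boxes form a vertical strip along
-- the left boundary; row-weak boundedness confines them to the rows from `suc K` on.
module ReversePeel (K : ℕ) where

  top : ℕ → Bool
  top r = suc K ≤ᵇ r

  private
    split : ∀ b (g : ℕ → ℤ) → ∑ (if b then suc K ∷ [] else []) g ≡ ⟦ T? b ⟧ ⊗ g (suc K)
    split true g = trans (⊕-identityʳ _) (sym (⊗-identityˡ _))
    split false g = sym (⊗-zeroˡ _)

    labels-split : ∀ b (g : ℕ → ℤ) → ∑ (flaggedLabels (suc K) (row b)) g ≡ ∑ (flaggedLabels K (row b)) g ⊕
      (⟦ T? false ⟧ ⊗ ∑ (flaggedLabels K (row b)) g ⊕ ⟦ T? (top (row b)) ⟧ ⊗ g (suc K))
    labels-split b g = trans (∑-++ (flaggedLabels K (row b)) _) (⊕-congʳ (trans (split (top (row b)) g)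
      (trans (sym (⊕-identityˡ _)) (cong (_⊕ ⟦ T? (top (row b)) ⟧ ⊗ g (suc K)) (sym (⊗-zeroˡ _))))))

  open Peeling (flaggedLabels (suc K) ∘ row) (flaggedLabels K ∘ row) id (suc K) (λ _ → false) top labels-split

  private
    cand : ∀ {b v} → v ∈ flaggedLabels K (row b) → v ≤ K
    cand {b} = flaggedLabels-≤ K (row b)

    ≤ᵇ-no : ∀ {a b} → ¬ (a ≤ b) → (a ≤ᵇ b) ≡ false
    ≤ᵇ-no {a} {b} h = T-false (λ q → h (ℕ.≤ᵇ⇒≤ a b q))
    ≤ᵇ-yes : ∀ {a b} → a ≤ b → (a ≤ᵇ b) ≡ true
    ≤ᵇ-yes h = T-true (ℕ.≤⇒≤ᵇ h)

    kept-drop : ∀ {v} g₁ g₂ → v ≤ K → ∀ x → x ≢ drop → (g₁ ⇒ᵇ (suc K <ᵇ v)) ∧ (g₂ ⇒ᵇ (suc K ≤ᵇ v)) ≡ (g₁ ⇒ᵇ horA x drop) ∧ (g₂ ⇒ᵇ verA x drop)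
    kept-drop {v} g₁ g₂ p x h rewrite ≤ᵇ-no {suc (suc K)} {v} (λ q → ℕ.<⇒≱ (ℕ.≤-trans (s≤s p) (ℕ.n≤1+n _)) q) | ≤ᵇ-no {suc K} {v} (ℕ.<⇒≱ (s≤s p)) with x
    ... | keep = refl
    ... | mark = refl
    ... | drop = contradiction refl h

    drop-kept : ∀ {v} g₁ g₂ → v ≤ K → ∀ x → x ≢ drop → (g₁ ⇒ᵇ (v <ᵇ suc K)) ∧ (g₂ ⇒ᵇ (v ≤ᵇ suc K)) ≡ (g₁ ⇒ᵇ horA drop x) ∧ (g₂ ⇒ᵇ verA drop x)
    drop-kept {v} g₁ g₂ p x h rewrite ≤ᵇ-yes {suc v} {suc K} (s≤s p) | ≤ᵇ-yes {v} {suc K} (ℕ.m≤n⇒m≤1+n p) with x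
    ... | keep = refl
    ... | mark = refl
    ... | drop = contradiction refl h

    Kept-≢ : ∀ {x f} → Kept x f → x ≢ drop
    Kept-≢ keep ()
    Kept-≢ mark ()

    Kept-id : ∀ {x f} → Kept x f → f ≡ id
    Kept-id keep = refl
    Kept-id mark = refl

    Kept-both : ∀ {x y f g} → Kept x f → Kept y g → horA x y ≡ true × verA x y ≡ true
    Kept-both keep keep = refl , refl
    Kept-both keep mark = refl , refl
    Kept-both mark keep = refl , refl
    Kept-both mark mark = refl , refl

    both-case : ∀ {x y f g} b d {v u} → Kept x f → Kept y g → reversePair (b , f v) (d , g u) ≡ reverseKinds (b , x) (d , y) ∧ reversePair (b , v) (d , u)
    both-case b d {v} {u} k k′ with refl ← Kept-id k with refl ← Kept-id k′ with Kept-both k k′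
    ... | e₁ , e₂ = ⇒ᵇ-∧-split (sameRowLeft b d) (sameColAbove b d) (sym (cong (_∧ (u <ᵇ v)) e₁)) (sym (cong (_∧ (u ≤ᵇ v)) e₂))

    right-case : ∀ {x f} b d {v} → Kept x f → v ≤ K → reversePair (b , f v) (d , suc K) ≡ reverseKinds (b , x) (d , drop)
    right-case {x} b d k p with refl ← Kept-id k = kept-drop (sameRowLeft b d) (sameColAbove b d) p x (Kept-≢ k)

    left-case : ∀ {x f} b d {v} → Kept x f → v ≤ K → reversePair (b , suc K) (d , f v) ≡ reverseKinds (b , drop) (d , x)
    left-case {x} b d k p with refl ← Kept-id k = drop-kept (sameRowLeft b d) (sameColAbove b d) p x (Kept-≢ k)

    pair-keep-keep : ∀ {x y f g} b d {v u} → Kept x f → Kept y g → v ∈ flaggedLabels K (row b) → u ∈ flaggedLabels K (row d) →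
      reversePair (b , f v) (d , g u) ≡ reverseKinds (b , x) (d , y) ∧ reversePair (b , v) (d , u)
    pair-keep-keep b d k k′ _ _ = both-case b d k k′

    pair-keep-drop : ∀ {x f} b d {v} → Kept x f → v ∈ flaggedLabels K (row b) → reversePair (b , f v) (d , suc K) ≡ reverseKinds (b , x) (d , drop)
    pair-keep-drop b d k v∈ = right-case b d k (cand {b} v∈)

    pair-drop-keep : ∀ {x f} b d {v} → Kept x f → v ∈ flaggedLabels K (row d) → reversePair (b , suc K) (d , f v) ≡ reverseKinds (b , drop) (d , x)
    pair-drop-keep b d k v∈ = left-case b d k (cand {d} v∈)

    pair-drop-drop : ∀ b d → reversePair (b , suc K) (d , suc K) ≡ reverseKinds (b , drop) (d , drop)
    pair-drop-drop b d = cong-⇒ᵇ (sameRowLeft b d) (sameColAbove b d) (≤ᵇ-no {suc (suc K)} {suc K} (ℕ.<-irrefl refl)) (≤ᵇ-yes {suc K} {suc K} ℕ.≤-refl)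

  open Pairs reversePair reverseKinds pair-keep-keep pair-keep-drop pair-drop-keep pair-drop-drop

  weightA : (List Box → ℤ) → List (Box × Kind) → ℤ
  weightA Ψ K′ = allowed (λ _ → false) top K′ ⊗ (⟦ T? (allPairsᵇ reverseKinds K′) ⟧ ⊗ (dropParity K′ ⊗ Ψ (kept K′)))

  private
    parity-combine : ∀ {K′ F G} → Combines K′ F G → parity G ≡ dropParity K′ ⊗ parity F
    parity-combine [] = sym (⊗-identityˡ _)
    parity-combine (keep v∈ c) = trans (cong ⊖_ (parity-combine c)) (solve 2 (λ a b → :- (a :* b) := a :* (:- b)) refl _ _)
    parity-combine (mark v∈ c) = trans (cong ⊖_ (parity-combine c)) (solve 2 (λ a b → :- (a :* b) := a :* (:- b)) refl _ _)
    parity-combine (drop c) = trans (cong ⊖_ (parity-combine c)) (solve 2 (λ a b → :- (a :* b) := (:- a) :* b) refl _ _)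

  peelA : ∀ S → reverseTableaux (suc K) S ≡ sumF S kinds (weightA (reverseTableaux K))
  peelA S = peel parity parity dropParity parity-combine S

  allowed-mark : ∀ X b Y → allowed (λ _ → false) top (X ++ (b , mark) ∷ Y) ≡ 0ℤ
  allowed-mark [] b Y = ⊗-zeroˡ _
  allowed-mark ((_ , keep) ∷ X) b Y = allowed-mark X b Y
  allowed-mark ((_ , mark) ∷ X) b Y = ⊗-zeroˡ _
  allowed-mark ((_ , drop) ∷ X) b Y = trans (⊗-congʳ (allowed-mark X b Y)) (⊗-zeroʳ _)

  weightA-mark : ∀ Ψ X b Y → weightA Ψ (X ++ (b , mark) ∷ Y) ≡ 0ℤ
  weightA-mark Ψ X b Y = trans (⊗-congˡ (allowed-mark X b Y)) (⊗-zeroˡ _)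

  module Rowwise (z B : ℕ) where
    open Shapes z
    open Matrices B
    open RowSums B
    open ChainIdentity B
    open Linking z B

    weightA-vanishes : ∀ Ψ → Vanishes BadA (weightA Ψ)
    weightA-vanishes Ψ X s j {x} {y} Y b = trans (⊗-congʳ (⟦⟧⊗-no (T? _) bad)) (⊗-zeroʳ _)
      where
      bad-horA : ∀ {x y} → BadA x y → ¬ T (horA x y)
      bad-horA keep-drop ()
      bad-horA drop-drop ()
      bad : ¬ T (allPairsᵇ reverseKinds (X ++ ((s , j) , x) ∷ ((s , suc j) , y) ∷ Y))
      bad h = bad-horA b (T-⇒⁻ (proj₁ (T-∧⁻ (T-allPairs⁻ {p = reverseKinds} _ h
        (∈.∈-++⁺ʳ X (here refl)) (∈.∈-++⁺ʳ X (there (here refl)))))) (T-∧⁺ (≡ᵇ-refl s) (ℕ.<⇒<ᵇ (ℕ.n<1+n j))))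

    Increment-bounds : ∀ {a b} → a ≡ b ⊎ suc a ≡ b → a ≤ b × b ≤ suc a
    Increment-bounds (inj₁ refl) = ℕ.≤-refl , ℕ.n≤1+n _
    Increment-bounds (inj₂ refl) = ℕ.n≤1+n _ , ℕ.≤-refl

    data ArrangedA : (s : ℕ) (a d b : Vec ℕ n) → List (Box × Kind) → Set where
      [] : ∀ {s} → ArrangedA s [] [] [] []
      _∷_ : ∀ {n s a d b} {as ds bs : Vec ℕ n} {K′} → (a ≡ b ⊎ suc a ≡ b) × b ≤ d → ArrangedA (suc s) as ds bs K′ →
        ArrangedA s (a ∷ as) (d ∷ ds) (b ∷ bs) (arrangementA s a b d ++ K′)

    data PositionA (a b d j : ℕ) : Kind → Set where
      keep : b < j → j ≤ d → PositionA a b d j keep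
      drop : a < j → j ≤ b → PositionA a b d j drop

    arrangementA-∈ : ∀ s a b d {c x} → (c , x) ∈ arrangementA s a b d → ∃ λ j → c ≡ (s , j ℕ.+ z) × PositionA a b d j x
    arrangementA-∈ s a b d p with ∈.∈-++⁻ (tag drop (rowCells s a b)) p
    ... | inj₁ q with r , refl ← tag-∈⁻ z _ q with j , e , u , v ← rowCells-∈⁻ z s a b r = j , e , drop u v
    ... | inj₂ q with r , refl ← tag-∈⁻ z _ q with j , e , u , v ← rowCells-∈⁻ z s b d r = j , e , keep u v

    ArrangedA-row : ∀ {s} {a d b : Vec ℕ n} {K′} → ArrangedA s a d b K′ → ∀ {c x} → (c , x) ∈ K′ → s ≤ row c
    ArrangedA-row (_∷_ {s = s} {a} {d} {b} _ arr) p with ∈.∈-++⁻ (arrangementA s a b d) p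
    ... | inj₁ q with _ , refl , _ ← arrangementA-∈ s a b d q = ℕ.≤-refl
    ... | inj₂ q = ℕ.<⇒≤ (ArrangedA-row arr q)

    drops-left : ∀ {s} {a d b : Vec ℕ n} {K′ p} → ArrangedA s a d b K′ → Descending p b → ∀ {c} → (c , drop) ∈ K′ → col c ≤ p ℕ.+ z
    drops-left (_∷_ {s = s} {a} {d} {b} _ arr) (b≤p ∷ desc) q with ∈.∈-++⁻ (arrangementA s a b d) q
    ... | inj₂ r = ℕ.≤-trans (drops-left arr desc r) (ℕ.+-monoˡ-≤ z b≤p)
    ... | inj₁ r with arrangementA-∈ s a b d r
    ...   | j , refl , drop _ j≤b = ℕ.+-monoˡ-≤ z (ℕ.≤-trans j≤b b≤p)

    first-drop : ∀ {s} {a d b : Vec ℕ n} {K′} → ArrangedA s a d b K′ → next a < next b → ((s , next b ℕ.+ z) , drop) ∈ K′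
    first-drop (_∷_ {s = s} {a} {d} {b} _ arr) a<b = ∈.∈-++⁺ˡ (∈.∈-++⁺ˡ (∈.∈-map⁺ (_, drop) (rowCells-∈⁺ z s b a<b ℕ.≤-refl)))

    first-step : ∀ {s} {a d b : Vec ℕ n} {K′} → ArrangedA s a d b K′ → (next a ≡ next b ⊎ suc (next a) ≡ next b) × next b ≤ next d
    first-step [] = inj₁ refl , z≤n
    first-step (c ∷ _) = c

    module _ {s a b d : ℕ} {as ds bs : Vec ℕ n} {K′ : List (Box × Kind)} (ab : a ≡ b ⊎ suc a ≡ b) (b≤d : b ≤ d)
      (na≤a : next as ≤ a) (nd≤d : next ds ≤ d) (arr : ArrangedA (suc s) as ds bs K′) where

      private
        L = arrangementA s a b d

        a≤b : a ≤ b
        a≤b = proj₁ (Increment-bounds ab)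

      -- Otherwise the dropped box in column `next bs` of the next row would lie under a kept box,
      -- so that a column would increase downwards.
      pairsA-row⁻ : T (allPairsᵇ reverseKinds (L ++ K′)) → next bs ≤ b × T (allPairsᵇ reverseKinds K′)
      pairsA-row⁻ h = cond , T-allPairs⁺ {p = reverseKinds} K′ (λ p q → T-allPairs⁻ {p = reverseKinds} (L ++ K′) h (∈.∈-++⁺ʳ L p) (∈.∈-++⁺ʳ L q))
        where
        cond : next bs ≤ b
        cond with next bs ≤? b
        ... | yes p = p
        ... | no p with nb≤nd ← proj₂ (first-step arr) = ⊥-elim (T-⇒⁻ (proj₂ (T-∧⁻ (T-allPairs⁻ {p = reverseKinds} (L ++ K′) h
              (∈.∈-++⁺ˡ (∈.∈-++⁺ʳ (tag drop (rowCells s a b)) (∈.∈-map⁺ (_, keep) (rowCells-∈⁺ z s (next bs) (ℕ.≰⇒> p) (ℕ.≤-trans nb≤nd nd≤d)))))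
              (∈.∈-++⁺ʳ L (first-drop arr (ℕ.≤-<-trans (ℕ.≤-trans na≤a a≤b) (ℕ.≰⇒> p)))))))
              (T-∧⁺ (≡ᵇ-refl (next bs ℕ.+ z)) (ℕ.<⇒<ᵇ (ℕ.n<1+n s))))

      pairsA-row⁺ : Descending b bs → T (allPairsᵇ reverseKinds K′) → T (allPairsᵇ reverseKinds (L ++ K′))
      pairsA-row⁺ desc h = T-allPairs⁺ {p = reverseKinds} (L ++ K′) (λ p q → go (∈.∈-++⁻ L p) (∈.∈-++⁻ L q))
        where
        go : ∀ {k k′} → k ∈ L ⊎ k ∈ K′ → k′ ∈ L ⊎ k′ ∈ K′ → T (reverseKinds k k′)
        go (inj₂ p) (inj₂ q) = T-allPairs⁻ {p = reverseKinds} K′ h p q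
        go (inj₁ p) (inj₁ q) with j , refl , x ← arrangementA-∈ s a b d p | i , refl , y ← arrangementA-∈ s a b d q =
          T-∧⁺ (T-⇒⁺ (λ e → leftOf x y (ℕ.+-cancelʳ-< z j i (ℕ.<ᵇ⇒< _ _ (proj₂ (T-∧⁻ {s ≡ᵇ s} e))))))
            (T-⇒⁺ (λ e → contradiction (ℕ.<ᵇ⇒< s s (proj₂ (T-∧⁻ {j ℕ.+ z ≡ᵇ i ℕ.+ z} e))) (ℕ.<-irrefl refl)))
          where
          b≤1+a : b ≤ suc a
          b≤1+a = proj₂ (Increment-bounds ab)
          leftOf : ∀ {j i x y} → PositionA a b d j x → PositionA a b d i y → j < i → T (horA x y)
          leftOf {j} {i} x (drop a<i i≤b) j<i = contradiction (ℕ.≤-trans (s≤s (left x)) (ℕ.≤-trans j<i (ℕ.≤-trans i≤b b≤1+a))) (ℕ.<-irrefl refl)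
            where
            left : ∀ {x} → PositionA a b d j x → suc a ≤ j
            left (keep b<j _) = ℕ.≤-<-trans a≤b b<j
            left (drop a<j _) = a<j
          leftOf (keep _ _) (keep _ _) _ = tt
          leftOf (drop _ _) (keep _ _) _ = tt
        go {k′ = (r , c′) , y} (inj₁ p) (inj₂ q) with j , refl , x ← arrangementA-∈ s a b d p =
          T-∧⁺ (T-⇒⁺ (λ e → contradiction (ℕ.≤-trans (ArrangedA-row arr q) (ℕ.≤-reflexive (sym (ℕ.≡ᵇ⇒≡ s r (proj₁ (T-∧⁻ {s ≡ᵇ r} e)))))) (ℕ.<-irrefl refl)))
            (T-⇒⁺ (λ e → column y x q (ℕ.≡ᵇ⇒≡ (j ℕ.+ z) c′ (proj₁ (T-∧⁻ {j ℕ.+ z ≡ᵇ c′} e)))))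
          where
          column : ∀ {j x} y → PositionA a b d j x → ((r , c′) , y) ∈ K′ → j ℕ.+ z ≡ c′ → T (verA x y)
          column _ (drop _ _) _ _ = tt
          column keep (keep _ _) _ _ = tt
          column mark (keep _ _) _ _ = tt
          column {j} drop (keep b<j _) q refl = contradiction (ℕ.+-cancelʳ-≤ z j b (drops-left arr desc q)) (ℕ.<⇒≱ b<j)
        go {k = (r , c′) , y} (inj₂ q) (inj₁ p) with j , refl , x ← arrangementA-∈ s a b d p =
          T-∧⁺ (T-⇒⁺ (λ e → contradiction (ℕ.≤-trans s<r (ℕ.≤-reflexive (ℕ.≡ᵇ⇒≡ r s (proj₁ (T-∧⁻ {r ≡ᵇ s} e))))) (ℕ.<-irrefl refl)))
            (T-⇒⁺ (λ e → contradiction (ℕ.<-trans s<r (ℕ.<ᵇ⇒< r s (proj₂ (T-∧⁻ {c′ ≡ᵇ j ℕ.+ z} e)))) (ℕ.<-irrefl refl)))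
          where s<r = ArrangedA-row arr q

    ArrangedA-descending : ∀ {s} {a d b : Vec ℕ n} {K′ p q} → ArrangedA s a d b K′ → Descending p a → Descending q d →
      T (allPairsᵇ reverseKinds K′) → ∀ {r} → next b ≤ r → Descending r b
    ArrangedA-descending [] _ _ _ _ = []
    ArrangedA-descending ((ab , b≤d) ∷ arr) (_ ∷ da) (_ ∷ dd) h le with p , h′ ← pairsA-row⁻ ab b≤d (next≤ da) (next≤ dd) arr h =
      le ∷ ArrangedA-descending arr da dd h′ p

    pairsA-row : ∀ {s a b d} {as ds bs : Vec ℕ n} {K′} → (ab : a ≡ b ⊎ suc a ≡ b) (b≤d : b ≤ d) → Descending a as → Descending d ds →
      ArrangedA (suc s) as ds bs K′ →
      ⟦ T? (allPairsᵇ reverseKinds (arrangementA s a b d ++ K′)) ⟧ ≡ ⟦ next bs ≤? b ⟧ ⊗ ⟦ T? (allPairsᵇ reverseKinds K′) ⟧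
    pairsA-row {s = s} {a} {b} {d} {bs = bs} {K′} ab b≤d da dd arr = trans
      (⟦⟧-cong (T? (allPairsᵇ reverseKinds (arrangementA s a b d ++ K′))) ((next bs ≤? b) ×-dec T? (allPairsᵇ reverseKinds K′))
        (pairsA-row⁻ ab b≤d (next≤ da) (next≤ dd) arr)
        (λ (p , h) → pairsA-row⁺ ab b≤d (next≤ da) (next≤ dd) arr (ArrangedA-descending arr da dd h p) h))
      (⟦⟧-× (next bs ≤? b) (T? (allPairsᵇ reverseKinds K′)))

    rowsAtA-cong : ∀ s (a d b : Vec ℕ n) {Θ Θ′} → (∀ K′ → ArrangedA s a d b K′ → Θ K′ ≡ Θ′ K′) → rowsAtA s a d b Θ ≡ rowsAtA s a d b Θ′
    rowsAtA-cong s [] [] [] h = h [] []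
    rowsAtA-cong s (a ∷ as) (d ∷ ds) (b ∷ bs) {Θ} {Θ′} h = go (a ≟ b) (suc a ≟ b)
      where
      rest : (List (Box × Kind) → ℤ) → ℤ
      rest Θ = rowsAtA (suc s) as ds bs (λ K′ → Θ (arrangementA s a b d ++ K′))
      tail : a ≡ b ⊎ suc a ≡ b → b ≤ d → rest Θ ≡ rest Θ′
      tail ab q = rowsAtA-cong (suc s) as ds bs (λ K′ arr → h _ ((ab , q) ∷ arr))
      go : (p : Dec (a ≡ b)) (q : Dec (suc a ≡ b)) → (⟦ p ⟧ ⊕ ⟦ q ⟧) ⊗ (⟦ b ≤? d ⟧ ⊗ rest Θ) ≡ (⟦ p ⟧ ⊕ ⟦ q ⟧) ⊗ (⟦ b ≤? d ⟧ ⊗ rest Θ′)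
      go (yes p) _ = ⊗-congʳ (⟦⟧-scale-cong (b ≤? d) (tail (inj₁ p)))
      go (no _) (yes q) = ⊗-congʳ (⟦⟧-scale-cong (b ≤? d) (tail (inj₂ q)))
      go (no _) (no _) = trans (solve 1 (λ x → (con 0ℤ :+ con 0ℤ) :* x := con 0ℤ) refl _) (sym (solve 1 (λ x → (con 0ℤ :+ con 0ℤ) :* x := con 0ℤ) refl _))

    rowsAtA-*ˡ : ∀ s (a d b : Vec ℕ n) c {Θ} → rowsAtA s a d b (λ K′ → c ⊗ Θ K′) ≡ c ⊗ rowsAtA s a d b Θ
    rowsAtA-*ˡ s [] [] [] c = refl
    rowsAtA-*ˡ s (a ∷ as) (d ∷ ds) (b ∷ bs) c = trans (⊗-congʳ (⊗-congʳ (rowsAtA-*ˡ (suc s) as ds bs c)))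
      (solve 4 (λ x y c r → x :* (y :* (c :* r)) := c :* (x :* (y :* r))) refl _ _ _ _)

    private
      keeps-allowed : ∀ S K′ → allowed (λ _ → false) top (tag keep S ++ K′) ≡ allowed (λ _ → false) top K′
      keeps-allowed [] K′ = refl
      keeps-allowed (_ ∷ S) K′ = keeps-allowed S K′

      keeps-parity : ∀ S K′ → dropParity (tag keep S ++ K′) ≡ dropParity K′
      keeps-parity [] K′ = refl
      keeps-parity (_ ∷ S) K′ = keeps-parity S K′

      keeps-kept : ∀ S K′ → kept (tag keep S ++ K′) ≡ S ++ kept K′
      keeps-kept [] K′ = refl
      keeps-kept (b ∷ S) K′ = cong (b ∷_) (keeps-kept S K′)

      unchanged : ∀ s a d K′ → arrangementA s a a d ++ K′ ≡ tag keep (rowCells s a d) ++ K′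
      unchanged s a d K′ = cong (λ x → (tag drop x ++ tag keep (rowCells s a d)) ++ K′) (rowCells-empty s a)

      shifted : ∀ s a d K′ → arrangementA s a (suc a) d ++ K′ ≡ ((s , suc a ℕ.+ z) , drop) ∷ tag keep (rowCells s (suc a) d) ++ K′
      shifted s a d K′ = cong (λ x → (tag drop x ++ tag keep (rowCells s (suc a) d)) ++ K′)
        (trans (rowCells-cons s ℕ.≤-refl) (cong ((s , suc a ℕ.+ z) ∷_) (rowCells-empty s (suc a))))

    rowsAtA-weight : ∀ s {p q} (a d b : Vec ℕ n) Ψ → Descending p a → Descending q d →
      rowsAtA s a d b (weightA Ψ) ≡ (aboveΠ b d ⊗ vertical (suc K) s a b) ⊗ Ψ (boxes s b d)
    rowsAtA-weight s [] [] [] Ψ _ _ = solve 1 (λ p → con 1ℤ :* (con 1ℤ :* (con 1ℤ :* p)) := (con 1ℤ :* con 1ℤ) :* p) refl _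
    rowsAtA-weight s (a ∷ as) (d ∷ ds) (b ∷ bs) Ψ (_ ∷ da) (_ ∷ dd) = begin
      (⟦ a ≟ b ⟧ ⊕ ⟦ suc a ≟ b ⟧) ⊗ (⟦ b ≤? d ⟧ ⊗ rowsAtA (suc s) as ds bs (λ K′ → weightA Ψ (arrangementA s a b d ++ K′)))
        ≡⟨ go (a ≟ b) (suc a ≟ b) ⟩
      (⟦ a ≟ b ⟧ ⊕ ⊖ (⟦ suc K ≤? s ⟧ ⊗ ⟦ suc a ≟ b ⟧)) ⊗ (⟦ b ≤? d ⟧ ⊗ (⟦ next bs ≤? b ⟧ ⊗ R))
        ≡⟨ solve 6 (λ ρ c e A V P → ρ :* (c :* (e :* ((A :* V) :* P))) := ((c :* A) :* (con 1ℤ :* (e :* (ρ :* V)))) :* P) refl _ _ _ _ _ _ ⟩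
      ((⟦ b ≤? d ⟧ ⊗ aboveΠ bs ds) ⊗ (1ℤ ⊗ (⟦ next bs ≤? b ⟧ ⊗ ((⟦ a ≟ b ⟧ ⊕ ⊖ (⟦ suc K ≤? s ⟧ ⊗ ⟦ suc a ≟ b ⟧)) ⊗ vertical (suc K) (suc s) as bs)))) ⊗ Ψ (boxes s (b ∷ bs) (d ∷ ds))
        ≡⟨ ⊗-congˡ (⊗-congʳ (⊗-congˡ (⟦⟧-yes (next as ≤? a) (next≤ da)))) ⟨
      (aboveΠ (b ∷ bs) (d ∷ ds) ⊗ vertical (suc K) s (a ∷ as) (b ∷ bs)) ⊗ Ψ (boxes s (b ∷ bs) (d ∷ ds)) ∎
      where
      R = (aboveΠ bs ds ⊗ vertical (suc K) (suc s) as bs) ⊗ Ψ (boxes s (b ∷ bs) (d ∷ ds))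
      Ψ′ : ℕ → List Box → ℤ
      Ψ′ b S = Ψ (rowCells s b d ++ S)
      go : (p : Dec (a ≡ b)) (q : Dec (suc a ≡ b)) →
        (⟦ p ⟧ ⊕ ⟦ q ⟧) ⊗ (⟦ b ≤? d ⟧ ⊗ rowsAtA (suc s) as ds bs (λ K′ → weightA Ψ (arrangementA s a b d ++ K′))) ≡
        (⟦ p ⟧ ⊕ ⊖ (⟦ suc K ≤? s ⟧ ⊗ ⟦ q ⟧)) ⊗ (⟦ b ≤? d ⟧ ⊗ (⟦ next bs ≤? b ⟧ ⊗ R))
      go (no _) (no _) = trans (solve 1 (λ x → (con 0ℤ :+ con 0ℤ) :* x := con 0ℤ) refl _)
        (sym (solve 2 (λ x y → (con 0ℤ :+ :- (y :* con 0ℤ)) :* x := con 0ℤ) refl _ _))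
      go (yes refl) (yes e) = contradiction e ℕ.1+n≢n
      go (yes refl) (no _) = trans (⊗-congʳ (⟦⟧-scale-cong (b ≤? d) (λ b≤d → trans (rowsAtA-cong (suc s) as ds bs λ K′ arr →
          trans (cong₂ _⊗_ (trans (cong (allowed _ top) (unchanged s a d K′)) (keeps-allowed (rowCells s a d) K′))
            (cong₂ _⊗_ (pairsA-row (inj₁ refl) b≤d da dd arr) (cong₂ _⊗_ (trans (cong dropParity (unchanged s a d K′)) (keeps-parity (rowCells s a d) K′))
              (cong Ψ (trans (cong kept (unchanged s a d K′)) (keeps-kept (rowCells s a d) K′))))))
          (solve 5 (λ p c h m r → p :* ((c :* h) :* (m :* r)) := c :* (p :* (h :* (m :* r)))) refl _ _ _ _ _))
          (trans (rowsAtA-*ˡ (suc s) as ds bs _) (⊗-congʳ (rowsAtA-weight (suc s) as ds bs (Ψ′ b) da dd))))))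
        (⊗-congˡ (solve 1 (λ y → con 1ℤ :+ con 0ℤ := con 1ℤ :+ :- (y :* con 0ℤ)) refl _))
      go (no _) (yes refl) = trans (⊗-congʳ (⟦⟧-scale-cong (b ≤? d) (λ b≤d → trans (rowsAtA-cong (suc s) as ds bs λ K′ arr →
          trans (cong₂ _⊗_ (trans (cong (allowed _ top) (shifted s a d K′)) (⊗-congʳ (keeps-allowed (rowCells s b d) K′)))
            (cong₂ _⊗_ (pairsA-row (inj₂ refl) b≤d da dd arr) (cong₂ _⊗_ (trans (cong dropParity (shifted s a d K′)) (cong ⊖_ (keeps-parity (rowCells s b d) K′)))
              (cong Ψ (trans (cong kept (shifted s a d K′)) (keeps-kept (rowCells s b d) K′))))))
          (solve 6 (λ μ p c h m r → (μ :* p) :* ((c :* h) :* ((:- m) :* r)) := ((:- μ) :* c) :* (p :* (h :* (m :* r)))) refl _ _ _ _ _ _))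
          (trans (rowsAtA-*ˡ (suc s) as ds bs _) (trans (⊗-congʳ (rowsAtA-weight (suc s) as ds bs (Ψ′ b) da dd)) (⊗-assoc _ _ _))))))
        (trans (solve 4 (λ c μ e r → (con 0ℤ :+ con 1ℤ) :* (c :* ((:- μ) :* (e :* r))) := (con 0ℤ :+ :- (μ :* con 1ℤ)) :* (c :* (e :* r))) refl _ _ _ _)
          (⊗-congˡ (⊕-congʳ (cong (λ x → ⊖ (x ⊗ 1ℤ)) (⟦⟧-cong (T? (top s)) (suc K ≤? s) (ℕ.≤ᵇ⇒≤ (suc K) s) ℕ.≤⇒≤ᵇ)))))

module _ (z B : ℕ) where
  open Shapes z
  open Matrices B
  open ChainIdentity B
  open Linking z B

  vertical-above : ∀ k s (a b : Vec ℕ n) → vertical k s a b ≢ 0ℤ → a ≤ᵛ b × (∀ {p} → next b ≤ p → Descending p b)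
  vertical-above k s [] [] _ = [] , λ _ → []
  vertical-above k s (a ∷ as) (b ∷ bs) h with h₁ ← *≢0ʳ ⟦ next as ≤? a ⟧ _ h with h₂ ← *≢0ʳ ⟦ next bs ≤? b ⟧ _ h₁
    with le , desc ← vertical-above k (suc s) as bs (*≢0ʳ _ _ h₂) = a≤b (*≢0ˡ _ _ h₂) ∷ le , λ p → p ∷ desc (⟦⟧≢0 (next bs ≤? b) (*≢0ˡ _ _ h₁))
    where
    a≤b : ⟦ a ≟ b ⟧ ⊕ ⊖ (⟦ k ≤? s ⟧ ⊗ ⟦ suc a ≟ b ⟧) ≢ 0ℤ → a ≤ b
    a≤b h with a ≟ b | suc a ≟ b
    ... | yes refl | _ = ℕ.≤-refl
    ... | no _ | yes refl = ℕ.n≤1+n a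
    ... | no _ | no _ = contradiction (solve 1 (λ x → con 0ℤ :+ :- (x :* con 0ℤ) := con 0ℤ) refl _) h

  verticalChain-below : ∀ K (a t : Vec ℕ n) → verticalChain K a t ≢ 0ℤ → a ≤ᵛ t
  verticalChain-below zero a t h with refl ← δ≢0 a t h = ≤ᵛ-refl
  verticalChain-below (suc K) a t h with b , p , q ← ∙≢0 (vertical (suc K) 1) (verticalChain K) a t h =
    ≤ᵛ-trans (proj₁ (vertical-above (suc K) 1 a b p)) (verticalChain-below K b t q)

  -- Label k may stand in rows from k on, which are the rows of Eₖ. Labels decrease away from the
  -- boundary a, so the largest label is the first factor of the chain.
  verticalChain-tableaux : ∀ K {a t : Vec ℕ n} → a ≤ᵛ t → Descending B a → Descending B t →
    verticalChain K a t ≡ reverseTableaux K (boxes 1 a t)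
  verticalChain-tableaux zero {a} {t} le _ _ with ≡-dec _≟_ a t
  ... | yes refl = sym (trans (cong (reverseTableaux 0) (boxes-empty 1 a)) (⊗-identityˡ _))
  ... | no a≢t with boxes 1 a t in e
  ...   | [] = contradiction (boxes-nonEmpty 1 le e) a≢t
  ...   | _ ∷ _ = refl
  verticalChain-tableaux {n = n} (suc K) {a} {t} le da dt = sym (begin
    reverseTableaux (suc K) (boxes 1 a t) ≡⟨ peelA (boxes 1 a t) ⟩
    sumF (boxes 1 a t) kinds (weightA (reverseTableaux K))
      ≡⟨ RowSums.sumF-boxesA B 1 a t le dt ℕ.≤-refl (weightA-vanishes (reverseTableaux K)) (weightA-mark (reverseTableaux K)) ⟩
    ΣV n (λ b → RowSums.rowsAtA B 1 a t b (weightA (reverseTableaux K)))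
      ≡⟨ ΣV-cong n (λ b → trans (rowsAtA-weight 1 a t b (reverseTableaux K) da dt) (compare b)) ⟩
    ΣV n (λ b → vertical (suc K) 1 a b ⊗ verticalChain K b t) ∎)
    where
    open ReversePeel K
    open Rowwise z B
    compare : ∀ b → (aboveΠ b t ⊗ vertical (suc K) 1 a b) ⊗ reverseTableaux K (boxes 1 b t) ≡ vertical (suc K) 1 a b ⊗ verticalChain K b t
    compare b = trans (solve 3 (λ x y r → (x :* y) :* r := y :* (x :* r)) refl _ _ _) (*-cancel-support (vertical (suc K) 1 a b) inner)
      where
      inner : vertical (suc K) 1 a b ≢ 0ℤ → aboveΠ b t ⊗ reverseTableaux K (boxes 1 b t) ≡ verticalChain K b t
      inner h with aboveΠ b t ℤ.≟ 0ℤ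
      ... | no h′ = let le′ = aboveΠ-≢0 b t h′ in trans (⊗-congˡ (aboveΠ-yes le′)) (trans (⊗-identityˡ _)
            (sym (verticalChain-tableaux K le′ (proj₂ (vertical-above (suc K) 1 a b h) (ℕ.≤-trans (next-≤ᵛ le′) (next≤ dt))) dt)))
      ... | yes e = trans (⊗-congˡ e) (trans (⊗-zeroˡ _) (sym vanish))
        where
        vanish : verticalChain K b t ≡ 0ℤ
        vanish with verticalChain K b t ℤ.≟ 0ℤ
        ... | yes e′ = e′
        ... | no h″ with () ← trans (sym (aboveΠ-yes (verticalChain-below K b t h″))) e

-- The coefficients and counts of the theorem as tableau sums.

∑≡sumℤ : (xs : List 𝒜) (f : 𝒜 → ℤ) → ∑ xs f ≡ sumℤ (map f xs)
∑≡sumℤ [] f = refl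
∑≡sumℤ (x ∷ xs) f = trans (⊕-def (f x) (∑ xs f)) (cong (ℤ._+_ (f x)) (∑≡sumℤ xs f))

all-cong : ∀ {p q : 𝒜 → Bool} xs → (∀ x → p x ≡ q x) → all p xs ≡ all q xs
all-cong [] h = refl
all-cong (x ∷ xs) h = cong₂ _∧_ (h x) (all-cong xs h)

filterᵇ-↭ : ∀ (p : 𝒜 → Bool) {xs ys} → xs ↭ ys → filterᵇ p xs ↭ filterᵇ p ys
filterᵇ-↭ p refl = refl
filterᵇ-↭ p (prep x q) with p x
... | true = prep x (filterᵇ-↭ p q)
... | false = filterᵇ-↭ p q
filterᵇ-↭ p (swap x y q) with p x in ex | p y in ey
... | true | true rewrite ex | ey = swap x y (filterᵇ-↭ p q)
... | true | false rewrite ex | ey = prep x (filterᵇ-↭ p q)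
... | false | true rewrite ex | ey = prep y (filterᵇ-↭ p q)
... | false | false rewrite ex | ey = filterᵇ-↭ p q
filterᵇ-↭ p (Perm.trans q r) = Perm.trans (filterᵇ-↭ p q) (filterᵇ-↭ p r)

countᵇ-↭ : ∀ (p : 𝒜 → Bool) {xs ys} → xs ↭ ys → countᵇ p xs ≡ countᵇ p ys
countᵇ-↭ p q = ↭.↭-length (filterᵇ-↭ p q)

labelCount-↭ : ∀ {F F′ : List (Box × List ℕ)} → F ↭ F′ → labelCount F ≡ labelCount F′
labelCount-↭ refl = refl
labelCount-↭ (prep x p) = cong (length (proj₂ x) ℕ.+_) (labelCount-↭ p)
labelCount-↭ (swap {ys = F′} (_ , v) (_ , u) p) = trans (cong (λ x → length v ℕ.+ (length u ℕ.+ x)) (labelCount-↭ p))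
  (trans (sym (ℕ.+-assoc (length v) _ (labelCount F′))) (trans (cong (ℕ._+ labelCount F′) (ℕ.+-comm (length v) (length u)))
    (ℕ.+-assoc (length u) _ (labelCount F′))))
labelCount-↭ (Perm.trans p q) = trans (labelCount-↭ p) (labelCount-↭ q)

sCoeff-sum : ∀ S c → + sCoeff S c ≡ sumF S (λ _ → range1 (length c)) (λ F → ⟦ T? (semistandardᵇ F ∧ contentIsᵇ c F) ⟧)
sCoeff-sum S c = trans (+countᵇ _ (fillings S (λ _ → range1 (length c)))) (∑-fillings S _ _)

GCoeff-sum : ∀ S c → GCoeff S c ≡ sumF S (λ _ → nonEmptySubsets (length c))
  (λ F → ⟦ T? (setSemistandardᵇ F ∧ setContentIsᵇ c F) ⟧ ⊗ sign (labelCount F ∸ length S))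
GCoeff-sum S c = trans (sym (∑≡sumℤ (filterᵇ _ (fillings S _)) _)) (trans (∑-filterᵇ _ (fillings S _)) (∑-fillings S _ _))

aCount-sum : ∀ S → + aCount S ≡ sumF S (λ b → range1 (row b)) (λ F → ⟦ T? (reverseRowStrictᵇ F) ⟧)
aCount-sum S = trans (+countᵇ _ (fillings S (λ b → range1 (row b)))) (∑-fillings S _ _)

bCount-sum : ∀ S → + bCount S ≡ sumF S (λ b → range1 (row b ∸ 1)) (λ F → ⟦ T? (semistandardᵇ F) ⟧)
bCount-sum S = trans (+countᵇ _ (fillings S (λ b → range1 (row b ∸ 1)))) (∑-fillings S _ _)

sCoeff-↭ : ∀ {S S′} c → S ↭ S′ → + sCoeff S c ≡ + sCoeff S′ c
sCoeff-↭ {S} {S′} c p = trans (sCoeff-sum S c) (trans (sumF-↭ _ p (λ q → cong (λ x → ⟦ T? x ⟧) (cong₂ _∧_ (allPairs-↭ _ q)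
  (all-cong (range1 (length c)) (λ i → cong (_≡ᵇ entry c i) (countᵇ-↭ _ q)))))) (sym (sCoeff-sum S′ c)))

GCoeff-↭ : ∀ {S S′} c → S ↭ S′ → GCoeff S c ≡ GCoeff S′ c
GCoeff-↭ {S} {S′} c p = trans (GCoeff-sum S c) (trans (sumF-↭ _ p (λ q → cong₂ (λ x y → ⟦ T? x ⟧ ⊗ sign y) (cong₂ _∧_ (allPairs-↭ _ q)
  (all-cong (range1 (length c)) (λ i → cong (_≡ᵇ entry c i) (countᵇ-↭ _ q)))) (cong (_∸ length S) (labelCount-↭ q))))
  (trans (cong (λ ℓ → sumF S′ (λ _ → nonEmptySubsets (length c)) (λ F → ⟦ T? (setSemistandardᵇ F ∧ setContentIsᵇ c F) ⟧ ⊗ sign (labelCount F ∸ ℓ)))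
    (↭.↭-length p)) (sym (GCoeff-sum S′ c))))

aCount-↭ : ∀ {S S′} → S ↭ S′ → aCount S ≡ aCount S′
aCount-↭ {S} {S′} p = ℤ.+-injective (trans (aCount-sum S) (trans (sumF-↭ _ p (λ q → cong (λ x → ⟦ T? x ⟧) (allPairs-↭ _ q))) (sym (aCount-sum S′))))

bCount-↭ : ∀ {S S′} → S ↭ S′ → bCount S ≡ bCount S′
bCount-↭ {S} {S′} p = ℤ.+-injective (trans (bCount-sum S) (trans (sumF-↭ _ p (λ q → cong (λ x → ⟦ T? x ⟧) (allPairs-↭ _ q))) (sym (bCount-sum S′))))

range1-snoc : ∀ m → range1 (suc m) ≡ range1 m ++ suc m ∷ []
range1-snoc m = trans (cong (map suc) (sym (List.upTo-∷ʳ m))) (List.map-++ suc (upTo m) _)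

∑-range1 : ∀ m (g : ℕ → ℤ) → ∑ (range1 (suc m)) g ≡ ∑ (range1 m) g ⊕ g (suc m)
∑-range1 m g = trans (cong (λ xs → ∑ xs g) (range1-snoc m)) (trans (∑-++ (range1 m) _) (⊕-congʳ (⊕-identityʳ _)))

all-range1 : ∀ m (p : ℕ → Bool) → ⟦ T? (all p (range1 (suc m))) ⟧ ≡ ⟦ T? (p (suc m)) ⟧ ⊗ ⟦ T? (all p (range1 m)) ⟧
all-range1 m p = trans (cong (λ xs → ⟦ T? (all p xs) ⟧) (range1-snoc m)) (trans (cong (λ x → ⟦ T? x ⟧) (all-snoc (range1 m))) (trans (⟦T?∧⟧ _ _) (⊗-comm _ _)))
  where
  all-snoc : ∀ xs → all p (xs ++ suc m ∷ []) ≡ all p xs ∧ p (suc m)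
  all-snoc [] = ∧-identityʳ _
  all-snoc (x ∷ xs) = trans (cong (p x ∧_) (all-snoc xs)) (sym (∧-assoc (p x) _ _))

-- Candidate lists are compared through sums, since `nonEmptySubsets` and `candidates` list the same
-- label sets in different orders.
sumF-candidates : ∀ S {C C′ : Box → List 𝒱} → (∀ {b} → b ∈ S → ∀ g → ∑ (C b) g ≡ ∑ (C′ b) g) → ∀ f → sumF S C f ≡ sumF S C′ f
sumF-candidates [] h f = refl
sumF-candidates (b ∷ S) {C} {C′} h f = trans (∑-cong (C b) (λ v → sumF-candidates S (h ∘ there) (λ F → f ((b , v) ∷ F))))
  (h (here refl) (λ v → sumF S C′ (λ F → f ((b , v) ∷ F))))

exactly : List ℕ → ℕ → ℕ → ℤ
exactly c i k = ⟦ k ≟ entry c i ⟧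

contentWeight-exactly : ∀ c m F → contentWeight (exactly c) m F ≡ ⟦ T? (all (λ i → count i F ≡ᵇ entry c i) (range1 m)) ⟧
contentWeight-exactly c zero F = refl
contentWeight-exactly c (suc m) F = trans (cong₂ _⊗_ (⟦⟧-cong (count (suc m) F ≟ entry c (suc m)) (T? (count (suc m) F ≡ᵇ entry c (suc m)))
  (ℕ.≡⇒≡ᵇ _ _) (ℕ.≡ᵇ⇒≡ _ _)) (contentWeight-exactly c m F)) (sym (all-range1 m _))

∑-sublists-snoc : ∀ xs y (g : List ℕ → ℤ) → ∑ (sublists (xs ++ y ∷ [])) g ≡ ∑ (sublists xs) g ⊕ ∑ (sublists xs) (λ v → g (v ++ y ∷ []))
∑-sublists-snoc [] y g = solve 2 (λ a b → a :+ (b :+ con 0ℤ) := (b :+ con 0ℤ) :+ (a :+ con 0ℤ)) refl _ _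
∑-sublists-snoc (x ∷ xs) y g = begin
  ∑ (map (x ∷_) (sublists (xs ++ y ∷ [])) ++ sublists (xs ++ y ∷ [])) g
    ≡⟨ trans (∑-++ (map (x ∷_) (sublists (xs ++ y ∷ []))) _) (cong₂ _⊕_ (trans (∑-map (x ∷_) (sublists (xs ++ y ∷ []))) (∑-sublists-snoc xs y (g ∘ (x ∷_)))) (∑-sublists-snoc xs y g)) ⟩
  (∑ (sublists xs) (g ∘ (x ∷_)) ⊕ ∑ (sublists xs) (λ v → g (x ∷ v ++ y ∷ []))) ⊕ (∑ (sublists xs) g ⊕ ∑ (sublists xs) (λ v → g (v ++ y ∷ [])))
    ≡⟨ solve 4 (λ a b c d → (a :+ b) :+ (c :+ d) := (a :+ c) :+ (b :+ d)) refl _ _ _ _ ⟩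
  (∑ (sublists xs) (g ∘ (x ∷_)) ⊕ ∑ (sublists xs) g) ⊕ (∑ (sublists xs) (λ v → g (x ∷ v ++ y ∷ [])) ⊕ ∑ (sublists xs) (λ v → g (v ++ y ∷ [])))
    ≡⟨ cong₂ _⊕_ (fold g) (fold (λ v → g (v ++ y ∷ []))) ⟨
  ∑ (sublists (x ∷ xs)) g ⊕ ∑ (sublists (x ∷ xs)) (λ v → g (v ++ y ∷ [])) ∎
  where
  fold : ∀ g → ∑ (sublists (x ∷ xs)) g ≡ ∑ (sublists xs) (g ∘ (x ∷_)) ⊕ ∑ (sublists xs) g
  fold g = trans (∑-++ (map (x ∷_) (sublists xs)) _) (cong (_⊕ ∑ (sublists xs) g) (∑-map (x ∷_) (sublists xs)))

∑-sublists-empty : ∀ xs (g : List ℕ → ℤ) → ∑ (sublists xs) g ≡ ∑ (sublists xs) (λ v → ⟦ T? (nonEmptyᵇ v) ⟧ ⊗ g v) ⊕ g []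
∑-sublists-empty [] g = solve 1 (λ a → a :+ con 0ℤ := (con 0ℤ :* a :+ con 0ℤ) :+ a) refl _
∑-sublists-empty (x ∷ xs) g = begin
  ∑ (map (x ∷_) (sublists xs) ++ sublists xs) g ≡⟨ trans (∑-++ (map (x ∷_) (sublists xs)) _) (⊕-congʳ (∑-sublists-empty xs g)) ⟩
  ∑ (map (x ∷_) (sublists xs)) g ⊕ (∑ (sublists xs) (λ v → ⟦ T? (nonEmptyᵇ v) ⟧ ⊗ g v) ⊕ g [])
    ≡⟨ cong (_⊕ _) (trans (∑-map (x ∷_) (sublists xs)) (trans (∑-cong (sublists xs) (λ v → sym (⊗-identityˡ _))) (sym (∑-map (x ∷_) (sublists xs))))) ⟩
  ∑ (map (x ∷_) (sublists xs)) g′ ⊕ (∑ (sublists xs) g′ ⊕ g []) ≡⟨ solve 3 (λ a b c → a :+ (b :+ c) := (a :+ b) :+ c) refl _ _ _ ⟩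
  (∑ (map (x ∷_) (sublists xs)) g′ ⊕ ∑ (sublists xs) g′) ⊕ g [] ≡⟨ cong (_⊕ g []) (∑-++ (map (x ∷_) (sublists xs)) _) ⟨
  ∑ (map (x ∷_) (sublists xs) ++ sublists xs) g′ ⊕ g [] ∎
  where
  g′ : List ℕ → ℤ
  g′ v = ⟦ T? (nonEmptyᵇ v) ⟧ ⊗ g v

∑-nonEmptySubsets : ∀ m (g : List ℕ → ℤ) → ∑ (nonEmptySubsets (suc m)) g ≡
  ∑ (nonEmptySubsets m) g ⊕ (∑ (nonEmptySubsets m) (g ∘ (_++ suc m ∷ [])) ⊕ g (suc m ∷ []))
∑-nonEmptySubsets m g = begin
  ∑ (nonEmptySubsets (suc m)) g ≡⟨ ∑-filterᵇ nonEmptyᵇ (sublists (range1 (suc m))) ⟩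
  ∑ (sublists (range1 (suc m))) g′ ≡⟨ cong (λ xs → ∑ (sublists xs) g′) (range1-snoc m) ⟩
  ∑ (sublists (range1 m ++ suc m ∷ [])) g′ ≡⟨ ∑-sublists-snoc (range1 m) (suc m) g′ ⟩
  ∑ (sublists (range1 m)) g′ ⊕ ∑ (sublists (range1 m)) (λ v → g′ (v ++ suc m ∷ []))
    ≡⟨ cong₂ _⊕_ (sym (∑-filterᵇ nonEmptyᵇ (sublists (range1 m)))) (trans (∑-cong (sublists (range1 m)) grow)
         (trans (∑-sublists-empty (range1 m) (λ v → g (v ++ suc m ∷ []))) (cong (_⊕ g (suc m ∷ [])) (sym (∑-filterᵇ nonEmptyᵇ (sublists (range1 m))))))) ⟩
  ∑ (nonEmptySubsets m) g ⊕ (∑ (nonEmptySubsets m) (g ∘ (_++ suc m ∷ [])) ⊕ g (suc m ∷ [])) ∎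
  where
  g′ : List ℕ → ℤ
  g′ v = ⟦ T? (nonEmptyᵇ v) ⟧ ⊗ g v
  grow : ∀ v → g′ (v ++ suc m ∷ []) ≡ g (v ++ suc m ∷ [])
  grow [] = ⊗-identityˡ _
  grow (_ ∷ _) = ⊗-identityˡ _

module _ (w : ℕ → ℕ → ℤ) (k : ℕ) where
  open SetTableaux w (λ _ r → r ≤ᵇ k) (λ _ _ → true)

  candidates-all : ∀ m r → r ≤ k → ∀ g → ∑ (nonEmptySubsets m) g ≡ ∑ (candidates m r) g
  candidates-all zero r _ g = refl
  candidates-all (suc m) r r≤k g = trans (∑-nonEmptySubsets m g) (sym (trans (candidates-split m r g)
    (cong₂ _⊕_ (sym (candidates-all m r r≤k g)) (cong₂ _⊕_ (trans (⟦⟧⊗-yes (T? (r ≤ᵇ k)) (ℕ.≤⇒≤ᵇ r≤k)) (sym (candidates-all m r r≤k _))) (⊗-identityˡ _)))))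

module _ (w : ℕ → ℕ → ℤ) (mo qo : ℕ → ℕ → Bool) where
  open SetTableaux w mo qo

  candidates-single : ∀ m r → (∀ ℓ → ¬ T (mo ℓ r)) → (∀ ℓ → ℓ ≤ m → T (qo ℓ r)) → ∀ g → ∑ (map (_∷ []) (range1 m)) g ≡ ∑ (candidates m r) g
  candidates-single zero r _ _ g = refl
  candidates-single (suc m) r hm hq g = trans (∑-map (_∷ []) (range1 (suc m))) (trans (∑-range1 m (g ∘ (_∷ []))) (sym (trans (candidates-split m r g)
    (cong₂ _⊕_ (trans (sym (candidates-single m r hm (λ ℓ p → hq ℓ (ℕ.m≤n⇒m≤1+n p)) g)) (∑-map (_∷ []) (range1 m)))
      (trans (cong₂ _⊕_ (⟦⟧⊗-no (T? (mo (suc m) r)) (hm (suc m))) (⟦⟧⊗-yes (T? (qo (suc m) r)) (hq (suc m) ℕ.≤-refl))) (⊕-identityˡ _))))))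

  candidates-stop : ∀ m r k → (∀ ℓ → ¬ T (mo ℓ r)) → (∀ ℓ → k < ℓ → ¬ T (qo ℓ r)) → k ≤ m → ∀ g → ∑ (candidates k r) g ≡ ∑ (candidates m r) g
  candidates-stop zero r zero hm hq z≤n g = refl
  candidates-stop (suc m) r k hm hq le g with k ≟ suc m
  ... | yes refl = refl
  ... | no ne = trans (candidates-stop m r k hm hq (ℕ.≤-pred (ℕ.≤∧≢⇒< le ne)) g) (sym (trans (candidates-split m r g)
    (trans (⊕-congʳ (trans (cong₂ _⊕_ (⟦⟧⊗-no (T? (mo (suc m) r)) (hm (suc m))) (⟦⟧⊗-no (T? (qo (suc m) r)) (hq (suc m) (ℕ.≤∧≢⇒< le ne)))) (⊕-identityˡ _))) (⊕-identityʳ _))))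

flaggedLabels-all : ∀ K r → K ≤ r → ∀ g → ∑ (range1 K) g ≡ ∑ (flaggedLabels K r) g
flaggedLabels-all zero r _ g = refl
flaggedLabels-all (suc K) r le g rewrite T-true {suc K ≤ᵇ r} (ℕ.≤⇒≤ᵇ le) = trans (∑-range1 K g)
  (sym (trans (∑-++ (flaggedLabels K r) _) (cong₂ _⊕_ (sym (flaggedLabels-all K r (ℕ.<⇒≤ le) g)) (⊕-identityʳ _))))

flaggedLabels-range : ∀ K r → r ≤ K → ∀ g → ∑ (range1 r) g ≡ ∑ (flaggedLabels K r) g
flaggedLabels-range zero zero _ g = refl
flaggedLabels-range (suc K) r le g with suc K ≤? r
... | yes p with refl ← ℕ.≤-antisym le p = flaggedLabels-all (suc K) r ℕ.≤-refl g
... | no p rewrite T-false {suc K ≤ᵇ r} (p ∘ ℕ.≤ᵇ⇒≤ (suc K) r) = trans (flaggedLabels-range K r (ℕ.≤-pred (ℕ.≰⇒> p)) g)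
  (sym (trans (∑-++ (flaggedLabels K r) []) (⊕-identityʳ _)))

singleton : Box × ℕ → Box × List ℕ
singleton (b , v) = b , v ∷ []

sumF-singletons : ∀ S (C : Box → List ℕ) f → sumF S (λ b → map (_∷ []) (C b)) f ≡ sumF S C (λ F → f (map singleton F))
sumF-singletons [] C f = refl
sumF-singletons (b ∷ S) C f = trans (∑-map (_∷ []) (C b)) (∑-cong (C b) (λ v → sumF-singletons S C _))

Convex : List Box → Set
Convex S = ∀ {b d e} → b ∈ S → e ∈ S → b ≼ d → d ≼ e → d ∈ S

-- `semistandardᵇ` compares any two boxes of a row or column, `setSemistandardᵇ` only neighbours.
-- Convexity supplies the boxes in between, along which the inequalities are chained.
semistandard-singletons : ∀ {C : Box → List ℕ} {S F} → Convex S → Filling C S F → semistandardᵇ F ≡ setSemistandardᵇ (map singleton F)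
semistandard-singletons {C} {S} {F} cvx fill = T-iff to from
  where
  to : T (semistandardᵇ F) → T (setSemistandardᵇ (map singleton F))
  to h = T-allPairs⁺ (map singleton F) λ p q → pair p q
    where
    pair : ∀ {x y} → x ∈ map singleton F → y ∈ map singleton F → _
    pair p q with ((r , c) , v) , p′ , refl ← ∈.∈-map⁻ singleton p | ((r′ , c′) , u) , q′ , refl ← ∈.∈-map⁻ singleton q =
      T-∧⁺ (T-⇒⁺ (λ e → let e₁ , e₂ = T-∧⁻ {r ≡ᵇ r′} e in ℕ.≤⇒≤ᵇ (ℕ.≤-trans (ℕ.≤-reflexive (ℕ.⊔-identityʳ v)) (ℕ.≤ᵇ⇒≤ v u (T-⇒⁻ (proj₁ (T-∧⁻ hh))
             (T-∧⁺ e₁ (ℕ.<⇒<ᵇ (ℕ.≤-reflexive (ℕ.≡ᵇ⇒≡ (suc c) c′ e₂)))))))))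
           (T-⇒⁺ (λ e → let e₁ , e₂ = T-∧⁻ {c ≡ᵇ c′} e in ℕ.<⇒<ᵇ (ℕ.≤-trans (s≤s (ℕ.≤-reflexive (ℕ.⊔-identityʳ v))) (ℕ.<ᵇ⇒< v u (T-⇒⁻ (proj₂ (T-∧⁻ hh))
             (T-∧⁺ e₁ (ℕ.<⇒<ᵇ (ℕ.≤-reflexive (ℕ.≡ᵇ⇒≡ (suc r) r′ e₂)))))))))
      where hh = T-allPairs⁻ F h p′ q′
  from : T (setSemistandardᵇ (map singleton F)) → T (semistandardᵇ F)
  from h = T-allPairs⁺ F λ { {(r , c) , v} {(r′ , c′) , u} p q →
      T-∧⁺ (T-⇒⁺ (λ e → let e₁ , e₂ = T-∧⁻ {r ≡ᵇ r′} e in ℕ.≤⇒≤ᵇ (along-row (c′ ∸ suc c) p (subst₂ (λ x y → ((x , y) , u) ∈ F)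
             (sym (ℕ.≡ᵇ⇒≡ r r′ e₁)) (sym (trans (ℕ.+-suc c _) (ℕ.m+[n∸m]≡n (ℕ.<ᵇ⇒< c c′ e₂)))) q))))
           (T-⇒⁺ (λ e → let e₁ , e₂ = T-∧⁻ {c ≡ᵇ c′} e in ℕ.<⇒<ᵇ (along-column (r′ ∸ suc r) p (subst₂ (λ x y → ((x , y) , u) ∈ F)
             (sym (trans (ℕ.+-suc r _) (ℕ.m+[n∸m]≡n (ℕ.<ᵇ⇒< r r′ e₂)))) (sym (ℕ.≡ᵇ⇒≡ c c′ e₁)) q)))) }
    where
    right : ∀ {r c v u} → ((r , c) , v) ∈ F → ((r , suc c) , u) ∈ F → v ≤ u
    right {r} {c} {v} {u} p q = ℕ.≤-trans (ℕ.≤-reflexive (sym (ℕ.⊔-identityʳ v))) (ℕ.≤ᵇ⇒≤ _ u (T-⇒⁻ (proj₁ (T-∧⁻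
      (T-allPairs⁻ (map singleton F) h (∈.∈-map⁺ singleton p) (∈.∈-map⁺ singleton q)))) (T-∧⁺ (≡ᵇ-refl r) (≡ᵇ-refl (suc c)))))
    down : ∀ {r c v u} → ((r , c) , v) ∈ F → ((suc r , c) , u) ∈ F → v < u
    down {r} {c} {v} {u} p q = ℕ.≤-trans (s≤s (ℕ.≤-reflexive (sym (ℕ.⊔-identityʳ v)))) (ℕ.<ᵇ⇒< _ u (T-⇒⁻ (proj₂ (T-∧⁻
      (T-allPairs⁻ (map singleton F) h (∈.∈-map⁺ singleton p) (∈.∈-map⁺ singleton q)))) (T-∧⁺ (≡ᵇ-refl c) (≡ᵇ-refl (suc r)))))
    along-row : ∀ g {r c v u} → ((r , c) , v) ∈ F → ((r , c ℕ.+ suc g) , u) ∈ F → v ≤ u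
    along-row zero {r} {c} {u = u} p q = right p (subst (λ x → ((r , x) , u) ∈ F) (ℕ.+-comm c 1) q)
    along-row (suc g) {r} {c} {u = u} p q with Filling-lookup fill (cvx {d = r , suc c} (proj₁ (Filling-∈ fill p)) (proj₁ (Filling-∈ fill q))
        (ℕ.≤-refl , ℕ.n≤1+n c) (ℕ.≤-refl , ℕ.≤-trans (s≤s (ℕ.m≤m+n c (suc g))) (ℕ.≤-reflexive (sym (ℕ.+-suc c (suc g))))))
    ... | x , m , _ = ℕ.≤-trans (right p m) (along-row g m (subst (λ y → ((r , y) , u) ∈ F) (ℕ.+-suc c (suc g)) q))
    along-column : ∀ g {r c v u} → ((r , c) , v) ∈ F → ((r ℕ.+ suc g , c) , u) ∈ F → v < u
    along-column zero {r} {c} {u = u} p q = down p (subst (λ x → ((x , c) , u) ∈ F) (ℕ.+-comm r 1) q)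
    along-column (suc g) {r} {c} {u = u} p q with Filling-lookup fill (cvx {d = suc r , c} (proj₁ (Filling-∈ fill p)) (proj₁ (Filling-∈ fill q))
        (ℕ.n≤1+n r , ℕ.≤-refl) (ℕ.≤-trans (s≤s (ℕ.m≤m+n r (suc g))) (ℕ.≤-reflexive (sym (ℕ.+-suc r (suc g)))) , ℕ.≤-refl))
    ... | x , m , _ = ℕ.<-trans (down p m) (along-column g m (subst (λ y → ((y , c) , u) ∈ F) (ℕ.+-suc r (suc g)) q))

sign-+ : ∀ a b → sign a ⊗ sign b ≡ sign (a ℕ.+ b)
sign-+ zero b = ⊗-identityˡ _
sign-+ (suc a) b = trans (⊗-congˡ (sym (⊖-def (sign a)))) (trans (solve 2 (λ x y → (:- x) :* y := :- (x :* y)) refl (sign a) (sign b))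
  (trans (cong ⊖_ (sign-+ a b)) (⊖-def _)))

-- The second component is carried along because the exponent is a truncated subtraction, which adds
-- up over the boxes only when it does not truncate.
sgF-labelCount : ∀ {C : Box → List (List ℕ)} {S F} → (∀ {b v} → v ∈ C b → T (nonEmptyᵇ v)) → Filling C S F →
  sgF F ≡ sign (labelCount F ∸ length S) × length S ≤ labelCount F
sgF-labelCount h [] = refl , z≤n
sgF-labelCount {C} {_ ∷ S} h (_∷_ {b} {v} {F = F} v∈ fill) with v | h {b} v∈ | sgF-labelCount h fill
... | x ∷ v | _ | e , le = trans (⊗-congʳ e) (trans (sign-+ (length v) _) (cong sign (sym (ℕ.+-∸-assoc (length v) le)))) ,
  s≤s (ℕ.≤-trans le (ℕ.m≤n+m _ (length v)))

-- When all rows are at most k, every box may carry several labels, so S⁽ᵏ⁾ is the full set-valued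
-- sum.
GCoeff-tableaux : ∀ c k S → (∀ {b} → b ∈ S → row b ≤ k) →
  GCoeff S c ≡ SetTableaux.tableaux (exactly c) (λ _ r → r ≤ᵇ k) (λ _ _ → true) (length c) S
GCoeff-tableaux c k S h = trans (GCoeff-sum S c) (trans
  (sumF-candidates S (λ b∈ → candidates-all (exactly c) k (length c) _ (h b∈)) _)
  (sumF-cong S λ F fill → trans (cong₂ _⊗_ (⟦T?∧⟧ (setSemistandardᵇ F) (setContentIsᵇ c F))
      (sym (proj₁ (sgF-labelCount (λ {b} v∈ → proj₁ (candidates-labels (length c) (row b) v∈)) fill))))
    (trans (⊗-congˡ (⊗-congʳ (sym (contentWeight-exactly c (length c) F))))
      (solve 3 (λ a b d → (a :* b) :* d := a :* (d :* b)) refl _ _ _))))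
  where open SetTableaux (exactly c) (λ _ r → r ≤ᵇ k) (λ _ _ → true)

sgF-singletons : ∀ F → sgF (map singleton F) ≡ 1ℤ
sgF-singletons [] = refl
sgF-singletons (_ ∷ F) = trans (⊗-identityˡ _) (sgF-singletons F)

count-singletons : ∀ i F → count i (map singleton F) ≡ countᵇ (λ bv → proj₂ bv ≡ᵇ i) F
count-singletons i [] = refl
count-singletons i ((_ , v) ∷ F) rewrite ∨-identityʳ (i ≡ᵇ v) | T-iff {i ≡ᵇ v} {v ≡ᵇ i} (λ e → ℕ.≡⇒≡ᵇ v i (sym (ℕ.≡ᵇ⇒≡ i v e))) (λ e → ℕ.≡⇒≡ᵇ i v (sym (ℕ.≡ᵇ⇒≡ v i e)))
  with v ≡ᵇ i
... | true = cong suc (count-singletons i F)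
... | false = count-singletons i F

-- For k = 0 no row may carry several labels; the set-valued tableaux that remain consist of
-- singletons.
sCoeff-tableaux : ∀ c S → Convex S → (∀ {b} → b ∈ S → 1 ≤ row b) →
  + sCoeff S c ≡ SetTableaux.tableaux (exactly c) (λ _ r → r ≤ᵇ 0) (λ _ _ → true) (length c) S
sCoeff-tableaux c S cvx h = begin
  + sCoeff S c ≡⟨ sCoeff-sum S c ⟩
  sumF S (λ _ → range1 m) (λ F → ⟦ T? (semistandardᵇ F ∧ contentIsᵇ c F) ⟧)
    ≡⟨ sumF-cong S (λ F fill → trans (⟦T?∧⟧ (semistandardᵇ F) (contentIsᵇ c F)) (cong₂ _⊗_ (cong (λ x → ⟦ T? x ⟧) (semistandard-singletons cvx fill))
         (trans (cong (λ x → ⟦ T? x ⟧) (all-cong (range1 m) (λ i → cong (_≡ᵇ entry c i) (sym (count-singletons i F)))))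
           (trans (sym (contentWeight-exactly c m (map singleton F))) (sym (trans (⊗-congˡ (sgF-singletons F)) (⊗-identityˡ _))))))) ⟩
  sumF S (λ _ → range1 m) (f ∘ map singleton) ≡⟨ sumF-singletons S (λ _ → range1 m) f ⟨
  sumF S (λ _ → map (_∷ []) (range1 m)) f
    ≡⟨ sumF-candidates S (λ {b} b∈ → candidates-single (exactly c) (λ _ r → r ≤ᵇ 0) (λ _ _ → true) m (row b)
         (λ _ q → ℕ.<⇒≱ (h b∈) (ℕ.≤ᵇ⇒≤ (row b) 0 q)) (λ _ _ → tt)) f ⟩
  SetTableaux.tableaux (exactly c) (λ _ r → r ≤ᵇ 0) (λ _ _ → true) m S ∎
  where
  m = length c
  f : List (Box × List ℕ) → ℤ
  f F = ⟦ T? (setSemistandardᵇ F) ⟧ ⊗ (sgF F ⊗ contentWeight (exactly c) m F)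

-- A label in row r is at most r - 1 ≤ K, so the alphabet 1, ..., K of the chain is large enough.
bCount-tableaux : ∀ K S → Convex S → (∀ {b} → b ∈ S → 1 ≤ row b × row b ∸ 1 ≤ K) →
  + bCount S ≡ SetTableaux.tableaux (λ _ _ → 1ℤ) (λ _ _ → false) (λ ℓ r → ℓ <ᵇ r) K S
bCount-tableaux K S cvx h = begin
  + bCount S ≡⟨ bCount-sum S ⟩
  sumF S (λ b → range1 (row b ∸ 1)) (λ F → ⟦ T? (semistandardᵇ F) ⟧)
    ≡⟨ sumF-cong S (λ F fill → trans (cong (λ x → ⟦ T? x ⟧) (semistandard-singletons cvx fill))
         (sym (trans (⊗-congʳ (trans (cong₂ _⊗_ (sgF-singletons F) (content-one K (map singleton F))) (⊗-identityˡ _))) (⊗-identityʳ _)))) ⟩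
  sumF S (λ b → range1 (row b ∸ 1)) (f ∘ map singleton) ≡⟨ sumF-singletons S (λ b → range1 (row b ∸ 1)) f ⟨
  sumF S (λ b → map (_∷ []) (range1 (row b ∸ 1))) f
    ≡⟨ sumF-candidates S (λ {b} b∈ g → trans
         (candidates-single (λ _ _ → 1ℤ) (λ _ _ → false) (λ ℓ r → ℓ <ᵇ r) (row b ∸ 1) (row b) (λ _ ()) (λ ℓ p → ℕ.<⇒<ᵇ (ℕ.≤-trans (s≤s p) (ℕ.≤-reflexive (ℕ.m+[n∸m]≡n (proj₁ (h b∈)))))) g)
         (candidates-stop (λ _ _ → 1ℤ) (λ _ _ → false) (λ ℓ r → ℓ <ᵇ r) K (row b) (row b ∸ 1) (λ _ ()) (λ ℓ p q → ℕ.<⇒≱ p (ℕ.∸-monoˡ-≤ 1 (ℕ.<ᵇ⇒< ℓ (row b) q))) (proj₂ (h b∈)) g)) f ⟩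
  SetTableaux.tableaux (λ _ _ → 1ℤ) (λ _ _ → false) (λ ℓ r → ℓ <ᵇ r) K S ∎
  where
  f : List (Box × List ℕ) → ℤ
  f F = ⟦ T? (setSemistandardᵇ F) ⟧ ⊗ (sgF F ⊗ contentWeight (λ _ _ → 1ℤ) K F)
  content-one : ∀ m F → contentWeight (λ _ _ → 1ℤ) m F ≡ 1ℤ
  content-one zero F = refl
  content-one (suc m) F = trans (⊗-identityˡ _) (content-one m F)

parity-sign : ∀ {C : Box → List 𝒱} {S F} → Filling C S F → parity F ≡ sign (length S)
parity-sign [] = refl
parity-sign (_ ∷ fill) = trans (cong ⊖_ (parity-sign fill)) (⊖-def _)

reverseTableaux-aCount : ∀ K S → (∀ {b} → b ∈ S → row b ≤ K) → reverseTableaux K S ≡ sign (length S) ⊗ + aCount S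
reverseTableaux-aCount K S h = begin
  reverseTableaux K S ≡⟨ sumF-candidates S (λ {b} b∈ → flaggedLabels-range K (row b) (h b∈)) _ ⟨
  sumF S (λ b → range1 (row b)) (λ F → ⟦ T? (reverseRowStrictᵇ F) ⟧ ⊗ parity F)
    ≡⟨ sumF-cong S (λ F fill → trans (⊗-congʳ (parity-sign fill)) (⊗-comm _ _)) ⟩
  sumF S (λ b → range1 (row b)) (λ F → sign (length S) ⊗ ⟦ T? (reverseRowStrictᵇ F) ⟧) ≡⟨ sumF-*ˡ S _ (sign (length S)) ⟩
  sign (length S) ⊗ sumF S (λ b → range1 (row b)) (λ F → ⟦ T? (reverseRowStrictᵇ F) ⟧) ≡⟨ ⊗-congʳ (aCount-sum S) ⟨
  sign (length S) ⊗ + aCount S ∎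

-- Coordinates of the boxes between two vectors.

at : Vec ℕ n → ℕ → ℕ
at [] i = 0
at (x ∷ v) zero = x
at (x ∷ v) (suc i) = at v i

at-≤ᵛ : {u v : Vec ℕ n} → u ≤ᵛ v → ∀ i → at u i ≤ at v i
at-≤ᵛ [] i = z≤n
at-≤ᵛ (p ∷ ps) zero = p
at-≤ᵛ (p ∷ ps) (suc i) = at-≤ᵛ ps i

at-bound : ∀ {p} {v : Vec ℕ n} → Descending p v → ∀ i → at v i ≤ p
at-bound [] i = z≤n
at-bound (q ∷ d) zero = q
at-bound (q ∷ d) (suc i) = ℕ.≤-trans (at-bound d i) q

at-antitone : ∀ {p} {v : Vec ℕ n} → Descending p v → ∀ {i j} → i ≤ j → at v j ≤ at v i
at-antitone [] _ = z≤n
at-antitone (q ∷ d) {j = zero} z≤n = ℕ.≤-refl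
at-antitone (q ∷ d) {j = suc j} z≤n = at-bound d j
at-antitone (q ∷ d) (s≤s p) = at-antitone d p

at-height : ∀ {h} (v : Vec ℕ n) → HeightLE h v → ∀ {i} → h ≤ i → at v i ≡ 0
at-height [] _ _ = refl
at-height {h = zero} (x ∷ v) (e , _) {zero} _ = e
at-height {h = zero} (x ∷ v) (_ , p) {suc i} _ = at-height v p z≤n
at-height {h = suc h} (x ∷ v) p (s≤s q) = at-height v p q

at-length : (v : Vec ℕ n) → ∀ {i} → n ≤ i → at v i ≡ 0
at-length [] _ = refl
at-length (x ∷ v) (s≤s p) = at-length v p

at-ext : {u v : Vec ℕ n} → (∀ i → at u i ≡ at v i) → u ≡ v
at-ext {u = []} {[]} h = refl
at-ext {u = x ∷ u} {y ∷ v} h = cong₂ _∷_ (h 0) (at-ext (h ∘ suc))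

HeightLE-all : ∀ {h} (v : Vec ℕ n) → n ≤ h → HeightLE h v
HeightLE-all [] _ = tt
HeightLE-all {h = suc h} (x ∷ v) (s≤s p) = HeightLE-all v p

HeightLE-at : ∀ h (v : Vec ℕ n) → (∀ i → h ≤ i → at v i ≡ 0) → HeightLE h v
HeightLE-at h [] _ = tt
HeightLE-at zero (x ∷ v) p = p 0 z≤n , HeightLE-at zero v (λ i _ → p (suc i) z≤n)
HeightLE-at (suc h) (x ∷ v) p = HeightLE-at h v (λ i q → p (suc i) (s≤s q))

module _ (z : ℕ) where
  open Shapes z

  InBoxes : ℕ → Vec ℕ n → Vec ℕ n → Box → Set
  InBoxes s t d b = ∃₂ λ i j → b ≡ (s ℕ.+ i , j ℕ.+ z) × at t i < j × j ≤ at d i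

  boxes-∈⁻ : ∀ s (t d : Vec ℕ n) {b} → b ∈ boxes s t d → InBoxes s t d b
  boxes-∈⁻ s [] [] ()
  boxes-∈⁻ s (t ∷ ts) (d ∷ ds) p with ∈.∈-++⁻ (rowCells s t d) p
  ... | inj₁ q with j , e , r ← rowCells-∈⁻ z s t d q = 0 , j , trans e (cong (_, j ℕ.+ z) (sym (ℕ.+-identityʳ s))) , r
  ... | inj₂ q with i , j , e , r ← boxes-∈⁻ (suc s) ts ds q = suc i , j , trans e (cong (_, j ℕ.+ z) (sym (ℕ.+-suc s i))) , r

  boxes-∈⁺ : ∀ s (t d : Vec ℕ n) i j → at t i < j → j ≤ at d i → (s ℕ.+ i , j ℕ.+ z) ∈ boxes s t d
  boxes-∈⁺ s [] [] i j p q = contradiction (ℕ.≤-trans p q) λ ()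
  boxes-∈⁺ s (t ∷ ts) (d ∷ ds) zero j p q = ∈.∈-++⁺ˡ (subst (λ x → (x , j ℕ.+ z) ∈ rowCells s t d) (sym (ℕ.+-identityʳ s)) (rowCells-∈⁺ z s j p q))
  boxes-∈⁺ s (t ∷ ts) (d ∷ ds) (suc i) j p q = ∈.∈-++⁺ʳ (rowCells s t d)
    (subst (λ x → (x , j ℕ.+ z) ∈ boxes (suc s) ts ds) (sym (ℕ.+-suc s i)) (boxes-∈⁺ (suc s) ts ds i j p q))

  boxes-convex : ∀ s {p q} {t d : Vec ℕ n} → Descending p t → Descending q d → Convex (boxes s t d)
  boxes-convex s {t = t} {d} dt dd {d = r , c} p q (r₁ , c₁) (r₂ , c₂)
    with i , j , refl , l₁ , l₂ ← boxes-∈⁻ s t d p | i′ , j′ , refl , m₁ , m₂ ← boxes-∈⁻ s t d q =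
    subst₂ (λ x y → (x , y) ∈ boxes s t d) er ec (boxes-∈⁺ s t d (r ∸ s) (c ∸ z)
      (ℕ.≤-<-trans (at-antitone dt i≤) (ℕ.<-≤-trans l₁ j≤)) (ℕ.≤-trans ≤j′ (ℕ.≤-trans m₂ (at-antitone dd ≤i′))))
    where
    er : s ℕ.+ (r ∸ s) ≡ r
    er = ℕ.m+[n∸m]≡n (ℕ.≤-trans (ℕ.m≤m+n s i) r₁)
    ec : (c ∸ z) ℕ.+ z ≡ c
    ec = ℕ.m∸n+n≡m (ℕ.≤-trans (ℕ.m≤n+m z j) c₁)
    i≤ : i ≤ r ∸ s
    i≤ = ℕ.+-cancelˡ-≤ s _ _ (ℕ.≤-trans r₁ (ℕ.≤-reflexive (sym er)))
    ≤i′ : r ∸ s ≤ i′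
    ≤i′ = ℕ.+-cancelˡ-≤ s _ _ (ℕ.≤-trans (ℕ.≤-reflexive er) r₂)
    j≤ : j ≤ c ∸ z
    j≤ = ℕ.+-cancelʳ-≤ z _ _ (ℕ.≤-trans c₁ (ℕ.≤-reflexive (sym ec)))
    ≤j′ : c ∸ z ≤ j′
    ≤j′ = ℕ.+-cancelʳ-≤ z _ _ (ℕ.≤-trans (ℕ.≤-reflexive ec) c₂)

  cells-unique : ∀ s a ℓ → Unique (cells s a ℓ)
  cells-unique s a zero = []
  cells-unique s a (suc ℓ) = All.tabulate (λ {x} p e → distinct p e) ∷ cells-unique s (suc a) ℓ
    where
    distinct : ∀ {x} → x ∈ cells s (suc a) ℓ → (s , suc a ℕ.+ z) ≡ x → ⊥
    distinct p refl with j , e , q , _ ← cells-∈⁻ z s (suc a) ℓ p = ℕ.<-irrefl (ℕ.+-cancelʳ-≡ z (suc a) j (cong proj₂ e)) q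

  boxes-unique : ∀ s (t d : Vec ℕ n) → Unique (boxes s t d)
  boxes-unique s [] [] = []
  boxes-unique s (t ∷ ts) (d ∷ ds) = Unique.++⁺ (cells-unique s t (d ∸ t)) (boxes-unique (suc s) ts ds) disjoint
    where
    disjoint : ∀ {x} → x ∈ rowCells s t d × x ∈ boxes (suc s) ts ds → ⊥
    disjoint (p , q) with j , refl , _ ← rowCells-∈⁻ z s t d p = ℕ.<-irrefl refl (boxes-row z (suc s) ts ds q)

  boxes-rows : ∀ {h} (t d : Vec ℕ n) → HeightLE h d → ∀ {b} → b ∈ boxes 1 t d → row b ≤ h
  boxes-rows {h = h} t d ht p with i , j , refl , q , r ← boxes-∈⁻ 1 t d p with suc i ≤? h
  ... | yes le = le
  ... | no nle = contradiction (ℕ.≤-trans q (ℕ.≤-trans r (ℕ.≤-reflexive (at-height d ht (ℕ.≤-pred (ℕ.≰⇒> nle)))))) λ ()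

-- The expansion for shapes given by row lengths.

module Canonical (z B : ℕ) where
  open Shapes z
  open Matrices B
  open ChainIdentity B
  open Linking z B
  open SetRows z B using (removeFrom)

  removeFrom-strip : ∀ mo qo s (t d κ : Vec ℕ n) w → removeFrom mo qo s t d κ w ≢ 0ℤ → Strip d κ × t ≤ᵛ κ
  removeFrom-strip mo qo s [] [] [] w _ = [] , []
  removeFrom-strip mo qo s (t ∷ ts) (d ∷ ds) (κ ∷ κs) w h with t ≤? κ | next ds ≤? κ | κ ≤? d
  ... | no _ | _ | _ = contradiction (⊗-zeroˡ _) h
  ... | yes _ | no _ | _ = contradiction (trans (⊗-congʳ (⊗-zeroˡ _)) (⊗-zeroʳ _)) h
  ... | yes _ | yes _ | no _ = contradiction (trans (⊗-congʳ (trans (⊗-congʳ (⊗-zeroˡ _)) (⊗-zeroʳ _))) (⊗-zeroʳ _)) h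
  ... | yes p | yes q | yes r = strip q r (proj₁ rest) , p ∷ proj₂ rest
    where
    r₁ = removeFrom mo qo (suc s) ts ds κs (λ x → w ((d ∸ κ) ℕ.+ x))
    r₂ = removeFrom mo qo (suc s) ts ds κs (λ x → w ((d ∸ κ) ℕ.+ suc x))
    rest : Strip ds κs × ts ≤ᵛ κs
    rest with r₁ ℤ.≟ 0ℤ | r₂ ℤ.≟ 0ℤ
    ... | no e | _ = removeFrom-strip mo qo (suc s) ts ds κs _ e
    ... | yes _ | no e = removeFrom-strip mo qo (suc s) ts ds κs _ e
    ... | yes e | yes e′ = contradiction (trans (⊗-congʳ (⊗-congʳ (⊗-congʳ (⊗-congʳ (cong₂ (λ a b → a ⊕ ⊖ (⟦ T? (mo s) ⟧ ⊗ (⟦ t <? κ ⟧ ⊗ (⟦ next ds <? κ ⟧ ⊗ b)))) e e′)))))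
      (solve 4 (λ a b c d → con 1ℤ :* (con 1ℤ :* (con 1ℤ :* (d :* (con 0ℤ :+ :- (a :* (b :* (c :* con 0ℤ))))))) := con 0ℤ) refl _ _ _ _)) h

  -- Each label forms a horizontal strip up to marks and opens at most one new row. Thus m labels
  -- below a boundary of height h reach row m + h at most, which makes the sum over μ finite for a
  -- given content.
  tableaux-height : ∀ w mo qo m {h p q} (t d : Vec ℕ n) → Descending p t → Descending q d → q ≤ B → t ≤ᵛ d → HeightLE h t →
    SetTableaux.tableaux w mo qo m (boxes 1 t d) ≢ 0ℤ → HeightLE (m ℕ.+ h) d
  tableaux-height w mo qo zero t d dt dd q≤B le ht nz
    with refl ← δ≢0 t d (λ e → nz (trans (tableaux-zero w mo qo 1 le) e)) = ht
  tableaux-height {n = n} w mo qo (suc m) {h} t d dt dd q≤B le ht nz = descend (ΣV≢0 n summands (λ e → nz (trans (SetTableaux.tableaux-peel w mo qo m z B t d le dt dd q≤B) e)))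
    where
    factor summands : Vec ℕ n → ℤ
    factor κ = removeFrom (mo (suc m)) (qo (suc m)) 1 t d κ (w (suc m))
    summands κ = factor κ ⊗ SetTableaux.tableaux w mo qo m (boxes 1 t κ)
    descend : (∃ λ κ → summands κ ≢ 0ℤ) → HeightLE (suc m ℕ.+ h) d
    descend (κ , p) with s , le′ ← removeFrom-strip (mo (suc m)) (qo (suc m)) 1 t d κ (w (suc m)) (*≢0ˡ (factor κ) _ p) =
      Strip-height s (tableaux-height w mo qo m t κ dt (Strip-descendingˡ s dd) q≤B le′ ht (*≢0ʳ (factor κ) _ p))

  vertical-descending : ∀ k s (a b : Vec ℕ n) → vertical k s a b ≢ 0ℤ → ∀ {p} → next a ≤ p → Descending p a
  vertical-descending k s [] [] _ _ = []
  vertical-descending k s (a ∷ as) (b ∷ bs) h le = le ∷ vertical-descending k (suc s) as bs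
    (*≢0ʳ _ _ (*≢0ʳ ⟦ next bs ≤? b ⟧ _ (*≢0ʳ ⟦ next as ≤? a ⟧ _ h))) (⟦⟧≢0 (next as ≤? a) (*≢0ˡ _ _ h))

  verticalChain-descending : ∀ K {p} (a t : Vec ℕ n) → verticalChain K a t ≢ 0ℤ → Descending p t → Descending p a
  verticalChain-descending zero a t h d with refl ← δ≢0 a t h = d
  verticalChain-descending (suc K) a t h d with b , p , q ← ∙≢0 (vertical (suc K) 1) (verticalChain K) a t h =
    vertical-descending (suc K) 1 a b p (ℕ.≤-trans (next-≤ᵛ (proj₁ (vertical-above z B (suc K) 1 a b p)))
      (next≤ (verticalChain-descending K b t q d)))

  Descending? : ∀ p (v : Vec ℕ n) → Dec (Descending p v)
  Descending? p [] = yes []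
  Descending? p (x ∷ v) with x ≤? p | Descending? x v
  ... | yes q | yes d = yes (q ∷ d)
  ... | no q | _ = no λ { (r ∷ _) → q r }
  ... | yes _ | no d = no λ { (_ ∷ e) → d e }

  HeightLE? : ∀ h (v : Vec ℕ n) → Dec (HeightLE h v)
  HeightLE? h [] = yes tt
  HeightLE? zero (x ∷ v) = (x ≟ 0) ×-dec HeightLE? zero v
  HeightLE? (suc h) (x ∷ v) = HeightLE? h v

  -- The pairs that describe the shapes μ ⊇ σ able to contribute; the height bound is the one forced
  -- by a nonzero coefficient of G.
  record Admissible {n} (K : ℕ) (t d d′ t′ : Vec ℕ n) : Set where
    constructor admissible
    field
      descending-d : Descending B d′
      descending-t : Descending B t′
      above : d ≤ᵛ d′
      below : t′ ≤ᵛ t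
      height : HeightLE K d′

  Admissible? : ∀ K (t d d′ t′ : Vec ℕ n) → Dec (Admissible K t d d′ t′)
  Admissible? K t d d′ t′ with Descending? B d′ | Descending? B t′ | Pointwise.decidable _≤?_ d d′ | Pointwise.decidable _≤?_ t′ t | HeightLE? K d′
  ... | yes a | yes b | yes c | yes e | yes f = yes (admissible a b c e f)
  ... | no a | _ | _ | _ | _ = no (a ∘ Admissible.descending-d)
  ... | yes _ | no b | _ | _ | _ = no (b ∘ Admissible.descending-t)
  ... | yes _ | yes _ | no c | _ | _ = no (c ∘ Admissible.above)
  ... | yes _ | yes _ | yes _ | no e | _ = no (e ∘ Admissible.below)
  ... | yes _ | yes _ | yes _ | yes _ | no f = no (f ∘ Admissible.height)

  -- A contributing μ ends by row K = length c + h, so S⁽ᴷ⁾ gives the coefficient of G for all of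
  -- them. The K strips H₁, ..., H_K start from height h and need n ≥ K + h rows.
  module _ (c : List ℕ) {h : ℕ} (t d : Vec ℕ n) (dt : Descending B t) (dd : Descending B d) (t≤d : t ≤ᵛ d) (ht : HeightLE h d)
    (long : (length c ℕ.+ h) ℕ.+ h ≤ n) where

    private
      M = length c
      K = M ℕ.+ h

      S : Vec ℕ n → Vec ℕ n → ℤ
      S d′ t′ = SetTableaux.tableaux (exactly c) (λ _ r → r ≤ᵇ K) (λ _ _ → true) M (boxes 1 t′ d′)

      ht′ : HeightLE h t
      ht′ = ≤ᵛ-height t≤d ht

    expandedTerm : Vec ℕ n → Vec ℕ n → ℤ
    expandedTerm d′ t′ = + bCount (boxes 1 d d′) ⊗ (GCoeff (boxes 1 t′ d′) c ⊗ (sign (length (boxes 1 t′ t)) ⊗ + aCount (boxes 1 t′ t)))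

    private
      row-positive : ∀ (u v : Vec ℕ n) {b} → b ∈ boxes 1 u v → 1 ≤ row b
      row-positive u v p with _ , _ , refl , _ ← boxes-∈⁻ z 1 u v p = s≤s z≤n

      -- A nonzero product implies all conditions of `Admissible` through the supports of its
      -- factors; for an admissible pair each factor is one of the counts in `expandedTerm`.
      summand : ∀ d′ t′ → addChain K d d′ ⊗ (S d′ t′ ⊗ verticalChain K t′ t) ≡ ⟦ Admissible? K t d d′ t′ ⟧ ⊗ expandedTerm d′ t′
      summand d′ t′ with Admissible? K t d d′ t′
      ... | yes (admissible dd′ dt′ above below hd′) = trans (cong₂ _⊗_
              (trans (sym (addChain-tableaux K above dd dd′)) (sym (bCount-tableaux K (boxes 1 d d′) (boxes-convex z 1 dd dd′)
                (λ p → row-positive d d′ p , ℕ.≤-trans (ℕ.m∸n≤m _ 1) (boxes-rows z d d′ hd′ p)))))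
              (cong₂ _⊗_ (sym (GCoeff-tableaux c K (boxes 1 t′ d′) (boxes-rows z t′ d′ hd′)))
                (trans (verticalChain-tableaux z B K below dt′ dt)
                  (reverseTableaux-aCount K (boxes 1 t′ t) (λ p → ℕ.≤-trans (boxes-rows z t′ t ht′ p) (ℕ.m≤n+m h M))))))
              (sym (⊗-identityˡ _))
      ... | no bad = trans vanish (sym (⊗-zeroˡ _))
        where
        vanish : addChain K d d′ ⊗ (S d′ t′ ⊗ verticalChain K t′ t) ≡ 0ℤ
        vanish with (addChain K d d′ ⊗ (S d′ t′ ⊗ verticalChain K t′ t)) ℤ.≟ 0ℤ
        ... | yes e = e
        ... | no nz = contradiction (admissible dd′ dt′ above below
                (tableaux-height (exactly c) (λ _ r → r ≤ᵇ K) (λ _ _ → true) M t′ d′ dt′ dd′ ℕ.≤-refl (≤ᵛ-trans below (≤ᵛ-trans t≤d above))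
                  (≤ᵛ-height below ht′) (*≢0ˡ (S d′ t′) _ nz₂))) bad
          where
          nz₂ : S d′ t′ ⊗ verticalChain K t′ t ≢ 0ℤ
          nz₂ = *≢0ʳ (addChain K d d′) _ nz
          ext = addChain-extends K d d′ (*≢0ˡ (addChain K d d′) _ nz) dd ht
          dd′ = Extends.descending ext
          above = Extends.above ext
          nzA = *≢0ʳ (S d′ t′) _ nz₂
          below = verticalChain-below z B K t′ t nzA
          dt′ = verticalChain-descending K t′ t nzA dt

    canonical-expansion : + sCoeff (boxes 1 t d) c ≡ ΣV n (λ d′ → ΣV n (λ t′ → ⟦ Admissible? K t d d′ t′ ⟧ ⊗ expandedTerm d′ t′))
    canonical-expansion = begin
      + sCoeff (boxes 1 t d) c ≡⟨ sCoeff-tableaux c (boxes 1 t d) (boxes-convex z 1 dt dd) (row-positive t d) ⟩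
      -- R₀ is the identity, so the kernels without marks give S⁽⁰⁾ without correction.
      S₀ d t ≡⟨ trans (removeChain-rook 0 (exactly c) M d t dd dt t≤d) (trans (∙-congʳ S₀ {rook 0 1} {δ} d t (λ t′ _ → rook-zero 0 t′ t dt)) (∙-δ S₀ d dt ℕ.≤-refl)) ⟨
      removeChain (exactly c) 0 M d t ≡⟨ expansion (exactly c) K M S dd ht long
        (λ d′ t′ dd′ dt′ le → removeChain-rook K (exactly c) M d′ t′ dd′ dt′ le) t dt t≤d ⟩
      ΣV n (λ d′ → addChain K d d′ ⊗ ΣV n (λ t′ → S d′ t′ ⊗ verticalChain K t′ t))
        ≡⟨ ΣV-cong n (λ d′ → trans (sym (ΣV-*ˡ n _)) (ΣV-cong n (summand d′))) ⟩
      ΣV n (λ d′ → ΣV n (λ t′ → ⟦ Admissible? K t d d′ t′ ⟧ ⊗ expandedTerm d′ t′)) ∎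
      where
      S₀ : Vec ℕ n → Vec ℕ n → ℤ
      S₀ d t = SetTableaux.tableaux (exactly c) (λ _ r → r ≤ᵇ 0) (λ _ _ → true) M (boxes 1 t d)

-- Independence of the sum from the chosen list of shapes.

module _ {R : 𝒜 → 𝒜 → Set} (R-sym : ∀ {x y} → R x y → R y x) (R-trans : ∀ {x y z} → R x y → R y z → R x z)
  (Valid : 𝒜 → Set) (f : 𝒜 → ℤ) (f-cong : ∀ {x y} → Valid x → Valid y → R x y → f x ≡ f y) where

  private
    separate : ∀ as {y bs} → AllPairs (λ x y → ¬ R x y) (as ++ y ∷ bs) →
      AllPairs (λ x y → ¬ R x y) (as ++ bs) × All (λ x → ¬ R y x) (as ++ bs)
    separate [] (h ∷ p) = p , h
    separate (a ∷ as) (h ∷ p) with q , r ← separate as p | h₁ , h₂ ∷ h₃ ← All.++⁻ as h = All.++⁺ h₁ h₃ ∷ q , (h₂ ∘ R-sym) ∷ r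

    omit : ∀ as {y bs} {P : 𝒜 → Set} → Any P (as ++ y ∷ bs) → ¬ P y → Any P (as ++ bs)
    omit as p ¬q with Any.++⁻ as p
    ... | inj₁ a = Any.++⁺ˡ a
    ... | inj₂ (here q) = contradiction q ¬q
    ... | inj₂ (there b) = Any.++⁺ʳ as b

  -- An element with nonzero value is matched with its partner in the other list and both are
  -- deleted; one with value zero is skipped. Elements of one list are pairwise unrelated, so no
  -- other element loses its partner by the deletion.
  ∑-coverings : ∀ xs ys → All Valid xs → All Valid ys →
    AllPairs (λ x y → ¬ R x y) xs → AllPairs (λ x y → ¬ R x y) ys →
    (∀ {x} → x ∈ xs → f x ≢ 0ℤ → Any (R x) ys) → (∀ {y} → y ∈ ys → f y ≢ 0ℤ → Any (R y) xs) → ∑ xs f ≡ ∑ ys f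
  ∑-coverings [] ys _ _ _ _ _ h = sym (∑-zero ys vanish)
    where
    vanish : ∀ {y} → y ∈ ys → f y ≡ 0ℤ
    vanish {y} p with f y ℤ.≟ 0ℤ
    ... | yes e = e
    ... | no e with () ← h p e
  ∑-coverings (x ∷ xs) ys (vx ∷ vxs) vys (dx ∷ dxs) dys g h with f x ℤ.≟ 0ℤ
  ... | yes e = trans (cong (_⊕ ∑ xs f) e) (trans (⊕-identityˡ _) (∑-coverings xs ys vxs vys dxs dys (g ∘ there) h′))
    where
    h′ : ∀ {y} → y ∈ ys → f y ≢ 0ℤ → Any (R y) xs
    h′ p ne with h p ne
    ... | here r = contradiction (trans (f-cong (All.lookup vys p) vx r) e) ne
    ... | there q = q
  ... | no fx≢0 with y , y∈ , r ← find (g (here refl) fx≢0) with as , bs , refl ← ∈.∈-∃++ y∈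
    with dys′ , dy ← separate as dys | vas , vy ∷ vbs ← All.++⁻ as vys = begin
    f x ⊕ ∑ xs f ≡⟨ cong₂ _⊕_ (f-cong vx vy r) (∑-coverings xs (as ++ bs) vxs (All.++⁺ vas vbs) dxs dys′ g′ h′) ⟩
    f y ⊕ ∑ (as ++ bs) f ≡⟨ ⊕-congʳ (∑-++ as bs) ⟩
    f y ⊕ (∑ as f ⊕ ∑ bs f) ≡⟨ solve 3 (λ a b c → a :+ (b :+ c) := b :+ (a :+ c)) refl _ _ _ ⟩
    ∑ as f ⊕ (f y ⊕ ∑ bs f) ≡⟨ ∑-++ as (y ∷ bs) ⟨
    ∑ (as ++ y ∷ bs) f ∎
    where
    g′ : ∀ {x′} → x′ ∈ xs → f x′ ≢ 0ℤ → Any (R x′) (as ++ bs)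
    g′ p ne = omit as (g (there p) ne) (λ q → All.lookup dx p (R-trans r (R-sym q)))
    reinsert : ∀ {y′} → y′ ∈ as ++ bs → y′ ∈ as ++ y ∷ bs
    reinsert p with ∈.∈-++⁻ as p
    ... | inj₁ q = ∈.∈-++⁺ˡ q
    ... | inj₂ q = ∈.∈-++⁺ʳ as (there q)
    h′ : ∀ {y′} → y′ ∈ as ++ bs → f y′ ≢ 0ℤ → Any (R y′) xs
    h′ p ne with h (reinsert p) ne
    ... | here q = contradiction (R-sym (R-trans q r)) (All.lookup dy p)
    ... | there q = q

SameSet-sym : ∀ {S S′} → SameSet S S′ → SameSet S′ S
SameSet-sym h b = mk⇔ (bwd (h b)) (fwd (h b))

SameSet-trans : ∀ {S S′ S″} → SameSet S S′ → SameSet S′ S″ → SameSet S S″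
SameSet-trans h h′ b = mk⇔ (fwd (h′ b) ∘ fwd (h b)) (bwd (h b) ∘ bwd (h′ b))

SameSet⇒↭ : ∀ {S S′} → Unique S → Unique S′ → SameSet S S′ → S ↭ S′
SameSet⇒↭ u u′ h = ∼bag⇒↭ (unique∧set⇒bag u u′ (λ {b} → h b))

term-↭ : ∀ σ c {μ ν} → μ ↭ ν → term σ c μ ≡ term σ c ν
term-↭ σ c {μ} {ν} p = cong₂ ℤ._*_ (cong sign (↭.↭-length a)) (cong₂ ℤ._*_ (cong +_ (cong₂ ℕ._*_ (aCount-↭ a) (bCount-↭ (filterᵇ-↭ _ p)))) (GCoeff-↭ c p))
  where
  a : Apart μ σ ↭ Apart ν σ
  a = filterᵇ-↭ _ p

T-any⁺ : ∀ {p : 𝒜 → Bool} {xs x} → x ∈ xs → T (p x) → T (any p xs)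
T-any⁺ {p = p} {y ∷ xs} (here refl) h with p y
... | true = tt
T-any⁺ {p = p} {y ∷ xs} (there q) h with p y
... | true = tt
... | false = T-any⁺ q h

T-any⁻ : ∀ {p : 𝒜 → Bool} xs → T (any p xs) → ∃ λ x → x ∈ xs × T (p x)
T-any⁻ {p = p} (y ∷ xs) h with p y in e
... | true = y , here refl , subst T (sym e) tt
... | false with x , q , r ← T-any⁻ xs h = x , there q , r

T-not⁺ : ∀ {b} → ¬ T b → T (not b)
T-not⁺ {false} _ = tt
T-not⁺ {true} h = h tt

T-not⁻ : ∀ {b} → T (not b) → ¬ T b
T-not⁻ {true} () _

T-∈ᵇ⁺ : ∀ {b S} → b ∈ S → T (b ∈ᵇ S)
T-∈ᵇ⁺ {r , c} p = T-any⁺ p (T-∧⁺ (≡ᵇ-refl r) (≡ᵇ-refl c))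

T-∈ᵇ⁻ : ∀ {b} S → T (b ∈ᵇ S) → b ∈ S
T-∈ᵇ⁻ {r , c} S h with (r′ , c′) , p , e ← T-any⁻ S h with e₁ , e₂ ← T-∧⁻ {r ≡ᵇ r′} e with refl ← ℕ.≡ᵇ⇒≡ r r′ e₁ | refl ← ℕ.≡ᵇ⇒≡ c c′ e₂ = p

InA InB : List Box → List Box → Box → Set
InA μ σ b = b ∈ μ × ¬ (b ∈ σ) × ∃ λ d → d ∈ σ × col d ≡ col b × row b < row d
InB μ σ b = b ∈ μ × ¬ (b ∈ σ) × ∃ λ d → d ∈ σ × col d ≡ col b × row d < row b

Apart-∈⁻ : ∀ μ σ {b} → b ∈ Apart μ σ → InA μ σ b
Apart-∈⁻ μ σ {b} p with q , h ← ∈.∈-filter⁻ (T? ∘ _) {xs = μ} p with h₁ , h₂ ← T-∧⁻ {not (b ∈ᵇ σ)} h with d , d∈ , e ← T-any⁻ σ h₂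
  with e₁ , e₂ ← T-∧⁻ {col d ≡ᵇ col b} e = q , (λ r → T-not⁻ h₁ (T-∈ᵇ⁺ r)) , d , d∈ , ℕ.≡ᵇ⇒≡ (col d) (col b) e₁ , ℕ.<ᵇ⇒< (row b) (row d) e₂

Bpart-∈⁻ : ∀ μ σ {b} → b ∈ Bpart μ σ → InB μ σ b
Bpart-∈⁻ μ σ {b} p with q , h ← ∈.∈-filter⁻ (T? ∘ _) {xs = μ} p with h₁ , h₂ ← T-∧⁻ {not (b ∈ᵇ σ)} h with d , d∈ , e ← T-any⁻ σ h₂
  with e₁ , e₂ ← T-∧⁻ {col d ≡ᵇ col b} e = q , (λ r → T-not⁻ h₁ (T-∈ᵇ⁺ r)) , d , d∈ , ℕ.≡ᵇ⇒≡ (col d) (col b) e₁ , ℕ.<ᵇ⇒< (row d) (row b) e₂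

Apart-∈⁺ : ∀ μ σ {b} → InA μ σ b → b ∈ Apart μ σ
Apart-∈⁺ μ σ {b} (q , h , d , d∈ , e , lt) = ∈.∈-filter⁺ (T? ∘ _) q
  (T-∧⁺ (T-not⁺ (h ∘ T-∈ᵇ⁻ σ)) (T-any⁺ d∈ (T-∧⁺ (ℕ.≡⇒≡ᵇ (col d) (col b) e) (ℕ.<⇒<ᵇ lt))))

Bpart-∈⁺ : ∀ μ σ {b} → InB μ σ b → b ∈ Bpart μ σ
Bpart-∈⁺ μ σ {b} (q , h , d , d∈ , e , lt) = ∈.∈-filter⁺ (T? ∘ _) q
  (T-∧⁺ (T-not⁺ (h ∘ T-∈ᵇ⁻ σ)) (T-any⁺ d∈ (T-∧⁺ (ℕ.≡⇒≡ᵇ (col d) (col b) e) (ℕ.<⇒<ᵇ lt))))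

-- Row lengths read off from a connected skew shape.

lenMax : {P : ℕ → Set} → (∀ j → Dec (P j)) → ℕ → ℕ
lenMax P? zero = 0
lenMax P? (suc n) with P? (suc n)
... | yes _ = suc n
... | no _ = lenMax P? n

lenMax-≤ : ∀ {P : ℕ → Set} (P? : ∀ j → Dec (P j)) n → lenMax P? n ≤ n
lenMax-≤ P? zero = z≤n
lenMax-≤ P? (suc n) with P? (suc n)
... | yes _ = ℕ.≤-refl
... | no _ = ℕ.m≤n⇒m≤1+n (lenMax-≤ P? n)

lenMax-⁺ : ∀ {P : ℕ → Set} (P? : ∀ j → Dec (P j)) n {j} → j ≤ n → P j → j ≤ lenMax P? n
lenMax-⁺ P? zero z≤n p = z≤n
lenMax-⁺ P? (suc n) {j} le p with P? (suc n)
... | yes _ = le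
... | no q with j ≟ suc n
...   | yes refl = contradiction p q
...   | no ne = lenMax-⁺ P? n (ℕ.≤-pred (ℕ.≤∧≢⇒< le ne)) p

lenMax-attained : ∀ {P : ℕ → Set} (P? : ∀ j → Dec (P j)) n → 1 ≤ lenMax P? n → P (lenMax P? n)
lenMax-attained P? (suc n) h with P? (suc n)
... | yes p = p
... | no _ = lenMax-attained P? n h

lenMax-mono : ∀ {P Q : ℕ → Set} (P? : ∀ j → Dec (P j)) (Q? : ∀ j → Dec (Q j)) n → (∀ {j} → 1 ≤ j → j ≤ n → P j → Q j) →
  lenMax P? n ≤ lenMax Q? n
lenMax-mono {P} P? Q? n h with lenMax P? n in e
... | zero = z≤n
... | suc j = lenMax-⁺ Q? n le (h (s≤s z≤n) le (subst P e (lenMax-attained P? n (ℕ.≤-trans (s≤s z≤n) (ℕ.≤-reflexive (sym e))))))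
  where
  le : suc j ≤ n
  le = ℕ.≤-trans (ℕ.≤-reflexive (sym e)) (lenMax-≤ P? n)

vecOf : ∀ n → ℕ → (ℕ → ℕ) → Vec ℕ n
vecOf zero s f = []
vecOf (suc n) s f = f s ∷ vecOf n (suc s) f

at-vecOf : ∀ n s f {i} → i < n → at (vecOf n s f) i ≡ f (s ℕ.+ i)
at-vecOf (suc n) s f {zero} _ = cong f (sym (ℕ.+-identityʳ s))
at-vecOf (suc n) s f {suc i} (s≤s p) = trans (at-vecOf n (suc s) f p) (cong f (sym (ℕ.+-suc s i)))

vecOf-descending : ∀ n s f {p} → f s ≤ p → (∀ i → f (suc i) ≤ f i) → Descending p (vecOf n s f)
vecOf-descending zero s f _ _ = []
vecOf-descending (suc n) s f le h = le ∷ vecOf-descending n (suc s) f (h s) h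

vecOf-≤ : ∀ n s f g → (∀ i → f i ≤ g i) → vecOf n s f ≤ᵛ vecOf n s g
vecOf-≤ zero s f g h = []
vecOf-≤ (suc n) s f g h = h s ∷ vecOf-≤ n (suc s) f g h

minimum : (f : 𝒜 → ℕ) → ∀ xs {x} → x ∈ xs → ∃ λ y → y ∈ xs × (∀ {u} → u ∈ xs → f y ≤ f u)
minimum f (x ∷ []) _ = x , here refl , λ { (here refl) → ℕ.≤-refl }
minimum f (x ∷ xs@(_ ∷ _)) _ with y , p , h ← minimum f xs (here refl) with ℕ.≤-total (f x) (f y)
... | inj₁ le = x , here refl , λ { (here refl) → ℕ.≤-refl ; (there q) → ℕ.≤-trans le (h q) }
... | inj₂ le = y , there p , λ { (here refl) → le ; (there q) → h q }

upper-bound : (f : 𝒜 → ℕ) → ∀ xs → ∃ λ N → ∀ {u} → u ∈ xs → f u ≤ N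
upper-bound f [] = 0 , λ ()
upper-bound f (x ∷ xs) with N , h ← upper-bound f xs = f x ⊔ N , λ { (here refl) → ℕ.m≤m⊔n _ _ ; (there q) → ℕ.≤-trans (h q) (ℕ.m≤n⊔m (f x) N) }

maximum : (f : 𝒜 → ℕ) → ∀ xs {x} → x ∈ xs → ∃ λ y → y ∈ xs × (∀ {u} → u ∈ xs → f u ≤ f y)
maximum f (x ∷ []) _ = x , here refl , λ { (here refl) → ℕ.≤-refl }
maximum f (x ∷ xs@(_ ∷ _)) _ with y , p , h ← maximum f xs (here refl) with ℕ.≤-total (f x) (f y)
... | inj₁ le = y , there p , λ { (here refl) → le ; (there q) → h q }
... | inj₂ le = x , here refl , λ { (here refl) → ℕ.≤-refl ; (there q) → ℕ.≤-trans (h q) le }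

-- Otherwise the box to the right of b lies strictly between b and d and belongs to S by interval
-- closure.
edge-col : ∀ {S b d} → IsSkewShape S → HasseEdge S b d → col d ≤ suc (col b)
edge-col {S} {r , c} {r′ , c′} (_ , _ , cvx) (b∈ , d∈ , ((r≤ , c≤) , _) , none) with c′ ≤? suc c
... | yes p = p
... | no p = contradiction (e , cvx b∈ d∈ b≼e e≼d , (b≼e , λ { () }) , (e≼d , λ { refl → p ℕ.≤-refl })) none
  where
  e : Box
  e = r , suc c
  b≼e : (r , c) ≼ e
  b≼e = ℕ.≤-refl , ℕ.n≤1+n c
  e≼d : e ≼ (r′ , c′)
  e≼d = r≤ , ℕ.<⇒≤ (ℕ.≰⇒> p)

-- A discrete intermediate value argument: an upward Hasse edge advances the column by at most one
-- and a downward edge never advances it, so the path skips no column.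
path-columns : ∀ {S b e} → IsSkewShape S → HassePath S b e → ∀ {j} → col b < j → j ≤ col e → ∃ λ x → x ∈ S × col x ≡ j
path-columns sk here lt le = contradiction le (ℕ.<⇒≱ lt)
path-columns sk (step {d = d} (inj₁ edge@(_ , d∈ , _)) p) {j} lt le with j ≤? col d
... | yes q = d , d∈ , ℕ.≤-antisym (ℕ.≤-trans (edge-col sk edge) lt) q
... | no q = path-columns sk p (ℕ.≰⇒> q) le
path-columns sk (step {d = d} (inj₂ (_ , _ , ((_ , c≤) , _) , _)) p) lt le = path-columns sk p (ℕ.≤-<-trans c≤ lt) le

module Representation (σ : List Box) (skσ : IsSkewShape σ) (conn : Connected σ) {b₀ : Box} (b₀∈σ : b₀ ∈ σ) where

  private
    leftmost = minimum col σ b₀∈σ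
    rightmost = maximum col σ b₀∈σ
    cmin = col (proj₁ leftmost)
    cmax = col (proj₁ rightmost)
    cmin-positive : 1 ≤ cmin
    cmin-positive = proj₂ (All.lookup (proj₁ (proj₂ skσ)) (proj₁ (proj₂ leftmost)))

  -- The columns of σ are z + 1, ..., z + B, and N bounds its rows.
  z B N : ℕ
  z = cmin ∸ 1
  B = cmax ∸ z
  N = proj₁ (upper-bound row σ)

  private
    suc-z : suc z ≡ cmin
    suc-z = ℕ.m+[n∸m]≡n cmin-positive
    z≤cmax : z ≤ cmax
    z≤cmax = ℕ.≤-trans (ℕ.n≤1+n z) (ℕ.≤-trans (ℕ.≤-reflexive suc-z) (proj₂ (proj₂ leftmost) (proj₁ (proj₂ rightmost))))
    B+z : B ℕ.+ z ≡ cmax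
    B+z = ℕ.m∸n+n≡m z≤cmax

  column : ∀ {b} → b ∈ σ → ∃ λ j → col b ≡ j ℕ.+ z × 1 ≤ j × j ≤ B
  column {b} p = col b ∸ z , sym e , ℕ.+-cancelʳ-≤ z 1 _ (ℕ.≤-trans lo (ℕ.≤-reflexive (sym e))) ,
    ℕ.∸-monoˡ-≤ z (proj₂ (proj₂ rightmost) p)
    where
    lo : suc z ≤ col b
    lo = ℕ.≤-trans (ℕ.≤-reflexive suc-z) (proj₂ (proj₂ leftmost) p)
    e = ℕ.m∸n+n≡m (ℕ.<⇒≤ lo)

  -- Connectedness enters here. Conversely to `column`, no column in the range is empty, so every
  -- box between two bounded vectors shares a column with σ.
  occupied : ∀ {j} → 1 ≤ j → j ≤ B → ∃ λ b → b ∈ σ × col b ≡ j ℕ.+ z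
  occupied {j} lo hi with j ℕ.+ z ≟ cmin
  ... | yes e = _ , proj₁ (proj₂ leftmost) , sym e
  ... | no ne = path-columns skσ (conn (proj₁ (proj₂ leftmost)) (proj₁ (proj₂ rightmost)))
    (ℕ.≤∧≢⇒< (ℕ.≤-trans (ℕ.≤-reflexive (sym suc-z)) (ℕ.+-monoˡ-≤ z lo)) (ne ∘ sym))
    (ℕ.≤-trans (ℕ.+-monoˡ-≤ z hi) (ℕ.≤-reflexive B+z))

  open Shapes z
  open Canonical z B

  -- The first says that position (i, j) is above all boxes of column j, the second that column j
  -- has a box in row i or lower. For skew shapes each holds on an initial segment of columns, whose
  -- length is the entry of t, respectively d, in row i.
  Top Body : List Box → ℕ → ℕ → Set
  Top μ i j = All (λ b → col b ≡ j ℕ.+ z → i < row b) μ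
  Body μ i j = Any (λ b → col b ≡ j ℕ.+ z × i ≤ row b) μ

  Top? : ∀ μ i j → Dec (Top μ i j)
  Top? μ i j = All.all? (λ b → (col b ≟ j ℕ.+ z) →-dec (i <? row b)) μ

  Body? : ∀ μ i j → Dec (Body μ i j)
  Body? μ i j = Any.any? (λ b → (col b ≟ j ℕ.+ z) ×-dec (i ≤? row b)) μ

  topLength bodyLength : List Box → ℕ → ℕ
  topLength μ i = lenMax (Top? μ i) B
  bodyLength μ i = lenMax (Body? μ i) B

  upper lower : ∀ L → List Box → Vec ℕ L
  upper L μ = vecOf L 1 (topLength μ)
  lower L μ = vecOf L 1 (bodyLength μ)

  upper-descending : ∀ L μ → Descending B (upper L μ)
  upper-descending L μ = vecOf-descending L 1 _ (lenMax-≤ (Top? μ 1) B) (λ i → lenMax-mono (Top? μ (suc i)) (Top? μ i) B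
    (λ _ _ → All.map (λ h e → ℕ.<⇒≤ (h e))))

  lower-descending : ∀ L μ → Descending B (lower L μ)
  lower-descending L μ = vecOf-descending L 1 _ (lenMax-≤ (Body? μ 1) B) (λ i → lenMax-mono (Body? μ (suc i)) (Body? μ i) B
    (λ _ _ → Any.map (λ (e , le) → e , ℕ.<⇒≤ le)))

  lower-height : ∀ L μ {h} → (∀ {b} → b ∈ μ → row b ≤ h) → HeightLE h (lower L μ)
  lower-height L μ {h} bd = HeightLE-at h (lower L μ) zero-at
    where
    zero-at : ∀ i → h ≤ i → at (lower L μ) i ≡ 0
    zero-at i h≤i with i <? L
    ... | no p = at-length (lower L μ) (ℕ.≮⇒≥ p)
    ... | yes p with bodyLength μ (suc i) in e
    ...   | zero = trans (at-vecOf L 1 (bodyLength μ) p) e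
    ...   | suc _ with b , b∈ , _ , le ← find (lenMax-attained (Body? μ (suc i)) B (subst (1 ≤_) (sym e) (s≤s z≤n))) =
      contradiction (ℕ.≤-trans (s≤s h≤i) (ℕ.≤-trans le (bd b∈))) (ℕ.<-irrefl refl)

  module Of (μ : List Box) (skμ : IsSkewShape μ) (μ⊇σ : μ ⊇ σ) where

    private
      convexμ = proj₂ (proj₂ skμ)

    positive : ∀ {b} → b ∈ μ → Positive b
    positive = All.lookup (proj₁ (proj₂ skμ))

    columnμ : ∀ {b} → b ∈ μ → ∃ λ j → col b ≡ j ℕ.+ z × 1 ≤ j × j ≤ B
    columnμ p with d , d∈ , e ← proj₂ μ⊇σ p with j , e′ , r ← column d∈ = j , trans (sym e) e′ , r

    occupiedμ : ∀ {j} → 1 ≤ j → j ≤ B → ∃ λ b → b ∈ μ × col b ≡ j ℕ.+ z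
    occupiedμ lo hi with b , b∈ , e ← occupied lo hi = b , proj₁ μ⊇σ b∈ , e

    -- A box (x, j′) with x ≤ i and a box of column j would span an interval containing (x, j),
    -- against the assumption on column j.
    Top-left : ∀ {i j j′} → 1 ≤ j′ → j′ ≤ j → j ≤ B → Top μ i j → Top μ i j′
    Top-left {i} {j} {j′} lo le hi h = All.tabulate left
      where
      left : ∀ {b} → b ∈ μ → col b ≡ j′ ℕ.+ z → i < row b
      left {x , _} b∈ refl with i <? x
      ... | yes p = p
      ... | no p with (y , _) , y∈ , refl ← occupiedμ (ℕ.≤-trans lo le) hi = All.lookup h
        (convexμ {d = x , j ℕ.+ z} b∈ y∈ (ℕ.≤-refl , ℕ.+-monoˡ-≤ z le) (ℕ.≤-trans (ℕ.≮⇒≥ p) (ℕ.<⇒≤ (All.lookup h y∈ refl)) , ℕ.≤-refl)) refl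

    -- A box of column j′ above row i and a box (y, j) with y ≥ i span an interval containing (y,
    -- j′).
    Body-left : ∀ {i j j′} → 1 ≤ j′ → j′ ≤ j → j ≤ B → Body μ i j → Body μ i j′
    Body-left {i} {j} {j′} lo le hi h with (y , _) , y∈ , refl , i≤y ← find h with (x , _) , x∈ , refl ← occupiedμ lo (ℕ.≤-trans le hi) with i ≤? x
    ... | yes p = lose x∈ (refl , p)
    ... | no p = lose (convexμ {d = y , j′ ℕ.+ z} x∈ y∈ (ℕ.≤-trans (ℕ.<⇒≤ (ℕ.≰⇒> p)) i≤y , ℕ.≤-refl) (ℕ.≤-refl , ℕ.+-monoˡ-≤ z le)) (refl , i≤y)

    upper≤lower : ∀ L → upper L μ ≤ᵛ lower L μ
    upper≤lower L = vecOf-≤ L 1 _ _ (λ i → lenMax-mono (Top? μ i) (Body? μ i) B (λ lo hi h →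
      let b , b∈ , e = occupiedμ lo hi in lose b∈ (e , ℕ.<⇒≤ (All.lookup h b∈ e))))

    upper≤upper : ∀ L → upper L μ ≤ᵛ upper L σ
    upper≤upper L = vecOf-≤ L 1 _ _ (λ i → lenMax-mono (Top? μ i) (Top? σ i) B (λ _ _ h → All.tabulate (λ p → All.lookup h (proj₁ μ⊇σ p))))

    lower≤lower : ∀ L → lower L σ ≤ᵛ lower L μ
    lower≤lower L = vecOf-≤ L 1 _ _ (λ i → lenMax-mono (Body? σ i) (Body? μ i) B (λ _ _ h → let b , b∈ , q = find h in lose (proj₁ μ⊇σ b∈) q))

    -- Columns are intervals by convexity: a position that is neither above nor below the boxes of
    -- its column lies between two of them.
    sameSet : ∀ L → (∀ {b} → b ∈ μ → row b ≤ L) → SameSet μ (boxes 1 (upper L μ) (lower L μ))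
    sameSet L bd b = mk⇔ to from
      where
      to : ∀ {b} → b ∈ μ → b ∈ boxes 1 (upper L μ) (lower L μ)
      to {zero , _} p with () ← proj₁ (positive p)
      to {suc i , c} p with j , refl , lo , hi ← columnμ p = boxes-∈⁺ z 1 (upper L μ) (lower L μ) i j
        (subst (_< j) (sym (at-vecOf L 1 (topLength μ) (bd p))) (ℕ.≰⇒> not-top))
        (subst (j ≤_) (sym (at-vecOf L 1 (bodyLength μ) (bd p))) (lenMax-⁺ (Body? μ (suc i)) B hi (lose p (refl , ℕ.≤-refl))))
        where
        not-top : ¬ (j ≤ topLength μ (suc i))
        not-top le = ℕ.<-irrefl refl (All.lookup (Top-left lo le (lenMax-≤ (Top? μ (suc i)) B)
          (lenMax-attained (Top? μ (suc i)) B (ℕ.≤-trans lo le))) p refl)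
      from : ∀ {b} → b ∈ boxes 1 (upper L μ) (lower L μ) → b ∈ μ
      from p with i , j , refl , lt , le ← boxes-∈⁻ z 1 (upper L μ) (lower L μ) p with i <? L
      ... | no q = contradiction (ℕ.≤-trans lt (ℕ.≤-trans le (ℕ.≤-reflexive (at-length (lower L μ) (ℕ.≮⇒≥ q))))) λ ()
      ... | yes q = between-rows (Top? μ (suc i) j)
        where
        le′ : j ≤ bodyLength μ (suc i)
        le′ = subst (j ≤_) (at-vecOf L 1 (bodyLength μ) q) le
        lo : 1 ≤ j
        lo = ℕ.≤-trans (s≤s z≤n) lt
        hi : j ≤ B
        hi = ℕ.≤-trans le′ (lenMax-≤ (Body? μ (suc i)) B)
        position : ∀ {x c} → ¬ (c ≡ j ℕ.+ z → suc i < x) → x ≤ suc i × c ≡ j ℕ.+ z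
        position {x} {c} nh with x ≤? suc i | c ≟ j ℕ.+ z
        ... | yes p | yes q = p , q
        ... | no p | _ = contradiction (λ _ → ℕ.≰⇒> p) nh
        ... | yes _ | no q = contradiction (λ e → contradiction e q) nh
        between-rows : Dec (Top μ (suc i) j) → (suc i , j ℕ.+ z) ∈ μ
        between-rows (yes h) = contradiction (lenMax-⁺ (Top? μ (suc i)) B hi h) (ℕ.<⇒≱ (subst (_< j) (at-vecOf L 1 (topLength μ) q) lt))
        between-rows (no h) with (y , _) , y∈ , e , i≤y ← find (Body-left lo le′ (lenMax-≤ (Body? μ (suc i)) B) (lenMax-attained (Body? μ (suc i)) B (ℕ.≤-trans lo le′)))
          with (x , _) , x∈ , nh ← find (All.¬All⇒Any¬ (λ b → (col b ≟ j ℕ.+ z) →-dec (suc i <? row b)) μ h) with x≤i , e′ ← position nh =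
          convexμ x∈ y∈ (x≤i , ℕ.≤-reflexive e′) (i≤y , ℕ.≤-reflexive (sym e))

    permutation : ∀ L → (∀ {b} → b ∈ μ → row b ≤ L) → μ ↭ boxes 1 (upper L μ) (lower L μ)
    permutation L bd = SameSet⇒↭ (proj₁ skμ) (boxes-unique z 1 (upper L μ) (lower L μ)) (sameSet L bd)

  σ⊇σ : σ ⊇ σ
  σ⊇σ = id , λ {b} p → b , p , refl

  -- The finite list of contributing shapes and its sum.

  module Expansion (c : List ℕ) where

    private
      module σ = Of σ skσ σ⊇σ
      M = length c
      -- The values required by `canonical-expansion` with h = N.
      K = M ℕ.+ N
      L = K ℕ.+ N
      rows-σ : ∀ {b} → b ∈ σ → row b ≤ N
      rows-σ = proj₂ (upper-bound row σ)
      t d : Vec ℕ L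
      t = upper L σ
      d = lower L σ
      N≤L : N ≤ L
      N≤L = ℕ.m≤n+m N K

      σ-boxes : SameSet σ (boxes 1 t d)
      σ-boxes = σ.sameSet L (λ p → ℕ.≤-trans (rows-σ p) N≤L)

      at-box : ∀ {i j} (u v : Vec ℕ L) → (suc i , j ℕ.+ z) ∈ boxes 1 u v → at u i < j × j ≤ at v i
      at-box {i} {j} u v p with i′ , j′ , e , r ← boxes-∈⁻ z 1 u v p with refl ← ℕ.suc-injective (cong proj₁ e)
        with refl ← ℕ.+-cancelʳ-≡ z j j′ (cong proj₂ e) = r

      dd = lower-descending L σ
      dt = upper-descending L σ

    module _ {d′ t′ : Vec ℕ L} (adm : Admissible K t d d′ t′) where
      open Admissible adm renaming (descending-d to dd′; descending-t to dt′)

      private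
        μ = boxes 1 t′ d′

      admissible-skew : IsSkewShape μ
      admissible-skew = boxes-unique z 1 t′ d′ , All.tabulate pos , boxes-convex z 1 dt′ dd′
        where
        pos : ∀ {b} → b ∈ μ → Positive b
        pos p with i , j , refl , lt , _ ← boxes-∈⁻ z 1 t′ d′ p = s≤s z≤n , ℕ.≤-trans (ℕ.≤-trans (s≤s z≤n) lt) (ℕ.m≤m+n j z)

      admissible-⊇ : μ ⊇ σ
      admissible-⊇ = inside , columns
        where
        inside : ∀ {b} → b ∈ σ → b ∈ μ
        inside {b} p with i , j , refl , lt , le ← boxes-∈⁻ z 1 t d (fwd (σ-boxes b) p) =
          boxes-∈⁺ z 1 t′ d′ i j (ℕ.≤-<-trans (at-≤ᵛ below i) lt) (ℕ.≤-trans le (at-≤ᵛ above i))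
        columns : ∀ {b} → b ∈ μ → ∃ λ x → x ∈ σ × col x ≡ col b
        columns p with i , j , refl , lt , le ← boxes-∈⁻ z 1 t′ d′ p = occupied (ℕ.≤-trans (s≤s z≤n) lt) (ℕ.≤-trans le (at-bound dd′ i))

      private
        σ-at : ∀ {i j} → (suc i , j ℕ.+ z) ∈ σ → at t i < j × j ≤ at d i
        σ-at p = at-box t d (fwd (σ-boxes _) p)

        σ-row : ∀ {r j} → (r , j ℕ.+ z) ∈ σ → ∃ λ i → r ≡ suc i × at t i < j × j ≤ at d i
        σ-row {zero} p with () ← proj₁ (σ.positive p)
        σ-row {suc i} p = i , refl , σ-at p

        upper-row : ∀ {i i′ j} → at t i′ < j → j ≤ at t i → i < i′
        upper-row {i} {i′} p q with i <? i′
        ... | yes lt = lt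
        ... | no nlt = contradiction (ℕ.≤-trans q (at-antitone dt (ℕ.≮⇒≥ nlt))) (ℕ.<⇒≱ p)

        lower-row : ∀ {i i′ j} → j ≤ at d i′ → at d i < j → i′ < i
        lower-row {i} {i′} p q with i′ <? i
        ... | yes lt = lt
        ... | no nlt = contradiction (ℕ.≤-trans p (at-antitone dd (ℕ.≮⇒≥ nlt))) (ℕ.<⇒≱ q)

        t≤d = σ.upper≤lower L

      -- A box of μ above a box of σ in row i′ has j ≤ t in its own row i: otherwise t < j in row i,
      -- while j is at most the entry of d in row i′ and hence in row i, so the box would lie in σ.
      -- For the converse, the column is occupied and the descent of t puts the box of σ lower.
      Apart-boxes : Apart μ σ ↭ boxes 1 t′ t
      Apart-boxes = SameSet⇒↭ (Unique.filter⁺ (T? ∘ _) (boxes-unique z 1 t′ d′)) (boxes-unique z 1 t′ t) (λ b → mk⇔ to from)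
        where
        to : ∀ {b} → b ∈ Apart μ σ → b ∈ boxes 1 t′ t
        to p with q , b∉σ , (r′ , _) , d∈ , refl , lt ← Apart-∈⁻ μ σ p with i , j , refl , l₁ , l₂ ← boxes-∈⁻ z 1 t′ d′ q
          with i′ , refl , m₁ , m₂ ← σ-row d∈ with j ≤? at t i
        ... | yes le = boxes-∈⁺ z 1 t′ t i j l₁ le
        ... | no nle = contradiction (bwd (σ-boxes _) (boxes-∈⁺ z 1 t d i j (ℕ.≰⇒> nle) (ℕ.≤-trans m₂ (at-antitone dd (ℕ.<⇒≤ (ℕ.≤-pred lt)))))) b∉σ
        from : ∀ {b} → b ∈ boxes 1 t′ t → b ∈ Apart μ σ
        from p with i , j , refl , l₁ , l₂ ← boxes-∈⁻ z 1 t′ t p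
          with (r , _) , d∈ , refl ← occupied (ℕ.≤-trans (s≤s z≤n) l₁) (ℕ.≤-trans l₂ (at-bound dt i)) with i′ , refl , m₁ , m₂ ← σ-row d∈ =
          Apart-∈⁺ μ σ (boxes-∈⁺ z 1 t′ d′ i j l₁ (ℕ.≤-trans l₂ (ℕ.≤-trans (at-≤ᵛ t≤d i) (at-≤ᵛ above i))) ,
            (λ q → ℕ.<⇒≱ (proj₁ (σ-at q)) l₂) , _ , d∈ , refl , s≤s (upper-row m₁ l₂))

      Bpart-boxes : Bpart μ σ ↭ boxes 1 d d′
      Bpart-boxes = SameSet⇒↭ (Unique.filter⁺ (T? ∘ _) (boxes-unique z 1 t′ d′)) (boxes-unique z 1 d d′) (λ b → mk⇔ to from)
        where
        to : ∀ {b} → b ∈ Bpart μ σ → b ∈ boxes 1 d d′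
        to p with q , b∉σ , (r′ , _) , d∈ , refl , lt ← Bpart-∈⁻ μ σ p with i , j , refl , l₁ , l₂ ← boxes-∈⁻ z 1 t′ d′ q
          with i′ , refl , m₁ , m₂ ← σ-row d∈ with j ≤? at d i
        ... | no nle = boxes-∈⁺ z 1 d d′ i j (ℕ.≰⇒> nle) l₂
        ... | yes le = contradiction (bwd (σ-boxes _) (boxes-∈⁺ z 1 t d i j (ℕ.≤-<-trans (at-antitone dt (ℕ.<⇒≤ (ℕ.≤-pred lt))) m₁) le)) b∉σ
        from : ∀ {b} → b ∈ boxes 1 d d′ → b ∈ Bpart μ σ
        from p with i , j , refl , l₁ , l₂ ← boxes-∈⁻ z 1 d d′ p
          with (r , _) , d∈ , refl ← occupied (ℕ.≤-trans (s≤s z≤n) l₁) (ℕ.≤-trans l₂ (at-bound dd′ i)) with i′ , refl , m₁ , m₂ ← σ-row d∈ =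
          Bpart-∈⁺ μ σ (boxes-∈⁺ z 1 t′ d′ i j (ℕ.≤-<-trans (ℕ.≤-trans (at-≤ᵛ below i) (at-≤ᵛ t≤d i)) l₁) l₂ ,
            (λ q → ℕ.<⇒≱ l₁ (proj₂ (σ-at q))) , _ , d∈ , refl , s≤s (lower-row m₂ l₁))

      term-boxes : term σ c μ ≡ expandedTerm c t d dt dd t≤d (lower-height L σ rows-σ) ℕ.≤-refl d′ t′
      term-boxes = begin
        sign (length (Apart μ σ)) ℤ.* (+ (aCount (Apart μ σ) ℕ.* bCount (Bpart μ σ)) ℤ.* GCoeff μ c)
          ≡⟨ cong₂ ℤ._*_ (cong sign (↭.↭-length Apart-boxes)) (cong (ℤ._* GCoeff μ c) (cong +_ (cong₂ ℕ._*_ (aCount-↭ Apart-boxes) (bCount-↭ Bpart-boxes)))) ⟩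
        sign ℓ ℤ.* (+ (a ℕ.* b) ℤ.* GCoeff μ c) ≡⟨ cong (λ x → sign ℓ ℤ.* (x ℤ.* GCoeff μ c)) (ℤ.pos-* a b) ⟩
        sign ℓ ℤ.* ((+ a ℤ.* + b) ℤ.* GCoeff μ c) ≡⟨ trans (⊗-def _ _) (cong (sign ℓ ℤ.*_) (trans (⊗-def _ _) (cong (ℤ._* GCoeff μ c) (⊗-def (+ a) (+ b))))) ⟨
        sign ℓ ⊗ ((+ a ⊗ + b) ⊗ GCoeff μ c) ≡⟨ solve 4 (λ s a b g → s :* ((a :* b) :* g) := b :* (g :* (s :* a))) refl (sign ℓ) (+ a) (+ b) (GCoeff μ c) ⟩
        + b ⊗ (GCoeff μ c ⊗ (sign ℓ ⊗ + a)) ∎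
        where
        ℓ = length (boxes 1 t′ t)
        a = aCount (boxes 1 t′ t)
        b = bCount (boxes 1 d d′)

    cube : ∀ n → List (Vec ℕ n)
    cube zero = [] ∷ []
    cube (suc n) = cartesianProductWith _∷_ (upTo (suc B)) (cube n)

    ∑-cartesianProductWith : ∀ {𝒜 A′ C : Set} (f : 𝒜 → A′ → C) xs ys (g : C → ℤ) →
      ∑ (cartesianProductWith f xs ys) g ≡ ∑ xs (λ x → ∑ ys (λ y → g (f x y)))
    ∑-cartesianProductWith f [] ys g = refl
    ∑-cartesianProductWith f (x ∷ xs) ys g = trans (∑-++ (map (f x) ys) _) (cong₂ _⊕_ (∑-map (f x) ys) (∑-cartesianProductWith f xs ys g))

    ∑-cube : ∀ n (f : Vec ℕ n → ℤ) → ∑ (cube n) f ≡ Matrices.ΣV B n f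
    ∑-cube zero f = ⊕-identityʳ _
    ∑-cube (suc n) f = trans (∑-cartesianProductWith _∷_ (upTo (suc B)) (cube n) f)
      (trans (∑≤-upTo B) (∑≤-cong B (λ j _ → ∑-cube n (λ v → f (j ∷ v)))))

    cube-unique : ∀ n → Unique (cube n)
    cube-unique zero = [] ∷ []
    cube-unique (suc n) = Unique.cartesianProductWith⁺ _∷_ (λ { refl → refl , refl }) (Unique.upTo⁺ (suc B)) (cube-unique n)

    cube-∈ : ∀ {n p} {v : Vec ℕ n} → Descending p v → p ≤ B → v ∈ cube n
    cube-∈ [] _ = here refl
    cube-∈ (q ∷ desc) p≤B = ∈.∈-cartesianProductWith⁺ _∷_ (∈.∈-upTo⁺ (s≤s (ℕ.≤-trans q p≤B))) (cube-∈ desc (ℕ.≤-trans q p≤B))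

    admissible? : (x : Vec ℕ L × Vec ℕ L) → Dec (Admissible K t d (proj₁ x) (proj₂ x))
    admissible? (d′ , t′) = Admissible? K t d d′ t′

    pairs : List (Vec ℕ L × Vec ℕ L)
    pairs = filter admissible? (cartesianProduct (cube L) (cube L))

    shape : Vec ℕ L × Vec ℕ L → List Box
    shape (d′ , t′) = boxes 1 t′ d′

    canonicalShapes : List (List Box)
    canonicalShapes = map shape pairs

    private
      pairs-admissible : ∀ {x} → x ∈ pairs → Admissible K t d (proj₁ x) (proj₂ x)
      pairs-admissible p = proj₂ (∈.∈-filter⁻ admissible? {xs = cartesianProduct (cube L) (cube L)} p)

      -- An empty row would leave its two ends undetermined, but t′ ≤ t ≤ d ≤ d′ pins them to the
      -- common value they have in σ; all other ends are seen on the boxes.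
      shape-injective : ∀ {x y} → x ∈ pairs → y ∈ pairs → SameSet (shape x) (shape y) → x ≡ y
      shape-injective {d₁ , t₁} {d₂ , t₂} p q h = cong₂ _,_
        (at-ext (λ i → ℕ.≤-antisym (lower-≤ a₂ a₁ (SameSet-sym h) i) (lower-≤ a₁ a₂ h i)))
        (at-ext (λ i → ℕ.≤-antisym (upper-≤ a₂ a₁ (SameSet-sym h) i) (upper-≤ a₁ a₂ h i)))
        where
        a₁ = pairs-admissible p
        a₂ = pairs-admissible q
        t≤d = σ.upper≤lower L
        upper-≤ : ∀ {d₁ t₁ d₂ t₂} → Admissible K t d d₁ t₁ → Admissible K t d d₂ t₂ → SameSet (boxes 1 t₁ d₁) (boxes 1 t₂ d₂) →
          ∀ i → at t₂ i ≤ at t₁ i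
        upper-≤ {d₁} {t₁} {d₂} {t₂} a₁ a₂ h i with at t₂ i ≤? at t₁ i
        ... | yes le = le
        ... | no nle = contradiction (proj₁ (at-box t₂ d₂ (fwd (h _) (boxes-∈⁺ z 1 t₁ d₁ i (at t₂ i) (ℕ.≰⇒> nle)
              (ℕ.≤-trans (at-≤ᵛ (Admissible.below a₂) i) (ℕ.≤-trans (at-≤ᵛ t≤d i) (at-≤ᵛ (Admissible.above a₁) i))))))) (ℕ.<-irrefl refl)
        lower-≤ : ∀ {d₁ t₁ d₂ t₂} → Admissible K t d d₁ t₁ → Admissible K t d d₂ t₂ → SameSet (boxes 1 t₁ d₁) (boxes 1 t₂ d₂) →
          ∀ i → at d₂ i ≤ at d₁ i
        lower-≤ {d₁} {t₁} {d₂} {t₂} a₁ a₂ h i with at d₂ i ≤? at d₁ i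
        ... | yes le = le
        ... | no nle = contradiction (proj₂ (at-box t₁ d₁ (bwd (h _) (boxes-∈⁺ z 1 t₂ d₂ i (at d₂ i)
              (ℕ.≤-<-trans (ℕ.≤-trans (at-≤ᵛ (Admissible.below a₂) i) (ℕ.≤-trans (at-≤ᵛ t≤d i) (at-≤ᵛ (Admissible.above a₁) i))) (ℕ.≰⇒> nle)) ℕ.≤-refl)))) nle

      distinct : ∀ xs → Unique xs → (∀ {x} → x ∈ xs → x ∈ pairs) → AllPairs (λ μ ν → ¬ SameSet μ ν) (map shape xs)
      distinct [] _ _ = []
      distinct (x ∷ xs) (h ∷ u) sub = All.map⁺ (All.tabulate (λ p e → All.lookup h p (shape-injective (sub (here refl)) (sub (there p)) e))) ∷
        distinct xs u (sub ∘ there)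

      -- μ is first described by vectors of length ρ, a bound for its own rows. The coefficient of
      -- its G is then a nonzero tableau sum, and `tableaux-height` improves the bound to K, so that
      -- vectors of length L suffice.
      complete : ∀ μ → IsSkewShape μ → μ ⊇ σ → term σ c μ ≢ + 0 → Any (SameSet μ) canonicalShapes
      complete μ skμ μ⊇σ nz = Any.map⁺ (lose (∈.∈-filter⁺ admissible? (∈.∈-cartesianProduct⁺
          (cube-∈ (lower-descending L μ) ℕ.≤-refl) (cube-∈ (upper-descending L μ) ℕ.≤-refl))
          (admissible (lower-descending L μ) (upper-descending L μ) (μ′.lower≤lower L) (μ′.upper≤upper L) (lower-height L μ rows-μ)))
        (μ′.sameSet L (λ p → ℕ.≤-trans (rows-μ p) (ℕ.m≤m+n K N))))
        where
        module μ′ = Of μ skμ μ⊇σ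
        ρ = proj₁ (upper-bound row μ)
        rows-ρ : ∀ {b} → b ∈ μ → row b ≤ ρ
        rows-ρ = proj₂ (upper-bound row μ)
        G≢0 : GCoeff μ c ≢ 0ℤ
        G≢0 e = nz (trans (cong (sign (length (Apart μ σ)) ℤ.*_) (trans (cong (+ b-coeff σ μ ℤ.*_) e) (ℤ.*-zeroʳ (+ b-coeff σ μ)))) (ℤ.*-zeroʳ (sign (length (Apart μ σ)))))
        perm = μ′.permutation ρ rows-ρ
        tab≢0 : SetTableaux.tableaux (exactly c) (λ _ r → r ≤ᵇ ρ) (λ _ _ → true) M (boxes 1 (upper ρ μ) (lower ρ μ)) ≢ 0ℤ
        tab≢0 e = G≢0 (trans (GCoeff-↭ c perm) (trans (GCoeff-tableaux c ρ _ (boxes-rows z (upper ρ μ) (lower ρ μ) (HeightLE-all (lower ρ μ) ℕ.≤-refl))) e))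
        height : HeightLE K (lower ρ μ)
        height = tableaux-height (exactly c) (λ _ r → r ≤ᵇ ρ) (λ _ _ → true) M (upper ρ μ) (lower ρ μ) (upper-descending ρ μ) (lower-descending ρ μ) ℕ.≤-refl
          (μ′.upper≤lower ρ) (≤ᵛ-height (≤ᵛ-trans (μ′.upper≤upper ρ) (σ.upper≤lower ρ)) (lower-height ρ σ rows-σ)) tab≢0
        rows-μ : ∀ {b} → b ∈ μ → row b ≤ K
        rows-μ p = boxes-rows z (upper ρ μ) (lower ρ μ) height (↭.∈-resp-↭ perm p)

    canonical-covering : Covering σ c canonicalShapes
    canonical-covering = All.map⁺ (All.tabulate (λ p → admissible-skew (pairs-admissible p) , admissible-⊇ (pairs-admissible p))) ,
      distinct pairs (Unique.filter⁺ admissible? (Unique.cartesianProduct⁺ (cube-unique L) (cube-unique L))) id , complete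

    canonical-sum : + sCoeff σ c ≡ ∑ canonicalShapes (term σ c)
    canonical-sum = begin
      + sCoeff σ c ≡⟨ sCoeff-↭ c (σ.permutation L (λ p → ℕ.≤-trans (rows-σ p) N≤L)) ⟩
      + sCoeff (boxes 1 t d) c ≡⟨ canonical-expansion c t d dt dd (σ.upper≤lower L) (lower-height L σ rows-σ) ℕ.≤-refl ⟩
      Matrices.ΣV B L (λ d′ → Matrices.ΣV B L (λ t′ → ⟦ Admissible? K t d d′ t′ ⟧ ⊗ E d′ t′))
        ≡⟨ trans (∑-cube L _) (Matrices.ΣV-cong B L (λ d′ → ∑-cube L _)) ⟨
      ∑ (cube L) (λ d′ → ∑ (cube L) (λ t′ → ⟦ admissible? (d′ , t′) ⟧ ⊗ E d′ t′)) ≡⟨ ∑-cartesianProductWith _,_ (cube L) (cube L) _ ⟨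
      ∑ (cartesianProduct (cube L) (cube L)) (λ x → ⟦ admissible? x ⟧ ⊗ E (proj₁ x) (proj₂ x)) ≡⟨ ∑-filter (cartesianProduct (cube L) (cube L)) ⟨
      ∑ pairs (λ x → E (proj₁ x) (proj₂ x)) ≡⟨ ∑-cong∈ pairs (λ p → sym (term-boxes (pairs-admissible p))) ⟩
      ∑ pairs (term σ c ∘ shape) ≡⟨ ∑-map shape pairs ⟨
      ∑ canonicalShapes (term σ c) ∎
      where
      E : Vec ℕ L → Vec ℕ L → ℤ
      E = expandedTerm c t d dt dd (σ.upper≤lower L) (lower-height L σ rows-σ) ℕ.≤-refl
      ∑-filter : ∀ xs → ∑ (filter admissible? xs) (λ x → E (proj₁ x) (proj₂ x)) ≡ ∑ xs (λ x → ⟦ admissible? x ⟧ ⊗ E (proj₁ x) (proj₂ x))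
      ∑-filter [] = refl
      ∑-filter (x ∷ xs) with admissible? x
      ... | yes _ = cong₂ _⊕_ (sym (⊗-identityˡ _)) (∑-filter xs)
      ... | no _ = trans (∑-filter xs) (trans (sym (⊕-identityˡ _)) (cong (_⊕ ∑ xs _) (sym (⊗-zeroˡ _))))

    covering-sum : ∀ Ms → Covering σ c Ms → + sCoeff σ c ≡ sumℤ (map (term σ c) Ms)
    covering-sum Ms (valid , apart , complete′) = trans canonical-sum (trans
      (∑-coverings SameSet-sym SameSet-trans (λ μ → IsSkewShape μ × μ ⊇ σ) (term σ c)
        (λ (sk , _) (sk′ , _) h → term-↭ σ c (SameSet⇒↭ (proj₁ sk) (proj₁ sk′) h))
        canonicalShapes Ms (proj₁ canonical-covering) valid (proj₁ (proj₂ canonical-covering)) apart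
        (λ {μ} p nz → let sk , sup = All.lookup (proj₁ canonical-covering) p in complete′ μ sk sup nz)
        (λ {μ} p nz → let sk , sup = All.lookup valid p in complete μ sk sup nz))
      (∑≡sumℤ Ms (term σ c)))

theorem4p1 : (σ : List Box) → IsSkewShape σ → Connected σ → TopRowIsOne σ →
    (c : List ℕ) →
    Σ (List (List Box)) (Covering σ c) ×
    ((Ms : List (List Box)) → Covering σ c Ms →
    + sCoeff σ c ≡ sumℤ (map (term σ c) Ms))
theorem4p1 σ sk conn (_ , b∈σ , _) c = (canonicalShapes , canonical-covering) , covering-sum
  where open Representation.Expansion σ sk conn b∈σ c
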